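{- For all integers $k\ge1$, $s$ and $r$ with $0\le s\le k$ and $0\le r\le k$ (and $s+r\le k$), \[GR_k((k-s-r)P_3,sK_3,rH_3)=\begin{cases} 5^{s/2}\cdot\lfloor21\cdot17^{(r-2)/2}\rfloor+1, & s,r \text{ both even and } s+r=k,\\ 2\cdot5^{s/2}\cdot17^{r/2}+1, & s,r \text{ both even and } s+r<k,\\ 5^{(s-1)/2}\cdot\lfloor42\cdot17^{(r-2)/2}\rfloor+1, & s \text{ odd}, r \text{ even and } s+r=k,\\ 4\cdot5^{(s-1)/2}\cdot17^{r/2}+1, & s \text{ odd}, r \text{ even and } s+r<k,\\ 10\cdot5^{(s-1)/2}\cdot17^{(r-1)/2}+1, & s,r \text{ both odd and } s+r=k,\\ 16\cdot5^{(s-1)/2}\cdot17^{(r-1)/2}+1, & s,r \text{ both odd and } s+r<k,\\ 4\cdot5^{s/2}\cdot17^{(r-1)/2}+1, & s \text{ even}, r \text{ odd and } s+r=k,\\ \lfloor32\cdot5^{(s-2)/2}\rfloor\cdot17^{(r-1)/2}+1, & s \text{ even}, r \text{ odd and } s+r<k. \end{cases}\]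
   Context: All graphs are finite, simple and undirected. $K_n$ denotes the complete graph and $P_n$ the path on $n$ vertices. $H_3$ is the graph $K_5$ minus one edge. An edge coloring of a complete graph is a Gallai coloring if it contains no rainbow triangle (a triangle whose three edges receive three distinct colors). For graphs $F_1,\dots,F_k$, $GR(F_1,\dots,F_k)$ is the minimum integer $n$ such that every Gallai coloring of $K_n$ with colors $1,\dots,k$ contains, for some $i\in\{1,\dots,k\}$, a monochromatic copy of $F_i$ in color $i$. The notation $GR_k((k-s-r)P_3,sK_3,rH_3)$ means $GR(F_1,\dots,F_k)$ with $F_1=\dots=F_r=H_3$, $F_{r+1}=\dots=F_{r+s}=K_3$ and $F_{r+s+1}=\dots=F_k=P_3$; i.e., the first $r$ colors are assigned to $H_3$, the next $s$ colors to $K_3$, and the last $k-s-r$ colors to $P_3$. -}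

module Defs where

open import Data.Nat using (_<?_; ℕ; zero; suc; _+_; _*_; _∸_; _^_; _≤_; _<_; _/_)
open import Data.Nat.Divisibility using (_∣_)
open import Data.Fin using (Fin; toℕ) renaming (zero to f0; suc to fs)
open import Data.Product using (Σ; _×_)
open import Data.Sum using (_⊎_)
open import Relation.Nullary using (¬_; yes; no)
open import Relation.Binary.PropositionalEquality using (_≡_; _≢_)
open import Function.Definitions using (Injective)

-- A finite simple graph on vertex set Fin order, given by a symmetric
-- irreflexive edge relation.
record Graph : Set₁ where
  field
    order : ℕ
    Adj   : Fin order → Fin order → Set

open Graph public

K3 : Graph
K3 = record { order = 3 ; Adj = λ u v → u ≢ v }

P3-adj : Fin 3 → Fin 3 → Set
P3-adj u v = (toℕ u ≡ 1 × toℕ v ≢ 1) ⊎ (toℕ u ≢ 1 × toℕ v ≡ 1)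

P3 : Graph
P3 = record { order = 3 ; Adj = P3-adj }

H3-adj : Fin 5 → Fin 5 → Set
H3-adj u v = u ≢ v × ¬ ((toℕ u ≡ 0 × toℕ v ≡ 1) ⊎ (toℕ u ≡ 1 × toℕ v ≡ 0))

H3 : Graph
H3 = record { order = 5 ; Adj = H3-adj }

-- An edge colouring of K_n with colours Fin k (the values on the diagonal
-- are irrelevant; symmetric on all pairs).
record Coloring (n k : ℕ) : Set where
  field
    col  : Fin n → Fin n → Fin k
    symm : ∀ u v → col u v ≡ col v u

open Coloring public

RainbowTriangle : ∀ {n k} → Coloring n k → Fin n → Fin n → Fin n → Set
RainbowTriangle c u v w =
  u ≢ v × v ≢ w × u ≢ w ×
  col c u v ≢ col c v w × col c v w ≢ col c u w × col c u v ≢ col c u w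

IsGallai : ∀ {n k} → Coloring n k → Set
IsGallai {n} c = ∀ (u v w : Fin n) → ¬ RainbowTriangle c u v w

MonoCopy : ∀ {n k} → Coloring n k → Graph → Fin k → Set
MonoCopy {n} c F i =
  Σ (Fin (order F) → Fin n) λ f →
    Injective _≡_ _≡_ f × (∀ x y → Adj F x y → col c (f x) (f y) ≡ i)

-- Target graph for colour i in GR_k((k-s-r)P_3, sK_3, rH_3):
-- colours 0..r-1 get H_3, colours r..r+s-1 get K_3, the rest P_3.
target : (s r : ℕ) → ℕ → Graph
target s r i with i <? r
... | yes _ = H3
... | no _ with i <? (r + s)
...   | yes _ = K3
...   | no _ = P3

Arrows : (k s r n : ℕ) → Set
Arrows k s r n =
  (c : Coloring n k) → IsGallai c → Σ (Fin k) λ i → MonoCopy c (target s r (toℕ i)) i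

IsGR : (k s r N : ℕ) → Set
IsGR k s r N = Arrows k s r N × (∀ m → m < N → ¬ Arrows k s r m)

Even Odd : ℕ → Set
Even n = 2 ∣ n
Odd n = ¬ Even n

{-# OPTIONS --safe #-}

-- Upper bound: by Gallai's theorem every Gallai colouring with at least two vertices either splits into two
-- parts joined completely in one colour, or partitions into parts such that between two of them all edges
-- have one of the same colour among only two colours a and b. In a join the forbidden graph of the joining
-- colour is distributed over the two sides; in a partition the parts carry smaller forbidden graphs in the
-- colours a and b, while the reduced graph obeys small two-colour Ramsey bounds. Induction over the colours
-- then needs a count for the intermediate targets K₂, P₃, K₃, K₄ - e and H₃, and the number F s r p of the
-- formula plays the role of a bound that is multiplicative up to slack. The only deep base case is
-- R(H₃, H₃) ≤ 22. There the neighbourhoods of a vertex avoid K₄ - e in one colour and H₃ in the other.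
-- Goodman's count of monochromatic triangles forces a neighbourhood on 11 or 12 vertices with many
-- edges; these are classified, and a search shows that none of them extends to the whole graph.
-- Lower bound: substitute extremal colourings into two-coloured patterns in fresh colours: K₂, the pentagon,
-- the Wagner graph with its complement and the Paley graph on 17 vertices, which contain no triangle in a
-- K₃-colour and no K₄ in an H₃-colour. Base cases are colourings of 4, 6, 10 and 21 vertices.
module Submission where

open import Defs
open import Data.Nat using (ℕ; zero; suc; _+_; _*_; _∸_; _^_; _/_; _%_; _≤_; _<_; _≤?_; _<?_; _≤ᵇ_; _<ᵇ_; _≡ᵇ_; z≤n; s≤s; NonZero; >-nonZero; ∣_-_∣)
open import Data.Nat.Properties hiding (_≟_)
open import Data.Nat.DivMod using (m≡m%n+[m/n]*n; m%n<n; m*n/n≡m; m<n⇒m%n≡m; _mod_)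
open import Data.Nat.Divisibility using (_∣_; divides; m%n≡0⇒n∣m; ∣m∣n⇒∣m+n; _∣?_)
open import Data.Nat.ListAction using () renaming (sum to sumˡ)
open import Data.Nat.ListAction.Properties using (sum-↭; sum-++)
open import Data.Bool using (Bool; true; false; not; _∧_; _∨_; if_then_else_)
open import Data.Bool.Properties using () renaming (_≟_ to _≟ᵇ_)
open import Data.Bool.ListAction using (any; all)
open import Data.Fin using (Fin; zero; suc; toℕ; _≟_)
open import Data.Fin.Properties using (any?; all?)
open import Data.List using (List; []; _∷_; _++_; length; map; concatMap; zipWith; tabulate; allFin; upTo)
open import Data.List.Properties using (map-++; map-cong; length-++; length-map; length-take; ++-identityʳ)
open import Data.List.Membership.Propositional using () renaming (_∈_ to _∈ˡ_)
open import Data.List.Membership.Propositional.Properties using (∈-++⁺ˡ; ∈-++⁺ʳ; ∈-map⁺; ∈-concatMap⁺; ∈-upTo⁺; ∈-lookup; ∈-allFin)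
open import Data.List.Relation.Unary.All using (All; []; _∷_)
import Data.List.Relation.Unary.All as All
import Data.List.Relation.Unary.All.Properties as All
open import Data.List.Relation.Unary.Any using (Any; here; there)
import Data.List.Relation.Unary.Any as Any
open import Data.List.Relation.Unary.AllPairs using (AllPairs; []; _∷_)
open import Data.List.Relation.Unary.Unique.Propositional using (Unique)
import Data.List.Relation.Unary.Unique.Propositional.Properties as Unique
open import Data.List.Relation.Binary.Permutation.Propositional using (_↭_; ↭-refl; ↭-sym; ↭-trans; prep; swap; ↭⇒↭ₛ)
import Data.List.Relation.Binary.Permutation.Propositional.Properties as ↭
import Data.List.Relation.Binary.Permutation.Setoid.Properties as ↭ₛ
open import Data.Product using (Σ; ∃; ∃₂; _×_; _,_; proj₁; proj₂)
open import Data.Sum using (_⊎_; inj₁; inj₂)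
open import Data.Empty using (⊥; ⊥-elim)
open import Data.Unit using (tt)
open import Function using (_∘_; id; case_of_)
open import Relation.Nullary using (¬_; Dec; yes; no; does; contradiction)
open import Relation.Nullary.Decidable using (¬?; _×-dec_; decidable-stable; map′; from-no)
open import Relation.Binary.PropositionalEquality hiding ([_])
open import Algebra.Properties.Semiring.Sum +-*-semiring using (sum; sum-cong-≗; ∑-distrib-+; ∑-comm; *-distribˡ-sum; *-distribʳ-sum)
open import Algebra.Properties.CommutativeSemigroup +-commutativeSemigroup using (interchange)

-- The delicate point of the upper bound is the term `total #d X` in `Bound-on`. This unit pays for
-- the vertex when a single vertex is joined to the rest in an H₃-colour, because H₃ minus a vertex
-- of full degree is K₄ - e. The price is that the slack of the other colours is carried through
-- every case; it is at most r, and `F` grows geometrically in r. In a partition there may be 21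
-- parts for two H₃-colours, although these colours may multiply the bound by 17 only. A part with
-- two vertices turns a K₄ among the parts into H₃, so with such parts the count drops to R(4,4) - 1
-- = 17, and for H₃ against K₃ from 10 to 8; a few extra parts with one vertex are absorbed by
-- arithmetic. Case distinctions on components or on the presence of a subgraph are made under a
-- double negation. This is harmless, since the goals are absurdities or decidable inequalities, and
-- the monochromatic copy is recovered at the end by exhaustive search. The long lists of numbers
-- are certificates, verified by evaluation.

module Subsets where

  -- Finite vertex sets, counting, and nearly complete subgraphs.

  open import Data.Fin.Properties using () renaming (suc-injective to suc-inj)
  open import Data.List using (filter; take)

  -- Properties such as `Reach` or the existence of a cut come without a decision procedure. When
  -- the goal is an absurdity, a decision may be assumed all the same.
  em : ∀ {a} {A : Set a} → (Dec A → ⊥) → ⊥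
  em k = k (no (k ∘ yes))

  -- Double-negation shift, which holds because the index set is finite. It turns separate case
  -- distinctions at the vertices into one simultaneous decision.
  ¬¬-all : ∀ {n a} {A : Fin n → Set a} → (∀ i → (A i → ⊥) → ⊥) → ((∀ i → A i) → ⊥) → ⊥
  ¬¬-all {zero} h k = k λ ()
  ¬¬-all {suc n} h k = h zero λ a → ¬¬-all (h ∘ suc) λ as → k λ { zero → a ; (suc i) → as i }

  em-all : ∀ {n a} (A : Fin n → Set a) → ((∀ i → Dec (A i)) → ⊥) → ⊥
  em-all A = ¬¬-all λ i → em

  sum-mono : ∀ {n} {f g : Fin n → ℕ} → (∀ i → f i ≤ g i) → sum f ≤ sum g
  sum-mono {zero} h = z≤n
  sum-mono {suc n} h = +-mono-≤ (h zero) (sum-mono (h ∘ suc))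

  sum-const : ∀ n a → sum {n} (λ _ → a) ≡ n * a
  sum-const zero a = refl
  sum-const (suc n) a = cong (a +_) (sum-const n a)

  sum-zero : ∀ {n} {f : Fin n → ℕ} → (∀ i → f i ≡ 0) → sum f ≡ 0
  sum-zero {n} h = trans (sum-cong-≗ h) (trans (sum-const n 0) (*-zeroʳ n))

  term≤sum : ∀ {n} (f : Fin n → ℕ) i → f i ≤ sum f
  term≤sum f zero = m≤m+n _ _
  term≤sum f (suc i) = ≤-trans (term≤sum (f ∘ suc) i) (m≤n+m _ _)

  χ : Bool → ℕ
  χ true = 1
  χ false = 0

  χ≤1 : ∀ b → χ b ≤ 1
  χ≤1 true = ≤-refl
  χ≤1 false = z≤n

  VSet : ℕ → Set
  VSet n = Fin n → Bool

  infix 4 _∈_ _⊆_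

  -- A record in place of the bare equation lets unification recover `x` and `Q` from the type of a
  -- membership proof.
  record _∈_ {n} (x : Fin n) (Q : VSet n) : Set where
    constructor mem
    field holds : Q x ≡ true

  open _∈_

  _∈?_ : ∀ {n} (x : Fin n) (Q : VSet n) → Dec (x ∈ Q)
  x ∈? Q = map′ mem holds (Q x ≟ᵇ true)

  _⊆_ : ∀ {n} → VSet n → VSet n → Set
  A ⊆ B = ∀ {x} → x ∈ A → x ∈ B

  count : ∀ {n} → VSet n → ℕ
  count Q = sum (χ ∘ Q)

  ⟨_⟩ : ∀ {n a} {A : Fin n → Set a} → (∀ x → Dec (A x)) → VSet n
  ⟨ d ⟩ x = does (d x)

  ∈⟨⟩ : ∀ {n a} {A : Fin n → Set a} (d : ∀ x → Dec (A x)) {x} → A x → x ∈ ⟨ d ⟩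
  ∈⟨⟩ {A = A} d {x} a = mem (lem (d x))
    where
    lem : (b : Dec (A x)) → does b ≡ true
    lem (yes _) = refl
    lem (no ¬a) = contradiction a ¬a

  ⟨⟩∈ : ∀ {n a} {A : Fin n → Set a} (d : ∀ x → Dec (A x)) {x} → x ∈ ⟨ d ⟩ → A x
  ⟨⟩∈ {A = A} d {x} (mem h) = lem (d x) h
    where
    lem : (b : Dec (A x)) → does b ≡ true → A x
    lem (yes a) _ = a

  count-mono : ∀ {n} {A B : VSet n} → A ⊆ B → count A ≤ count B
  count-mono {A = A} {B} h = sum-mono λ i → lem (A i) (B i) (holds ∘ h ∘ mem)
    where
    lem : ∀ a b → (a ≡ true → b ≡ true) → χ a ≤ χ b
    lem false b f = z≤n
    lem true true f = ≤-refl
    lem true false f = case f refl of λ ()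

  count-∪ : ∀ {n} {Q A B : VSet n} → (∀ {x} → x ∈ Q → x ∈ A ⊎ x ∈ B) → count Q ≤ count A + count B
  count-∪ {Q = Q} {A} {B} h = ≤-trans (sum-mono λ i → lem (Q i) (A i) (B i) λ q → case h (mem q) of λ { (inj₁ (mem a)) → inj₁ a ; (inj₂ (mem b)) → inj₂ b }) (≤-reflexive (∑-distrib-+ (χ ∘ A) (χ ∘ B)))
    where
    lem : ∀ q a b → (q ≡ true → a ≡ true ⊎ b ≡ true) → χ q ≤ χ a + χ b
    lem false a b f = z≤n
    lem true true b f = s≤s z≤n
    lem true false true f = ≤-refl
    lem true false false f = case f refl of λ { (inj₁ ()) ; (inj₂ ()) }

  count-⊎ : ∀ {n} {Q A B : VSet n} → A ⊆ Q → B ⊆ Q → (∀ {x} → x ∈ A → x ∈ B → ⊥) → count A + count B ≤ count Q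
  count-⊎ {Q = Q} {A} {B} f g d = ≤-trans (≤-reflexive (sym (∑-distrib-+ (χ ∘ A) (χ ∘ B)))) (sum-mono λ i → lem (Q i) (A i) (B i) (holds ∘ f ∘ mem) (holds ∘ g ∘ mem) λ a b → d (mem a) (mem b))
    where
    lem : ∀ q a b → (a ≡ true → q ≡ true) → (b ≡ true → q ≡ true) → (a ≡ true → b ≡ true → ⊥) → χ a + χ b ≤ χ q
    lem q false false f g d = z≤n
    lem true true false f g d = ≤-refl
    lem true false true f g d = ≤-refl
    lem q true true f g d = ⊥-elim (d refl refl)
    lem false true false f g d = case f refl of λ ()
    lem false false true f g d = case g refl of λ ()

  count-∈ : ∀ {n} {Q : VSet n} {x} → x ∈ Q → 1 ≤ count Q
  count-∈ {Q = Q} {x} (mem h) = ≤-trans (≤-reflexive (cong χ (sym h))) (term≤sum (χ ∘ Q) x)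

  count-⊂ : ∀ {n} {A Q : VSet n} {x} → A ⊆ Q → x ∈ Q → ¬ x ∈ A → count A < count Q
  count-⊂ {A = A} {Q} {x} f q ¬a =
    ≤-trans (≤-trans (≤-reflexive (+-comm 1 (count A))) (+-monoʳ-≤ (count A) (count-∈ {Q = ⟨ x ≟_ ⟩} (∈⟨⟩ (x ≟_) refl))))
      (count-⊎ f (λ h → subst (_∈ Q) (⟨⟩∈ (x ≟_) h) q) (λ a h → ¬a (subst (_∈ A) (sym (⟨⟩∈ (x ≟_) h)) a)))

  count≤1 : ∀ {n} {Q : VSet n} → (∀ {x y} → x ∈ Q → y ∈ Q → x ≡ y) → count Q ≤ 1
  count≤1 {zero} h = z≤n
  count≤1 {suc n} {Q} h with Q zero in e
  ... | false = count≤1 {n} {Q ∘ suc} λ a b → suc-inj (h (mem (holds a)) (mem (holds b)))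
  ... | true = s≤s (≤-reflexive (sum-zero λ i → lem i (Q (suc i)) refl))
    where
    lem : ∀ i b → Q (suc i) ≡ b → χ b ≡ 0
    lem i false _ = refl
    lem i true e' = case h (mem e) (mem e') of λ ()

  count≤1+ : ∀ {n} {Q A : VSet n} v → (∀ {x} → x ∈ Q → x ≢ v → x ∈ A) → count Q ≤ 1 + count A
  count≤1+ {Q = Q} {A} v f = ≤-trans (count-∪ {A = ⟨ v ≟_ ⟩} {A} lem)
    (+-monoˡ-≤ (count A) (count≤1 λ a b → trans (sym (⟨⟩∈ (v ≟_) a)) (⟨⟩∈ (v ≟_) b)))
    where
    lem : ∀ {x} → x ∈ Q → x ∈ ⟨ v ≟_ ⟩ ⊎ x ∈ A
    lem {x} q = case v ≟ x of λ { (yes e) → inj₁ (∈⟨⟩ (v ≟_) e) ; (no ne) → inj₂ (f q (ne ∘ sym)) }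

  elems : ∀ {n} → VSet n → List (Fin n)
  elems {n} Q = filter (_∈? Q) (allFin n)

  length-elems : ∀ {n} (Q : VSet n) → length (elems Q) ≡ count Q
  length-elems {n} Q = go n id
    where
    go : ∀ m (f : Fin m → Fin n) → length (filter (_∈? Q) (tabulate f)) ≡ sum (χ ∘ Q ∘ f)
    go zero f = refl
    go (suc m) f with Q (f zero)
    ... | true = cong suc (go m (f ∘ suc))
    ... | false = go m (f ∘ suc)

  Picks : ∀ {n} → ℕ → VSet n → List (Fin n) → Set
  Picks k Q ys = length ys ≡ k × Unique ys × All (_∈ Q) ys

  pick : ∀ {n} {Q : VSet n} k → k ≤ count Q → ∃ (Picks k Q)
  pick {n} {Q} k h = take k (elems Q)
    , trans (length-take k (elems Q)) (m≤n⇒m⊓n≡m (≤-trans h (≤-reflexive (sym (length-elems Q)))))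
    , Unique.take⁺ k (Unique.filter⁺ (_∈? Q) (Unique.allFin⁺ n))
    , All.take⁺ k (All.all-filter (_∈? Q) (allFin n))

  unpick : ∀ {n} {Q : VSet n} {ys} k → Picks k Q ys → k ≤ count Q
  unpick zero p = z≤n
  unpick {Q = Q} {y ∷ ys} (suc k) (l , u ∷ us , q ∷ qs) =
    ≤-trans (s≤s (unpick {Q = Q'} k (suc-injective l , us , All.zipWith (λ { (a , b) → ∈⟨⟩ d (a , b) }) (qs , u))))
      (count-⊂ {A = Q'} {Q} {y} (λ h → proj₁ (⟨⟩∈ d h)) q (λ h → proj₂ (⟨⟩∈ d h) refl))
    where
    d : ∀ x → Dec (x ∈ Q × y ≢ x)
    d x = (x ∈? Q) ×-dec ¬? (y ≟ x)
    Q' = ⟨ d ⟩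

  pick₁ : ∀ {n} {Q : VSet n} → 1 ≤ count Q → ∃ (_∈ Q)
  pick₁ h with pick 1 h
  ... | x ∷ [] , _ , _ , q ∷ [] = x , q

  -- ys spans all but (miss e ys) of its pairs in the graph e
  row : ∀ {n} → (Fin n → Fin n → Bool) → Fin n → List (Fin n) → ℕ
  row e x [] = 0
  row e x (y ∷ ys) = χ (not (e x y)) + row e x ys

  miss : ∀ {n} → (Fin n → Fin n → Bool) → List (Fin n) → ℕ
  miss e [] = 0
  miss e (y ∷ ys) = row e y ys + miss e ys

  -- K_k minus at most d edges. With d = 1 and k = 3, 4, 5 this is P₃, K₄ - e and H₃.
  Has : ∀ {n} → (Fin n → Fin n → Bool) → ℕ → ℕ → VSet n → Set
  Has e k d Q = ∃ λ ys → Picks k Q ys × miss e ys ≤ d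

  row-0 : ∀ {n} {e : Fin n → Fin n → Bool} {x ys} → All (λ y → e x y ≡ true) ys → row e x ys ≡ 0
  row-0 [] = refl
  row-0 {e = e} {x} {y ∷ ys} (p ∷ ps) = trans (cong (λ b → χ (not b) + row e x ys) p) (row-0 ps)

  row-++ : ∀ {n} (e : Fin n → Fin n → Bool) x ys zs → row e x (ys ++ zs) ≡ row e x ys + row e x zs
  row-++ e x [] zs = refl
  row-++ e x (y ∷ ys) zs = trans (cong (χ (not (e x y)) +_) (row-++ e x ys zs)) (sym (+-assoc (χ (not (e x y))) _ _))

  miss-++ : ∀ {n} {e : Fin n → Fin n → Bool} {ys zs} → All (λ y → All (λ z → e y z ≡ true) zs) ys → miss e (ys ++ zs) ≡ miss e ys + miss e zs
  miss-++ [] = refl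
  miss-++ {e = e} {y ∷ ys} {zs} (p ∷ ps) = begin
    row e y (ys ++ zs) + miss e (ys ++ zs)        ≡⟨ cong₂ _+_ (row-++ e y ys zs) (miss-++ ps) ⟩
    (row e y ys + row e y zs) + (miss e ys + miss e zs) ≡⟨ cong (λ t → (row e y ys + t) + (miss e ys + miss e zs)) (row-0 p) ⟩
    (row e y ys + 0) + (miss e ys + miss e zs)    ≡⟨ cong (_+ (miss e ys + miss e zs)) (+-identityʳ (row e y ys)) ⟩
    row e y ys + (miss e ys + miss e zs)          ≡⟨ +-assoc (row e y ys) _ _ ⟨
    (row e y ys + miss e ys) + miss e zs          ∎
    where open ≡-Reasoning

  Has-mono : ∀ {n} {e e' : Fin n → Fin n → Bool} {k d d' A B} → (∀ {x y} → x ≢ y → x ∈ A → y ∈ A → e x y ≡ true → e' x y ≡ true) →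
    A ⊆ B → d ≤ d' → Has e k d A → Has e' k d' B
  Has-mono {n} {e} {e'} {A = A} f g h (ys , (l , u , p) , m) = ys , (l , u , All.map g p) , ≤-trans (le u p) (≤-trans m h)
    where
    χle : ∀ {a b} → (a ≡ true → b ≡ true) → χ (not b) ≤ χ (not a)
    χle {false} {b} _ = χ≤1 (not b)
    χle {true} {true} _ = z≤n
    χle {true} {false} q = case q refl of λ ()
    rle : ∀ {x ys} → x ∈ A → All (x ≢_) ys → All (_∈ A) ys → row e' x ys ≤ row e x ys
    rle x [] [] = z≤n
    rle x (ne ∷ nes) (y ∷ ys) = +-mono-≤ (χle (f ne x y)) (rle x nes ys)
    le : ∀ {ys} → Unique ys → All (_∈ A) ys → miss e' ys ≤ miss e ys
    le [] [] = z≤n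
    le (u ∷ us) (p ∷ ps) = +-mono-≤ (rle p u ps) (le us ps)

  Has-⊆ : ∀ {n} {e : Fin n → Fin n → Bool} {k d A B} → A ⊆ B → Has e k d A → Has e k d B
  Has-⊆ g = Has-mono (λ _ _ _ h → h) g ≤-refl

  Has-≤ : ∀ {n} {e : Fin n → Fin n → Bool} {k d d' A} → d ≤ d' → Has e k d A → Has e k d' A
  Has-≤ = Has-mono (λ _ _ _ h → h) (λ h → h)

  -- No pair between the two lists is missing, so orders and defects add. Nearly every forbidden
  -- subgraph in the upper bound is assembled in this way from a small piece on either side of a
  -- monochromatic join.
  Has-join : ∀ {n} {e : Fin n → Fin n → Bool} {k d k' d' A B Q} → A ⊆ Q → B ⊆ Q → (∀ {x y} → x ∈ A → y ∈ B → x ≢ y × e x y ≡ true) →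
    Has e k d A → Has e k' d' B → Has e (k + k') (d + d') Q
  Has-join {e = e} f g h (ys , (l , u , p) , m) (zs , (l' , u' , p') , m') =
    ys ++ zs , (trans (length-++ ys) (cong₂ _+_ l l') , Unique.++⁺ u u' (λ { (a , b) → proj₁ (h (All.lookup p a) (All.lookup p' b)) refl })
      , All.++⁺ (All.map f p) (All.map g p')) ,
    ≤-trans (≤-reflexive (miss-++ (All.map (λ a → All.map (λ b → proj₂ (h a b)) p') p))) (+-mono-≤ m m')

  Has-1 : ∀ {n} {e : Fin n → Fin n → Bool} {Q x} → x ∈ Q → Has e 1 0 Q
  Has-1 {x = x} q = x ∷ [] , (refl , [] ∷ [] , q ∷ []) , z≤n

  Has-2 : ∀ {n} {e : Fin n → Fin n → Bool} {Q x y} → x ∈ Q → y ∈ Q → x ≢ y → e x y ≡ true → Has e 2 0 Q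
  Has-2 {x = x} {y} p q ne h = x ∷ y ∷ [] , (refl , (ne ∷ []) ∷ [] ∷ [] , p ∷ q ∷ []) , ≤-reflexive (cong (λ t → χ (not t) + 0 + 0) h)

  -- Two vertices, adjacent or not, supply the missing edge of P₃, K₄ - e or H₃ when joined to a
  -- vertex, an edge or a triangle.
  Has-21 : ∀ {n} {e : Fin n → Fin n → Bool} {Q} → 2 ≤ count Q → Has e 2 1 Q
  Has-21 {e = e} h with pick 2 h
  ... | x ∷ y ∷ [] , p = x ∷ y ∷ [] , p , ≤-trans (≤-reflexive (trans (+-identityʳ _) (+-identityʳ _))) (χ≤1 (not (e x y)))

  edge : ∀ {n} {e : Fin n → Fin n → Bool} {Q} → Has e 2 0 Q → ∃ λ x → ∃ λ y → x ∈ Q × y ∈ Q × x ≢ y × e x y ≡ true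
  edge {e = e} (x ∷ y ∷ [] , (_ , (ne ∷ _) ∷ _ , p ∷ q ∷ _) , m) with e x y in eq
  ... | true = x , y , p , q , ne , eq
  ... | false = case m of λ ()

  Has-full : ∀ {n} {e : Fin n → Fin n → Bool} {Q} k → (∀ {x y} → x ∈ Q → y ∈ Q → x ≢ y → e x y ≡ true) → k ≤ count Q → Has e k 0 Q
  Has-full {e = e} {Q} k f h = let ys , p@(_ , u , q) = pick k h in ys , p , ≤-reflexive (go u q)
    where
    go : ∀ {ys} → Unique ys → All (_∈ Q) ys → miss e ys ≡ 0
    go [] [] = refl
    go (u ∷ us) (q ∷ qs) = cong₂ _+_ (row-0 (All.zipWith (λ { (ne , q') → f q q' ne }) (u , qs))) (go us qs)

-- Two-colour Ramsey bounds by neighbourhood recursion.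

module SmallRamsey where

  import Data.Sum as Sum
  open Subsets

  BGraph : ℕ → Set
  BGraph n = Fin n → Fin n → Bool

  Symm : ∀ {n} → BGraph n → Set
  Symm e = ∀ x y → e x y ≡ e y x

  nbhd? : ∀ {n} (e : BGraph n) (v : Fin n) (Q : VSet n) (x : Fin n) → Dec (x ∈ Q × v ≢ x × e v x ≡ true)
  nbhd? e v Q x = (x ∈? Q) ×-dec ¬? (v ≟ x) ×-dec (e v x ≟ᵇ true)

  nbhd : ∀ {n} → BGraph n → Fin n → VSet n → VSet n
  nbhd e v Q = ⟨ nbhd? e v Q ⟩

  nbhd-⊆ : ∀ {n} (g : BGraph n) v {Q} → nbhd g v Q ⊆ Q
  nbhd-⊆ g v {Q} p = proj₁ (⟨⟩∈ (nbhd? g v Q) p)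

  Has-nbhd : ∀ {n} {e : BGraph n} {v k d Q} → v ∈ Q → Has e k d (nbhd e v Q) → Has e (suc k) d Q
  Has-nbhd {e = e} {v} {Q = Q} q h = Has-join {A = ⟨ v ≟_ ⟩}
    (λ p → subst (_∈ Q) (⟨⟩∈ (v ≟_) p) q) (nbhd-⊆ e v)
    (λ p r → subst (λ t → t ≢ _ × e t _ ≡ true) (⟨⟩∈ (v ≟_) p) (proj₂ (⟨⟩∈ (nbhd? e v Q) r)))
    (Has-1 (∈⟨⟩ (v ≟_) refl)) h

  Covers : ∀ {n} → BGraph n → BGraph n → VSet n → Set
  Covers e f Q = ∀ {x y} → x ∈ Q → y ∈ Q → x ≢ y → e x y ≡ true ⊎ f x y ≡ true

  module _ {n} (e f : BGraph n) where

    Bound : ℕ → ℕ → ℕ → ℕ → ℕ → Set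
    Bound k d k' d' N = ∀ {Q} → Covers e f Q → ¬ Has e k d Q → ¬ Has f k' d' Q → count Q ≤ N

    degrees : ∀ {v Q} → Covers e f Q → v ∈ Q → count Q ≤ 1 + (count (nbhd e v Q) + count (nbhd f v Q))
    degrees {v} {Q} c q = ≤-trans (count≤1+ {A = ⟨ d ⟩} v (λ p ne → ∈⟨⟩ d (p , ne ∘ sym)))
      (s≤s (count-∪ λ r → let p , ne = ⟨⟩∈ d r in case c q p ne of λ
        { (inj₁ h) → inj₁ (∈⟨⟩ (nbhd? e v Q) (p , ne , h)) ; (inj₂ h) → inj₂ (∈⟨⟩ (nbhd? f v Q) (p , ne , h)) }))
      where
      d : ∀ x → Dec (x ∈ Q × v ≢ x)
      d x = (x ∈? Q) ×-dec ¬? (v ≟ x)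

    Covers-⊆ : ∀ {A Q} → A ⊆ Q → Covers e f Q → Covers e f A
    Covers-⊆ g c p q = c (g p) (g q)

    red-degree : ∀ {k d k' d' N v Q} → Bound k d k' d' N → Covers e f Q → ¬ Has e (suc k) d Q → ¬ Has f k' d' Q → v ∈ Q → count (nbhd e v Q) ≤ N
    red-degree {v = v} b c h h' q = b (Covers-⊆ (nbhd-⊆ e v) c) (h ∘ Has-nbhd q) (h' ∘ Has-⊆ (nbhd-⊆ e v))

    blue-degree : ∀ {k d k' d' N v Q} → Bound k d k' d' N → Covers e f Q → ¬ Has e k d Q → ¬ Has f (suc k') d' Q → v ∈ Q → count (nbhd f v Q) ≤ N
    blue-degree {v = v} b c h h' q = b (Covers-⊆ (nbhd-⊆ f v) c) (h ∘ Has-⊆ (nbhd-⊆ f v)) (h' ∘ Has-nbhd q)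

    -- The Erdős-Szekeres recursion. The numbers bound orders of colourings, one below Ramsey
    -- numbers, whence the form 1 + (N + N′): a vertex and its two neighbourhoods.
    Bound-step : ∀ {k d k' d' N N'} → Bound k d (suc k') d' N → Bound (suc k) d k' d' N' → Bound (suc k) d (suc k') d' (1 + (N + N'))
    Bound-step b b' {Q} c h h' with 1 ≤? count Q
    ... | no z = ≤-trans (≤-pred (≰⇒> z)) z≤n
    ... | yes p = let v , q = pick₁ p in ≤-trans (degrees c q) (s≤s (+-mono-≤ (red-degree b c h h' q) (blue-degree b' c h h' q)))

    Bound-2,0 : ∀ {k' d'} → Bound 2 0 (suc k') d' k'
    Bound-2,0 {k'} {d'} {Q} c h h' with count Q ≤? k'
    ... | yes p = p
    ... | no p = ⊥-elim (h' (Has-≤ z≤n (Has-full (suc k') (λ x y ne → case c x y ne of λ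
      { (inj₁ r) → ⊥-elim (h (Has-2 x y ne r)) ; (inj₂ b) → b }) (≰⇒> p))))

    Bound-2,1 : ∀ {k' d'} → Bound 2 1 k' d' 1
    Bound-2,1 {Q = Q} c h h' with count Q ≤? 1
    ... | yes p = p
    ... | no p = ⊥-elim (h (Has-21 (≰⇒> p)))

  Bound-sym : ∀ {n} {e f : BGraph n} {k d k' d' N} → Bound e f k d k' d' N → Bound f e k' d' k d N
  Bound-sym b c h h' = b (λ p q ne → Sum.swap (c p q ne)) h' h

  module _ {n} (e f : BGraph n) where

    K₃-K₃ : Bound e f 3 0 3 0 5
    K₃-K₃ = Bound-step e f (Bound-2,0 e f) (Bound-sym (Bound-2,0 f e))

    K₄-K₃′ : Bound e f 4 0 3 0 9
    K₄-K₃′ = Bound-step e f K₃-K₃ (Bound-sym (Bound-2,0 f e))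

    P₃-J₄ : Bound e f 3 1 4 1 5
    P₃-J₄ = Bound-step e f (Bound-2,1 e f) (Bound-step e f (Bound-2,1 e f) (Bound-sym (Bound-2,1 f e)))

    P₃-J₅ : Bound e f 3 1 5 1 7
    P₃-J₅ = Bound-step e f (Bound-2,1 e f) P₃-J₄

  module _ {n} (e f : BGraph n) where

    -- The recursion gives 19 = 1 + 7 + (1 + 5 + 5). This lies two below 21, the room for the slack
    -- of K₄ - e in both colours when all parts are single vertices.
    J₄-J₅ : Bound e f 4 1 5 1 19
    J₄-J₅ = Bound-step e f (P₃-J₅ e f) (Bound-step e f (P₃-J₄ e f) (Bound-sym (P₃-J₄ f e)))

  -- Handshake argument: by symmetry the first row and the first column contribute equally, and the
  -- rest is a smaller symmetric matrix.
  even-sum : ∀ {n} (g : Fin n → Fin n → ℕ) → (∀ x → g x x ≡ 0) → (∀ x y → g x y ≡ g y x) → 2 ∣ sum (λ x → sum (g x))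
  even-sum {zero} g d s = divides 0 refl
  even-sum {suc n} g d s = subst (2 ∣_) (sym eq) (∣m∣n⇒∣m+n (divides (sum (g zero ∘ suc)) refl) (even-sum (λ x y → g (suc x) (suc y)) (d ∘ suc) (λ x y → s (suc x) (suc y))))
    where
    open ≡-Reasoning
    r = sum (g zero ∘ suc)
    t = sum (λ x → sum (λ y → g (suc x) (suc y)))
    eq : sum (λ x → sum (g x)) ≡ r * 2 + t
    eq = begin
      (g zero zero + r) + sum (λ x → g (suc x) zero + sum (λ y → g (suc x) (suc y)))
        ≡⟨ cong₂ _+_ (cong (_+ r) (d zero)) (∑-distrib-+ (λ x → g (suc x) zero) (λ x → sum (λ y → g (suc x) (suc y)))) ⟩
      r + (sum (λ x → g (suc x) zero) + t)
        ≡⟨ cong (λ w → r + (w + t)) (sum-cong-≗ (λ x → s (suc x) zero)) ⟩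
      r + (r + t)   ≡⟨ +-assoc r r t ⟨
      (r + r) + t   ≡⟨ cong (_+ t) (trans (cong (r +_) (sym (+-identityʳ r))) (*-comm 2 r)) ⟩
      r * 2 + t     ∎

  -- Every vertex of a K₄/K₃-colouring on 9 vertices has blue degree 3, and 9 * 3 is odd.
  K₄-K₃ : ∀ {n} (e f : BGraph n) → Symm f → Bound e f 4 0 3 0 8
  K₄-K₃ {n} e f sf {Q} c h h' with count Q ≤? 8
  ... | yes p = p
  ... | no p = ⊥-elim (from-no (2 ∣? 27) (subst (2 ∣_) total (even-sum g diag g-sym)))
    where
    g : Fin n → Fin n → ℕ
    g x y = χ (Q x ∧ nbhd f x Q y)
    nine : count Q ≡ 9
    nine = ≤-antisym (K₄-K₃′ e f c h h') (≰⇒> p)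
    -- The red neighbourhood carries a K₃/K₃-colouring, so 9 ≤ 1 + 5 + (blue degree); the blue
    -- degree is at most 3 because blue neighbours are pairwise red.
    three : ∀ {x} → x ∈ Q → count (nbhd f x Q) ≡ 3
    three q = ≤-antisym (blue-degree e f (Bound-sym (Bound-2,0 f e)) c h h' q)
      (+-cancelˡ-≤ 6 _ _ (≤-trans (≤-reflexive (sym nine)) (≤-trans (degrees e f c q) (s≤s (+-monoˡ-≤ _ (red-degree e f (K₃-K₃ e f) c h h' q))))))
    rowsum : ∀ x b → Q x ≡ b → sum (λ y → χ (b ∧ nbhd f x Q y)) ≡ 3 * χ b
    rowsum x true q = three (mem q)
    rowsum x false _ = sum-zero {n} (λ _ → refl)
    total : sum (λ x → sum (g x)) ≡ 27
    total = trans (sum-cong-≗ (λ x → rowsum x (Q x) refl)) (trans (sym (*-distribˡ-sum 3 (χ ∘ Q))) (cong (3 *_) nine))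
    iff : ∀ {a b} → (a ≡ true → b ≡ true) → (b ≡ true → a ≡ true) → χ a ≡ χ b
    iff {true} {true} _ _ = refl
    iff {false} {false} _ _ = refl
    iff {true} {false} u _ = case u refl of λ ()
    iff {false} {true} _ u = case u refl of λ ()
    ∧-true : ∀ {a b} → a ∧ b ≡ true → a ≡ true × b ≡ true
    ∧-true {true} {true} _ = refl , refl
    flip : ∀ x y → Q x ∧ nbhd f x Q y ≡ true → Q y ∧ nbhd f y Q x ≡ true
    flip x y h = let q , r = ∧-true h ; p , ne , b = ⟨⟩∈ (nbhd? f x Q) (mem r) in
      cong₂ _∧_ (_∈_.holds p) (_∈_.holds (∈⟨⟩ (nbhd? f y Q) (mem q , ne ∘ sym , trans (sf y x) b)))
    g-sym : ∀ x y → g x y ≡ g y x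
    g-sym x y = iff (flip x y) (flip y x)
    diag : ∀ x → g x x ≡ 0
    diag x with Q x ∧ nbhd f x Q x in eq
    ... | false = refl
    ... | true = ⊥-elim (proj₁ (proj₂ (⟨⟩∈ (nbhd? f x Q) (mem (proj₂ (∧-true {Q x} eq))))) refl)

  K₄-K₄ : ∀ {n} (e f : BGraph n) → Symm e → Symm f → Bound e f 4 0 4 0 17
  K₄-K₄ e f se sf = Bound-step e f (Bound-sym (K₄-K₃ f e se)) (K₄-K₃ e f sf)

-- Exhaustive extension of small graphs vertex by vertex.

module Extension where

  open import Data.Bool using (T)
  open Subsets
  open SmallRamsey

  -- A graph on a list of vertices: each row records the adjacency of a vertex to the vertices after it.
  Row : Set
  Row = List Bool

  Matrix : Set
  Matrix = List Row

  matrix : ∀ {n} → BGraph n → List (Fin n) → Matrix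
  matrix r [] = []
  matrix r (x ∷ xs) = map (r x) xs ∷ matrix r xs

  cost : Bool → Bool → ℕ
  cost true b = χ (not b)
  cost false b = χ b

  addCost : Bool → Row → List ℕ → List ℕ
  addCost c (b ∷ bs) (w ∷ ws) = (cost c b + w) ∷ addCost c bs ws
  addCost c _ _ = []

  -- k further vertices spanning, together with the vertices already charged in ws, at most d non-edges of colour c
  dense : Bool → ℕ → ℕ → List ℕ → Matrix → Bool
  dense c zero d ws G = true
  dense c (suc k) d (w ∷ ws) (g ∷ G) = (if w ≤ᵇ d then dense c k (d ∸ w) (addCost c g ws) G else false) ∨ dense c (suc k) d ws G
  dense c (suc k) d _ _ = false

  -- (c , k , d) forbids K_{k+2} with at most d edges missing in colour c. The two vertices not
  -- counted in k are the new vertex and the first old one, which `violates` always puts into the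
  -- copy.
  Constraint : Set
  Constraint = Bool × ℕ × ℕ

  violates : Row → Matrix → Constraint → Bool
  violates (b ∷ ρ) (g ∷ G) (c , k , d) =
    if cost c b ≤ᵇ d then dense c k (d ∸ cost c b) (addCost c g (map (cost c) ρ)) G else false
  violates _ _ _ = false

  violatesAny : List Constraint → Row → Matrix → Bool
  violatesAny [] ρ G = false
  violatesAny (γ ∷ γs) ρ G = if violates ρ G γ then true else violatesAny γs ρ G

  -- Rows are built from the back. A forbidden copy that avoids the vertex of `g` was already tested
  -- for the shorter row, so only copies through both the new vertex and the vertex of `g` are
  -- examined here.
  extend : List Constraint → Row → Matrix → Matrix → Matrix
  extend γs g G [] = []
  extend γs g G (ρ ∷ ρs) = keep true (keep false (extend γs g G ρs))
    where
    keep : Bool → Matrix → Matrix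
    keep b rest = if violatesAny γs (b ∷ ρ) (g ∷ G) then rest else (b ∷ ρ) ∷ rest

  -- all rows by which a further vertex can be attached, its last entry being one of bs
  rows : List Constraint → Row → Matrix → Matrix
  rows γs bs [] = [] ∷ []
  rows γs bs (g ∷ []) = map (_∷ []) bs
  rows γs bs (g ∷ G@(_ ∷ _)) = extend γs g G (rows γs bs G)

  both : Row
  both = true ∷ false ∷ []

  -- all matrices arising from G by attaching k vertices in turn
  grow : List Constraint → Row → ℕ → Matrix → List Matrix
  grow γs bs zero G = G ∷ []
  grow γs bs (suc k) G = concatMap (λ H → map (_∷ H) (rows γs bs H)) (grow γs bs k G)

  matrices : List Constraint → ℕ → List Matrix
  matrices γs k = grow γs both k []

  colour : ∀ {n} → Bool → BGraph n → BGraph n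
  colour true r = r
  colour false r x y = not (r x y)

  cost-colour : ∀ {n} c (r : BGraph n) x y → cost c (r x y) ≡ χ (not (colour c r x y))
  cost-colour true r x y = refl
  cost-colour false r x y with r x y
  ... | true = refl
  ... | false = refl

  if-true : ∀ {b c} → (if b then c else false) ≡ true → b ≡ true × c ≡ true
  if-true {true} h = refl , h

  ∨-true : ∀ {b c} → b ∨ c ≡ true → b ≡ true ⊎ c ≡ true
  ∨-true {true} h = inj₁ refl
  ∨-true {false} h = inj₂ h

  ≤ᵇ-true : ∀ {m k} → (m ≤ᵇ k) ≡ true → m ≤ k
  ≤ᵇ-true {m} {k} h = ≤ᵇ⇒≤ m k (subst T (sym h) tt)

  addCost-map : ∀ {n} c (r : BGraph n) x (ω : Fin n → ℕ) xs →
    addCost c (map (r x) xs) (map ω xs) ≡ map (λ y → χ (not (colour c r x y)) + ω y) xs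
  addCost-map c r x ω [] = refl
  addCost-map c r x ω (y ∷ ys) = cong₂ _∷_ (cong (_+ ω y) (cost-colour c r x y)) (addCost-map c r x ω ys)

  row+charges : ∀ {n} (e : BGraph n) x (ω : Fin n → ℕ) ys → sumˡ (map (λ y → χ (not (e x y)) + ω y) ys) ≡ row e x ys + sumˡ (map ω ys)
  row+charges e x ω [] = refl
  row+charges e x ω (y ∷ ys) = trans (cong (χ (not (e x y)) + ω y +_) (row+charges e x ω ys)) (interchange (χ (not (e x y))) (ω y) (row e x ys) (sumˡ (map ω ys)))

  -- In use, the charge ω of a vertex is the number of missing pairs between it and the vertices
  -- chosen so far. Charges and `miss` together then count all missing pairs of the final copy.
  dense-sound : ∀ {n} (r : BGraph n) c k d (ω : Fin n → ℕ) {Q xs} → Unique xs → All (_∈ Q) xs → dense c k d (map ω xs) (matrix r xs) ≡ true →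
    ∃ λ ys → Picks k Q ys × (∀ {z} → All (z ≢_) xs → All (z ≢_) ys) × sumˡ (map ω ys) + miss (colour c r) ys ≤ d
  dense-sound r c zero d ω u q h = [] , (refl , [] , []) , (λ _ → []) , z≤n
  dense-sound r c (suc k) d ω {xs = x ∷ xs} (u ∷ us) (q ∷ qs) h with ∨-true h
  ... | inj₂ h' = let ys , p , w , le = dense-sound r c (suc k) d ω us qs h' in ys , p , (λ { (_ ∷ a) → w a }) , le
  ... | inj₁ h' = let a , b = if-true h'
                      ys , (l , u' , q') , w , le = dense-sound r c k (d ∸ ω x) (λ y → χ (not (e x y)) + ω y) us qs
                        (trans (cong (λ t → dense c k (d ∸ ω x) t (matrix r xs)) (sym (addCost-map c r x ω xs))) b)
                  in x ∷ ys , (cong suc l , w u ∷ u' , q ∷ q') , (λ { (z ∷ a) → z ∷ w a }) , bound ys (≤ᵇ-true a) le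
    where
    e = colour c r
    open ≤-Reasoning
    bound : ∀ ys → ω x ≤ d → sumˡ (map (λ y → χ (not (e x y)) + ω y) ys) + miss e ys ≤ d ∸ ω x → (ω x + sumˡ (map ω ys)) + (row e x ys + miss e ys) ≤ d
    bound ys a le = begin
      (ω x + s) + (row e x ys + miss e ys)  ≡⟨ +-assoc (ω x) s _ ⟩
      ω x + (s + (row e x ys + miss e ys))  ≡⟨ cong (ω x +_) (trans (sym (+-assoc s _ _)) (cong (_+ miss e ys) (+-comm s _))) ⟩
      ω x + ((row e x ys + s) + miss e ys)  ≡⟨ cong (λ t → ω x + (t + miss e ys)) (row+charges e x ω ys) ⟨
      ω x + (sumˡ (map (λ y → χ (not (e x y)) + ω y) ys) + miss e ys) ≤⟨ +-monoʳ-≤ (ω x) le ⟩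
      ω x + (d ∸ ω x)                       ≡⟨ m+[n∸m]≡n a ⟩
      d                                     ∎
      where s = sumˡ (map ω ys)

  Forbids : ∀ {n} → BGraph n → VSet n → Constraint → Set
  Forbids r Q (c , k , d) = ¬ Has (colour c r) (2 + k) d Q

  violates-sound : ∀ {n} (r : BGraph n) {Q y xs} γ → Unique (y ∷ xs) → All (_∈ Q) (y ∷ xs) → Forbids r Q γ → violates (map (r y) xs) (matrix r xs) γ ≡ false
  violates-sound r {Q} {y} {[]} γ u q f = refl
  violates-sound r {Q} {y} {x ∷ xs} γ@(c , k , d) ((ne ∷ nes) ∷ u ∷ us) (qy ∷ q ∷ qs) f with violates (map (r y) (x ∷ xs)) (matrix r (x ∷ xs)) γ in eq
  ... | false = refl
  ... | true = ⊥-elim (f (y ∷ x ∷ ys , (cong (2 +_) l , (ne ∷ w nes) ∷ w u ∷ u' , qy ∷ q ∷ q') , bound))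
    where
    e = colour c r
    ω : _ → ℕ
    ω z = χ (not (e x z)) + χ (not (e y z))
    t = if-true eq
    weights : ∀ zs → addCost c (map (r x) zs) (map (cost c) (map (r y) zs)) ≡ map ω zs
    weights [] = refl
    weights (z ∷ zs) = cong₂ _∷_ (cong₂ _+_ (cost-colour c r x z) (cost-colour c r y z)) (weights zs)
    ds = dense-sound r c k (d ∸ cost c (r y x)) ω us qs (trans (cong (λ z → dense c k (d ∸ cost c (r y x)) z (matrix r xs)) (sym (weights xs))) (proj₂ t))
    ys = proj₁ ds
    l = proj₁ (proj₁ (proj₂ ds))
    u' = proj₁ (proj₂ (proj₁ (proj₂ ds)))
    q' = proj₂ (proj₂ (proj₁ (proj₂ ds)))
    w : ∀ {z} → All (z ≢_) xs → All (z ≢_) ys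
    w = proj₁ (proj₂ (proj₂ ds))
    rowsum : ∀ zs → sumˡ (map ω zs) ≡ row e x zs + row e y zs
    rowsum zs = trans (row+charges e x (λ z → χ (not (e y z))) zs) (cong (row e x zs +_) (sym (lem zs)))
      where
      lem : ∀ zs → row e y zs ≡ sumˡ (map (λ z → χ (not (e y z))) zs)
      lem [] = refl
      lem (z ∷ zs) = cong (χ (not (e y z)) +_) (lem zs)
    bound : (χ (not (e y x)) + row e y ys) + (row e x ys + miss e ys) ≤ d
    bound = begin
      (χ (not (e y x)) + row e y ys) + (row e x ys + miss e ys)  ≡⟨ cong (λ z → (z + row e y ys) + (row e x ys + miss e ys)) (sym (cost-colour c r y x)) ⟩
      (p + row e y ys) + (row e x ys + miss e ys)                ≡⟨ +-assoc p _ _ ⟩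
      p + (row e y ys + (row e x ys + miss e ys))                ≡⟨ cong (p +_) (trans (sym (+-assoc (row e y ys) _ _)) (cong (_+ miss e ys) (+-comm (row e y ys) _))) ⟩
      p + ((row e x ys + row e y ys) + miss e ys)                ≡⟨ cong (λ z → p + (z + miss e ys)) (rowsum ys) ⟨
      p + (sumˡ (map ω ys) + miss e ys)                          ≤⟨ +-monoʳ-≤ p (proj₂ (proj₂ (proj₂ ds))) ⟩
      p + (d ∸ p)                                                ≡⟨ m+[n∸m]≡n {p} (≤ᵇ-true {p} (proj₁ t)) ⟩
      d                                                          ∎
      where
      p = cost c (r y x)
      open ≤-Reasoning

  violatesAny-sound : ∀ {n} (r : BGraph n) {Q y xs} γs → Unique (y ∷ xs) → All (_∈ Q) (y ∷ xs) → All (Forbids r Q) γs → violatesAny γs (map (r y) xs) (matrix r xs) ≡ false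
  violatesAny-sound r [] u q [] = refl
  violatesAny-sound r {y = y} {xs} (γ ∷ γs) u q (f ∷ fs) rewrite violates-sound r {y = y} {xs} γ u q f = violatesAny-sound r γs u q fs

  extend-sound : ∀ γs g G {ρs} b ρ → ρ ∈ˡ ρs → violatesAny γs (b ∷ ρ) (g ∷ G) ≡ false → (b ∷ ρ) ∈ˡ extend γs g G ρs
  extend-sound γs g G true ρ (here refl) h rewrite h = here refl
  extend-sound γs g G false ρ (here refl) h rewrite h with violatesAny γs (true ∷ ρ) (g ∷ G)
  ... | true = here refl
  ... | false = there (here refl)
  extend-sound γs g G {ρ' ∷ ρs} b ρ (there i) h with violatesAny γs (true ∷ ρ') (g ∷ G) | violatesAny γs (false ∷ ρ') (g ∷ G) | extend-sound γs g G {ρs} b ρ i h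
  ... | true | true | j = j
  ... | true | false | j = there j
  ... | false | true | j = there j
  ... | false | false | j = there (there j)

  -- In the gluing steps the base list ends in a fixed vertex whose colour towards the new vertices
  -- is prescribed, so the last entry alone is constrained.
  data Last {A : Set} (P : A → Set) : List A → Set where
    [] : Last P []
    last : ∀ {x} → P x → Last P (x ∷ [])
    _∷_ : ∀ x {y ys} → Last P (y ∷ ys) → Last P (x ∷ y ∷ ys)

  rows-sound : ∀ {n} (r : BGraph n) {Q y xs} γs bs → Unique (y ∷ xs) → All (_∈ Q) (y ∷ xs) → All (Forbids r Q) γs →
    Last (λ z → r y z ∈ˡ bs) xs → map (r y) xs ∈ˡ rows γs bs (matrix r xs)
  rows-sound r γs bs u q f [] = here refl
  rows-sound r γs bs u q f (last i) = ∈-map⁺ (_∷ []) i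
  rows-sound r {y = y} {xs = x ∷ x' ∷ xs} γs bs u@((_ ∷ u') ∷ (_ ∷ u'')) (qy ∷ q ∷ qs) f (x ∷ l) =
    extend-sound γs (map (r x) (x' ∷ xs)) (matrix r (x' ∷ xs)) (r y x) (map (r y) (x' ∷ xs)) (rows-sound r γs bs (u' ∷ u'') (qy ∷ qs) f l)
      (violatesAny-sound r γs u (qy ∷ q ∷ qs) f)

  Last-all : ∀ {A : Set} {P : A → Set} → (∀ x → P x) → ∀ xs → Last P xs
  Last-all f [] = []
  Last-all f (x ∷ []) = last (f x)
  Last-all f (x ∷ y ∷ ys) = x ∷ Last-all f (y ∷ ys)

  ∈both : ∀ b → b ∈ˡ both
  ∈both true = here refl
  ∈both false = there (here refl)

  grow-sound : ∀ {n} (r : BGraph n) {Q} γs bs → All (Forbids r Q) γs → ∀ k {xs ys} → length xs ≡ k → Unique (xs ++ ys) → All (_∈ Q) (xs ++ ys) →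
    (∀ {x} → x ∈ˡ xs → ∀ zs → Last (λ z → r x z ∈ˡ bs) (zs ++ ys)) → matrix r (xs ++ ys) ∈ˡ grow γs bs k (matrix r ys)
  grow-sound r γs bs f zero {[]} l u q e = here refl
  grow-sound r γs bs f (suc k) {x ∷ xs} {ys} l u@(_ ∷ us) q@(_ ∷ qs) e = ∈-concatMap⁺ (λ H → map (_∷ H) (rows γs bs H))
    (Any.map (λ { refl → ∈-map⁺ (_∷ matrix r (xs ++ ys)) (rows-sound r γs bs u q f (e (here refl) xs)) })
      (grow-sound r γs bs f k (suc-injective l) us qs (e ∘ there)))

  matrices-sound : ∀ {n} (r : BGraph n) {Q} γs → All (Forbids r Q) γs → ∀ k {xs} → Picks k Q xs → matrix r xs ∈ˡ matrices γs k
  matrices-sound r {Q} γs f k {xs} (l , u , q) = subst (λ t → matrix r t ∈ˡ matrices γs k) (++-identityʳ xs)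
    (grow-sound r γs both f k {xs} {[]} l (subst Unique (sym (++-identityʳ xs)) u) (subst (All (_∈ Q)) (sym (++-identityʳ xs)) q)
      (λ {x} _ zs → Last-all (λ z → ∈both (r x z)) (zs ++ [])))
    where open import Data.List.Properties using (++-identityʳ)

-- Certified classification of graphs up to the order of their vertices.

module Enumeration where

  open import Data.Bool using (T)
  open Subsets
  open SmallRamsey
  open Extension

  ∧-true : ∀ {a b} → a ∧ b ≡ true → a ≡ true × b ≡ true
  ∧-true {true} {true} _ = refl , refl

  all-sound : ∀ {A : Set} (p : A → Bool) {xs x} → all p xs ≡ true → x ∈ˡ xs → p x ≡ true
  all-sound p {x ∷ xs} h (here refl) = proj₁ (∧-true h)
  all-sound p {x ∷ xs} h (there i) = all-sound p (proj₂ (∧-true {p x} h)) i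

  any-sound : ∀ {A : Set} (p : A → Bool) xs → any p xs ≡ true → ∃ λ x → x ∈ˡ xs × p x ≡ true
  any-sound p (x ∷ xs) h with ∨-true h
  ... | inj₁ e = x , here refl , e
  ... | inj₂ e = let y , i , e' = any-sound p xs e in y , there i , e'

  sameRow : Row → Row → Bool
  sameRow [] [] = true
  sameRow (true ∷ a) (true ∷ b) = sameRow a b
  sameRow (false ∷ a) (false ∷ b) = sameRow a b
  sameRow _ _ = false

  sameRow-sound : ∀ a b → sameRow a b ≡ true → a ≡ b
  sameRow-sound [] [] h = refl
  sameRow-sound (true ∷ a) (true ∷ b) h = cong (true ∷_) (sameRow-sound a b h)
  sameRow-sound (false ∷ a) (false ∷ b) h = cong (false ∷_) (sameRow-sound a b h)

  sameMatrix : Matrix → Matrix → Bool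
  sameMatrix [] [] = true
  sameMatrix (a ∷ G) (b ∷ H) = sameRow a b ∧ sameMatrix G H
  sameMatrix _ _ = false

  sameMatrix-sound : ∀ G H → sameMatrix G H ≡ true → G ≡ H
  sameMatrix-sound [] [] h = refl
  sameMatrix-sound (a ∷ G) (b ∷ H) h = cong₂ _∷_ (sameRow-sound a b (proj₁ (∧-true h))) (sameMatrix-sound G H (proj₂ (∧-true {sameRow a b} h)))

  _∈ᵇ_ : Row → List Row → Bool
  ρ ∈ᵇ ρs = any (sameRow ρ) ρs

  ∈ᵇ-sound : ∀ ρ ρs → (ρ ∈ᵇ ρs) ≡ true → ρ ∈ˡ ρs
  ∈ᵇ-sound ρ ρs h = let σ , i , e = any-sound (sameRow ρ) ρs h in subst (_∈ˡ ρs) (sym (sameRow-sound ρ σ e)) i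

  bits : ℕ → ℕ → Row
  bits zero m = []
  bits (suc k) m = (m % 2 ≡ᵇ 1) ∷ bits k (m / 2)

  toFront : ∀ {A : Set} → ℕ → List A → List A
  toFront zero xs = xs
  toFront (suc i) [] = []
  toFront (suc i) (x ∷ xs) = swapIn (toFront i xs)
    where
    swapIn : List _ → List _
    swapIn [] = x ∷ []
    swapIn (y ∷ ys) = y ∷ x ∷ ys

  -- In a triangular matrix an exchange of the first two vertices keeps their common entry and swaps
  -- the remainders of their rows. Bringing vertex i to the front is a chain of such exchanges.
  toFrontᴹ : ℕ → Matrix → Matrix
  toFrontᴹ zero G = G
  toFrontᴹ (suc i) [] = []
  toFrontᴹ (suc i) (g ∷ G) = merge (toFront i g) (toFrontᴹ i G)
    where
    merge : Row → Matrix → Matrix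
    merge (b ∷ g′) (ρ ∷ G′) = (b ∷ ρ) ∷ g′ ∷ G′
    merge _ _ = g ∷ []

  toFront-↭ : ∀ {A : Set} i (xs : List A) → toFront i xs ↭ xs
  toFront-↭ zero xs = ↭-refl
  toFront-↭ (suc i) [] = ↭-refl
  toFront-↭ (suc i) (x ∷ xs) with toFront i xs | toFront-↭ i xs
  ... | [] | p = prep x p
  ... | y ∷ ys | p = ↭-trans (swap y x ↭-refl) (prep x p)

  toFront-map : ∀ {A B : Set} (f : A → B) i xs → toFront i (map f xs) ≡ map f (toFront i xs)
  toFront-map f zero xs = refl
  toFront-map f (suc i) [] = refl
  toFront-map f (suc i) (x ∷ xs) rewrite toFront-map f i xs with toFront i xs
  ... | [] = refl
  ... | y ∷ ys = refl

  toFront-matrix : ∀ {n} {r : BGraph n} → Symm r → ∀ i xs → matrix r (toFront i xs) ≡ toFrontᴹ i (matrix r xs)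
  toFront-matrix s zero xs = refl
  toFront-matrix s (suc i) [] = refl
  toFront-matrix {r = r} s (suc i) (x ∷ xs) rewrite toFront-map (r x) i xs | sym (toFront-matrix s i xs) with toFront i xs | toFront-↭ i xs
  ... | y ∷ ys | p = cong (λ b → (b ∷ map (r y) ys) ∷ map (r x) ys ∷ matrix r ys) (s y x)
  ... | [] | p with ↭.↭-empty-inv (↭-sym p)
  ...   | refl = refl

  shuffle : List ℕ → Matrix → Matrix
  shuffle [] G = G
  shuffle (i ∷ is) G = shuffle is (toFrontᴹ i G)

  shuffle-sound : ∀ {n} {r : BGraph n} → Symm r → ∀ is xs → ∃ λ zs → zs ↭ xs × matrix r zs ≡ shuffle is (matrix r xs)
  shuffle-sound s [] xs = xs , ↭-refl , refl
  shuffle-sound s (i ∷ is) xs = let zs , p , e = shuffle-sound s is (toFront i xs) in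
    zs , ↭-trans p (toFront-↭ i xs) , trans e (cong (shuffle is) (toFront-matrix s i xs))

  degree : Row → ℕ
  degree ρ = sumˡ (map χ ρ)

  edges : Matrix → ℕ
  edges G = sumˡ (map degree G)

  -- A reordering is stored as one number whose base 12 digits are successive indices for `toFront`;
  -- positions in graphs on at most 12 vertices fit into one digit.
  digits : ℕ → ℕ → List ℕ
  digits zero m = []
  digits (suc k) m = m % 12 ∷ digits k (m / 12)

  -- A vertex of minimum degree has at most the average degree, which is 2e / k for e edges. Rows
  -- violating this are skipped, because the deleted vertex is always chosen of minimum degree.
  light : ℕ → ℕ → Row → Matrix → Bool
  light k m ρ G = (m ≤ᵇ degree ρ + edges G) ∧ (k * degree ρ ≤ᵇ 2 * (degree ρ + edges G))

  -- One code is consumed for each light row, in the order in which `rows` produces them; it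
  -- reorders the extended graph into one of the listed graphs.
  checkRows : ℕ → ℕ → Matrix → List Matrix → Matrix → List ℕ → Bool
  checkRows k m G Hs [] cs = true
  checkRows k m G Hs (ρ ∷ ρs) cs = if light k m ρ G then use cs else checkRows k m G Hs ρs cs
    where
    use : List ℕ → Bool
    use [] = false
    use (c ∷ cs) = any (sameMatrix (shuffle (digits k c) (ρ ∷ G))) Hs ∧ checkRows k m G Hs ρs cs

  checkLevel : ℕ → ℕ → List Constraint → List Matrix → List (List ℕ) → List Matrix → Bool
  checkLevel k m γs [] css Hs = true
  checkLevel k m γs (G ∷ Gs) [] Hs = false
  checkLevel k m γs (G ∷ Gs) (cs ∷ css) Hs = checkRows k m G Hs (rows γs both G) cs ∧ checkLevel k m γs Gs css Hs

  checkRows-sound : ∀ k m G Hs ρs cs → checkRows k m G Hs ρs cs ≡ true → ∀ {ρ} → ρ ∈ˡ ρs → light k m ρ G ≡ true → ∃ λ is → shuffle is (ρ ∷ G) ∈ˡ Hs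
  checkRows-sound k m G Hs (ρ ∷ ρs) cs h i li with light k m ρ G in eq
  checkRows-sound k m G Hs (ρ ∷ ρs) cs h (here refl) li | false = case trans (sym eq) li of λ ()
  checkRows-sound k m G Hs (ρ ∷ ρs) cs h (there i) li | false = checkRows-sound k m G Hs ρs cs h i li
  checkRows-sound k m G Hs (ρ ∷ ρs) (c ∷ cs) h (here refl) li | true =
    let H , i , e = any-sound _ Hs (proj₁ (∧-true h)) in digits k c , subst (_∈ˡ Hs) (sym (sameMatrix-sound _ H e)) i
  checkRows-sound k m G Hs (ρ ∷ ρs) (c ∷ cs) h (there i) li | true = checkRows-sound k m G Hs ρs cs (proj₂ (∧-true {any (sameMatrix (shuffle (digits k c) (ρ ∷ G))) Hs} h)) i li

  checkLevel-sound : ∀ k m γs Gs css Hs → checkLevel k m γs Gs css Hs ≡ true → ∀ {G ρ} → G ∈ˡ Gs → ρ ∈ˡ rows γs both G → light k m ρ G ≡ true →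
    ∃ λ is → shuffle is (ρ ∷ G) ∈ˡ Hs
  checkLevel-sound k m γs (G ∷ Gs) (cs ∷ css) Hs h (here refl) i li = checkRows-sound k m G Hs (rows γs both G) cs (proj₁ (∧-true h)) i li
  checkLevel-sound k m γs (G ∷ Gs) (cs ∷ css) Hs h (there j) i li = checkLevel-sound k m γs Gs css Hs (proj₂ (∧-true {checkRows k m G Hs (rows γs both G) cs} h)) j i li

  light-true : ∀ k m ρ G → m ≤ degree ρ + edges G → k * degree ρ ≤ 2 * (degree ρ + edges G) → light k m ρ G ≡ true
  light-true k m ρ G a b = cong₂ _∧_ (lem (≤⇒≤ᵇ a)) (lem (≤⇒≤ᵇ b))
    where
    lem : ∀ {b} → T b → b ≡ true
    lem {true} _ = refl

  degreeIn : ∀ {n} → BGraph n → List (Fin n) → Fin n → ℕ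
  degreeIn r xs x = sumˡ (map (χ ∘ r x) xs)

  degree-map : ∀ {n} (r : BGraph n) x xs → degree (map (r x) xs) ≡ degreeIn r xs x
  degree-map r x [] = refl
  degree-map r x (y ∷ ys) = cong (χ (r x y) +_) (degree-map r x ys)

  Irr : ∀ {n} → BGraph n → Set
  Irr r = ∀ x → r x x ≡ false

  handshake : ∀ {n} {r : BGraph n} → Symm r → Irr r → ∀ xs → sumˡ (map (degreeIn r xs) xs) ≡ 2 * edges (matrix r xs)
  handshake s i [] = refl
  handshake {r = r} s i (x ∷ xs) = begin
    (χ (r x x) + d) + sumˡ (map (λ y → χ (r y x) + degreeIn r xs y) xs)  ≡⟨ cong₂ _+_ (cong (λ b → χ b + d) (i x)) (split xs) ⟩
    d + (d + sumˡ (map (degreeIn r xs) xs))  ≡⟨ cong (λ t → d + (d + t)) (handshake s i xs) ⟩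
    d + (d + 2 * e)                          ≡⟨ +-assoc d d (2 * e) ⟨
    (d + d) + 2 * e                          ≡⟨ cong (λ t → (d + t) + 2 * e) (+-identityʳ d) ⟨
    2 * d + 2 * e                            ≡⟨ *-distribˡ-+ 2 d e ⟨
    2 * (d + e)                              ≡⟨ cong (λ t → 2 * (t + e)) (degree-map r x xs) ⟨
    2 * (degree (map (r x) xs) + e)          ∎
    where
    open ≡-Reasoning
    d = degreeIn r xs x
    e = edges (matrix r xs)
    split : ∀ ys → sumˡ (map (λ y → χ (r y x) + degreeIn r xs y) ys) ≡ degreeIn r ys x + sumˡ (map (degreeIn r xs) ys)
    split [] = refl
    split (y ∷ ys) = trans (cong₂ _+_ (cong (λ b → χ b + degreeIn r xs y) (s y x)) (split ys)) (interchange (χ (r x y)) (degreeIn r xs y) _ _)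

  minimal : ∀ {A : Set} (f : A → ℕ) x xs → ∃ λ y → ∃ λ ys → (y ∷ ys) ↭ (x ∷ xs) × length (y ∷ ys) * f y ≤ sumˡ (map f (y ∷ ys))
  minimal f x xs = let y , ys , p , a = go x xs in y , ys , p , bound (≤-refl ∷ a)
    where
    go : ∀ x xs → ∃ λ y → ∃ λ ys → (y ∷ ys) ↭ (x ∷ xs) × All (λ z → f y ≤ f z) ys
    go x [] = x , [] , ↭-refl , []
    go x (x' ∷ xs) with go x' xs
    ... | y , ys , p , a with f y ≤? f x
    ...   | yes le = y , x ∷ ys , ↭-trans (swap y x ↭-refl) (prep x p) , le ∷ a
    ...   | no gt = x , y ∷ ys , prep x p , <⇒≤ (≰⇒> gt) ∷ All.map (≤-trans (<⇒≤ (≰⇒> gt))) a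
    bound : ∀ {m zs} → All (λ z → m ≤ f z) zs → length zs * m ≤ sumˡ (map f zs)
    bound [] = z≤n
    bound (h ∷ hs) = +-mono-≤ h (bound hs)

  Classified : ∀ {n} → BGraph n → VSet n → ℕ → ℕ → List Matrix → Set
  Classified r Q k m Gs = ∀ {xs} → Picks k Q xs → m ≤ edges (matrix r xs) → ∃ λ zs → zs ↭ xs × matrix r zs ∈ˡ Gs

  Picks-↭ : ∀ {n k} {Q : VSet n} {xs ys} → ys ↭ xs → Picks k Q xs → Picks k Q ys
  Picks-↭ {Q = Q} p (l , u , q) = trans (↭.↭-length p) l , ↭ₛ.Unique-resp-↭ (setoid _) (↭⇒↭ₛ (↭-sym p)) u , ↭.All-resp-↭ (↭-sym p) q

  sum-map-↭ : ∀ {A : Set} (f : A → ℕ) {xs ys} → xs ↭ ys → sumˡ (map f xs) ≡ sumˡ (map f ys)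
  sum-map-↭ f p = sum-↭ (↭.map⁺ f p)

  -- A set with m′ edges keeps m of them when a vertex of minimum degree is deleted.
  classify : ∀ {n} {r : BGraph n} {Q} → Symm r → Irr r → ∀ γs → All (Forbids r Q) γs → ∀ k m m′ {Gs} css Hs →
    (∀ e d → m′ ≤ d + e → suc k * d ≤ 2 * (d + e) → m ≤ e) → checkLevel (suc k) m′ γs Gs css Hs ≡ true →
    Classified r Q k m Gs → Classified r Q (suc k) m′ Hs
  classify {r = r} {Q} s irr γs f k m m′ {Gs} css Hs arith chk cl {x ∷ xs} p h =
    zs , ↭-trans perm (↭-trans (prep y (proj₁ (proj₂ rec))) (proj₁ (proj₂ (proj₂ mn)))) , subst (_∈ˡ Hs) (sym e) (proj₂ level)
    where
    mn = minimal (degreeIn r (x ∷ xs)) x xs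
    y = proj₁ mn
    ys = proj₁ (proj₂ mn)
    p₁ : Picks (suc k) Q (y ∷ ys)
    p₁ = Picks-↭ {Q = Q} (proj₁ (proj₂ (proj₂ mn))) p
    d = degreeIn r ys y
    eys = edges (matrix r ys)
    deg≡ : degreeIn r (x ∷ xs) y ≡ d
    deg≡ = trans (sum-map-↭ (χ ∘ r y) (↭-sym (proj₁ (proj₂ (proj₂ mn))))) (cong (λ b → χ b + d) (irr y))
    total : 2 * (d + eys) ≡ 2 * edges (matrix r (x ∷ xs))
    total = begin
      2 * (d + eys)                     ≡⟨ cong (λ t → 2 * (t + eys)) (degree-map r y ys) ⟨
      2 * edges (matrix r (y ∷ ys))     ≡⟨ handshake s irr (y ∷ ys) ⟨
      sumˡ (map (degreeIn r (y ∷ ys)) (y ∷ ys)) ≡⟨ cong sumˡ (map-cong (λ z → sum-map-↭ (χ ∘ r z) (proj₁ (proj₂ (proj₂ mn)))) (y ∷ ys)) ⟩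
      sumˡ (map (degreeIn r (x ∷ xs)) (y ∷ ys)) ≡⟨ sum-map-↭ _ (proj₁ (proj₂ (proj₂ mn))) ⟩
      sumˡ (map (degreeIn r (x ∷ xs)) (x ∷ xs)) ≡⟨ handshake s irr (x ∷ xs) ⟩
      2 * edges (matrix r (x ∷ xs))     ∎
      where open ≡-Reasoning
    h₁ : m′ ≤ d + eys
    h₁ = ≤-trans h (≤-reflexive (sym (*-cancelˡ-≡ _ _ 2 total)))
    h₂ : suc k * d ≤ 2 * (d + eys)
    h₂ = begin
      suc k * d  ≡⟨ cong₂ _*_ (sym (proj₁ p₁)) (sym deg≡) ⟩
      length (y ∷ ys) * degreeIn r (x ∷ xs) y ≤⟨ proj₂ (proj₂ (proj₂ mn)) ⟩
      sumˡ (map (degreeIn r (x ∷ xs)) (y ∷ ys)) ≡⟨ sum-map-↭ _ (proj₁ (proj₂ (proj₂ mn))) ⟩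
      sumˡ (map (degreeIn r (x ∷ xs)) (x ∷ xs)) ≡⟨ handshake s irr (x ∷ xs) ⟩
      2 * edges (matrix r (x ∷ xs)) ≡⟨ total ⟨
      2 * (d + eys) ∎
      where open ≤-Reasoning
    uq : ∀ {zs} → Picks (suc k) Q (y ∷ zs) → Picks k Q zs
    uq (l , _ ∷ u , _ ∷ q) = suc-injective l , u , q
    rec = cl (uq p₁) (arith eys d h₁ h₂)
    ws = proj₁ rec
    p₂ : Picks (suc k) Q (y ∷ ws)
    p₂ = Picks-↭ {Q = Q} (prep y (proj₁ (proj₂ rec))) p₁
    dw : degree (map (r y) ws) ≡ d
    dw = trans (degree-map r y ws) (sum-map-↭ (χ ∘ r y) (proj₁ (proj₂ rec)))
    ew : edges (matrix r ws) ≡ eys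
    ew = *-cancelˡ-≡ _ _ 2 (trans (sym (handshake s irr ws)) (trans (trans (cong sumˡ (map-cong (λ z → sum-map-↭ (χ ∘ r z) (proj₁ (proj₂ rec))) ws)) (sum-map-↭ _ (proj₁ (proj₂ rec)))) (handshake s irr ys)))
    level = checkLevel-sound (suc k) m′ γs Gs css Hs chk (proj₂ (proj₂ rec)) (rows-sound r γs both (proj₁ (proj₂ p₂)) (proj₂ (proj₂ p₂)) f (Last-all (λ z → ∈both (r y z)) ws))
      (light-true (suc k) m′ (map (r y) ws) (matrix r ws) (subst (λ t → m′ ≤ t) (sym (cong₂ _+_ dw ew)) h₁)
        (subst₂ (λ a b → suc k * a ≤ 2 * b) (sym dw) (sym (cong₂ _+_ dw ew)) h₂))
    sh = shuffle-sound s (proj₁ level) (y ∷ ws)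
    zs = proj₁ sh
    perm = proj₁ (proj₂ sh)
    e = proj₂ (proj₂ sh)

-- Dense neighbourhoods on up to 12 vertices.

module Classification where

  open Subsets
  open SmallRamsey
  open Extension
  open Enumeration

  -- The upper triangle is read row by row, lowest bit first.
  decode : ℕ → ℕ → Matrix
  decode zero m = []
  decode (suc k) m = bits k m ∷ decode k (halve k m)
    where
    halve : ℕ → ℕ → ℕ
    halve zero m = m
    halve (suc k) m = halve k (m / 2)

  -- With two vertices implicit in a `Constraint`, (2 , 1) is K₄ - e and (3 , 1) is H₃. The first
  -- list describes a red neighbourhood in an H₃/H₃-colouring, the second the whole colouring.
  J₄-J₅-free J₅-J₅-free : List Constraint
  J₄-J₅-free = (true , 2 , 1) ∷ (false , 3 , 1) ∷ []
  J₅-J₅-free = (true , 3 , 1) ∷ (false , 3 , 1) ∷ []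

  -- Each list `graphsN` contains, up to the order of the vertices, all admissible graphs on N
  -- vertices with at least the number of edges demanded in `classifiedN`. The thresholds are traced
  -- back from 30 edges on 12 and 24 on 11 vertices by deleting vertices of minimum degree;
  -- `shufflesN` certifies the step from N - 1 to N.
  graphs2 : List Matrix
  graphs2 = map (decode 2) (
    1 ∷ [])

  shuffles2 : List (List ℕ)
  shuffles2 =
    (0 ∷ []) ∷ []

  graphs3 : List Matrix
  graphs3 = map (decode 3) (
    7 ∷ 6 ∷ [])

  shuffles3 : List (List ℕ)
  shuffles3 =
    (0 ∷ 0 ∷ 313 ∷ []) ∷ []

  graphs4 : List Matrix
  graphs4 = map (decode 4) (
    60 ∷ 51 ∷ [])

  shuffles4 : List (List ℕ)
  shuffles4 =
    (0 ∷ 5654 ∷ 5653 ∷ []) ∷ (5511 ∷ 5499 ∷ 0 ∷ []) ∷ []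

  graphs5 : List Matrix
  graphs5 = map (decode 5) (
    969 ∷ 965 ∷ 825 ∷ [])

  shuffles5 : List (List ℕ)
  shuffles5 =
    (0 ∷ 0 ∷ 90472 ∷ []) ∷ (90196 ∷ 90184 ∷ 0 ∷ 90339 ∷ 90171 ∷ 90170 ∷ []) ∷ []

  graphs6 : List Matrix
  graphs6 = map (decode 6) (
    31018 ∷ 30897 ∷ 30887 ∷ 30886 ∷ 30883 ∷ 26418 ∷ 26413 ∷ 26412 ∷ [])

  shuffles6 : List (List ℕ)
  shuffles6 =
    (0 ∷ 1355537 ∷ 1357253 ∷ 1355525 ∷ []) ∷ (1336529 ∷ 0 ∷ 1355536 ∷ 1334800 ∷ 0 ∷ 0 ∷ 1355536 ∷ 0 ∷ []) ∷ (1356833 ∷ 1356821 ∷ 0 ∷ 1336061 ∷ 0 ∷ 0 ∷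
    1355090 ∷ 1355249 ∷ 1355078 ∷ 1355237 ∷ 1355066 ∷ []) ∷ []

  graphs7 : List Matrix
  graphs7 = map (decode 7) (
    1985185 ∷ 1985172 ∷ 1985171 ∷ 1985170 ∷ 1985169 ∷ 1985163 ∷ 1985162 ∷ 1985161 ∷ 1977429 ∷ 1977428 ∷ 1977422 ∷ 1977421 ∷ 1977420 ∷ 1977418 ∷ 1977414
    ∷ 1977413 ∷ 1976800 ∷ 1976721 ∷ 1976710 ∷ 1976707 ∷ 1976521 ∷ 1690778 ∷ 1690776 ∷ 1690469 ∷ 1690464 ∷ 1690401 ∷ 1690371 ∷ [])

  shuffles7 : List (List ℕ)
  shuffles7 =
    (0 ∷ 0 ∷ 0 ∷ 0 ∷ 0 ∷ 19544310 ∷ 19544310 ∷ 0 ∷ 0 ∷ 0 ∷ 19544310 ∷ 19544310 ∷ []) ∷ (19503150 ∷ 19250862 ∷ 0 ∷ 0 ∷ 19501421 ∷ 19520430 ∷ 0 ∷ 0 ∷ 0 ∷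
    19520430 ∷ 0 ∷ 19520430 ∷ 0 ∷ 0 ∷ 19520430 ∷ []) ∷ (19544022 ∷ 19295790 ∷ 19275042 ∷ 0 ∷ 19294061 ∷ 19544009 ∷ 19273313 ∷ 19542893 ∷ 19292332 ∷
    19271584 ∷ 19543996 ∷ 19541164 ∷ 19544151 ∷ 19542422 ∷ 19540693 ∷ []) ∷ (19544022 ∷ 19295790 ∷ 19295790 ∷ 19275042 ∷ 19539437 ∷ 19294061 ∷ 19501421
    ∷ 19501421 ∷ 0 ∷ 19290604 ∷ 19292332 ∷ 19499692 ∷ 19523874 ∷ 19499692 ∷ 0 ∷ 19523874 ∷ 0 ∷ []) ∷ (19544022 ∷ 19295790 ∷ 19295319 ∷ 19294061 ∷
    19544009 ∷ 19293590 ∷ 19295790 ∷ 19294061 ∷ 0 ∷ []) ∷ (0 ∷ 19523886 ∷ 0 ∷ 19521870 ∷ 19542606 ∷ 19542462 ∷ 19521858 ∷ 19542594 ∷ 19542450 ∷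
    19540698 ∷ []) ∷ (19544046 ∷ 19544034 ∷ 0 ∷ 19295790 ∷ 19523274 ∷ 19271598 ∷ 0 ∷ 19523741 ∷ 19274909 ∷ 19295189 ∷ 19273181 ∷ 19543997 ∷ 19523741 ∷
    19295188 ∷ 19273180 ∷ 19543996 ∷ 19523740 ∷ 19542279 ∷ 19271439 ∷ 19544463 ∷ 19295162 ∷ 19523594 ∷ 19523725 ∷ []) ∷ (19544046 ∷ 19544034 ∷ 19503150
    ∷ 19295790 ∷ 19523274 ∷ 19523274 ∷ 0 ∷ 19254173 ∷ 19274909 ∷ 19542303 ∷ 19543997 ∷ 19523741 ∷ 19543997 ∷ 19542291 ∷ 19543996 ∷ 19523740 ∷ 19543996
    ∷ 19542279 ∷ 19542279 ∷ 19544463 ∷ 0 ∷ []) ∷ []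

  graphs8 : List Matrix
  graphs8 = map (decode 8) (
    254103721 ∷ 254103718 ∷ 254103717 ∷ 254103702 ∷ 254103701 ∷ 254103699 ∷ 254102038 ∷ 254102035 ∷ 254101914 ∷ 254101913 ∷ 254101912 ∷ 254101898 ∷
    254101897 ∷ 254101785 ∷ 254101779 ∷ 254101771 ∷ 254101653 ∷ 254100931 ∷ 254100905 ∷ 254100897 ∷ 254100867 ∷ 254100615 ∷ 253110940 ∷ 253110938 ∷
    253110936 ∷ 253110924 ∷ 253110812 ∷ 253110810 ∷ 253110809 ∷ 253110803 ∷ 253110795 ∷ 253110051 ∷ 253110049 ∷ 253110034 ∷ 253109921 ∷ 253109898 ∷
    253109771 ∷ 253109767 ∷ 253109515 ∷ 253020301 ∷ 216419636 ∷ 216419634 ∷ 216419632 ∷ 216419618 ∷ 216419335 ∷ 216380085 ∷ 216380084 ∷ 216371365 ∷ [])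

  shuffles8 : List (List ℕ)
  shuffles8 =
    (0 ∷ 0 ∷ 0 ∷ 273624403 ∷ 273624403 ∷ 0 ∷ 0 ∷ 0 ∷ 273624403 ∷ []) ∷ (270638731 ∷ 270573066 ∷ 270571338 ∷ 270572776 ∷ 270571048 ∷ 0 ∷ 273375883 ∷ 0 ∷
    273624403 ∷ []) ∷ (270638731 ∷ 270388171 ∷ 270593802 ∷ 270343242 ∷ 0 ∷ 0 ∷ 0 ∷ 273374155 ∷ 273374155 ∷ 273374155 ∷ 273579786 ∷ 273329226 ∷ 0 ∷ 0 ∷
    273374155 ∷ 273374155 ∷ []) ∷ (270638731 ∷ 270569610 ∷ 270341514 ∷ 270638419 ∷ 0 ∷ 273374155 ∷ 270389575 ∷ 0 ∷ 0 ∷ 273374155 ∷ []) ∷ (270638419 ∷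
    270638419 ∷ 270638106 ∷ 0 ∷ []) ∷ (0 ∷ 270638731 ∷ 270388159 ∷ 0 ∷ 270638731 ∷ 273125323 ∷ 270140743 ∷ 273125323 ∷ 270637962 ∷ 0 ∷ 273125011 ∷
    270141055 ∷ 273125011 ∷ 273374143 ∷ 270388159 ∷ 273374143 ∷ 270389117 ∷ 270596488 ∷ 273624403 ∷ 273373831 ∷ 270347643 ∷ 0 ∷ []) ∷ (270638731 ∷
    273127051 ∷ 273125323 ∷ 270140743 ∷ 270638731 ∷ 273125011 ∷ 270141055 ∷ 270139327 ∷ 270388159 ∷ 270638419 ∷ 270387847 ∷ []) ∷ (270638731 ∷
    270638731 ∷ 273559050 ∷ 270638731 ∷ 273125011 ∷ 273125011 ∷ 273125311 ∷ 270139327 ∷ 0 ∷ []) ∷ (273562507 ∷ 273310219 ∷ 270574794 ∷ 273557322 ∷ 0 ∷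
    0 ∷ 273619530 ∷ 0 ∷ 273600523 ∷ 273374154 ∷ 273374154 ∷ 273579787 ∷ 273600523 ∷ 273619530 ∷ 0 ∷ 273619530 ∷ 273600523 ∷ 273579787 ∷ []) ∷
    (273310219 ∷ 273557322 ∷ 0 ∷ 0 ∷ 0 ∷ 273374154 ∷ 273374154 ∷ 0 ∷ 0 ∷ 273374154 ∷ []) ∷ (273623971 ∷ 270324235 ∷ 273310219 ∷ 270638731 ∷ 270638731 ∷
    270572331 ∷ 0 ∷ 273104586 ∷ 0 ∷ 273373539 ∷ 273373539 ∷ 270570723 ∷ 273623933 ∷ 0 ∷ 273623933 ∷ 273084964 ∷ 273556707 ∷ 273373539 ∷ []) ∷
    (273623971 ∷ 273375115 ∷ 270638731 ∷ 270631818 ∷ 270638731 ∷ 270574794 ∷ 273560778 ∷ 273371641 ∷ 270614539 ∷ 0 ∷ 273373395 ∷ 270348415 ∷ 270348415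
    ∷ 273373383 ∷ 273557321 ∷ 273334399 ∷ 270593791 ∷ 270571337 ∷ 273084820 ∷ 0 ∷ 270078076 ∷ 273084806 ∷ 270098810 ∷ []) ∷ (273310219 ∷ 270638731 ∷
    270638731 ∷ 273560778 ∷ 270614539 ∷ 273373395 ∷ 270327679 ∷ 270614539 ∷ 273557321 ∷ 270571337 ∷ 0 ∷ 0 ∷ []) ∷ (273562507 ∷ 273310219 ∷ 273125322 ∷
    273125322 ∷ 273104586 ∷ 273313663 ∷ 273555593 ∷ 270071945 ∷ 0 ∷ []) ∷ (273375115 ∷ 270638731 ∷ 273104586 ∷ 273084964 ∷ 273556551 ∷ 270614539 ∷ [])
    ∷ (270638731 ∷ 273623958 ∷ 270614539 ∷ 273084820 ∷ 270638731 ∷ 270638731 ∷ 273084806 ∷ 270638731 ∷ 270614539 ∷ []) ∷ (273306763 ∷ 273057919 ∷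
    273064843 ∷ 273623958 ∷ 273104574 ∷ 270078847 ∷ 273102845 ∷ 273623945 ∷ []) ∷ (273623971 ∷ 273127051 ∷ 270611083 ∷ 270590335 ∷ 273555594 ∷
    270362238 ∷ 273368969 ∷ 273082109 ∷ 273124553 ∷ 270322494 ∷ 0 ∷ 273579773 ∷ []) ∷ (273064228 ∷ 273106303 ∷ 273307840 ∷ 270574179 ∷ 270638731 ∷
    273559049 ∷ 273559049 ∷ []) ∷ (273623971 ∷ 273127051 ∷ 273106303 ∷ 273375232 ∷ 273125322 ∷ 273623958 ∷ 273559037 ∷ 273354640 ∷ 273123593 ∷
    273623945 ∷ 273560766 ∷ []) ∷ (273623971 ∷ 270611083 ∷ 273555122 ∷ 270631818 ∷ 273623958 ∷ 273306278 ∷ 273555593 ∷ 273306749 ∷ []) ∷ (0 ∷ 0 ∷ 0 ∷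
    273622699 ∷ 273622699 ∷ 273623934 ∷ 0 ∷ 273622687 ∷ 273622687 ∷ 273623933 ∷ 273624703 ∷ 273375099 ∷ 273622951 ∷ []) ∷ (270638731 ∷ 270617995 ∷
    270615979 ∷ 273623934 ∷ 270637950 ∷ 270615967 ∷ 273623933 ∷ 270637949 ∷ 0 ∷ []) ∷ (0 ∷ 0 ∷ 273334411 ∷ 273106170 ∷ 273332395 ∷ 273104442 ∷
    273080250 ∷ 273332383 ∷ 273104441 ∷ 273080249 ∷ 273080103 ∷ []) ∷ (273106170 ∷ 273375138 ∷ 273104442 ∷ 273623946 ∷ 273375137 ∷ 273104441 ∷
    273623945 ∷ 273375123 ∷ 273375111 ∷ []) ∷ (273313530 ∷ 270576090 ∷ 273375138 ∷ 270637962 ∷ 0 ∷ 273375137 ∷ 270637961 ∷ 273624703 ∷ 270636244 ∷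
    270636218 ∷ []) ∷ (273623995 ∷ 273623983 ∷ 273127051 ∷ 273603223 ∷ 270636206 ∷ 273106170 ∷ 273622252 ∷ 273623946 ∷ 270389103 ∷ 273622240 ∷
    273623945 ∷ 270368367 ∷ 273622228 ∷ 270345902 ∷ []) ∷ []

  graphs9 : List Matrix
  graphs9 = map (decode 9) (
    65050552652 ∷ 65050552620 ∷ 65050552618 ∷ 65050552614 ∷ 65050551939 ∷ 65050551860 ∷ 65050551858 ∷ 65050551857 ∷ 65050551850 ∷ 65050551849 ∷
    65050551846 ∷ 65050551843 ∷ 65050551827 ∷ 65050551819 ∷ 65050551602 ∷ 65050551601 ∷ 65050551590 ∷ 65050551571 ∷ 65050547843 ∷ 65050547785 ∷
    65050547779 ∷ 65050547747 ∷ 65050547523 ∷ 65050547017 ∷ 65050546993 ∷ 65050546985 ∷ 65050121772 ∷ 65050121770 ∷ 65050121766 ∷ 65050121763 ∷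
    65050121735 ∷ 65050121001 ∷ 65050120974 ∷ 65050120973 ∷ 65050090115 ∷ 65050090027 ∷ 65050090026 ∷ 65050090024 ∷ 65050090017 ∷ 65050089861 ∷
    65050089859 ∷ 65050089773 ∷ 65050089772 ∷ 65050089769 ∷ 65050089768 ∷ 65050089761 ∷ 65050089741 ∷ 65050089740 ∷ 65050089737 ∷ 65050089513 ∷
    65050089509 ∷ 65050089507 ∷ 65050089485 ∷ 65050089483 ∷ 65050085645 ∷ 65050057091 ∷ 65050057004 ∷ 65050056998 ∷ 65050056997 ∷ 65050056967 ∷
    65050055446 ∷ 65050055443 ∷ 65050053411 ∷ 65050023189 ∷ 65050023187 ∷ 65049838417 ∷ 65049838409 ∷ 65049838401 ∷ 65049831813 ∷ 65049831725 ∷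
    65049831724 ∷ 65049831717 ∷ 65049831716 ∷ 65049831685 ∷ 65049829669 ∷ 65049829645 ∷ 64796400678 ∷ 64796400646 ∷ 64796400170 ∷ 64796399629 ∷
    64796367910 ∷ 64796367402 ∷ 64796367374 ∷ 64796367367 ∷ 64796367148 ∷ 64796367142 ∷ 64796367118 ∷ 64796367117 ∷ 64796365606 ∷ 64796365593 ∷
    64796365590 ∷ 64796363534 ∷ 64796173109 ∷ 64796173108 ∷ 64796173104 ∷ 64796173093 ∷ 64796173092 ∷ 64796168711 ∷ 64796139797 ∷ 64796100401 ∷
    55403349857 ∷ [])

  shuffles9 : List (List ℕ)
  shuffles9 =
    (0 ∷ 3749083880 ∷ 3752567216 ∷ 3749083568 ∷ 0 ∷ 0 ∷ 3749083880 ∷ 0 ∷ 3749083880 ∷ 3752567216 ∷ 3749083568 ∷ []) ∷ (0 ∷ 3716735720 ∷ 0 ∷ 0 ∷ 0 ∷ 0 ∷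
    0 ∷ 0 ∷ 0 ∷ 0 ∷ 0 ∷ []) ∷ (3716735408 ∷ 0 ∷ 0 ∷ 3749082152 ∷ 3749082152 ∷ 3713251748 ∷ 0 ∷ 3749082152 ∷ 0 ∷ 3749082152 ∷ []) ∷ (0 ∷ 3716735720 ∷
    3748833320 ∷ 0 ∷ 0 ∷ 3748833008 ∷ 3752567216 ∷ 0 ∷ 3752567216 ∷ 3752567216 ∷ []) ∷ (3716735720 ∷ 3716735720 ∷ 3748833320 ∷ 3713250020 ∷ 0 ∷
    3716735408 ∷ 3748833008 ∷ 3713250332 ∷ 3713250332 ∷ 3749082140 ∷ 3752567216 ∷ 3749081828 ∷ []) ∷ (3716735720 ∷ 3716735720 ∷ 3716735720 ∷ 0 ∷
    3748833008 ∷ 0 ∷ 3748833308 ∷ 0 ∷ []) ∷ (3746595560 ∷ 3749495143 ∷ 3749493415 ∷ 3749494853 ∷ 3749493125 ∷ 0 ∷ 0 ∷ 0 ∷ 0 ∷ 3752567216 ∷ 3752567216 ∷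
    0 ∷ []) ∷ (3749495143 ∷ 3749493415 ∷ 3749494853 ∷ 3749493125 ∷ 3716735720 ∷ 3716486888 ∷ 0 ∷ 0 ∷ 0 ∷ 3752318696 ∷ []) ∷ (3746595560 ∷ 0 ∷
    3746345000 ∷ 3746095856 ∷ 3746550631 ∷ 3752522599 ∷ 3746300071 ∷ 3746095543 ∷ 3752501573 ∷ 3746298053 ∷ 3752501271 ∷ 0 ∷ 0 ∷ 3749581232 ∷ 0 ∷
    3746297751 ∷ 3749580919 ∷ 3752522599 ∷ 0 ∷ 3746091941 ∷ 3746069487 ∷ 3749539301 ∷ 3749581232 ∷ 3752501573 ∷ 3752501271 ∷ []) ∷ (0 ∷ 3746595560 ∷ 0
    ∷ 3710264048 ∷ 3752272039 ∷ 3752272039 ∷ 3746300071 ∷ 3746095531 ∷ 3752480837 ∷ 0 ∷ 0 ∷ 3752478806 ∷ 0 ∷ 0 ∷ 3752272039 ∷ 3752272039 ∷ 0 ∷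
    3746091797 ∷ 3745759169 ∷ 0 ∷ 0 ∷ 3746069330 ∷ 0 ∷ 3752272039 ∷ 3746007830 ∷ []) ∷ (3746595560 ∷ 3746345000 ∷ 3746550631 ∷ 3746300071 ∷ 3746296325
    ∷ 3716485160 ∷ 3716485160 ∷ 0 ∷ 0 ∷ 0 ∷ 3745757441 ∷ 0 ∷ 0 ∷ []) ∷ (3746345000 ∷ 3746300071 ∷ 3746091941 ∷ 3746069487 ∷ 3746346404 ∷ 3716485160 ∷
    3716440231 ∷ 3746032193 ∷ []) ∷ (3746595560 ∷ 3746300071 ∷ 3746091797 ∷ 3745759169 ∷ 3716485160 ∷ 3746069330 ∷ 3716485160 ∷ 3716690791 ∷ 3746007830
    ∷ 0 ∷ []) ∷ (3746595560 ∷ 3710763440 ∷ 0 ∷ 3749282599 ∷ 3745798939 ∷ 3746296325 ∷ 0 ∷ 3713001188 ∷ 3710015516 ∷ 0 ∷ 0 ∷ 3746047745 ∷ 3749581232 ∷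
    3749581232 ∷ 0 ∷ []) ∷ (3710763752 ∷ 3710513192 ∷ 3749510695 ∷ 3749282599 ∷ 3746595248 ∷ 3716735720 ∷ 3746008026 ∷ 3716485160 ∷ 3746346404 ∷
    3709927386 ∷ 0 ∷ 0 ∷ 3752316968 ∷ 3752316968 ∷ []) ∷ (3710514596 ∷ 3749282599 ∷ 3746049473 ∷ 3746346404 ∷ 3746346404 ∷ 3746049473 ∷ 3716735720 ∷ 0
    ∷ 3745783361 ∷ []) ∷ (3710264348 ∷ 3710219419 ∷ 3715987184 ∷ 3745802395 ∷ 3745849052 ∷ 3745847324 ∷ 3710264348 ∷ 3745804123 ∷ 0 ∷ 0 ∷ 3752522599 ∷
    []) ∷ (3716237120 ∷ 0 ∷ 3751819304 ∷ 3748834724 ∷ 0 ∷ 3751819304 ∷ 0 ∷ 3751818992 ∷ 3748835036 ∷ 3752316956 ∷ 3748835036 ∷ 3752316956 ∷ 3752316956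
    ∷ 3752567216 ∷ 3752316644 ∷ []) ∷ (0 ∷ 3752481127 ∷ 3716645863 ∷ 3752480837 ∷ 3716645573 ∷ 0 ∷ 0 ∷ 3749083880 ∷ 3746344988 ∷ 0 ∷ 0 ∷ 3749083880 ∷
    3752567216 ∷ 3752567216 ∷ 3749083568 ∷ 0 ∷ []) ∷ (3746595560 ∷ 3710263447 ∷ 3709927387 ∷ 3751818992 ∷ 3748835036 ∷ 3716485148 ∷ 3746344988 ∷ 0 ∷
    3713707349 ∷ 0 ∷ []) ∷ (3746595560 ∷ 3745758975 ∷ 3749242190 ∷ 3751819304 ∷ 3748993503 ∷ 3746007662 ∷ 3748835036 ∷ 3746344988 ∷ []) ∷ (3746595560 ∷
    3710763440 ∷ 3745757247 ∷ 3751819304 ∷ 3715987496 ∷ 3748993503 ∷ 3751818992 ∷ 3715987184 ∷ 3748833308 ∷ 3745847012 ∷ []) ∷ (3752566640 ∷ 3746260328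
    ∷ 3752232296 ∷ 3749580643 ∷ 3746507431 ∷ 3752479399 ∷ 3749242097 ∷ 3749492656 ∷ 3752566590 ∷ 0 ∷ 3752566590 ∷ 3716484222 ∷ 3752566590 ∷ 3716396273
    ∷ 3716646832 ∷ 3749330224 ∷ 0 ∷ []) ∷ (3746510887 ∷ 3710675623 ∷ 3752477670 ∷ 0 ∷ 3752477670 ∷ 3710673894 ∷ []) ∷ (3752232296 ∷ 3749496871 ∷
    3752479399 ∷ 3752477670 ∷ 3710673894 ∷ 0 ∷ 3752277224 ∷ []) ∷ (3752317784 ∷ 3752566603 ∷ 3716397833 ∷ 3716646676 ∷ 3716690792 ∷ 3716711528 ∷
    3716730535 ∷ 3716665841 ∷ []) ∷ (3752232296 ∷ 3746260328 ∷ 3752479399 ∷ 3746507431 ∷ 3749242097 ∷ 3749492656 ∷ 0 ∷ 3752566590 ∷ 3716484222 ∷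
    3716396273 ∷ 3716646832 ∷ 3749330224 ∷ []) ∷ (3752232296 ∷ 3716647591 ∷ 0 ∷ 3752477670 ∷ 3713659878 ∷ 0 ∷ 0 ∷ []) ∷ (3752019752 ∷ 3716400488 ∷
    3716734795 ∷ 3749241953 ∷ 0 ∷ 3751818366 ∷ 0 ∷ 3710762814 ∷ 0 ∷ 0 ∷ []) ∷ (3752232296 ∷ 3752479399 ∷ 3716735720 ∷ 3716735720 ∷ 3716148198 ∷
    3716485159 ∷ 3712913370 ∷ 0 ∷ 0 ∷ 0 ∷ 3752316967 ∷ []) ∷ (3752232296 ∷ 3716396129 ∷ 3716485159 ∷ 3716485159 ∷ 3746527373 ∷ 3716735720 ∷ 3746504941
    ∷ 0 ∷ []) ∷ (3713748848 ∷ 3752566640 ∷ 3746503975 ∷ 3713251135 ∷ 0 ∷ 0 ∷ 3752045186 ∷ 0 ∷ 3751998520 ∷ 3752271146 ∷ 0 ∷ 0 ∷ 3746299178 ∷ 3752045186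
    ∷ 3752045186 ∷ 3748765012 ∷ 3751756165 ∷ []) ∷ (3752566640 ∷ 3752232296 ∷ 3746503975 ∷ 3713160487 ∷ 3716484544 ∷ 3716194843 ∷ 3751998520 ∷
    3746299178 ∷ 3748767642 ∷ 3751778945 ∷ 3748763704 ∷ 3749242370 ∷ []) ∷ (3752566640 ∷ 3709930844 ∷ 3746595560 ∷ 3749515000 ∷ 3716735720 ∷ 3751798567
    ∷ 3748746906 ∷ 3746503974 ∷ 3710195238 ∷ 3751778945 ∷ 0 ∷ []) ∷ (3752566640 ∷ 3752317784 ∷ 3716644135 ∷ 3713160487 ∷ 3752061222 ∷ 3746305244 ∷
    3749033766 ∷ 3746256859 ∷ 3746550620 ∷ 3716195681 ∷ 0 ∷ 3716195667 ∷ []) ∷ (3749496871 ∷ 3752482855 ∷ 3716735720 ∷ 3752479398 ∷ 3716445404 ∷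
    3749493414 ∷ []) ∷ (3752317784 ∷ 3752482855 ∷ 3716734819 ∷ 3746506501 ∷ 3715896737 ∷ 3751778643 ∷ 3713662574 ∷ 3749493414 ∷ 3710673133 ∷ 3710757652
    ∷ []) ∷ (3716734832 ∷ 3746595560 ∷ 3746595560 ∷ 3746257948 ∷ 3746571368 ∷ 3748744561 ∷ 3752478496 ∷ 3749249756 ∷ 0 ∷ 3749493414 ∷ 3710757796 ∷ [])
    ∷ (3752566640 ∷ 3752317784 ∷ 3746527229 ∷ 3746525499 ∷ 3715946011 ∷ 3752235740 ∷ 3752496678 ∷ 3749013030 ∷ []) ∷ (3745798865 ∷ 3716154353 ∷
    3751985191 ∷ 3749531420 ∷ 3751730701 ∷ 3749330467 ∷ 3748997466 ∷ 3716235414 ∷ 3712934905 ∷ 3746254636 ∷ []) ∷ ([]) ∷ (3716645088 ∷ []) ∷ ([]) ∷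
    ([]) ∷ (0 ∷ 3716734795 ∷ 3716174908 ∷ 3713748811 ∷ 3716174907 ∷ 3716734794 ∷ 3713188924 ∷ 3713748810 ∷ 3713188923 ∷ 3749577620 ∷ []) ∷ ([]) ∷ ([])
    ∷ ([]) ∷ []

  graphs10 : List Matrix
  graphs10 = map (decode 10) (
    33305882957923 ∷ 33305882957910 ∷ 33305882957909 ∷ 33305882957847 ∷ 33305882941511 ∷ 33305882938454 ∷ 33305882592873 ∷ 33305882552406 ∷
    33305882552403 ∷ 33305882551388 ∷ 33305882551382 ∷ 33305882551379 ∷ 33305882551319 ∷ 33305882550876 ∷ 33305882550870 ∷ 33305882550869 ∷
    33305882550861 ∷ 33305882547302 ∷ 33305882547239 ∷ 33305882546790 ∷ 33305882546765 ∷ 33305882545254 ∷ 33305882531430 ∷ 33305882531420 ∷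
    33305882419804 ∷ 33305882419801 ∷ 33305882419789 ∷ 33305882419741 ∷ 33305882414182 ∷ 33305662346255 ∷ 33305662344215 ∷ 33305661952541 ∷
    33305646139027 ∷ 33305646138969 ∷ 33305646138966 ∷ 33305646008921 ∷ 33305629186063 ∷ 33305629183003 ∷ 33305629182493 ∷ 33305517269587 ∷
    33305517265507 ∷ 33175739190323 ∷ 28366515126813 ∷ [])

  shuffles10 : List (List ℕ)
  shuffles10 =
    (0 ∷ 50617771460 ∷ 0 ∷ 0 ∷ 50617771460 ∷ 50617771460 ∷ 0 ∷ []) ∷ (50620733252 ∷ 50620732962 ∷ 0 ∷ 50659661325 ∷ []) ∷ (50229679941 ∷ 50226196293 ∷
    50229679629 ∷ 50226195981 ∷ []) ∷ (50620733252 ∷ 50226195981 ∷ 0 ∷ 50226196293 ∷ []) ∷ (0 ∷ 50620026501 ∷ 50623244037 ∷ 50653190277 ∷ []) ∷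
    (50229679941 ∷ 50223620836 ∷ 0 ∷ 50623829517 ∷ 0 ∷ 50653602532 ∷ 50617772284 ∷ []) ∷ (0 ∷ 0 ∷ 0 ∷ 0 ∷ []) ∷ (50620024773 ∷ 50587998021 ∷ 0 ∷ 0 ∷ 0
    ∷ 0 ∷ []) ∷ (50587998021 ∷ 50587997709 ∷ 0 ∷ 50229679941 ∷ 50154032961 ∷ 0 ∷ []) ∷ (50614806212 ∷ 50229679941 ∷ 0 ∷ 50229679941 ∷ 0 ∷ []) ∷ (0 ∷
    50229679941 ∷ 50226603364 ∷ 50229679941 ∷ []) ∷ (50614806212 ∷ 50653581796 ∷ 50226582628 ∷ 50650381682 ∷ []) ∷ (50226582628 ∷ 50650177310 ∷
    50229679941 ∷ []) ∷ (50587998021 ∷ 50617772140 ∷ 0 ∷ 50229679941 ∷ 0 ∷ []) ∷ (50154532353 ∷ 50154283833 ∷ 50584265529 ∷ []) ∷ (0 ∷ 0 ∷ 50584014969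
    ∷ 0 ∷ 0 ∷ []) ∷ (0 ∷ 50229679941 ∷ 50584514049 ∷ []) ∷ (50154532353 ∷ 50154532353 ∷ 50226194565 ∷ []) ∷ ([]) ∷ (50620729796 ∷ 50189866809 ∷
    50158016013 ∷ []) ∷ (50655678285 ∷ []) ∷ (50587998021 ∷ 50189866497 ∷ 50655678597 ∷ []) ∷ (50223594614 ∷ 50587997709 ∷ 50154530937 ∷ []) ∷
    (50620729796 ∷ 50158016013 ∷ 50584014657 ∷ []) ∷ (50225698317 ∷ 50158016325 ∷ 50158016325 ∷ []) ∷ (50225698629 ∷ 50158016325 ∷ 50584016385 ∷ []) ∷
    (50220362273 ∷ 50220360545 ∷ 50220362563 ∷ 50220360835 ∷ []) ∷ (50656568516 ∷ 50226585092 ∷ 50656568226 ∷ 50226584802 ∷ 0 ∷ []) ∷ (50226585092 ∷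
    50649954499 ∷ 0 ∷ []) ∷ (50650703685 ∷ 50656568516 ∷ 50187127124 ∷ 50229679629 ∷ []) ∷ (50154670238 ∷ 50151435710 ∷ 50229679941 ∷ []) ∷
    (50656568516 ∷ 50656566788 ∷ 0 ∷ []) ∷ (50229679941 ∷ []) ∷ (50656566788 ∷ 50226584802 ∷ 50587749189 ∷ []) ∷ (50220721989 ∷ 0 ∷ 50581775493 ∷
    50656675341 ∷ 50581526349 ∷ 0 ∷ 50223457413 ∷ 0 ∷ 50223457413 ∷ 50223208269 ∷ 50223457413 ∷ 50650405876 ∷ 50223595059 ∷ 50650177612 ∷ 50190749210 ∷
    []) ∷ (50193597573 ∷ 50650703685 ∷ 50229679941 ∷ 50220471429 ∷ 50578542393 ∷ 50148310137 ∷ 50193552644 ∷ 50650658756 ∷ 50229635012 ∷ 50220426500 ∷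
    50220423878 ∷ 50220401413 ∷ 50229613986 ∷ 50220424482 ∷ 50229591521 ∷ 50220402017 ∷ 50220424180 ∷ 50220401715 ∷ 50220195759 ∷ 50220173437 ∷
    50220195916 ∷ 50220173594 ∷ 50184092917 ∷ 50184093074 ∷ []) ∷ (50650703685 ∷ 50220471429 ∷ 50220222285 ∷ 50650658756 ∷ 50220426500 ∷ 50220221972 ∷
    50650406178 ∷ 50650383713 ∷ 50650405876 ∷ 50650383411 ∷ []) ∷ (50220471429 ∷ 50223593633 ∷ 50220607939 ∷ 50220400289 ∷ []) ∷ ([]) ∷ (0 ∷
    50659552179 ∷ 50223707973 ∷ 50223707973 ∷ 50223707973 ∷ 50223707973 ∷ []) ∷ (50619985029 ∷ 50578744580 ∷ 50220721677 ∷ 50220387543 ∷ 50157765765 ∷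
    50223457413 ∷ 50220612531 ∷ 50223615795 ∷ 50223457413 ∷ 50223615795 ∷ 50223457413 ∷ 50223615795 ∷ []) ∷ (50650369084 ∷ 50220387399 ∷ 50650412298 ∷
    50220430589 ∷ 50656633122 ∷ 50226651413 ∷ 50581522146 ∷ 50151042762 ∷ 50578536149 ∷ 50148056765 ∷ 50151018556 ∷ 50148032583 ∷ []) ∷ (50229679941 ∷
    50650703685 ∷ 50193597573 ∷ 50220471429 ∷ 50578542393 ∷ 50193803204 ∷ 50220677060 ∷ 50229384452 ∷ 50650408196 ∷ 50148514040 ∷ 50151187230 ∷
    50151434333 ∷ 50151185332 ∷ 50151435891 ∷ []) ∷ (50650703685 ∷ 50223614067 ∷ 50650408196 ∷ 50220632131 ∷ 50223204066 ∷ 50183888573 ∷ []) ∷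
    (50220721989 ∷ 50220471429 ∷ 50226600354 ∷ 50220426500 ∷ 50223407010 ∷ 50147948957 ∷ []) ∷ ([]) ∷ (50581522146 ∷ 50581499679 ∷ 50147950685 ∷
    50150936500 ∷ []) ∷ (50223614067 ∷ 50226600354 ∷ 50183888561 ∷ 50186850352 ∷ []) ∷ (50223407010 ∷ 50151432605 ∷ []) ∷ ([]) ∷ ([]) ∷ ([]) ∷
    (50650453125 ∷ 50220218069 ∷ []) ∷ (50650703685 ∷ 50223407010 ∷ 50220218213 ∷ []) ∷ ([]) ∷ (50613874821 ∷ 50578042701 ∷ 50581776897 ∷ 50581528377 ∷
    50581528377 ∷ []) ∷ (50220471429 ∷ 50650703685 ∷ 50148310137 ∷ 50578542393 ∷ 0 ∷ []) ∷ (50614871565 ∷ 50226393284 ∷ 50148467383 ∷ 0 ∷ []) ∷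
    (50650703685 ∷ 50578203703 ∷ 0 ∷ []) ∷ (50154419679 ∷ 50151185150 ∷ 50229679941 ∷ []) ∷ (50220218478 ∷ []) ∷ (50656374980 ∷ 50189753823 ∷
    50587747461 ∷ []) ∷ (50226393284 ∷ 50153940759 ∷ 50157765765 ∷ []) ∷ (50614372473 ∷ []) ∷ (50614119522 ∷ 50222710593 ∷ []) ∷ (50578932932 ∷
    50183893125 ∷ 50222961477 ∷ 50578932642 ∷ 50183892813 ∷ 50222961165 ∷ 0 ∷ 50222961477 ∷ 50222961165 ∷ []) ∷ (50149058061 ∷ 50155030029 ∷
    50148807801 ∷ 50154779769 ∷ 0 ∷ 50190862149 ∷ 50222959749 ∷ 50187129345 ∷ []) ∷ (50154779457 ∷ 50193755500 ∷ 50223615351 ∷ 50186880825 ∷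
    50186879097 ∷ []) ∷ ([]) ∷ ([]) ∷ (50587655876 ∷ 50587655586 ∷ []) ∷ ([]) ∷ (50226583364 ∷ 50226583074 ∷ []) ∷ ([]) ∷ ([]) ∷ (50228682573 ∷ []) ∷
    (50659660605 ∷ 50229181221 ∷ 50656674608 ∷ 50226195224 ∷ []) ∷ ([]) ∷ ([]) ∷ (50659660568 ∷ 50228821780 ∷ []) ∷ (50229323973 ∷ 50229571076 ∷
    50578541443 ∷ []) ∷ (50157517989 ∷ 50190363668 ∷ 50581413528 ∷ []) ∷ (50190363668 ∷ 50620733251 ∷ []) ∷ (50193256216 ∷ 50581413529 ∷ []) ∷ ([]) ∷
    (50650702579 ∷ 50614373251 ∷ []) ∷ ([]) ∷ ([]) ∷ (50578541323 ∷ 50578541311 ∷ 0 ∷ []) ∷ (50659305669 ∷ 50659552772 ∷ 50193487806 ∷ 50193738365 ∷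
    50229679941 ∷ []) ∷ (50193487662 ∷ 50619986743 ∷ []) ∷ ([]) ∷ ([]) ∷ (50614870916 ∷ 50190112844 ∷ 50193278526 ∷ []) ∷ (50587997060 ∷ 50154462881 ∷
    50578041907 ∷ 50157180594 ∷ []) ∷ (50229678909 ∷ 50578041919 ∷ []) ∷ (50229678909 ∷ 50229586628 ∷ 50152043251 ∷ []) ∷ ([]) ∷ (50653330232 ∷ []) ∷
    (50220697797 ∷ []) ∷ (0 ∷ []) ∷ []

  graphs11 : List Matrix
  graphs11 = map (decode 11) (
    34105224148913336 ∷ 34105224148913305 ∷ 34105224148900049 ∷ 34105224148899025 ∷ 34105224148899013 ∷ 34105223775102136 ∷ 34105223775102124 ∷
    34105223733663886 ∷ 34105223732621358 ∷ 34105223732091034 ∷ 34104981646363850 ∷ 34104981646363820 ∷ [])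

  shuffles11 : List (List ℕ)
  shuffles11 =
    (0 ∷ 675028689514 ∷ 0 ∷ 675028689514 ∷ []) ∷ (0 ∷ 674598707818 ∷ []) ∷ (0 ∷ 0 ∷ []) ∷ (670260442879 ∷ 674598707818 ∷ 674595721233 ∷ []) ∷
    (675423206049 ∷ []) ∷ (670227613457 ∷ 674595472089 ∷ 674595430615 ∷ []) ∷ (0 ∷ 0 ∷ 674960509546 ∷ []) ∷ (674602191778 ∷ 669764897386 ∷ 674920694686
    ∷ 0 ∷ []) ∷ (670254533409 ∷ []) ∷ (0 ∷ []) ∷ ([]) ∷ ([]) ∷ (670302374818 ∷ []) ∷ (675422516578 ∷ 675354659746 ∷ []) ∷ (675422516578 ∷ 0 ∷
    669757797307 ∷ []) ∷ (675386758246 ∷ []) ∷ (675354659746 ∷ 670302374818 ∷ []) ∷ ([]) ∷ ([]) ∷ (669787657172 ∷ []) ∷ (675414313761 ∷ 669787677908 ∷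
    []) ∷ (669787674452 ∷ []) ∷ ([]) ∷ (674589749409 ∷ 674560302137 ∷ 669442411426 ∷ 674517500559 ∷ 669432949686 ∷ []) ∷ ([]) ∷ ([]) ∷ ([]) ∷ ([]) ∷
    (670191395422 ∷ []) ∷ (669758045921 ∷ 669758044192 ∷ 669761280449 ∷ 669761278720 ∷ []) ∷ (670224111567 ∷ []) ∷ ([]) ∷ (0 ∷ 675032128545 ∷ 0 ∷
    669364526686 ∷ 670188772350 ∷ 670188773776 ∷ []) ∷ ([]) ∷ (669433140197 ∷ 670302374818 ∷ 675348437218 ∷ 670299388522 ∷ 669328446358 ∷ 674914921263
    ∷ []) ∷ ([]) ∷ ([]) ∷ ([]) ∷ ([]) ∷ (675018985054 ∷ 674986137826 ∷ 675018985366 ∷ 674986137514 ∷ []) ∷ ([]) ∷ ([]) ∷ ([]) ∷ []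

  graphs12 : List Matrix
  graphs12 = map (decode 12) (
    69847002411753165155 ∷ [])

  shuffles12 : List (List ℕ)
  shuffles12 =
    ([]) ∷ ([]) ∷ ([]) ∷ ([]) ∷ ([]) ∷ ([]) ∷ ([]) ∷ ([]) ∷ ([]) ∷ ([]) ∷ (0 ∷ []) ∷ ([]) ∷ []

  -- If e < m then (k - 1) * (d + e) ≤ (k + 1) * e, since (k + 1) * d ≤ 2 * (d + e); the hypothesis rules that out.
  fewer : ∀ k m′ m → ((2 + k) * m ≤ᵇ k * m′ + (1 + k)) ≡ true → ∀ e d → m′ ≤ d + e → (2 + k) * d ≤ 2 * (d + e) → m ≤ e
  fewer k m′ m h e d h₁ h₂ with m ≤? e
  ... | yes le = le
  ... | no gt = ⊥-elim (<-irrefl refl (begin-strict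
    (2 + k) * m            ≤⟨ ≤ᵇ-true h ⟩
    k * m′ + (1 + k)       <⟨ +-monoʳ-< (k * m′) (n<1+n (1 + k)) ⟩
    k * m′ + (2 + k)       ≤⟨ +-monoˡ-≤ (2 + k) (*-monoʳ-≤ k h₁) ⟩
    k * (d + e) + (2 + k)  ≤⟨ +-monoˡ-≤ (2 + k) bound ⟩
    (2 + k) * e + (2 + k)  ≡⟨ trans (+-comm _ (2 + k)) (sym (*-suc (2 + k) e)) ⟩
    (2 + k) * suc e        ≤⟨ *-monoʳ-≤ (2 + k) (≰⇒> gt) ⟩
    (2 + k) * m            ∎))
    where
    open ≤-Reasoning
    bound : k * (d + e) ≤ (2 + k) * e
    bound = +-cancelˡ-≤ (2 * (d + e)) _ _ (begin
      2 * (d + e) + k * (d + e)  ≡⟨ *-distribʳ-+ (d + e) 2 k ⟨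
      (2 + k) * (d + e)          ≡⟨ *-distribˡ-+ (2 + k) d e ⟩
      (2 + k) * d + (2 + k) * e  ≤⟨ +-monoˡ-≤ ((2 + k) * e) h₂ ⟩
      2 * (d + e) + (2 + k) * e  ∎)

  module _ {n} {r : BGraph n} {Q} (s : Symm r) (irr : Irr r) (f : All (Forbids r Q) J₄-J₅-free) where

    classified1 : Classified r Q 1 0 (([] ∷ []) ∷ [])
    classified1 {x ∷ []} p h = x ∷ [] , ↭-refl , here refl

    classified2 : Classified r Q 2 1 graphs2
    classified2 = classify {Q = Q} s irr J₄-J₅-free f 1 0 1 shuffles2 graphs2 (fewer 0 1 0 refl) refl classified1

    classified3 : Classified r Q 3 2 graphs3
    classified3 = classify {Q = Q} s irr J₄-J₅-free f 2 1 2 shuffles3 graphs3 (fewer 1 2 1 refl) refl classified2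

    classified4 : Classified r Q 4 4 graphs4
    classified4 = classify {Q = Q} s irr J₄-J₅-free f 3 2 4 shuffles4 graphs4 (fewer 2 4 2 refl) refl classified3

    classified5 : Classified r Q 5 6 graphs5
    classified5 = classify {Q = Q} s irr J₄-J₅-free f 4 4 6 shuffles5 graphs5 (fewer 3 6 4 refl) refl classified4

    classified6 : Classified r Q 6 8 graphs6
    classified6 = classify {Q = Q} s irr J₄-J₅-free f 5 6 8 shuffles6 graphs6 (fewer 4 8 6 refl) refl classified5

    classified7 : Classified r Q 7 10 graphs7
    classified7 = classify {Q = Q} s irr J₄-J₅-free f 6 8 10 shuffles7 graphs7 (fewer 5 10 8 refl) refl classified6

    classified8 : Classified r Q 8 13 graphs8
    classified8 = classify {Q = Q} s irr J₄-J₅-free f 7 10 13 shuffles8 graphs8 (fewer 6 13 10 refl) refl classified7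

    classified9 : Classified r Q 9 16 graphs9
    classified9 = classify {Q = Q} s irr J₄-J₅-free f 8 13 16 shuffles9 graphs9 (fewer 7 16 13 refl) refl classified8

    classified10 : Classified r Q 10 20 graphs10
    classified10 = classify {Q = Q} s irr J₄-J₅-free f 9 16 20 shuffles10 graphs10 (fewer 8 20 16 refl) refl classified9

    classified11 : Classified r Q 11 24 graphs11
    classified11 = classify {Q = Q} s irr J₄-J₅-free f 10 20 24 shuffles11 graphs11 (fewer 9 24 20 refl) refl classified10

    classified12 : Classified r Q 12 30 graphs12
    classified12 = classify {Q = Q} s irr J₄-J₅-free f 11 24 30 shuffles12 graphs12 (fewer 10 30 24 refl) refl classified11

-- Dense neighbourhoods do not extend to 22 vertices.

module Gluing where

  open Subsets
  open SmallRamsey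
  open Extension
  open Enumeration
  open Classification

  -- A certificate that the blue side of the fixed vertex cannot be attached. A node lists pivot
  -- rows, each with a certificate for the graph enlarged by a vertex with that row, and classes
  -- that cover all other admissible rows. If no pivot row occurs, the classes together hold too few
  -- vertices.
  data Tree : Set where
    node : List (ℕ × Tree) → List (Bool × List ℕ) → Tree

  -- A class (false , ρs) has no two compatible rows; a class (true , ρs) has no two rows that a red edge
  -- could join, so that it carries at most three vertices.
  capacity : List (Bool × List ℕ) → ℕ
  capacity [] = 0
  capacity ((c , _) ∷ cs) = (if c then 3 else 1) + capacity cs

  clash : Matrix → Bool → Row → Row → Bool
  clash G b ρ σ = violatesAny J₅-J₅-free (b ∷ σ) (ρ ∷ G)

  clashᶜ : Matrix → Bool → Row → Row → Bool
  clashᶜ G true ρ σ = clash G true ρ σ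
  clashᶜ G false ρ σ = clash G true ρ σ ∧ clash G false ρ σ

  -- A row is compared with itself as well, because two distinct vertices may have the same row.
  pairwise : (Row → Row → Bool) → List Row → Bool
  pairwise p [] = true
  pairwise p (ρ ∷ ρs) = all (p ρ) (ρ ∷ ρs) ∧ pairwise p ρs

  classRows : Matrix → List ℕ → List Row
  classRows G = map (bits (length G))

  classesOK : Matrix → List (Bool × List ℕ) → Bool
  classesOK G [] = true
  classesOK G ((c , ms) ∷ cs) = pairwise (clashᶜ G c) (classRows G ms) ∧ classesOK G cs

  inClasses : Matrix → List (Bool × List ℕ) → Row → Bool
  inClasses G [] ρ = false
  inClasses G ((c , ms) ∷ cs) ρ = (ρ ∈ᵇ classRows G ms) ∨ inClasses G cs ρ

  isPivot : Matrix → List (ℕ × Tree) → Row → Bool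
  isPivot G [] ρ = false
  isPivot G ((m , _) ∷ ps) ρ = sameRow ρ (bits (length G) m) ∨ isPivot G ps ρ

  -- The number counts the vertices still to be attached. Classes of total capacity k cannot hold k
  -- + 1 of them, and once one serves as a pivot k remain.
  refutes : ℕ → Tree → Matrix → Bool
  refutesAll : ℕ → List (ℕ × Tree) → Matrix → Bool
  refutes zero t G = false
  refutes (suc k) (node ps cs) G = (capacity cs ≤ᵇ k) ∧ (classesOK G cs ∧ (all (λ ρ → isPivot G ps ρ ∨ inClasses G cs ρ) (rows J₅-J₅-free (false ∷ []) G) ∧ refutesAll k ps G))
  refutesAll k [] G = true
  refutesAll k ((m , t) ∷ ps) G = refutes k t (bits (length G) m ∷ G) ∧ refutesAll k ps G

  pairwise-sound : ∀ p ρs {ρ σ} → pairwise p ρs ≡ true → ρ ∈ˡ ρs → σ ∈ˡ ρs → p ρ σ ≡ true ⊎ p σ ρ ≡ true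
  pairwise-sound p (x ∷ ρs) h (here refl) j = inj₁ (all-sound (p x) (proj₁ (∧-true h)) j)
  pairwise-sound p (x ∷ ρs) h i@(there _) (here refl) = inj₂ (all-sound (p x) (proj₁ (∧-true h)) i)
  pairwise-sound p (x ∷ ρs) h (there i) (there j) = pairwise-sound p ρs (proj₂ (∧-true {all (p x) (x ∷ ρs)} h)) i j

  module _ {n} {r : BGraph n} {Q : VSet n} (s : Symm r) (f : All (Forbids r Q) J₅-J₅-free) {v : Fin n} where

    -- the base graph xs, whose last vertex is v, and further vertices Y in the blue neighbourhood of v
    record Config (xs : List (Fin n)) (Y : VSet n) : Set where
      field
        unique : Unique xs
        inside : All (_∈ Q) xs
        ends   : Last (_≡ v) xs
        v∈     : v ∈ˡ xs
        Y⊆Q    : Y ⊆ Q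
        fresh  : ∀ {y} → y ∈ Y → All (y ≢_) xs
        blue   : ∀ {y} → y ∈ Y → r y v ≡ false
    open Config

    rowOf : List (Fin n) → Fin n → Row
    rowOf xs y = map (r y) xs

    no-clash : ∀ {xs Y} → Config xs Y → ∀ {x y} → x ∈ Y → y ∈ Y → x ≢ y → clash (matrix r xs) (r y x) (rowOf xs x) (rowOf xs y) ≡ false
    no-clash {xs} c {x} {y} p q ne = violatesAny-sound r {y = y} {x ∷ xs} J₅-J₅-free
      (((ne ∘ sym) ∷ fresh c q) ∷ fresh c p ∷ unique c) (Y⊆Q c q ∷ Y⊆Q c p ∷ inside c) f

    class-size : ∀ {xs Y} → Config xs Y → ∀ b ρs → pairwise (clashᶜ (matrix r xs) b) ρs ≡ true → ∀ {Z} → Z ⊆ Y →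
      (∀ {y} → y ∈ Z → rowOf xs y ∈ˡ ρs) → count Z ≤ (if b then 3 else 1)
    class-size {xs} {Y} c false ρs ok {Z} g i = count≤1 λ {x} {y} p q → case x ≟ y of λ
      { (yes e) → e
      ; (no ne) → case pairwise-sound _ ρs ok (i p) (i q) of λ
        { (inj₁ h) → ⊥-elim (go p q ne h) ; (inj₂ h) → ⊥-elim (go q p (ne ∘ sym) h) } }
      where
      go : ∀ {x y} → x ∈ Z → y ∈ Z → x ≢ y → clashᶜ (matrix r xs) false (rowOf xs x) (rowOf xs y) ≡ true → ⊥
      go {x} {y} p q ne h with r y x | no-clash c (g p) (g q) ne
      ... | true | e = case trans (sym e) (proj₁ (∧-true h)) of λ ()
      ... | false | e = case trans (sym e) (proj₂ (∧-true {clash (matrix r xs) true (rowOf xs x) (rowOf xs y)} h)) of λ ()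
    class-size {xs} {Y} c true ρs ok {Z} g i with count Z ≤? 3
    ... | yes le = le
    -- Four pairwise blue vertices of the class would form a blue K₅ with `v`.
    ... | no gt = ⊥-elim (All.lookup f (there (here refl))
        (Has-≤ z≤n (Has-join {A = ⟨ v ≟_ ⟩} {B = Z} (λ p → subst (_∈ Q) (⟨⟩∈ (v ≟_) p) (All.lookup (inside c) (v∈ c))) (Y⊆Q c ∘ g)
          (λ p q → subst (λ t → t ≢ _ × not (r t _) ≡ true) (⟨⟩∈ (v ≟_) p)
            ((λ e → All.lookup (fresh c (g q)) (v∈ c) (sym e)) , cong not (trans (s v _) (blue c (g q)))))
          (Has-1 (∈⟨⟩ (v ≟_) refl)) (Has-full 4 allBlue (≰⇒> gt)))))
      where
      go : ∀ {x y} → x ∈ Z → y ∈ Z → x ≢ y → clash (matrix r xs) true (rowOf xs x) (rowOf xs y) ≡ true → not (r y x) ≡ true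
      go {x} {y} p q ne h with r y x | no-clash c (g p) (g q) ne
      ... | false | e = refl
      ... | true | e = case trans (sym e) h of λ ()
      allBlue : ∀ {x y} → x ∈ Z → y ∈ Z → x ≢ y → not (r x y) ≡ true
      allBlue {x} {y} p q ne with pairwise-sound _ ρs ok (i p) (i q)
      ... | inj₁ h = trans (cong not (s x y)) (go p q ne h)
      ... | inj₂ h = go q p (ne ∘ sym) h

    classes-size : ∀ {xs Y} → Config xs Y → ∀ cs → classesOK (matrix r xs) cs ≡ true → ∀ {Z} → Z ⊆ Y →
      (∀ {y} → y ∈ Z → inClasses (matrix r xs) cs (rowOf xs y) ≡ true) → count Z ≤ capacity cs
    classes-size {xs} c [] ok {Z} g i = ≤-reflexive (sum-zero λ y → lem y (Z y) refl)
      where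
      open import Algebra.Properties.Semiring.Sum +-*-semiring using (sum)
      lem : ∀ y b → Z y ≡ b → χ b ≡ 0
      lem y false e = refl
      lem y true e = case i (mem e) of λ ()
    classes-size {xs} c ((b , ms) ∷ cs) ok {Z} g i = ≤-trans (count-∪ {A = ⟨ d₁ ⟩} {⟨ d₂ ⟩} split)
      (+-mono-≤ (class-size c b (classRows G ms) (proj₁ (∧-true ok)) (g ∘ proj₁ ∘ ⟨⟩∈ d₁) (λ {y} p → ∈ᵇ-sound (rowOf xs y) (classRows G ms) (proj₂ (⟨⟩∈ d₁ p))))
        (classes-size c cs (proj₂ (∧-true {pairwise (clashᶜ G b) (classRows G ms)} ok)) (g ∘ proj₁ ∘ ⟨⟩∈ d₂) (λ p → proj₂ (⟨⟩∈ d₂ p))))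
      where
      G = matrix r xs
      d₁ : ∀ y → Dec (y ∈ Z × (rowOf xs y ∈ᵇ classRows G ms) ≡ true)
      d₁ y = (y ∈? Z) ×-dec (_ ≟ᵇ true)
      d₂ : ∀ y → Dec (y ∈ Z × inClasses G cs (rowOf xs y) ≡ true)
      d₂ y = (y ∈? Z) ×-dec (_ ≟ᵇ true)
      split : ∀ {y} → y ∈ Z → y ∈ ⟨ d₁ ⟩ ⊎ y ∈ ⟨ d₂ ⟩
      split p with ∨-true (i p)
      ... | inj₁ h = inj₁ (∈⟨⟩ d₁ (p , h))
      ... | inj₂ h = inj₂ (∈⟨⟩ d₂ (p , h))

    refutes-sound : ∀ k t {xs Y} → Config xs Y → refutes k t (matrix r xs) ≡ true → k ≤ count Y → ⊥
    refutesAll-sound : ∀ k ps {xs Y y} → Config xs Y → refutesAll k ps (matrix r xs) ≡ true → suc k ≤ count Y → y ∈ Y →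
      isPivot (matrix r xs) ps (rowOf xs y) ≡ true → ⊥
    refutes-sound (suc k) (node ps cs) {xs} {Y} c h le with any? d
      where
      d : ∀ y → Dec (y ∈ Y × isPivot (matrix r xs) ps (rowOf xs y) ≡ true)
      d y = (y ∈? Y) ×-dec (_ ≟ᵇ true)
    ... | yes (y , p , e) = refutesAll-sound k ps c
            (proj₂ (∧-true {all (λ ρ → isPivot G ps ρ ∨ inClasses G cs ρ) (rows J₅-J₅-free (false ∷ []) G)} (proj₂ (∧-true {classesOK G cs} (proj₂ (∧-true {capacity cs ≤ᵇ k} h)))))) le p e
      where G = matrix r xs
    ... | no ¬p = <-irrefl refl (≤-trans le (≤-trans (classes-size c cs (proj₁ (∧-true (proj₂ (∧-true {capacity cs ≤ᵇ k} h)))) (λ p → p) covered) (≤ᵇ-true (proj₁ (∧-true h)))))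
      where
      G = matrix r xs
      last-blue : ∀ {y} → y ∈ Y → ∀ {zs} → Last (_≡ v) zs → Last (λ z → r y z ∈ˡ (false ∷ [])) zs
      last-blue p [] = []
      last-blue p (last refl) = last (here (blue c p))
      last-blue p (x ∷ l) = x ∷ last-blue p l
      covered : ∀ {y} → y ∈ Y → inClasses G cs (rowOf xs y) ≡ true
      covered {y} p with ∨-true (all-sound (λ ρ → isPivot G ps ρ ∨ inClasses G cs ρ) (proj₁ (∧-true (proj₂ (∧-true {classesOK G cs} (proj₂ (∧-true {capacity cs ≤ᵇ k} h))))))
        (rows-sound r {y = y} {xs} J₅-J₅-free (false ∷ []) (fresh c p ∷ unique c) (Y⊆Q c p ∷ inside c) f (last-blue p (ends c))))
      ... | inj₂ e = e
      ... | inj₁ e = ⊥-elim (¬p (y , p , e))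
    refutesAll-sound k ((m , t) ∷ ps) {xs} {Y} {y} c h le p e with ∨-true e
    ... | inj₂ e' = refutesAll-sound k ps c (proj₂ (∧-true {refutes k t (bits (length (matrix r xs)) m ∷ matrix r xs)} h)) le p e'
    ... | inj₁ e' = refutes-sound k t {y ∷ xs} {⟨ d ⟩}
            record { unique = fresh c p ∷ unique c ; inside = Y⊆Q c p ∷ inside c ; ends = cons (ends c) (v∈ c) ; v∈ = there (v∈ c)
                   ; Y⊆Q = Y⊆Q c ∘ proj₁ ∘ ⟨⟩∈ d ; fresh = λ q → proj₂ (⟨⟩∈ d q) ∷ fresh c (proj₁ (⟨⟩∈ d q)) ; blue = blue c ∘ proj₁ ∘ ⟨⟩∈ d }
            (subst (λ ρ → refutes k t (ρ ∷ matrix r xs) ≡ true) (sym (sameRow-sound _ _ e')) (proj₁ (∧-true h)))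
            (≤-pred (≤-trans le (count≤1+ y λ q ne → ∈⟨⟩ d (q , ne))))
      where
      d : ∀ z → Dec (z ∈ Y × z ≢ y)
      d z = (z ∈? Y) ×-dec ¬? (z ≟ y)
      cons : ∀ {zs} → Last (_≡ v) zs → v ∈ˡ zs → Last (_≡ v) (y ∷ zs)
      cons l@(last _) _ = y ∷ l
      cons l@(_ ∷ _) _ = y ∷ l

  -- The apex is appended as the last vertex, where `rows` can prescribe the colour blue towards all
  -- further vertices.
  cone : Matrix → Matrix
  cone [] = [] ∷ []
  cone (g ∷ G) = (g ++ true ∷ []) ∷ cone G

  cone-matrix : ∀ {n} (r : BGraph n) v {zs} → All (λ z → r z v ≡ true) zs → matrix r (zs ++ v ∷ []) ≡ cone (matrix r zs)
  cone-matrix r v [] = refl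
  cone-matrix r v {z ∷ zs} (h ∷ hs) = cong₂ _∷_ (trans (map-++ (r z) zs (v ∷ [])) (cong (λ b → map (r z) zs ++ b ∷ []) h)) (cone-matrix r v hs)

  refutesEach : ℕ → List Tree → List Matrix → Bool
  refutesEach k ts [] = true
  refutesEach k [] (G ∷ Gs) = false
  refutesEach k (t ∷ ts) (G ∷ Gs) = refutes k t (cone G) ∧ refutesEach k ts Gs

  refutesEach-sound : ∀ k ts Gs → refutesEach k ts Gs ≡ true → ∀ {G} → G ∈ˡ Gs → ∃ λ t → refutes k t (cone G) ≡ true
  refutesEach-sound k (t ∷ ts) (G ∷ Gs) h (here refl) = t , proj₁ (∧-true h)
  refutesEach-sound k (t ∷ ts) (G ∷ Gs) h (there i) = refutesEach-sound k ts Gs (proj₂ (∧-true {refutes k t (cone G)} h)) i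

  module _ {n} {r : BGraph n} {Q : VSet n} (s : Symm r) (irr : Irr r) (f : All (Forbids r Q) J₅-J₅-free) {v : Fin n} (v∈ : v ∈ Q) where

    blueSide? : ∀ y → Dec (y ∈ Q × v ≢ y × r v y ≡ false)
    blueSide? y = (y ∈? Q) ×-dec ¬? (v ≟ y) ×-dec (r v y ≟ᵇ false)

    -- A dense red neighbourhood is one of the listed graphs after reordering; with `v` appended it
    -- is a cone, and the certificate excludes attaching j vertices of the blue side.
    no-critical : ∀ k m j {Gs} → (∀ {R} → R ⊆ nbhd r v Q → Classified r R k m Gs) → ∀ ts → refutesEach j ts Gs ≡ true →
      ∀ {xs} → Picks k (nbhd r v Q) xs → m ≤ edges (matrix r xs) → j ≤ count ⟨ blueSide? ⟩ → ⊥
    no-critical k m j {Gs} cl ts chk p h le =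
      let zs , perm , i = cl (λ q → q) p h
          t , e = refutesEach-sound j ts Gs chk i
          l , u , q = Picks-↭ {Q = nbhd r v Q} perm p
          N = nbhd? r v Q
      in refutes-sound s f {v} j t {zs ++ v ∷ []} {⟨ blueSide? ⟩}
        record { unique = Unique.++⁺ u ([] ∷ []) (λ { (a , here refl) → proj₁ (proj₂ (⟨⟩∈ N (All.lookup q a))) refl })
               ; inside = All.++⁺ (All.map (nbhd-⊆ r v) q) (v∈ ∷ [])
               ; ends = endsWith zs
               ; v∈ = ∈-++⁺ʳ zs (here refl)
               ; Y⊆Q = proj₁ ∘ ⟨⟩∈ blueSide?
               ; fresh = λ {y} b → let _ , ne , bl = ⟨⟩∈ blueSide? b in All.++⁺ (All.map (λ w eq → case trans (sym bl) (trans (cong (r v) eq) (proj₂ (proj₂ (⟨⟩∈ N w)))) of λ ()) q) ((ne ∘ sym) ∷ [])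
               ; blue = λ {y} b → trans (s y v) (proj₂ (proj₂ (⟨⟩∈ blueSide? b))) }
        (subst (λ G → refutes j t G ≡ true) (sym (cone-matrix r v (All.map (λ {z} w → trans (s z v) (proj₂ (proj₂ (⟨⟩∈ N w)))) q))) e) le
      where
      endsWith : ∀ zs → Last (_≡ v) (zs ++ v ∷ [])
      endsWith [] = last refl
      endsWith (z ∷ []) = z ∷ last refl
      endsWith (z ∷ z' ∷ zs) = z ∷ endsWith (z' ∷ zs)

  -- The trees were found by computer search; a number is the binary code of a row.
  trees11 : List Tree
  trees11 =
    (node ((231 , node ([])
        ((false , (3262 ∷ 3260 ∷ 3256 ∷ 3257 ∷ 3258 ∷ 2234 ∷ 1434 ∷ 1214 ∷ 1458 ∷ 2238 ∷ 1210 ∷ 1466 ∷ [])) ∷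
        (false , (3441 ∷ 3440 ∷ [])) ∷
        (false , (1694 ∷ 2002 ∷ 1726 ∷ 1598 ∷ 1566 ∷ 1596 ∷ 1564 ∷ 1938 ∷ 1718 ∷ 1946 ∷ 1970 ∷ 1590 ∷ 1978 ∷ 1724 ∷ 1692 ∷ 1722 ∷ 1714 ∷ 1690 ∷ 1715 ∷ 702 ∷ 694 ∷ [])) ∷
        (false , (2623 ∷ 1599 ∷ 1567 ∷ 1565 ∷ 575 ∷ 1597 ∷ 572 ∷ 573 ∷ 574 ∷ 2621 ∷ 567 ∷ 566 ∷ [])) ∷
        (false , (1719 ∷ 1591 ∷ 434 ∷ 186 ∷ 695 ∷ 442 ∷ 946 ∷ 954 ∷ 698 ∷ 691 ∷ 690 ∷ [])) ∷
        (false , (2924 ∷ 2746 ∷ 2730 ∷ 2734 ∷ 2622 ∷ 2750 ∷ 2726 ∷ 2738 ∷ 2668 ∷ 2742 ∷ 2614 ∷ 2722 ∷ 974 ∷ 2796 ∷ 2812 ∷ 2300 ∷ 2684 ∷ 2732 ∷ 2620 ∷ 2748 ∷ [])) ∷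
        (false , (2615 ∷ 2723 ∷ 2743 ∷ 2727 ∷ 2739 ∷ 2236 ∷ [])) ∷
        (false , (190 ∷ 188 ∷ 636 ∷ 700 ∷ 252 ∷ 124 ∷ 764 ∷ 1212 ∷ 2172 ∷ 2284 ∷ [])) ∷ [])) ∷
      [])
      ((true , (863 ∷ 1391 ∷ 367 ∷ 351 ∷ 1371 ∷ 1359 ∷ 343 ∷ 359 ∷ 847 ∷ 487 ∷ 1307 ∷ 983 ∷ 1383 ∷ 1375 ∷ 1311 ∷ 1631 ∷ 335 ∷ 799 ∷ 1351 ∷ 95 ∷ 855 ∷ 967 ∷ 455 ∷ 839 ∷ 1630 ∷ 1629 ∷ 283 ∷ 607 ∷ 471 ∷ 1367 ∷ 327 ∷ 1119 ∷ 859 ∷ 347 ∷ 795 ∷ 1363 ∷ 783 ∷ 1342 ∷ 1150 ∷ 287 ∷ 1310 ∷ 1406 ∷ 1374 ∷ 1118 ∷ [])) ∷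
      (false , (1462 ∷ 286 ∷ 318 ∷ 62 ∷ 1334 ∷ 1142 ∷ 382 ∷ 350 ∷ 126 ∷ 1086 ∷ 1366 ∷ 1398 ∷ [])) ∷
      (false , (1720 ∷ [])) ∷
      (false , (1001 ∷ 717 ∷ 221 ∷ 969 ∷ 349 ∷ 217 ∷ 473 ∷ 477 ∷ 345 ∷ 729 ∷ 845 ∷ 985 ∷ 989 ∷ 973 ∷ 733 ∷ 857 ∷ 861 ∷ [])) ∷
      (false , (1373 ∷ 93 ∷ 1361 ∷ 1369 ∷ 1365 ∷ 1117 ∷ 605 ∷ [])) ∷
      (false , (1628 ∷ 606 ∷ [])) ∷
      (false , (846 ∷ 862 ∷ 798 ∷ 782 ∷ 94 ∷ [])) ∷ [])) ∷
    (node ([])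
      ((false , (1720 ∷ [])) ∷
      (false , (231 ∷ [])) ∷
      (false , (124 ∷ 380 ∷ 508 ∷ 252 ∷ 382 ∷ 1140 ∷ 1396 ∷ 1148 ∷ 126 ∷ 1142 ∷ 1404 ∷ 1398 ∷ 1150 ∷ 1406 ∷ [])) ∷
      (false , (1119 ∷ 1631 ∷ 1628 ∷ 1630 ∷ 1629 ∷ 606 ∷ 607 ∷ 605 ∷ [])) ∷
      (false , (1373 ∷ 1369 ∷ 1365 ∷ 1361 ∷ 1364 ∷ 1372 ∷ 1374 ∷ 1366 ∷ 1116 ∷ 1117 ∷ 1118 ∷ [])) ∷
      (false , (1001 ∷ 220 ∷ 969 ∷ 845 ∷ 476 ∷ 972 ∷ 988 ∷ 717 ∷ 716 ∷ 860 ∷ 844 ∷ 973 ∷ 732 ∷ 985 ∷ 221 ∷ 477 ∷ 861 ∷ 217 ∷ 857 ∷ 733 ∷ 473 ∷ 729 ∷ 989 ∷ [])) ∷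
      (false , (862 ∷ 798 ∷ 782 ∷ 846 ∷ 94 ∷ 350 ∷ [])) ∷
      (false , (95 ∷ 349 ∷ 93 ∷ 345 ∷ [])) ∷
      (false , (348 ∷ 92 ∷ 604 ∷ [])) ∷ [])) ∷
    (node ([])
      ((false , (974 ∷ 846 ∷ 718 ∷ 605 ∷ 781 ∷ 860 ∷ 796 ∷ 604 ∷ 797 ∷ 844 ∷ 845 ∷ 924 ∷ 861 ∷ 988 ∷ 732 ∷ 716 ∷ 989 ∷ 973 ∷ 717 ∷ 733 ∷ 972 ∷ 909 ∷ 925 ∷ [])) ∷
      (false , (1720 ∷ [])) ∷
      (false , (207 ∷ 719 ∷ 413 ∷ 476 ∷ 220 ∷ 221 ∷ 205 ∷ 461 ∷ 477 ∷ [])) ∷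
      (false , (1398 ∷ 1366 ∷ 1142 ∷ 1373 ∷ 1372 ∷ 1365 ∷ 1116 ∷ 1364 ∷ 1117 ∷ 1141 ∷ 1333 ∷ 1140 ∷ 1396 ∷ 1404 ∷ 1341 ∷ 1405 ∷ 1397 ∷ 1149 ∷ 1148 ∷ [])) ∷
      (false , (252 ∷ 508 ∷ 309 ∷ 381 ∷ 373 ∷ 117 ∷ 125 ∷ 317 ∷ 124 ∷ 61 ∷ 380 ∷ 1085 ∷ [])) ∷
      (false , (1143 ∷ 119 ∷ [])) ∷
      (false , (1433 ∷ 1437 ∷ 1309 ∷ [])) ∷
      (false , (285 ∷ 93 ∷ 92 ∷ 349 ∷ 348 ∷ [])) ∷
      (false , (1629 ∷ 1628 ∷ [])) ∷ [])) ∷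
    (node ([])
      ((false , (926 ∷ 798 ∷ [])) ∷
      (false , (1722 ∷ 1720 ∷ [])) ∷
      (false , (731 ∷ 219 ∷ [])) ∷
      (false , (889 ∷ 825 ∷ 125 ∷ 380 ∷ 61 ∷ 377 ∷ 313 ∷ 381 ∷ 124 ∷ 317 ∷ 1329 ∷ 1333 ∷ 1141 ∷ 1393 ∷ 1405 ∷ 1149 ∷ 1401 ∷ 1337 ∷ 1400 ∷ 1085 ∷ 1148 ∷ 1397 ∷ 1341 ∷ 1404 ∷ [])) ∷
      (false , (1628 ∷ 1629 ∷ 1305 ∷ 1117 ∷ 1368 ∷ 1369 ∷ 1116 ∷ 1372 ∷ 1309 ∷ 1373 ∷ 1140 ∷ 1396 ∷ [])) ∷
      (false , (1433 ∷ 1437 ∷ [])) ∷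
      (false , (1370 ∷ 1402 ∷ [])) ∷
      (false , (63 ∷ 1087 ∷ [])) ∷
      (false , (508 ∷ 252 ∷ [])) ∷ [])) ∷
    (node ([])
      ((false , (1720 ∷ 1722 ∷ 1016 ∷ 696 ∷ 952 ∷ 698 ∷ 888 ∷ 760 ∷ 504 ∷ 248 ∷ 824 ∷ 826 ∷ 250 ∷ 890 ∷ 1018 ∷ 954 ∷ 378 ∷ 506 ∷ 376 ∷ 762 ∷ [])) ∷
      (false , (1457 ∷ 1461 ∷ 1329 ∷ 1372 ∷ 1392 ∷ 1393 ∷ 1368 ∷ 1333 ∷ 1309 ∷ 1373 ∷ 1396 ∷ 1369 ∷ 1397 ∷ 1141 ∷ 1305 ∷ 1085 ∷ 1140 ∷ 1404 ∷ 1149 ∷ 1341 ∷ 1401 ∷ 1337 ∷ 1405 ∷ 1148 ∷ 1400 ∷ [])) ∷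
      (false , (63 ∷ 1087 ∷ 61 ∷ 381 ∷ 124 ∷ 125 ∷ 317 ∷ 313 ∷ 377 ∷ 380 ∷ 1117 ∷ [])) ∷
      (false , (1628 ∷ 1629 ∷ 1116 ∷ [])) ∷
      (false , (1362 ∷ 1394 ∷ 1370 ∷ 1402 ∷ [])) ∷
      (false , (252 ∷ 508 ∷ [])) ∷
      (false , (825 ∷ 889 ∷ [])) ∷ [])) ∷
    (node ([])
      ((true , (471 ∷ 861 ∷ 847 ∷ 991 ∷ 223 ∷ 927 ∷ 989 ∷ 799 ∷ 479 ∷ 863 ∷ 718 ∷ 733 ∷ 971 ∷ 477 ∷ 857 ∷ 1391 ∷ 975 ∷ 973 ∷ 979 ∷ 607 ∷ 990 ∷ 983 ∷ 859 ∷ 335 ∷ 974 ∷ 862 ∷ 926 ∷ 1359 ∷ 605 ∷ 735 ∷ 919 ∷ 798 ∷ 985 ∷ 351 ∷ 845 ∷ 987 ∷ 734 ∷ 349 ∷ 207 ∷ 463 ∷ 969 ∷ 95 ∷ 367 ∷ 93 ∷ 221 ∷ 846 ∷ 841 ∷ 719 ∷ 843 ∷ [])) ∷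
      (true , (407 ∷ 791 ∷ 467 ∷ 475 ∷ 459 ∷ 911 ∷ 455 ∷ 415 ∷ 287 ∷ 279 ∷ 478 ∷ 783 ∷ 222 ∷ 462 ∷ 967 ∷ 963 ∷ 855 ∷ 910 ∷ 451 ∷ 414 ∷ 903 ∷ 343 ∷ [])) ∷
      (false , (215 ∷ 727 ∷ 851 ∷ [])) ∷
      (false , (970 ∷ 986 ∷ 606 ∷ 782 ∷ 206 ∷ [])) ∷
      (false , (925 ∷ 797 ∷ 717 ∷ 473 ∷ [])) ∷ [])) ∷
    (node ([])
      ((false , (319 ∷ 63 ∷ 287 ∷ 279 ∷ 311 ∷ [])) ∷
      (false , (887 ∷ 819 ∷ 375 ∷ 822 ∷ 886 ∷ 790 ∷ 854 ∷ 851 ∷ 883 ∷ 791 ∷ 823 ∷ 855 ∷ 343 ∷ [])) ∷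
      (false , (415 ∷ 783 ∷ 782 ∷ 799 ∷ 911 ∷ 846 ∷ 927 ∷ 925 ∷ 797 ∷ 606 ∷ 862 ∷ 798 ∷ 718 ∷ 222 ∷ 926 ∷ 910 ∷ 734 ∷ 478 ∷ 974 ∷ 990 ∷ 414 ∷ 407 ∷ 919 ∷ [])) ∷
      (false , (215 ∷ 726 ∷ 206 ∷ 918 ∷ 902 ∷ 982 ∷ 462 ∷ 470 ∷ 454 ∷ 214 ∷ 966 ∷ 451 ∷ 406 ∷ 455 ∷ 903 ∷ 467 ∷ 963 ∷ 967 ∷ 727 ∷ 979 ∷ 471 ∷ 983 ∷ [])) ∷
      (false , (725 ∷ 213 ∷ 977 ∷ 241 ∷ 853 ∷ 497 ∷ 849 ∷ 469 ∷ 789 ∷ 465 ∷ 981 ∷ 917 ∷ 341 ∷ 753 ∷ 501 ∷ 693 ∷ 245 ∷ 821 ∷ 885 ∷ 373 ∷ 881 ∷ 949 ∷ 1013 ∷ 1009 ∷ 945 ∷ 757 ∷ 817 ∷ [])) ∷ [])) ∷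
    (node ([])
      ((false , (63 ∷ 1087 ∷ 151 ∷ 663 ∷ 1689 ∷ 1561 ∷ 1173 ∷ 1685 ∷ 159 ∷ 671 ∷ 1055 ∷ 31 ∷ 667 ∷ 543 ∷ 659 ∷ 539 ∷ 1181 ∷ 1695 ∷ 1563 ∷ 1565 ∷ 1687 ∷ 1693 ∷ 1175 ∷ 1183 ∷ 1567 ∷ 1691 ∷ 1683 ∷ [])) ∷
      (false , (822 ∷ 886 ∷ 690 ∷ 946 ∷ 242 ∷ 851 ∷ 754 ∷ 339 ∷ 818 ∷ 467 ∷ 371 ∷ 979 ∷ 915 ∷ 787 ∷ 498 ∷ 243 ∷ 819 ∷ 499 ∷ 882 ∷ 883 ∷ 947 ∷ 1011 ∷ 755 ∷ 691 ∷ 1010 ∷ [])) ∷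
      (false , (1625 ∷ 1629 ∷ 1681 ∷ [])) ∷
      (false , (1712 ∷ 1714 ∷ 1713 ∷ 1715 ∷ [])) ∷
      (false , (1363 ∷ 1395 ∷ 723 ∷ 211 ∷ [])) ∷
      (false , (727 ∷ 215 ∷ [])) ∷
      (false , (795 ∷ 923 ∷ [])) ∷ [])) ∷
    (node ([])
      ((false , (1716 ∷ [])) ∷
      (false , (999 ∷ 935 ∷ 998 ∷ 967 ∷ 487 ∷ 455 ∷ 934 ∷ 903 ∷ 423 ∷ 486 ∷ 390 ∷ 966 ∷ 902 ∷ 391 ∷ 454 ∷ 422 ∷ [])) ∷
      (false , (1363 ∷ [])) ∷
      (false , (1421 ∷ 1445 ∷ 1423 ∷ 1413 ∷ 1415 ∷ 397 ∷ 1438 ∷ 398 ∷ 1422 ∷ 1430 ∷ 1455 ∷ 1454 ∷ 429 ∷ 1453 ∷ 1447 ∷ 1446 ∷ 414 ∷ 431 ∷ 1414 ∷ 406 ∷ 399 ∷ 462 ∷ 910 ∷ 430 ∷ [])) ∷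
      (false , (798 ∷ 918 ∷ 790 ∷ 854 ∷ 926 ∷ 782 ∷ 781 ∷ 783 ∷ 909 ∷ 911 ∷ 974 ∷ 982 ∷ 862 ∷ 990 ∷ 846 ∷ [])) ∷
      (false , (238 ∷ 234 ∷ 490 ∷ 478 ∷ 470 ∷ 494 ∷ [])) ∷ [])) ∷
    (node ([])
      ((false , (995 ∷ 694 ∷ 902 ∷ 934 ∷ 690 ∷ 950 ∷ 946 ∷ 918 ∷ 994 ∷ 726 ∷ 214 ∷ 754 ∷ 966 ∷ 246 ∷ 982 ∷ 454 ∷ 242 ∷ 470 ∷ 758 ∷ 1014 ∷ 486 ∷ 502 ∷ 1010 ∷ 998 ∷ 498 ∷ [])) ∷
      (false , (237 ∷ [])) ∷
      (false , (1363 ∷ [])) ∷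
      (false , (151 ∷ 1629 ∷ 1686 ∷ 1684 ∷ 1694 ∷ 1566 ∷ 1692 ∷ 542 ∷ 670 ∷ 663 ∷ 1565 ∷ 1175 ∷ 543 ∷ 671 ∷ 1173 ∷ 1181 ∷ 1695 ∷ 31 ∷ 1685 ∷ 1183 ∷ 159 ∷ 1687 ∷ 1567 ∷ 1055 ∷ 1693 ∷ [])) ∷
      (false , (782 ∷ 798 ∷ 414 ∷ 910 ∷ 926 ∷ 1214 ∷ 406 ∷ 158 ∷ 190 ∷ 1470 ∷ 1438 ∷ 446 ∷ 1430 ∷ 1462 ∷ 1182 ∷ 438 ∷ [])) ∷
      (false , (1716 ∷ 1712 ∷ 1718 ∷ 1206 ∷ 1714 ∷ 182 ∷ 1174 ∷ [])) ∷
      (false , (727 ∷ 215 ∷ [])) ∷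
      (false , (662 ∷ 150 ∷ [])) ∷ [])) ∷
    (node ((1622 , node ([])
        ((false , (718 ∷ 3406 ∷ 654 ∷ 2766 ∷ 2702 ∷ 462 ∷ 974 ∷ 398 ∷ 910 ∷ 1614 ∷ 1358 ∷ 1550 ∷ 1678 ∷ 1742 ∷ 1422 ∷ 1806 ∷ 1870 ∷ 1486 ∷ 1998 ∷ 455 ∷ 967 ∷ 1934 ∷ [])) ∷
        (false , (2843 ∷ 2842 ∷ [])) ∷
        (false , (1974 ∷ 918 ∷ 1942 ∷ 950 ∷ 1958 ∷ 1718 ∷ 1686 ∷ 694 ∷ 647 ∷ 919 ∷ 663 ∷ 2738 ∷ 2740 ∷ 2742 ∷ [])) ∷
        (false , (2694 ∷ 2808 ∷ 2758 ∷ 2800 ∷ 724 ∷ 2772 ∷ 726 ∷ 2710 ∷ 2774 ∷ 2708 ∷ 2722 ∷ 739 ∷ 2790 ∷ 2804 ∷ 754 ∷ 742 ∷ 2786 ∷ 755 ∷ 738 ∷ 2806 ∷ 2726 ∷ 758 ∷ 2802 ∷ 756 ∷ 725 ∷ 727 ∷ [])) ∷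
        (false , (1620 ∷ 1748 ∷ 1623 ∷ 1621 ∷ 1622 ∷ 1750 ∷ 1607 ∷ 1670 ∷ 1606 ∷ 1734 ∷ 1862 ∷ 1990 ∷ 1478 ∷ 1863 ∷ 1926 ∷ [])) ∷
        (false , (995 ∷ 994 ∷ 483 ∷ 966 ∷ 482 ∷ 454 ∷ 486 ∷ 902 ∷ 998 ∷ 934 ∷ 903 ∷ [])) ∷
        (false , (710 ∷ 646 ∷ 678 ∷ 662 ∷ 711 ∷ [])) ∷
        (false , (1702 ∷ [])) ∷ [])) ∷
      [])
      ((false , (327 ∷ 1703 ∷ 867 ∷ 803 ∷ 227 ∷ 679 ∷ 807 ∷ 359 ∷ 871 ∷ 903 ∷ 931 ∷ 775 ∷ 839 ∷ 483 ∷ 739 ∷ 995 ∷ 199 ∷ 231 ∷ 967 ∷ 999 ∷ 487 ∷ 711 ∷ 935 ∷ 743 ∷ 455 ∷ [])) ∷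
      (false , (1421 ∷ [])) ∷
      (false , (1404 ∷ 362 ∷ 1347 ∷ 1379 ∷ 369 ∷ 363 ∷ 371 ∷ 1361 ∷ 1393 ∷ 1354 ∷ 1363 ∷ 1395 ∷ 1400 ∷ 1386 ∷ 1355 ∷ 379 ∷ 1387 ∷ 1369 ∷ 377 ∷ 378 ∷ 1403 ∷ 1401 ∷ 1370 ∷ 1371 ∷ 1402 ∷ [])) ∷
      (false , (987 ∷ 971 ∷ 859 ∷ 459 ∷ 979 ∷ 475 ∷ 843 ∷ 963 ∷ [])) ∷
      (false , (810 ∷ 811 ∷ 875 ∷ 874 ∷ 331 ∷ 347 ∷ [])) ∷
      (false , (241 ∷ 243 ∷ 497 ∷ 499 ∷ 451 ∷ 467 ∷ [])) ∷
      (false , (1351 ∷ 1383 ∷ [])) ∷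
      (false , (355 ∷ 323 ∷ 835 ∷ [])) ∷
      (false , (851 ∷ 339 ∷ [])) ∷ [])) ∷
    (node ([])
      ((false , (1622 ∷ [])) ∷
      (false , (807 ∷ 930 ∷ 679 ∷ 775 ∷ 931 ∷ 935 ∷ 903 ∷ 806 ∷ 678 ∷ 1702 ∷ 1703 ∷ 934 ∷ 738 ∷ 803 ∷ 739 ∷ 867 ∷ 994 ∷ 999 ∷ 839 ∷ 742 ∷ 967 ∷ 743 ∷ 995 ∷ 711 ∷ 871 ∷ 870 ∷ 998 ∷ [])) ∷
      (false , (1207 ∷ 1444 ∷ 1447 ∷ 1191 ∷ 1301 ∷ 1446 ∷ 1190 ∷ 1445 ∷ 1413 ∷ 1414 ∷ 1429 ∷ 1415 ∷ 1319 ∷ 55 ∷ 182 ∷ 309 ∷ 1204 ∷ 279 ∷ 439 ∷ 437 ∷ 438 ∷ 183 ∷ 407 ∷ 181 ∷ 311 ∷ 423 ∷ 1205 ∷ 391 ∷ 295 ∷ 167 ∷ 263 ∷ 422 ∷ 166 ∷ 1333 ∷ 1287 ∷ 1431 ∷ 1206 ∷ 1335 ∷ 1430 ∷ 1463 ∷ 1461 ∷ 1462 ∷ 1460 ∷ 1079 ∷ 1303 ∷ [])) ∷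
      (false , (502 ∷ 246 ∷ 359 ∷ 327 ∷ 227 ∷ 231 ∷ 199 ∷ 230 ∷ 451 ∷ 455 ∷ 487 ∷ 486 ∷ 483 ∷ 963 ∷ [])) ∷
      (false , (791 ∷ 835 ∷ 919 ∷ [])) ∷
      (false , (1383 ∷ 1351 ∷ [])) ∷ [])) ∷
    []

  trees12 : List Tree
  trees12 =
    (node ([])
      ((false , (3407 ∷ [])) ∷
      (false , (3244 ∷ [])) ∷
      (false , (2842 ∷ [])) ∷
      (false , (1621 ∷ [])) ∷
      (false , (483 ∷ [])) ∷
      (false , (1974 ∷ [])) ∷
      (false , (2809 ∷ [])) ∷ [])) ∷
    []

  trees11-refute : refutesEach 10 trees11 graphs11 ≡ true
  trees11-refute = refl

  trees12-refute : refutesEach 9 trees12 graphs12 ≡ true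
  trees12-refute = refl

-- Degree sums in a neighbourhood by a weighted count of triangles.

module DegreeSums where

  open Subsets
  open SmallRamsey
  open Extension
  open Enumeration
  open Classification
  open import Data.List using (lookup; filter)
  open Gluing

  sum-elems : ∀ {n} (C : VSet n) (f : Fin n → ℕ) → sumˡ (map f (elems C)) ≡ sum (λ y → χ (C y) * f y)
  sum-elems {n} C f = go n id
    where
    go : ∀ m (h : Fin m → Fin n) → sumˡ (map f (filter (_∈? C) (tabulate h))) ≡ sum (λ y → χ (C (h y)) * f (h y))
    go zero h = refl
    go (suc m) h with C (h zero)
    ... | true = cong₂ _+_ (sym (+-identityʳ _)) (go m (h ∘ suc))
    ... | false = go m (h ∘ suc)

  picks-elems : ∀ {n} (C : VSet n) → Picks (count C) C (elems C)
  picks-elems {n} C = length-elems C , Unique.filter⁺ (_∈? C) (Unique.allFin⁺ n) , All.all-filter (_∈? C) (allFin n)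

  edges-elems : ∀ {n} {r : BGraph n} → Symm r → Irr r → ∀ C → 2 * edges (matrix r (elems C)) ≡ sum (λ x → χ (C x) * sum (λ y → χ (C y) * χ (r x y)))
  edges-elems {r = r} s i C = begin
    2 * edges (matrix r (elems C))                             ≡⟨ handshake s i (elems C) ⟨
    sumˡ (map (degreeIn r (elems C)) (elems C))                ≡⟨ sum-elems C (degreeIn r (elems C)) ⟩
    sum (λ x → χ (C x) * degreeIn r (elems C) x)               ≡⟨ sum-cong-≗ (λ x → cong (χ (C x) *_) (sum-elems C (χ ∘ r x))) ⟩
    sum (λ x → χ (C x) * sum (λ y → χ (C y) * χ (r x y)))      ∎
    where open ≡-Reasoning

  -- Inside a K₄ - e/H₃-colouring the red neighbours of x span a red matching, since a red P₃ among
  -- them would complete K₄ - e with x. Blue H₃ stays forbidden.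
  matching : List Constraint
  matching = (true , 1 , 1) ∷ (false , 3 , 1) ∷ []

  -- A matching on seven vertices leaves five of them with at most one edge, which is a blue H₃. For
  -- the same reason it must be perfect on six vertices and have two edges on five, as the next two
  -- checks say.
  no-matching₇ : matrices matching 7 ≡ []
  no-matching₇ = refl

  matching₆ : all (λ G → 6 ≤ᵇ 2 * edges G) (matrices matching 6) ≡ true
  matching₆ = refl

  matching₅ : all (λ G → 4 ≤ᵇ 2 * edges G) (matrices matching 5) ≡ true
  matching₅ = refl

  -- c and k stand for the degree of a vertex and twice the number of its triangles
  Local : ℕ → ℕ → Set
  Local c k = c ≤ 6 × k ≤ c × (c ≡ 5 → 4 ≤ k) × (c ≡ 6 → 6 ≤ k)

  local? : ∀ c k → Dec (Local c k)
  local? c k = (c ≤? 6) ×-dec (k ≤? c) ×-dec imp (c ≡? 5) (4 ≤? k) ×-dec imp (c ≡? 6) (6 ≤? k)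
    where
    open import Data.Nat renaming (_≟_ to _≡?_)
    open import Relation.Nullary.Decidable using () renaming (_→-dec_ to imp)

  module Neighbourhood {n} {r : BGraph n} (s : Symm r) (irr : Irr r) {W : VSet n} (f : All (Forbids r W) J₄-J₅-free) where

    d : ℕ
    d = count W

    M : Fin n → Fin n → ℕ
    M x y = χ (W x) * (χ (W y) * χ (r x y))

    c k : Fin n → ℕ
    c x = sum (M x)
    k x = sum (λ y → sum (λ z → M x y * (M x z * M y z)))

    M-sym : ∀ x y → M x y ≡ M y x
    M-sym x y = trans (x∙yz≈y∙xz (χ (W x)) (χ (W y)) _) (cong (λ b → χ (W y) * (χ (W x) * χ b)) (s x y))
      where open import Algebra.Properties.CommutativeSemigroup *-commutativeSemigroup using (x∙yz≈y∙xz)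

    M-nbhd : ∀ x y → W x ≡ true → M x y ≡ χ (nbhd r x W y)
    M-nbhd x y wx with W x | W y in wy | x ≟ y | r x y in e
    ... | true | false | _ | _ = refl
    ... | true | true | no _ | false = refl
    ... | true | true | no _ | true = refl
    ... | true | true | yes refl | true = case trans (sym e) (irr x) of λ ()
    ... | true | true | yes refl | false = refl

    M-diag : ∀ x → M x x ≡ 0
    M-diag x = trans (cong (λ b → χ (W x) * (χ (W x) * χ b)) (irr x)) (trans (cong (χ (W x) *_) (*-zeroʳ (χ (W x)))) (*-zeroʳ (χ (W x))))

    M≤1 : ∀ x y → M x y ≤ 1
    M≤1 x y with W x | W y | r x y
    ... | false | _ | _ = z≤n
    ... | true | false | _ = z≤n
    ... | true | true | false = z≤n
    ... | true | true | true = ≤-refl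

    M-edge : ∀ x y → M x y ≡ 0 ⊎ (M x y ≡ 1 × x ∈ W × y ∈ W × x ≢ y × r x y ≡ true)
    M-edge x y with W x in wx | W y in wy | r x y in e
    ... | false | _ | _ = inj₁ refl
    ... | true | false | _ = inj₁ refl
    ... | true | true | false = inj₁ refl
    ... | true | true | true = inj₂ (refl , mem wx , mem wy , (λ { refl → case trans (sym e) (irr x) of λ () }) , refl)

    c-count : ∀ {x} → x ∈ W → c x ≡ count (nbhd r x W)
    c-count {x} (mem w) = sum-cong-≗ (λ y → M-nbhd x y w)

    degree-bound : ∀ {x} → x ∈ W → Has (colour true r) 3 1 (nbhd r x W) → ⊥
    degree-bound p h = All.lookup f (here refl) (Has-nbhd p h)

    module _ {x} (p : x ∈ W) where

      C : VSet n
      C = nbhd r x W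

      forbids : All (Forbids r C) matching
      forbids = degree-bound p ∷ (All.lookup f (there (here refl)) ∘ Has-⊆ (nbhd-⊆ r x)) ∷ []

      k-edges : k x ≡ 2 * edges (matrix r (elems C))
      k-edges = trans (sum-cong-≗ λ y → trans (sum-cong-≗ (term y)) (sym (*-distribˡ-sum (χ (C y)) (λ z → χ (C z) * χ (r y z))))) (sym (edges-elems s irr C))
        where
        term : ∀ y z → M x y * (M x z * M y z) ≡ χ (C y) * (χ (C z) * χ (r y z))
        term y z with M-edge x y | M-edge x z
        ... | inj₁ e | _ = trans (cong (_* (M x z * M y z)) e) (cong (_* (χ (C z) * χ (r y z))) (trans (sym e) (M-nbhd x y (_∈_.holds p))))
        ... | inj₂ _ | inj₁ e = trans (cong (λ t → M x y * (t * M y z)) e) (trans (*-zeroʳ (M x y)) (sym (trans (cong (λ t → χ (C y) * (t * χ (r y z))) (trans (sym (M-nbhd x z (_∈_.holds p))) e)) (*-zeroʳ (χ (C y))))))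
        ... | inj₂ (_ , _ , wy , _) | inj₂ (_ , _ , wz , _) = cong₂ _*_ (M-nbhd x y (_∈_.holds p)) (cong₂ _*_ (M-nbhd x z (_∈_.holds p))
                (trans (cong₂ (λ a b → χ a * (χ b * χ (r y z))) (_∈_.holds wy) (_∈_.holds wz)) (trans (*-identityˡ _) (*-identityˡ _))))

      c≤6 : c x ≤ 6
      c≤6 with c x ≤? 6
      ... | yes le = le
      ... | no gt = let ys , q = pick 7 (≤-trans (≰⇒> gt) (≤-reflexive (c-count p))) in
        case subst (matrix r ys ∈ˡ_) no-matching₇ (matrices-sound r matching forbids 7 q) of λ ()

      k≥ : ∀ m b → all (λ G → b ≤ᵇ 2 * edges G) (matrices matching m) ≡ true → c x ≡ m → b ≤ k x
      k≥ m b chk eq = ≤-trans (≤ᵇ-true (all-sound _ chk (matrices-sound r matching forbids m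
        (subst (λ t → Picks t C (elems C)) (trans (sym (c-count p)) eq) (picks-elems C))))) (≤-reflexive (sym k-edges))

      k≤c : k x ≤ c x
      k≤c = sum-mono λ y → case M-edge x y of λ
        { (inj₁ e) → ≤-trans (≤-reflexive (sum-zero {n} λ z → cong (_* (M x z * M y z)) e)) z≤n
        ; (inj₂ (e , _ , wy , ne , re)) → ≤-trans (one y (∈⟨⟩ (nbhd? r x W) (wy , ne , re)) e) (≤-reflexive (sym e)) }
        where
        one : ∀ y → y ∈ C → M x y ≡ 1 → sum (λ z → M x y * (M x z * M y z)) ≤ 1
        one y q e₁ = ≤-trans (sum-mono le) (count≤1 {Q = ⟨ D ⟩} λ {z} {z'} a b → case z ≟ z' of λ
          { (yes e) → e
          ; (no ne) → let zx , zy = ⟨⟩∈ D a ; zx' , zy' = ⟨⟩∈ D b in ⊥-elim (degree-bound p (bad zx zx' zy zy' ne)) })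
          where
          D : ∀ z → Dec (z ∈ C × r y z ≡ true)
          D z = (z ∈? C) ×-dec (r y z ≟ᵇ true)
          bad : ∀ {z z'} → z ∈ C → z' ∈ C → r y z ≡ true → r y z' ≡ true → z ≢ z' → Has r 3 1 C
          bad {z} {z'} a b e e' ne = Has-join {A = ⟨ y ≟_ ⟩} {B = ⟨ D ⟩} (λ w → subst (_∈ C) (⟨⟩∈ (y ≟_) w) q) (proj₁ ∘ ⟨⟩∈ D)
            (λ w w' → subst (λ t → t ≢ _ × r t _ ≡ true) (⟨⟩∈ (y ≟_) w) ((λ { refl → case trans (sym (proj₂ (⟨⟩∈ D w'))) (irr y) of λ () }) , proj₂ (⟨⟩∈ D w')))
            (Has-1 (∈⟨⟩ (y ≟_) refl)) (Has-21 (unpick {ys = z ∷ z' ∷ []} 2 (refl , (ne ∷ []) ∷ [] ∷ [] , ∈⟨⟩ D (a , e) ∷ ∈⟨⟩ D (b , e') ∷ [])))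
          le : ∀ z → M x y * (M x z * M y z) ≤ χ (⟨ D ⟩ z)
          le z with M-edge x z | M-edge y z
          ... | inj₁ e | _ = ≤-trans (≤-reflexive (trans (cong (λ t → M x y * (t * M y z)) e) (*-zeroʳ (M x y)))) z≤n
          ... | inj₂ _ | inj₁ e = ≤-trans (≤-reflexive (trans (cong (λ t → M x y * (M x z * t)) e) (trans (cong (M x y *_) (*-zeroʳ (M x z))) (*-zeroʳ (M x y))))) z≤n
          ... | inj₂ (e , _ , wz , ne , re) | inj₂ (e' , _ , _ , _ , re') = ≤-reflexive (trans (cong₂ _*_ e₁ (cong₂ _*_ e e'))
                (sym (cong χ (_∈_.holds (∈⟨⟩ D (∈⟨⟩ (nbhd? r x W) (wz , ne , re) , re'))))))

      local : Local (c x) (k x)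
      local = c≤6 , k≤c , k≥ 5 4 matching₅ , k≥ 6 6 matching₆

    K₃ : Fin n → Fin n → Fin n → ℕ
    K₃ x y z = M x y * (M x z * M y z)

    -- a further vertex is adjacent to at most one vertex of a triangle
    triangle : ∀ x y z → K₃ x y z * (c x + (c y + c z)) ≤ K₃ x y z * (d + 3)
    triangle x y z with M-edge x y | M-edge x z | M-edge y z
    ... | inj₁ e | _ | _ = ≤-reflexive (trans (cong (λ t → t * (M x z * M y z) * (c x + (c y + c z))) e) (sym (cong (λ t → t * (M x z * M y z) * (d + 3)) e)))
    ... | inj₂ _ | inj₁ e | _ = ≤-trans (≤-reflexive (cong (_* (c x + (c y + c z))) (trans (cong (λ t → M x y * (t * M y z)) e) (*-zeroʳ (M x y))))) z≤n
    ... | inj₂ _ | inj₂ _ | inj₁ e = ≤-trans (≤-reflexive (cong (_* (c x + (c y + c z))) (trans (cong (λ t → M x y * (M x z * t)) e) (trans (cong (M x y *_) (*-zeroʳ (M x z))) (*-zeroʳ (M x y)))))) z≤n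
    ... | inj₂ (_ , wx , wy , xy , rxy) | inj₂ (_ , _ , wz , xz , rxz) | inj₂ (_ , _ , _ , yz , ryz) = *-monoʳ-≤ (K₃ x y z) (begin
      c x + (c y + c z)                                          ≡⟨ cong (c x +_) (∑-distrib-+ (M y) (M z)) ⟨
      c x + sum (λ u → M y u + M z u)                            ≡⟨ ∑-distrib-+ (M x) _ ⟨
      sum (λ u → M x u + (M y u + M z u))                        ≤⟨ sum-mono each ⟩
      sum (λ u → χ (W u) + (δ x u + (δ y u + δ z u)))            ≡⟨ ∑-distrib-+ (χ ∘ W) _ ⟩
      d + sum (λ u → δ x u + (δ y u + δ z u))                    ≡⟨ cong (d +_) (trans (∑-distrib-+ (δ x) _) (cong (sum (δ x) +_) (∑-distrib-+ (δ y) (δ z)))) ⟩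
      d + (sum (δ x) + (sum (δ y) + sum (δ z)))                  ≤⟨ +-monoʳ-≤ d (+-mono-≤ (one x) (+-mono-≤ (one y) (one z))) ⟩
      d + 3                                                      ∎)
      where
      open ≤-Reasoning
      δ : Fin n → Fin n → ℕ
      δ v u = χ (does (v ≟ u))
      one : ∀ v → sum (δ v) ≤ 1
      one v = count≤1 {Q = ⟨ v ≟_ ⟩} λ a b → trans (sym (⟨⟩∈ (v ≟_) a)) (⟨⟩∈ (v ≟_) b)
      two : ∀ {a b u} → a ≢ b → u ≢ a → u ≢ b → a ∈ W → b ∈ W → u ∈ W → ∀ {e} → e ∈ W → e ≢ a → e ≢ b → u ≢ e → r a b ≡ true → r a e ≡ true → r b e ≡ true → r a u ≡ true → r b u ≡ true → ⊥
      two {a} {b} {u} ab ua ub wa wb wu {e} we ea eb ue rab rae rbe rau rbu = All.lookup f (here refl)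
        (a ∷ b ∷ u ∷ e ∷ [] , (refl , (ab ∷ (ua ∘ sym) ∷ (ea ∘ sym) ∷ []) ∷ ((ub ∘ sym) ∷ (eb ∘ sym) ∷ []) ∷ (ue ∷ []) ∷ [] ∷ [] , wa ∷ wb ∷ wu ∷ we ∷ []) ,
         subst₂ (λ p q → p + (q + (χ (not (r u e)) + 0 + 0)) ≤ 1) (sym (row-0 {e = r} {a} {b ∷ u ∷ e ∷ []} (rab ∷ rau ∷ rae ∷ []))) (sym (row-0 {e = r} {b} {u ∷ e ∷ []} (rbu ∷ rbe ∷ [])))
           (≤-trans (≤-reflexive (trans (+-identityʳ _) (+-identityʳ _))) (χ≤1 (not (r u e)))))
      each : ∀ u → M x u + (M y u + M z u) ≤ χ (W u) + (δ x u + (δ y u + δ z u))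
      each u with x ≟ u | y ≟ u | z ≟ u
      ... | yes refl | yes refl | _ = ⊥-elim (xy refl)
      ... | yes refl | no _ | yes refl = ⊥-elim (xz refl)
      ... | no _ | yes refl | yes refl = ⊥-elim (yz refl)
      ... | yes refl | no _ | no _ = ≤-trans (+-mono-≤ (≤-reflexive (M-diag x)) (+-mono-≤ (M≤1 y x) (M≤1 z x))) (≤-reflexive (cong (λ b → χ b + 1) (sym (_∈_.holds wx))))
      ... | no _ | yes refl | no _ = ≤-trans (+-mono-≤ (M≤1 x y) (+-mono-≤ (≤-reflexive (M-diag y)) (M≤1 z y))) (≤-reflexive (cong (λ b → χ b + 1) (sym (_∈_.holds wy))))
      ... | no _ | no _ | yes refl = ≤-trans (+-mono-≤ (M≤1 x z) (+-mono-≤ (M≤1 y z) (≤-reflexive (M-diag z)))) (≤-reflexive (cong (λ b → χ b + 1) (sym (_∈_.holds wz))))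
      ... | no ux | no uy | no uz with M-edge x u | M-edge y u | M-edge z u
      ...   | inj₁ e | inj₁ e' | inj₁ e'' = ≤-trans (≤-reflexive (cong₂ _+_ e (cong₂ _+_ e' e''))) z≤n
      ...   | inj₂ (e , _ , wu , _) | inj₁ e' | inj₁ e'' = ≤-reflexive (trans (cong₂ _+_ e (cong₂ _+_ e' e'')) (cong (λ b → χ b + 0) (sym (_∈_.holds wu))))
      ...   | inj₁ e | inj₂ (e' , _ , wu , _) | inj₁ e'' = ≤-reflexive (trans (cong₂ _+_ e (cong₂ _+_ e' e'')) (cong (λ b → χ b + 0) (sym (_∈_.holds wu))))
      ...   | inj₁ e | inj₁ e' | inj₂ (e'' , _ , wu , _) = ≤-reflexive (trans (cong₂ _+_ e (cong₂ _+_ e' e'')) (cong (λ b → χ b + 0) (sym (_∈_.holds wu))))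
      ...   | inj₂ (_ , _ , wu , _ , e) | inj₂ (_ , _ , _ , _ , e') | _ = ⊥-elim (two xy (ux ∘ sym) (uy ∘ sym) wx wy wu wz (xz ∘ sym) (yz ∘ sym) (uz ∘ sym) rxy rxz ryz e e')
      ...   | inj₂ (_ , _ , wu , _ , e) | inj₁ _ | inj₂ (_ , _ , _ , _ , e') = ⊥-elim (two xz (ux ∘ sym) (uz ∘ sym) wx wz wu wy (xy ∘ sym) yz (uy ∘ sym) rxz rxy (trans (s z y) ryz) e e')
      ...   | inj₁ _ | inj₂ (_ , _ , wu , _ , e) | inj₂ (_ , _ , _ , _ , e') = ⊥-elim (two yz (uy ∘ sym) (uz ∘ sym) wy wz wu wx xy xz (ux ∘ sym) ryz (trans (s y x) rxy) (trans (s z x) rxz) e e')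

    ∑∑∑ : (Fin n → Fin n → Fin n → ℕ) → ℕ
    ∑∑∑ g = sum (λ x → sum (λ y → sum (g x y)))

    kc : ℕ
    kc = sum (λ x → k x * c x)

    ∑∑∑-cong : ∀ {g h : Fin n → Fin n → Fin n → ℕ} → (∀ x y z → g x y z ≡ h x y z) → ∑∑∑ g ≡ ∑∑∑ h
    ∑∑∑-cong e = sum-cong-≗ λ x → sum-cong-≗ λ y → sum-cong-≗ (e x y)

    K₃c₁ : ∑∑∑ (λ x y z → K₃ x y z * c x) ≡ kc
    K₃c₁ = sum-cong-≗ λ x → trans (sum-cong-≗ λ y → sym (*-distribʳ-sum (c x) (K₃ x y))) (sym (*-distribʳ-sum (c x) (λ y → sum (K₃ x y))))

    K₃c₂ : ∑∑∑ (λ x y z → K₃ x y z * c y) ≡ kc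
    K₃c₂ = trans (∑-comm (λ x y → sum (λ z → K₃ x y z * c y)))
      (trans (∑∑∑-cong λ y x z → cong (_* c y) (cong₂ _*_ (M-sym x y) (*-comm (M x z) (M y z)))) K₃c₁)

    K₃c₃ : ∑∑∑ (λ x y z → K₃ x y z * c z) ≡ kc
    K₃c₃ = trans (sum-cong-≗ λ x → ∑-comm (λ y z → K₃ x y z * c z))
      (trans (∑∑∑-cong λ x z y → cong (_* c z) (trans (x∙yz≈y∙xz (M x y) (M x z) _) (cong (λ t → M x z * (M x y * t)) (M-sym y z)))) K₃c₂)
      where open import Algebra.Properties.CommutativeSemigroup *-commutativeSemigroup using (x∙yz≈y∙xz)

    -- Summed over ordered triangles, each of the three degrees contributes the same total `kc` by
    -- symmetry, while each triangle allows d + 3.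
    triangles : kc + (kc + kc) ≤ (d + 3) * sum k
    triangles = begin
      kc + (kc + kc)  ≡⟨ cong₂ _+_ K₃c₁ (cong₂ _+_ K₃c₂ K₃c₃) ⟨
      ∑∑∑ g₁ + (∑∑∑ g₂ + ∑∑∑ g₃)
        ≡⟨ trans (add g₁ (λ x y z → g₂ x y z + g₃ x y z)) (cong (∑∑∑ g₁ +_) (add g₂ g₃)) ⟨
      ∑∑∑ (λ x y z → g₁ x y z + (g₂ x y z + g₃ x y z))
        ≡⟨ ∑∑∑-cong (λ x y z → trans (*-distribˡ-+ (K₃ x y z) (c x) _) (cong (g₁ x y z +_) (*-distribˡ-+ (K₃ x y z) (c y) (c z)))) ⟨
      ∑∑∑ (λ x y z → K₃ x y z * (c x + (c y + c z)))  ≤⟨ sum-mono (λ x → sum-mono λ y → sum-mono (triangle x y)) ⟩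
      ∑∑∑ (λ x y z → K₃ x y z * (d + 3))
        ≡⟨ (sum-cong-≗ λ x → trans (sum-cong-≗ λ y → sym (*-distribʳ-sum (d + 3) (K₃ x y))) (sym (*-distribʳ-sum (d + 3) (λ y → sum (K₃ x y))))) ⟩
      sum (λ x → k x * (d + 3))  ≡⟨ *-distribʳ-sum (d + 3) k ⟨
      sum k * (d + 3)            ≡⟨ *-comm (sum k) (d + 3) ⟩
      (d + 3) * sum k            ∎
      where
      open ≤-Reasoning
      g₁ g₂ g₃ : Fin n → Fin n → Fin n → ℕ
      g₁ x y z = K₃ x y z * c x
      g₂ x y z = K₃ x y z * c y
      g₃ x y z = K₃ x y z * c z
      add : ∀ g h → ∑∑∑ (λ x y z → g x y z + h x y z) ≡ ∑∑∑ g + ∑∑∑ h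
      add g h = trans (sum-cong-≗ λ x → trans (sum-cong-≗ λ y → ∑-distrib-+ (g x y) (h x y)) (∑-distrib-+ (λ y → sum (g x y)) (λ y → sum (h x y)))) (∑-distrib-+ (λ x → sum (λ y → sum (g x y))) (λ x → sum (λ y → sum (h x y))))

    -- Linear programming duality: the pointwise inequality is summed over W and `triangles` removes
    -- all terms in k. The coefficient 12 = 3 * 4 puts the stationary point of 12c + (d + 3)k - 3kc
    -- at c = (d + 3) / 3 and k = 4, which is two triangles per vertex.
    degree-sum : ∀ K → (∀ c k → Local c k → 12 * c + (d + 3) * k ≤ K + 3 * (k * c)) → 12 * sum c ≤ K * d
    degree-sum K h = +-cancelʳ-≤ ((d + 3) * sum k) _ _ (begin
      12 * sum c + (d + 3) * sum k                             ≡⟨ cong₂ _+_ (*-distribˡ-sum 12 c) (*-distribˡ-sum (d + 3) k) ⟩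
      sum (λ x → 12 * c x) + sum (λ x → (d + 3) * k x)         ≡⟨ ∑-distrib-+ (λ x → 12 * c x) (λ x → (d + 3) * k x) ⟨
      sum (λ x → 12 * c x + (d + 3) * k x)                     ≤⟨ sum-mono (λ x → each x (W x) refl) ⟩
      sum (λ x → K * χ (W x) + 3 * (k x * c x))                ≡⟨ ∑-distrib-+ (λ x → K * χ (W x)) (λ x → 3 * (k x * c x)) ⟩
      sum (λ x → K * χ (W x)) + sum (λ x → 3 * (k x * c x))    ≡⟨ cong₂ _+_ (*-distribˡ-sum K (χ ∘ W)) (*-distribˡ-sum 3 (λ x → k x * c x)) ⟨
      K * d + 3 * kc                                           ≡⟨ cong (λ t → K * d + (kc + (kc + t))) (+-identityʳ kc) ⟩
      K * d + (kc + (kc + kc))                                 ≤⟨ +-monoʳ-≤ (K * d) triangles ⟩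
      K * d + (d + 3) * sum k                                  ∎)
      where
      open ≤-Reasoning
      outside : ∀ {x} → W x ≡ false → c x ≡ 0 × k x ≡ 0
      outside {x} e = sum-zero (λ y → zero-M y) , sum-zero (λ y → sum-zero {n} (λ z → cong (_* (M x z * M y z)) (zero-M y)))
        where
        zero-M : ∀ y → M x y ≡ 0
        zero-M y = cong (λ b → χ b * (χ (W y) * χ (r x y))) e
      each : ∀ x b → W x ≡ b → 12 * c x + (d + 3) * k x ≤ K * χ b + 3 * (k x * c x)
      each x true e = ≤-trans (h (c x) (k x) (local (mem e))) (≤-reflexive (cong (_+ 3 * (k x * c x)) (sym (*-identityʳ K))))
      each x false e = ≤-trans (≤-reflexive (trans (cong₂ (λ a b → 12 * a + (d + 3) * b) (proj₁ (outside e)) (proj₂ (outside e))) (*-zeroʳ (d + 3)))) z≤n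

    degree-sum′ : sum c ≤ 6 * d
    degree-sum′ = ≤-trans (sum-mono (λ x → each x (W x) refl)) (≤-reflexive (sym (*-distribˡ-sum 6 (χ ∘ W))))
      where
      each : ∀ x b → W x ≡ b → c x ≤ 6 * χ b
      each x true e = c≤6 (mem e)
      each x false e = ≤-trans (≤-reflexive (sum-zero {n} λ y → cong (λ b → χ b * (χ (W y) * χ (r x y))) e)) z≤n

  -- maximal degree sum in a K₄ - e/H₃-colouring on d vertices; the optimum (d + 3) / 3 for the average
  -- degree is attained at two triangles per vertex
  local-bound : ℕ → ℕ
  local-bound 7 = 28
  local-bound 8 = 32
  local-bound 9 = 36
  local-bound 10 = 43
  local-bound 11 = 51
  local-bound 12 = 60
  local-bound 13 = 70
  local-bound 14 = 81
  local-bound d = 6 * d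

  pointwise : ∀ d K → Set
  pointwise d K = ∀ c k → Local c k → 12 * c + (d + 3) * k ≤ K + 3 * (k * c)

  pointwiseᵇ : ℕ → ℕ → ℕ → ℕ → Bool
  pointwiseᵇ d K c k = not (does (local? c k)) ∨ (12 * c + (d + 3) * k ≤ᵇ K + 3 * (k * c))

  pointwise? : ∀ d K → all (λ c → all (pointwiseᵇ d K c) (upTo 7)) (upTo 7) ≡ true → pointwise d K
  pointwise? d K h c k l with ∨-true {not (does (local? c k))} (all-sound (pointwiseᵇ d K c) {upTo 7} {k} (all-sound (λ c → all (pointwiseᵇ d K c) (upTo 7)) {upTo 7} {c} h (∈-upTo⁺ (s≤s (proj₁ l)))) (∈-upTo⁺ (s≤s (≤-trans (proj₁ (proj₂ l)) (proj₁ l)))))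
  ... | inj₂ e = ≤ᵇ-true e
  ... | inj₁ e = ⊥-elim (refute (local? c k) e)
    where
    refute : (d : Dec (Local c k)) → not (does d) ≡ true → ⊥
    refute (no ¬l) _ = ¬l l

  degree-sum≤ : ∀ {n} {r : BGraph n} (s : Symm r) (irr : Irr r) {W} (f : All (Forbids r W) J₄-J₅-free) → sum (Neighbourhood.c s irr f) ≤ local-bound (count W)
  degree-sum≤ s irr {W} f = go (count W) refl
    where
    open Neighbourhood s irr f
    via : ∀ m K b → pointwise m K → (K * m < 12 * (1 + b)) → d ≡ m → sum c ≤ b
    via m K b p lt e = ≤-pred (*-cancelˡ-< 12 _ _ (≤-<-trans (subst (λ t → 12 * sum c ≤ K * t) e (degree-sum K (subst (λ t → pointwise t K) (sym e) p))) lt))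
    <! : ∀ {a b} → (suc a ≤ᵇ b) ≡ true → a < b
    <! = ≤ᵇ-true
    rest : ∀ m → d ≡ m → sum c ≤ 6 * m
    rest m refl = degree-sum′
    go : ∀ m → d ≡ m → sum c ≤ local-bound m
    go 7 e = via 7 48 28 (pointwise? 7 48 refl) (<! refl) e
    go 8 e = via 8 48 32 (pointwise? 8 48 refl) (<! refl) e
    go 9 e = via 9 48 36 (pointwise? 9 48 refl) (<! refl) e
    go 10 e = via 10 52 43 (pointwise? 10 52 refl) (<! refl) e
    go 11 e = via 11 56 51 (pointwise? 11 56 refl) (<! refl) e
    go 12 e = via 12 60 60 (pointwise? 12 60 refl) (<! refl) e
    go 13 e = via 13 65 70 (pointwise? 13 65 refl) (<! refl) e
    go 14 e = via 14 70 81 (pointwise? 14 70 refl) (<! refl) e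
    go 0 e = rest 0 e
    go 1 e = rest 1 e
    go 2 e = rest 2 e
    go 3 e = rest 3 e
    go 4 e = rest 4 e
    go 5 e = rest 5 e
    go 6 e = rest 6 e
    go m@(suc (suc (suc (suc (suc (suc (suc (suc (suc (suc (suc (suc (suc (suc (suc _))))))))))))))) e = rest m e

-- Goodman's count of monochromatic triangles on 22 vertices.

module Goodman where

  open import Data.Bool using (T)
  open Subsets
  open SmallRamsey
  open Extension
  open Enumeration
  open Classification
  open Gluing
  open DegreeSums

  ⊤ˢ : ∀ {n} → VSet n
  ⊤ˢ _ = true

  -- The diagonal is excluded so that blue is again an irreflexive graph and everything shown for
  -- red neighbourhoods applies with the colours exchanged.
  complement : ∀ {n} → BGraph n → BGraph n
  complement r x y = not (does (x ≟ y)) ∧ not (r x y)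

  complement-symm : ∀ {n} {r : BGraph n} → Symm r → Symm (complement r)
  complement-symm {r = r} s x y with x ≟ y | y ≟ x
  ... | yes _ | yes _ = refl
  ... | no _ | no _ = cong not (s x y)
  ... | yes refl | no ne = ⊥-elim (ne refl)
  ... | no ne | yes refl = ⊥-elim (ne refl)

  complement-irr : ∀ {n} {r : BGraph n} → Irr (complement r)
  complement-irr x with x ≟ x
  ... | yes _ = refl
  ... | no ne = ⊥-elim (ne refl)

  complement-≢ : ∀ {n} {r : BGraph n} {x y} → x ≢ y → complement r x y ≡ not (r x y)
  complement-≢ {x = x} {y} ne with x ≟ y
  ... | yes e = ⊥-elim (ne e)
  ... | no _ = refl

  complement-forbids : ∀ {n} {r : BGraph n} {Q} → All (Forbids r Q) J₅-J₅-free → All (Forbids (complement r) Q) J₅-J₅-free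
  complement-forbids {r = r} (f ∷ g ∷ []) =
    (g ∘ Has-mono (λ ne _ _ h → trans (sym (complement-≢ {r = r} ne)) h) (λ q → q) ≤-refl) ∷
    (f ∘ Has-mono (λ {x} {y} ne _ _ h → trans (sym (dn (r x y))) (trans (cong not (sym (complement-≢ {r = r} ne))) h)) (λ q → q) ≤-refl) ∷ []
    where
    dn : ∀ b → not (not b) ≡ b
    dn true = refl
    dn false = refl

  J₄-J₅-nbhd : ∀ {n} {r : BGraph n} {Q v R} → v ∈ Q → All (Forbids r Q) J₅-J₅-free → R ⊆ nbhd r v Q → All (Forbids r R) J₄-J₅-free
  J₄-J₅-nbhd {r = r} {v = v} q (f ∷ g ∷ []) h = (f ∘ Has-nbhd q ∘ Has-⊆ h) ∷ (g ∘ Has-⊆ (nbhd-⊆ r v ∘ h)) ∷ []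

  module _ {n} {r : BGraph n} (s : Symm r) (irr : Irr r) (f : All (Forbids r ⊤ˢ) J₅-J₅-free) where

    local-free : ∀ v → All (Forbids r (nbhd r v ⊤ˢ)) J₄-J₅-free
    local-free v = J₄-J₅-nbhd {Q = ⊤ˢ} (mem refl) f (λ q → q)

    nbhd≡ : ∀ v x → nbhd r v ⊤ˢ x ≡ r v x
    nbhd≡ v x with v ≟ x | r v x in e
    ... | yes refl | true = trans (sym (irr v)) e
    ... | yes refl | false = refl
    ... | no _ | true = refl
    ... | no _ | false = refl

    deg : Fin n → ℕ
    deg v = sum (λ x → χ (r v x))

    deg-nbhd : ∀ v → count (nbhd r v ⊤ˢ) ≡ deg v
    deg-nbhd v = sum-cong-≗ λ x → cong χ (nbhd≡ v x)

    -- twice the number of edges in the neighbourhood of v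
    links : Fin n → ℕ
    links v = sum (λ x → sum (λ y → χ (r v x) * (χ (r v y) * χ (r x y))))

    links-c : ∀ v → sum (Neighbourhood.c s irr (local-free v)) ≡ links v
    links-c v = sum-cong-≗ λ x → sum-cong-≗ λ y → cong₂ (λ a b → χ a * (χ b * χ (r x y))) (nbhd≡ v x) (nbhd≡ v y)

    links≤ : ∀ v → links v ≤ local-bound (deg v)
    links≤ v = subst₂ _≤_ (links-c v) (cong local-bound (deg-nbhd v)) (degree-sum≤ s irr (local-free v))

    links-edges : ∀ v → 2 * edges (matrix r (elems (nbhd r v ⊤ˢ))) ≡ links v
    links-edges v = trans (edges-elems s irr (nbhd r v ⊤ˢ)) (trans (sum-cong-≗ λ x → *-distribˡ-sum (χ (nbhd r v ⊤ˢ x)) (λ y → χ (nbhd r v ⊤ˢ y) * χ (r x y))) (links-c v))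

    half : ∀ {a b} → 2 * a ≤ 1 + 2 * b → a ≤ b
    half {a} {b} h with a ≤? b
    ... | yes le = le
    ... | no gt = ⊥-elim (<-irrefl refl (≤-trans (≤-reflexive (sym (*-suc 2 b))) (≤-trans (*-monoʳ-≤ 2 (≰⇒> gt)) h)))

    codeg : ∀ v → count ⟨ blueSide? s irr f {v} (mem refl) ⟩ ≡ sum (λ x → χ (complement r v x))
    codeg v = sum-cong-≗ λ x → cong χ (lem x)
      where
      lem : ∀ x → does (blueSide? s irr f {v} (mem refl) x) ≡ complement r v x
      lem x with v ≟ x | r v x
      ... | yes _ | _ = refl
      ... | no _ | true = refl
      ... | no _ | false = refl

    -- The threshold is where the count breaks down: 46 + 43 + 3 * 110 = 419 is still below 420.
    -- Degree sums are even, so 47 forces 24 edges.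
    not-critical₁₁ : ∀ v → deg v ≡ 11 → sum (λ x → χ (complement r v x)) ≡ 10 → 47 ≤ links v → ⊥
    not-critical₁₁ v e e' h = no-critical s irr f {v} (mem refl) 11 24 10 (λ g → classified11 s irr (J₄-J₅-nbhd {Q = ⊤ˢ} (mem refl) f g)) trees11 trees11-refute
      (subst (λ t → Picks t (nbhd r v ⊤ˢ) (elems (nbhd r v ⊤ˢ))) (trans (deg-nbhd v) e) (picks-elems (nbhd r v ⊤ˢ)))
      (half (s≤s (≤-trans h (≤-reflexive (sym (links-edges v)))))) (≤-reflexive (trans (sym e') (sym (codeg v))))

    -- Here 59 + 36 + 3 * 108 = 419 is the limit, so the excluded case is a degree sum of 60, that
    -- is 30 edges.
    not-critical₁₂ : ∀ v → deg v ≡ 12 → sum (λ x → χ (complement r v x)) ≡ 9 → 60 ≤ links v → ⊥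
    not-critical₁₂ v e e' h = no-critical s irr f {v} (mem refl) 12 30 9 (λ g → classified12 s irr (J₄-J₅-nbhd {Q = ⊤ˢ} (mem refl) f g)) trees12 trees12-refute
      (subst (λ t → Picks t (nbhd r v ⊤ˢ) (elems (nbhd r v ⊤ˢ))) (trans (deg-nbhd v) e) (picks-elems (nbhd r v ⊤ˢ)))
      (*-cancelˡ-≤ 2 (≤-trans h (≤-reflexive (sym (links-edges v))))) (≤-reflexive (trans (sym e') (sym (codeg v))))

  module Goodman {n} {r : BGraph n} (s : Symm r) (irr : Irr r) where

    b : BGraph n
    b = complement r

    bs : Symm b
    bs = complement-symm s

    distinct : BGraph n
    distinct x y = not (does (x ≟ y))

    K₃ : BGraph n → Fin n → Fin n → Fin n → ℕ
    K₃ e v x y = χ (e v x) * (χ (e v y) * χ (e x y))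

    cherry : Fin n → Fin n → Fin n → ℕ
    cherry v x y = χ (r v x) * χ (b v y) + χ (b v x) * χ (r v y)

    ∑∑∑ : (Fin n → Fin n → Fin n → ℕ) → ℕ
    ∑∑∑ g = sum (λ x → sum (λ y → sum (g x y)))

    ∑∑∑-+ : ∀ g h → ∑∑∑ (λ x y z → g x y z + h x y z) ≡ ∑∑∑ g + ∑∑∑ h
    ∑∑∑-+ g h = trans (sum-cong-≗ λ x → trans (sum-cong-≗ λ y → ∑-distrib-+ (g x y) (h x y)) (∑-distrib-+ (λ y → sum (g x y)) (λ y → sum (h x y)))) (∑-distrib-+ (λ x → sum (λ y → sum (g x y))) (λ x → sum (λ y → sum (h x y))))

    ∑∑∑-* : ∀ a g → ∑∑∑ (λ x y z → a * g x y z) ≡ a * ∑∑∑ g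
    ∑∑∑-* a g = sym (trans (*-distribˡ-sum a (λ x → sum (λ y → sum (g x y)))) (sum-cong-≗ λ x → trans (*-distribˡ-sum a (λ y → sum (g x y))) (sum-cong-≗ λ y → *-distribˡ-sum a (g x y))))

    mixed : ℕ
    mixed = sum (λ v → sum (χ ∘ r v) * sum (χ ∘ b v))

    product : ∀ (f g : Fin n → ℕ) → sum (λ x → sum (λ y → f x * g y)) ≡ sum f * sum g
    product f g = sym (trans (*-distribʳ-sum (sum g) f) (sum-cong-≗ λ x → *-distribˡ-sum (f x) g))

    cherries : ∑∑∑ cherry ≡ 2 * mixed
    cherries = trans (∑∑∑-+ (λ v x y → χ (r v x) * χ (b v y)) (λ v x y → χ (b v x) * χ (r v y)))
      (cong₂ _+_ (sum-cong-≗ λ v → product (χ ∘ r v) (χ ∘ b v))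
        (trans (sum-cong-≗ λ v → trans (product (χ ∘ b v) (χ ∘ r v)) (*-comm (sum (χ ∘ b v)) _)) (sym (+-identityʳ mixed))))

    -- A triple that is not monochromatic has exactly two vertices incident with both colours.
    triple : ∀ v x y → 2 * K₃ distinct v x y ≤ 2 * (K₃ r v x y + K₃ b v x y) + (cherry v x y + (cherry x v y + cherry y v x))
    triple v x y = ≤-trans core (≤-reflexive (cong (λ t → 2 * (K₃ r v x y + K₃ b v x y) + (cherry v x y + t)) (sym (cong₂ _+_
        (cong₂ (λ p q → χ p * χ (b x y) + χ q * χ (r x y)) (s x v) (bs x v))
        (cong₂ _+_ (cong₂ (λ p q → χ p * χ q) (s y v) (bs y x)) (cong₂ (λ p q → χ p * χ q) (bs y v) (s y x)))))))
      where
      core : 2 * K₃ distinct v x y ≤ 2 * (K₃ r v x y + K₃ b v x y) +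
        (cherry v x y + ((χ (r v x) * χ (b x y) + χ (b v x) * χ (r x y)) + (χ (r v y) * χ (b x y) + χ (b v y) * χ (r x y))))
      table : ∀ p q t → 2 ≤ 2 * (χ p * (χ q * χ t) + χ (not p) * (χ (not q) * χ (not t))) +
        ((χ p * χ (not q) + χ (not p) * χ q) + ((χ p * χ (not t) + χ (not p) * χ t) + (χ q * χ (not t) + χ (not q) * χ t)))
      table true true true = s≤s (s≤s z≤n)
      table true true false = s≤s (s≤s z≤n)
      table true false true = s≤s (s≤s z≤n)
      table true false false = s≤s (s≤s z≤n)
      table false true true = s≤s (s≤s z≤n)
      table false true false = s≤s (s≤s z≤n)
      table false false true = s≤s (s≤s z≤n)
      table false false false = s≤s (s≤s z≤n)
      core with v ≟ x | v ≟ y | x ≟ y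
      ... | yes _ | _ | _ = z≤n
      ... | no _ | yes _ | _ = z≤n
      ... | no _ | no _ | yes _ = z≤n
      ... | no _ | no _ | no _ = table (r v x) (r v y) (r x y)

    goodman : 2 * ∑∑∑ (K₃ distinct) ≤ 2 * (∑∑∑ (K₃ r) + ∑∑∑ (K₃ b)) + (2 * mixed + (2 * mixed + 2 * mixed))
    goodman = begin
      2 * ∑∑∑ (K₃ distinct)  ≡⟨ ∑∑∑-* 2 (K₃ distinct) ⟨
      ∑∑∑ (λ v x y → 2 * K₃ distinct v x y)  ≤⟨ sum-mono (λ v → sum-mono λ x → sum-mono (triple v x)) ⟩
      ∑∑∑ (λ v x y → 2 * (K₃ r v x y + K₃ b v x y) + (cherry v x y + (cherry x v y + cherry y v x)))
        ≡⟨ trans (∑∑∑-+ (λ v x y → 2 * (K₃ r v x y + K₃ b v x y)) (λ v x y → cherry v x y + (cherry x v y + cherry y v x))) (cong₂ _+_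
             (trans (∑∑∑-* 2 (λ v x y → K₃ r v x y + K₃ b v x y)) (cong (2 *_) (∑∑∑-+ (K₃ r) (K₃ b))))
             (trans (∑∑∑-+ cherry (λ v x y → cherry x v y + cherry y v x)) (cong (∑∑∑ cherry +_) (∑∑∑-+ (λ v x y → cherry x v y) (λ v x y → cherry y v x))))) ⟩
      2 * (∑∑∑ (K₃ r) + ∑∑∑ (K₃ b)) + (∑∑∑ cherry + (∑∑∑ (λ v x y → cherry x v y) + ∑∑∑ (λ v x y → cherry y v x)))
        ≡⟨ cong (2 * (∑∑∑ (K₃ r) + ∑∑∑ (K₃ b)) +_) (cong₂ _+_ cherries (cong₂ _+_ (trans swap₁₂ cherries) (trans (trans (sum-cong-≗ λ v → ∑-comm (λ x y → cherry y v x)) swap₁₂) cherries))) ⟩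
      2 * (∑∑∑ (K₃ r) + ∑∑∑ (K₃ b)) + (2 * mixed + (2 * mixed + 2 * mixed))  ∎
      where
      open ≤-Reasoning
      swap₁₂ : ∑∑∑ (λ v x y → cherry x v y) ≡ ∑∑∑ cherry
      swap₁₂ = ∑-comm (λ v x → sum (λ y → cherry x v y))

    average : ∀ m → (∀ v → (sum (λ x → sum (K₃ r v x)) + sum (λ x → sum (K₃ b v x))) + 3 * (sum (χ ∘ r v) * sum (χ ∘ b v)) ≤ m) →
      ∑∑∑ (K₃ distinct) ≤ n * m
    average m h = *-cancelˡ-≤ 2 (begin
      2 * ∑∑∑ (K₃ distinct)                           ≤⟨ goodman ⟩
      2 * (∑∑∑ (K₃ r) + ∑∑∑ (K₃ b)) + (2 * mixed + (2 * mixed + 2 * mixed))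
        ≡⟨ cong (2 * (∑∑∑ (K₃ r) + ∑∑∑ (K₃ b)) +_) (trans (cong (λ t → 2 * mixed + (2 * mixed + t)) (sym (+-identityʳ (2 * mixed)))) (trans (sym (*-assoc 3 2 mixed)) (*-assoc 2 3 mixed))) ⟩
      2 * (∑∑∑ (K₃ r) + ∑∑∑ (K₃ b)) + 2 * (3 * mixed) ≡⟨ *-distribˡ-+ 2 (∑∑∑ (K₃ r) + ∑∑∑ (K₃ b)) (3 * mixed) ⟨
      2 * ((∑∑∑ (K₃ r) + ∑∑∑ (K₃ b)) + 3 * mixed)     ≡⟨ cong (2 *_) (cong₂ _+_ (∑-distrib-+ A B) (sym (*-distribˡ-sum 3 D))) ⟨
      2 * (sum (λ v → A v + B v) + sum (λ v → 3 * D v)) ≡⟨ cong (2 *_) (∑-distrib-+ (λ v → A v + B v) (λ v → 3 * D v)) ⟨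
      2 * sum (λ v → (A v + B v) + 3 * D v)            ≤⟨ *-monoʳ-≤ 2 (≤-trans (sum-mono h) (≤-reflexive (sum-const n m))) ⟩
      2 * (n * m)                                     ∎)
      where
      open ≤-Reasoning
      A B D : Fin n → ℕ
      A v = sum (λ x → sum (K₃ r v x))
      B v = sum (λ x → sum (K₃ b v x))
      D v = sum (χ ∘ r v) * sum (χ ∘ b v)

    deg-total : ∀ v → suc (sum (λ x → χ (r v x)) + sum (λ x → χ (b v x))) ≡ n
    deg-total v = begin
      suc (sum (χ ∘ r v) + sum (χ ∘ b v))  ≡⟨ cong suc (∑-distrib-+ (χ ∘ r v) (χ ∘ b v)) ⟨
      suc (sum (λ x → χ (r v x) + χ (b v x)))  ≡⟨ cong (_+ sum (λ x → χ (r v x) + χ (b v x))) (one v) ⟨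
      sum (λ x → χ (does (v ≟ x))) + sum (λ x → χ (r v x) + χ (b v x)) ≡⟨ ∑-distrib-+ (λ x → χ (does (v ≟ x))) _ ⟨
      sum (λ x → χ (does (v ≟ x)) + (χ (r v x) + χ (b v x)))  ≡⟨ sum-cong-≗ each ⟩
      sum {n} (λ _ → 1)                        ≡⟨ trans (sum-const n 1) (*-identityʳ n) ⟩
      n                                    ∎
      where
      open ≡-Reasoning
      one : ∀ v → sum (λ x → χ (does (v ≟ x))) ≡ 1
      one v = ≤-antisym (count≤1 {Q = ⟨ v ≟_ ⟩} λ p q → trans (sym (⟨⟩∈ (v ≟_) p)) (⟨⟩∈ (v ≟_) q)) (count-∈ {Q = ⟨ v ≟_ ⟩} (∈⟨⟩ (v ≟_) refl))
      each : ∀ x → χ (does (v ≟ x)) + (χ (r v x) + χ (b v x)) ≡ 1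
      each x with v ≟ x | r v x in e
      ... | yes refl | true = case trans (sym e) (irr v) of λ ()
      ... | yes refl | false = refl
      ... | no _ | true = refl
      ... | no _ | false = refl

  complement-complement : ∀ {n} {r : BGraph n} → Irr r → ∀ v x → complement (complement r) v x ≡ r v x
  complement-complement {r = r} irr v x with v ≟ x
  ... | yes refl = sym (irr v)
  ... | no _ with r v x
  ...   | true = refl
  ...   | false = refl

  -- On 22 vertices links r v + links b v + 3 * d * d′ averages at least 420, where d + d′ = 21. Only at
  -- the degrees 9, 10, 11 and 12 do the local bounds allow this.
  ordinary : ℕ → Bool
  ordinary d = (d ≡ᵇ 9) ∨ ((d ≡ᵇ 10) ∨ ((d ≡ᵇ 11) ∨ ((d ≡ᵇ 12) ∨ (local-bound d + local-bound (21 ∸ d) + 3 * (d * (21 ∸ d)) <ᵇ 420))))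

  triples : ∀ n → ℕ
  triples n = sum {n} (λ v → sum {n} (λ x → sum {n} (λ y → χ (not (does (v ≟ x))) * (χ (not (does (v ≟ y))) * χ (not (does (x ≟ y)))))))

  -- 22 * 21 * 20 ordered triples of distinct vertices, or 420 for each vertex.
  triples-22 : triples 22 ≡ 9240
  triples-22 = refl

  module _ {n} {r : BGraph n} (s : Symm r) (irr : Irr r) (f : All (Forbids r ⊤ˢ) J₅-J₅-free) (n≡22 : n ≡ 22) where

    open Goodman s irr

    private
      irrᵇ : Irr b
      irrᵇ = complement-irr {r = r}
      fᵇ = complement-forbids {Q = ⊤ˢ} f
      A B dr db : Fin n → ℕ
      A = links s irr f
      B = links bs irrᵇ fᵇ
      dr = deg s irr f
      db = deg bs irrᵇ fᵇ
      bb : ∀ v → sum (λ x → χ (complement b v x)) ≡ dr v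
      bb v = sum-cong-≗ λ x → cong χ (complement-complement irr v x)
      total : ∀ v → dr v + db v ≡ 21
      total v = suc-injective (trans (deg-total v) n≡22)
      each : ∀ v → (A v + B v) + 3 * (dr v * db v) ≤ 419
      each v = go (all-sound ordinary {upTo 22} {dr v} refl (∈-upTo⁺ (s≤s (≤-trans (m≤m+n (dr v) (db v)) (≤-reflexive (total v))))))
        where
        below : ∀ {a m} → ¬ (suc m ≤ a) → a ≤ m
        below h = ≤-pred (≰⇒> h)
        combine : ∀ p q d d′ → A v ≤ p → B v ≤ q → p + q + 3 * (d * d′) ≤ 419 → (A v + B v) + 3 * (d * d′) ≤ 419
        combine p q d d′ a b h = ≤-trans (+-monoˡ-≤ (3 * (d * d′)) (+-mono-≤ a b)) h
        Abound : ∀ {d} → dr v ≡ d → A v ≤ local-bound d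
        Abound refl = links≤ s irr f v
        Bbound : ∀ {d} → db v ≡ d → B v ≤ local-bound d
        Bbound refl = links≤ bs irrᵇ fᵇ v
        codegree : ∀ {d d′} → dr v ≡ d → d + d′ ≡ 21 → db v ≡ d′
        codegree {d} {d′} e t = +-cancelˡ-≡ d (db v) d′ (trans (cong (_+ db v) (sym e)) (trans (total v) (sym t)))
        sized : ∀ {d d′} → dr v ≡ d → db v ≡ d′ → (A v + B v) + 3 * (d * d′) ≤ 419 → (A v + B v) + 3 * (dr v * db v) ≤ 419
        sized refl refl h = h
        at : ∀ m → (dr v ≡ᵇ m) ≡ true → dr v ≡ m
        at m h = ≡ᵇ⇒≡ (dr v) m (subst T (sym h) tt)
        go : ordinary (dr v) ≡ true → (A v + B v) + 3 * (dr v * db v) ≤ 419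
        go o with ∨-true o
        -- In these four cases the total is exactly 419: the colour of degree 11 or 12 has the bound
        -- improved by the gluing step, the other one its `local-bound`.
        ... | inj₁ h = let e = at 9 h ; e′ = codegree e refl in sized e e′ (combine 36 59 9 12 (Abound e) (below (not-critical₁₂ bs irrᵇ fᵇ v e′ (trans (bb v) e))) (≤ᵇ-true refl))
        ... | inj₂ o with ∨-true o
        ...   | inj₁ h = let e = at 10 h ; e′ = codegree e refl in sized e e′ (combine 43 46 10 11 (Abound e) (below (not-critical₁₁ bs irrᵇ fᵇ v e′ (trans (bb v) e))) (≤ᵇ-true refl))
        ...   | inj₂ o with ∨-true o
        ...     | inj₁ h = let e = at 11 h ; e′ = codegree e refl in sized e e′ (combine 46 43 11 10 (below (not-critical₁₁ s irr f v e e′)) (Bbound e′) (≤ᵇ-true refl))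
        ...     | inj₂ o with ∨-true o
        ...       | inj₁ h = let e = at 12 h ; e′ = codegree e refl in sized e e′ (combine 59 36 12 9 (below (not-critical₁₂ s irr f v e e′)) (Bbound e′) (≤ᵇ-true refl))
        ...       | inj₂ h = sized refl e′ (combine (local-bound (dr v)) (local-bound (21 ∸ dr v)) (dr v) (21 ∸ dr v) (Abound refl) (Bbound e′) (≤-pred (≤ᵇ-true h)))
          where
          e′ : db v ≡ 21 ∸ dr v
          e′ = codegree refl (m+[n∸m]≡n (≤-trans (m≤m+n (dr v) (db v)) (≤-reflexive (total v))))

    H₃-H₃-22 : ⊥
    H₃-H₃-22 = <-irrefl refl (≤-<-trans (average 419 each) (subst (λ m → m * 419 < triples m) (sym n≡22) (subst (22 * 419 <_) (sym triples-22) (≤ᵇ-true refl))))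

-- The bounds for K₄ - e/K₃, H₃/K₃ and H₃/H₃.

module TwoColours where

  open Subsets
  open SmallRamsey
  open Extension
  open Enumeration
  open Classification
  open import Data.List using (lookup)
  open Gluing
  open DegreeSums
  open Goodman

  covers-not : ∀ {n} {e f : BGraph n} {Q k d A} → Covers e f Q → A ⊆ Q → Has (colour false e) k d A → Has f k d Q
  covers-not {e = e} c g = Has-mono (λ {x} {y} ne p q h → lem (c (g p) (g q) ne) h) g ≤-refl
    where
    lem : ∀ {a b} → a ≡ true ⊎ b ≡ true → not a ≡ true → b ≡ true
    lem {true} _ ()
    lem {false} (inj₂ h) _ = h

  J₄-K₃-free J₅-K₃-free : List Constraint
  J₄-K₃-free = (true , 2 , 1) ∷ (false , 1 , 0) ∷ []
  J₅-K₃-free = (true , 3 , 1) ∷ (false , 1 , 0) ∷ []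

  no-J₄-K₃-7 : matrices J₄-K₃-free 7 ≡ []
  no-J₄-K₃-7 = refl

  J₄-K₃-6 : ∀ {n} (e f : BGraph n) → Bound e f 4 1 3 0 6
  J₄-K₃-6 e f {Q} c h h' with count Q ≤? 6
  ... | yes le = le
  ... | no gt = let ys , p = pick 7 (≰⇒> gt) in
    case subst (matrix e ys ∈ˡ_) no-J₄-K₃-7 (matrices-sound e J₄-K₃-free (h ∷ (h' ∘ covers-not c (λ q → q)) ∷ []) 7 p) of λ ()

  -- a vertex together with its four blue neighbours
  blueStar : Matrix
  blueStar = (true ∷ true ∷ true ∷ false ∷ []) ∷ (true ∷ true ∷ false ∷ []) ∷ (true ∷ false ∷ []) ∷ (false ∷ []) ∷ [] ∷ []

  no-J₅-K₃-11 : grow J₅-K₃-free (true ∷ []) 6 blueStar ≡ []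
  no-J₅-K₃-11 = refl

  -- The recursion alone gives 11 = 1 + 6 + 4. At that order a vertex has exactly 6 red and 4 blue
  -- neighbours, and the latter are pairwise red; the search attaches the 6 red ones to this star in
  -- vain.
  J₅-K₃ : ∀ {n} (e f : BGraph n) → Symm e → Bound e f 5 1 3 0 10
  J₅-K₃ {n} e f se {Q} c h h' with count Q ≤? 10
  ... | yes le = le
  ... | no gt = ⊥-elim (contra (pick 6 six) (pick 4 four))
    where
    v = proj₁ (pick₁ {Q = Q} (≤-trans (s≤s z≤n) (≰⇒> gt)))
    v∈ : v ∈ Q
    v∈ = proj₂ (pick₁ {Q = Q} (≤-trans (s≤s z≤n) (≰⇒> gt)))
    R N B : VSet n
    R = nbhd e v Q
    N? : ∀ x → Dec (x ∈ Q × v ≢ x × e v x ≡ false)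
    N? x = (x ∈? Q) ×-dec ¬? (v ≟ x) ×-dec (e v x ≟ᵇ false)
    N = ⟨ N? ⟩
    B = nbhd f v Q
    free : All (Forbids e Q) J₅-K₃-free
    free = h ∷ (h' ∘ covers-not c (λ q → q)) ∷ []
    N⊆B : N ⊆ B
    N⊆B {x} p with ⟨⟩∈ N? p
    ... | q , ne , b with c v∈ q ne
    ...   | inj₂ t = ∈⟨⟩ (nbhd? f v Q) (q , ne , t)
    ...   | inj₁ t = case trans (sym t) b of λ ()
    R≤6 : count R ≤ 6
    R≤6 = red-degree e f (J₄-K₃-6 e f) c h h' v∈
    N≤4 : count N ≤ 4
    N≤4 = ≤-trans (count-mono N⊆B) (blue-degree e f (Bound-sym (Bound-2,0 f e)) c h h' v∈)
    total : 11 ≤ 1 + (count R + count N)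
    total = ≤-trans (≰⇒> gt) (≤-trans (count≤1+ {A = ⟨ d ⟩} v (λ p ne → ∈⟨⟩ d (p , ne ∘ sym))) (s≤s (count-∪ λ {x} r → split x (⟨⟩∈ d r))))
      where
      d : ∀ x → Dec (x ∈ Q × v ≢ x)
      d x = (x ∈? Q) ×-dec ¬? (v ≟ x)
      split : ∀ x → x ∈ Q × v ≢ x → x ∈ R ⊎ x ∈ N
      split x (p , ne) with e v x in eq
      ... | true = inj₁ (∈⟨⟩ (nbhd? e v Q) (p , ne , eq))
      ... | false = inj₂ (∈⟨⟩ N? (p , ne , eq))
    six : 6 ≤ count R
    six = +-cancelʳ-≤ 4 6 (count R) (≤-trans (≤-pred total) (+-monoʳ-≤ (count R) N≤4))
    four : 4 ≤ count N
    four = +-cancelˡ-≤ 6 4 (count N) (≤-trans (≤-pred total) (+-monoˡ-≤ (count N) R≤6))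
    red : ∀ {x y} → x ∈ N → y ∈ N → x ≢ y → e x y ≡ true
    red {x} {y} p q ne with e x y in eq
    ... | true = refl
    ... | false = ⊥-elim (h' (Has-nbhd v∈ (Has-2 (N⊆B p) (N⊆B q) ne (lem (c (proj₁ (⟨⟩∈ N? p)) (proj₁ (⟨⟩∈ N? q)) ne)))))
      where
      lem : e x y ≡ true ⊎ f x y ≡ true → f x y ≡ true
      lem (inj₁ t) = case trans (sym t) eq of λ ()
      lem (inj₂ t) = t
    contra : ∃ (Picks 6 R) → ∃ (Picks 4 N) → ⊥
    contra (ws , lw , uw , qw) (as@(a ∷ b ∷ a' ∷ b' ∷ []) , la , ua@((ab ∷ aa' ∷ ab' ∷ []) ∷ (ba' ∷ bb' ∷ []) ∷ (a'b' ∷ []) ∷ [] ∷ []) , qa@(pa ∷ pb ∷ pa' ∷ pb' ∷ [])) =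
      case subst (matrix e (ws ++ as ++ v ∷ []) ∈ˡ_) no-J₅-K₃-11 (subst (λ G → matrix e (ws ++ as ++ v ∷ []) ∈ˡ grow J₅-K₃-free (true ∷ []) 6 G) star
        (grow-sound e J₅-K₃-free (true ∷ []) free 6 {ws} {as ++ v ∷ []} lw
          (Unique.++⁺ uw (Unique.++⁺ ua ([] ∷ []) λ { (i , here refl) → proj₁ (proj₂ (⟨⟩∈ N? (All.lookup qa i))) refl }) disj)
          (All.++⁺ (All.map (nbhd-⊆ e v) qw) (All.++⁺ (All.map (proj₁ ∘ ⟨⟩∈ N?) qa) (v∈ ∷ [])))
          (λ i zs → ends zs (proj₂ (proj₂ (⟨⟩∈ (nbhd? e v Q) (All.lookup qw i))))))) of λ ()
      where
      eb : ∀ {x} → x ∈ N → e v x ≡ false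
      eb p = proj₂ (proj₂ (⟨⟩∈ N? p))
      disj : ∀ {x} → x ∈ˡ ws × x ∈ˡ (as ++ v ∷ []) → ⊥
      disj (i , j) with ⟨⟩∈ (nbhd? e v Q) (All.lookup qw i)
      ... | _ , ne , t = lem j
        where
        lem : _ ∈ˡ (as ++ v ∷ []) → ⊥
        lem (here refl) = case trans (sym t) (eb pa) of λ ()
        lem (there (here refl)) = case trans (sym t) (eb pb) of λ ()
        lem (there (there (here refl))) = case trans (sym t) (eb pa') of λ ()
        lem (there (there (there (here refl)))) = case trans (sym t) (eb pb') of λ ()
        lem (there (there (there (there (here refl))))) = ne refl
      ends : ∀ {x} zs → e v x ≡ true → Last (λ z → e x z ∈ˡ (true ∷ [])) (zs ++ as ++ v ∷ [])
      ends {x} [] t = a ∷ b ∷ a' ∷ b' ∷ last (here (trans (se x v) t))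
      ends (z ∷ []) t = z ∷ ends [] t
      ends (z ∷ zs@(_ ∷ _)) t = z ∷ ends zs t
      star : matrix e (as ++ v ∷ []) ≡ blueStar
      star = cong₂ _∷_ (cong₂ _∷_ (red pa pb ab) (cong₂ _∷_ (red pa pa' aa') (cong₂ _∷_ (red pa pb' ab') (cong (_∷ []) (ev pa)))))
        (cong₂ _∷_ (cong₂ _∷_ (red pb pa' ba') (cong₂ _∷_ (red pb pb' bb') (cong (_∷ []) (ev pb))))
        (cong₂ _∷_ (cong₂ _∷_ (red pa' pb' a'b') (cong (_∷ []) (ev pa')))
        (cong₂ _∷_ (cong (_∷ []) (ev pb')) refl)))
        where
        ev : ∀ {x} → x ∈ N → e x v ≡ false
        ev {x} p = trans (se x v) (eb p)

  Has-map : ∀ {m n} {e : BGraph m} {f : BGraph n} {k d A Q} (φ : Fin m → Fin n) → (∀ {i j} → φ i ≡ φ j → i ≡ j) →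
    (∀ {i} → i ∈ A → φ i ∈ Q) → (∀ i j → e i j ≡ true → f (φ i) (φ j) ≡ true) → Has e k d A → Has f k d Q
  Has-map {e = e} {f} {Q = Q} φ inj g h (ys , (l , u , q) , b) =
    map φ ys , (trans (length-map φ ys) l , Unique.map⁺ inj u , All.map⁺ (All.map g q)) , ≤-trans (misses ys) b
    where
    open import Data.List.Properties using (length-map)
    χle : ∀ {a b} → (a ≡ true → b ≡ true) → χ (not b) ≤ χ (not a)
    χle {false} {b} _ = χ≤1 (not b)
    χle {true} {true} _ = z≤n
    χle {true} {false} q = case q refl of λ ()
    rowle : ∀ x ys → row f (φ x) (map φ ys) ≤ row e x ys
    rowle x [] = z≤n
    rowle x (y ∷ ys) = +-mono-≤ (χle (h x y)) (rowle x ys)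
    misses : ∀ ys → miss f (map φ ys) ≤ miss e ys
    misses [] = z≤n
    misses (y ∷ ys) = +-mono-≤ (rowle y ys) (misses ys)

  lookup-unique : ∀ {n} {xs : List (Fin n)} → Unique xs → ∀ {i j} → lookup xs i ≡ lookup xs j → i ≡ j
  lookup-unique (u ∷ us) {zero} {zero} h = refl
  lookup-unique (u ∷ us) {zero} {suc j} h = ⊥-elim (All.lookup u (∈-lookup j) h)
  lookup-unique (u ∷ us) {suc i} {zero} h = ⊥-elim (All.lookup u (∈-lookup i) (sym h))
  lookup-unique (u ∷ us) {suc i} {suc j} h = cong suc (lookup-unique us h)

  -- Goodman's count runs over a whole vertex set, so 22 vertices picked from Q are relabelled as a
  -- graph of their own, with the diagonal cleared.
  H₃-H₃ : ∀ {n} (e f : BGraph n) → Symm e → Bound e f 5 1 5 1 21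
  H₃-H₃ e f se {Q} c h h' with count Q ≤? 21
  ... | yes le = le
  ... | no gt = ⊥-elim (contra (pick 22 (≰⇒> gt)))
    where
    contra : ∃ (Picks 22 Q) → ⊥
    contra (ys , l , u , q) = H₃-H₃-22 {r = r} rs rirr ((h ∘ Has-map φ (lookup-unique u) φ∈ (λ i j t → proj₂ (edge⇒ i j t))) ∷
      (h' ∘ blue) ∷ []) l
      where
      φ = lookup ys
      φ∈ : ∀ {i} → i ∈ ⊤ˢ → φ i ∈ Q
      φ∈ {i} _ = All.lookup q (∈-lookup i)
      r : BGraph (length ys)
      r i j = not (does (i ≟ j)) ∧ e (φ i) (φ j)
      rs : Symm r
      rs i j with i ≟ j | j ≟ i
      ... | yes _ | yes _ = refl
      ... | no _ | no _ = se (φ i) (φ j)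
      ... | yes refl | no ne = ⊥-elim (ne refl)
      ... | no ne | yes refl = ⊥-elim (ne refl)
      rirr : Irr r
      rirr i with i ≟ i
      ... | yes _ = refl
      ... | no ne = ⊥-elim (ne refl)
      edge⇒ : ∀ i j → r i j ≡ true → i ≢ j × e (φ i) (φ j) ≡ true
      edge⇒ i j t with i ≟ j
      ... | no ne = ne , t
      b : BGraph (length ys)
      b i j = not (does (i ≟ j)) ∧ not (e (φ i) (φ j))
      blue : Has (colour false r) 5 1 ⊤ˢ → Has f 5 1 Q
      blue t = Has-map {e = b} φ (lookup-unique u) φ∈ (λ i j w → lem i j w) (Has-mono (λ {i} {j} ne _ _ w → tob i j ne w) (λ p → p) ≤-refl t)
        where
        tob : ∀ i j → i ≢ j → not (r i j) ≡ true → b i j ≡ true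
        tob i j ne w with i ≟ j
        ... | yes eq = ⊥-elim (ne eq)
        ... | no _ = w
        lem : ∀ i j → b i j ≡ true → f (φ i) (φ j) ≡ true
        lem i j w with i ≟ j
        ... | no ne with e (φ i) (φ j) in eq
        ...   | false with c (φ∈ {i} (mem refl)) (φ∈ {j} (mem refl)) (ne ∘ lookup-unique u)
        ...     | inj₁ t = case trans (sym t) eq of λ ()
        ...     | inj₂ t = t

-- The extremal number and inequalities between sums of its values.

module ExtremalNumber where

  open Extension using (≤ᵇ-true)
  open Enumeration using (all-sound)

  -- F s r p is the largest order for s colours with target K₃, r colours with target H₃, and p colours
  -- with target P₃. Except at s = 0 or r = 0 two K₃-colours multiply it by 5 and two H₃-colours by 17.
  F′ : ℕ → ℕ → Bool → ℕ
  F′ (suc (suc (suc s))) r p = 5 * F′ (suc s) r p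
  F′ 0 (suc (suc (suc r))) p = 17 * F′ 0 (suc r) p
  F′ 1 (suc (suc (suc r))) p = 17 * F′ 1 (suc r) p
  F′ 2 (suc (suc (suc r))) p = 17 * F′ 2 (suc r) p
  F′ 0 0 false = 1
  F′ 1 0 false = 2
  F′ 2 0 false = 5
  F′ 0 1 false = 4
  F′ 1 1 false = 10
  F′ 2 1 false = 20
  F′ 0 2 false = 21
  F′ 1 2 false = 42
  F′ 2 2 false = 105
  F′ 0 0 true = 2
  F′ 1 0 true = 4
  F′ 2 0 true = 10
  F′ 0 1 true = 6
  F′ 1 1 true = 16
  F′ 2 1 true = 32
  F′ 0 2 true = 34
  F′ 1 2 true = 68
  F′ 2 2 true = 170

  positive : ℕ → Bool
  positive zero = false
  positive (suc _) = true

  F : ℕ → ℕ → ℕ → ℕ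
  F s r p = F′ s r (positive p)

  F-17 : ∀ s r p → F s (3 + r) p ≡ 17 * F s (1 + r) p
  F-17 0 r p = refl
  F-17 1 r p = refl
  F-17 2 r p = refl
  F-17 (suc (suc (suc s))) r p = trans (cong (5 *_) (F-17 (suc s) r p)) (trans (sym (*-assoc 5 17 (F (suc s) (1 + r) p))) (*-assoc 17 5 (F (suc s) (1 + r) p)))

  -- the graph forbidden in a colour: K₂, P₃, K₃, K₄ - e or H₃
  data Target : Set where
    k₂ p₃ k₃ d₄ h₃ : Target

  order-of defect-of : Target → ℕ
  order-of k₂ = 2
  order-of p₃ = 3
  order-of k₃ = 3
  order-of d₄ = 4
  order-of h₃ = 5
  defect-of k₂ = 0
  defect-of p₃ = 1
  defect-of k₃ = 0
  defect-of d₄ = 1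
  defect-of h₃ = 1

  -- K₄ - e counts as an H₃-colour, and `#d` records the vertex it gives up in return. K₂ counts
  -- nowhere, so that setting a colour to `k₂` removes it.
  #k #h #p #d : Target → ℕ
  #k k₃ = 1
  #k _ = 0
  #h d₄ = 1
  #h h₃ = 1
  #h _ = 0
  #p p₃ = 1
  #p _ = 0
  #d d₄ = 1
  #d _ = 0

  -- The parameters count the colours other than the two under discussion; `val α β` is the extremal
  -- number when those two receive the targets α and β.
  module Bounds (s r p : ℕ) where

    val : Target → Target → ℕ
    val α β = F (s + (#k α + #k β)) (r + (#h α + #h β)) (p + (#p α + #p β))

    V : List (Target × Target) → ℕ
    V L = sumˡ (map (λ { (α , β) → val α β }) L)

    V-++ : ∀ L M → V (L ++ M) ≡ V L + V M
    V-++ L M = trans (cong sumˡ (map-++ _ L M)) (sum-++ (map _ L) (map _ M))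

    V₁ : ∀ α β → V ((α , β) ∷ []) ≡ val α β
    V₁ α β = +-identityʳ (val α β)

  open Bounds using (V)

  V-5 : ∀ s r p L → V (3 + s) r p L ≡ 5 * V (1 + s) r p L
  V-5 s r p [] = refl
  V-5 s r p ((α , β) ∷ L) = trans (cong (Bounds.val (3 + s) r p α β +_) (V-5 s r p L)) (sym (*-distribˡ-+ 5 (Bounds.val (1 + s) r p α β) (V (1 + s) r p L)))

  V-17 : ∀ s r p L → V s (3 + r) p L ≡ 17 * V s (1 + r) p L
  V-17 s r p [] = refl
  V-17 s r p ((α , β) ∷ L) = trans (cong₂ _+_ (F-17 (s + (#k α + #k β)) (r + (#h α + #h β)) (p + (#p α + #p β))) (V-17 s r p L)) (sym (*-distribˡ-+ 17 (Bounds.val s (1 + r) p α β) (V s (1 + r) p L)))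

  V-pos : ∀ s r p L → V s r (suc p) L ≡ V s r 1 L
  V-pos s r p [] = refl
  V-pos s r p ((α , β) ∷ L) = cong (Bounds.val s r 1 α β +_) (V-pos s r p L)

  -- V is homogeneous under s ↦ s + 2 and r ↦ r + 2, so an inequality need only be checked at small s and r.
  check : (L M : List (Target × Target)) → Bool
  check L M = all (λ s → all (λ r → all (λ p → V s r p L ≤ᵇ V s r p M) (upTo 2)) (upTo 3)) (upTo 3)

  module _ (L M : List (Target × Target)) (h : check L M ≡ true) where

    private
      small : ∀ {s r p} → s < 3 → r < 3 → p < 2 → V s r p L ≤ V s r p M
      small {s} {r} {p} a b c = ≤ᵇ-true (all-sound (λ p → V s r p L ≤ᵇ V s r p M) {upTo 2} {p}
        (all-sound (λ r → all (λ p → V s r p L ≤ᵇ V s r p M) (upTo 2)) {upTo 3} {r}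
          (all-sound (λ s → all (λ r → all (λ p → V s r p L ≤ᵇ V s r p M) (upTo 2)) (upTo 3)) {upTo 3} {s} h (∈-upTo⁺ a)) (∈-upTo⁺ b)) (∈-upTo⁺ c))

      any-p : ∀ {s r} p → s < 3 → r < 3 → V s r p L ≤ V s r p M
      any-p zero a b = small a b (s≤s z≤n)
      any-p {s} {r} (suc p) a b = subst₂ _≤_ (sym (V-pos s r p L)) (sym (V-pos s r p M)) (small a b ≤-refl)

      any-r : ∀ {s} r p → s < 3 → V s r p L ≤ V s r p M
      any-r 0 p a = any-p p a (s≤s z≤n)
      any-r 1 p a = any-p p a (s≤s (s≤s z≤n))
      any-r 2 p a = any-p p a ≤-refl
      any-r {s} (suc (suc (suc r))) p a = subst₂ _≤_ (sym (V-17 s r p L)) (sym (V-17 s r p M)) (*-monoʳ-≤ 17 (any-r (suc r) p a))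

    V-≤ : ∀ s r p → V s r p L ≤ V s r p M
    V-≤ 0 r p = any-r r p (s≤s z≤n)
    V-≤ 1 r p = any-r r p (s≤s (s≤s z≤n))
    V-≤ 2 r p = any-r r p ≤-refl
    V-≤ (suc (suc (suc s))) r p = subst₂ _≤_ (sym (V-5 s r p L)) (sym (V-5 s r p M)) (*-monoʳ-≤ 5 (V-≤ (suc s) r p))

  module _ (α β : Target) (c : ℕ) (h : all (λ s → all (λ r → all (λ p → c + r ≤ᵇ Bounds.val s r p α β) (upTo 2)) (upTo 3)) (upTo 3) ≡ true) where

    open Bounds using (val)

    private
      small : ∀ {s r p} → s < 3 → r < 3 → p < 2 → c + r ≤ val s r p α β
      small {s} {r} {p} a b d = ≤ᵇ-true (all-sound (λ p → c + r ≤ᵇ val s r p α β) {upTo 2} {p}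
        (all-sound (λ r → all (λ p → c + r ≤ᵇ val s r p α β) (upTo 2)) {upTo 3} {r}
          (all-sound (λ s → all (λ r → all (λ p → c + r ≤ᵇ val s r p α β) (upTo 2)) (upTo 3)) {upTo 3} {s} h (∈-upTo⁺ a)) (∈-upTo⁺ b)) (∈-upTo⁺ d))

      any-p : ∀ {s r} p → s < 3 → r < 3 → c + r ≤ val s r p α β
      any-p zero a b = small a b (s≤s z≤n)
      any-p {s} {r} (suc p) a b = small {p = 1} a b ≤-refl

      any-r : ∀ {s} r p → s < 3 → c + r ≤ val s r p α β
      any-r 0 p a = any-p p a (s≤s z≤n)
      any-r 1 p a = any-p p a (s≤s (s≤s z≤n))
      any-r 2 p a = any-p p a ≤-refl
      any-r {s} (suc (suc (suc r))) p a = step (any-r (suc r) p a)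
        where
        open ≤-Reasoning
        step : c + (1 + r) ≤ val s (1 + r) p α β → c + (3 + r) ≤ val s (3 + r) p α β
        step ih = begin
          c + (3 + r)                       ≡⟨ trans (cong (c +_) (+-comm 2 (1 + r))) (sym (+-assoc c (1 + r) 2)) ⟩
          c + (1 + r) + 2                   ≤⟨ +-mono-≤ ih (≤-trans (s≤s (s≤s z≤n)) (*-monoʳ-≤ 16 (≤-trans (≤-trans (s≤s z≤n) (m≤n+m (1 + r) c)) ih))) ⟩
          val s (1 + r) p α β + 16 * val s (1 + r) p α β ≡⟨ F-17 (s + (#k α + #k β)) (r + (#h α + #h β)) (p + (#p α + #p β)) ⟨
          val s (3 + r) p α β               ∎

    -- Configurations of bounded size still carry slack, one unit for each K₄ - e among the other
    -- colours and hence at most r. The geometric growth of `F` in r absorbs it.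
    room : ∀ s r p → c + r ≤ val s r p α β
    room 0 r p = any-r r p (s≤s z≤n)
    room 1 r p = any-r r p (s≤s (s≤s z≤n))
    room 2 r p = any-r r p ≤-refl
    room (suc (suc (suc s))) r p = ≤-trans (room (suc s) r p) (m≤m+n _ (4 * val (suc s) r p α β))

  module _ where

    open Bounds using (val)

    -- the three ways in which one big part leaves room among at most 21 parts
    trichotomy : ∀ s r p → val s r p k₂ k₂ ≡ 1 ⊎ 35 + r ≤ val s r p h₃ h₃ ⊎ V s r p ((k₂ , k₂) ∷ (h₃ , k₃) ∷ (k₃ , h₃) ∷ []) ≤ val s r p h₃ h₃
    trichotomy 0 0 0 = inj₁ refl
    -- Here `val h₃ h₃` is 34, one short of 35, but 2 + 16 + 16 = 34 fits exactly.
    trichotomy 0 0 (suc p) = inj₂ (inj₂ (≤ᵇ-true refl))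
    trichotomy 1 0 0 = inj₂ (inj₁ (≤ᵇ-true refl))
    trichotomy 1 0 (suc p) = inj₂ (inj₁ (≤ᵇ-true refl))
    trichotomy 2 0 0 = inj₂ (inj₁ (≤ᵇ-true refl))
    trichotomy 2 0 (suc p) = inj₂ (inj₁ (≤ᵇ-true refl))
    trichotomy (suc (suc (suc s))) 0 p = inj₂ (inj₁ (≤-trans (≤ᵇ-true {35} {5 * 21} refl) (*-monoʳ-≤ 5 (room h₃ h₃ 21 refl (suc s) 0 p))))
    trichotomy s (suc r) p = inj₂ (inj₁ (begin
      35 + suc r                ≤⟨ +-mono-≤ (≤ᵇ-true {35} {17 * 3} refl) (m≤n*m (suc r) 17) ⟩
      17 * 3 + 17 * suc r       ≡⟨ *-distribˡ-+ 17 3 (suc r) ⟨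
      17 * (3 + suc r)          ≡⟨ cong (17 *_) (+-suc 3 r) ⟩
      17 * (4 + r)              ≤⟨ *-monoʳ-≤ 17 (room h₃ k₂ 4 refl s r p) ⟩
      17 * F (s + 0) (r + 1) (p + 0) ≡⟨ cong (λ t → 17 * F (s + 0) t (p + 0)) (+-comm r 1) ⟩
      17 * F (s + 0) (1 + r) (p + 0) ≡⟨ F-17 (s + 0) r (p + 0) ⟨
      F (s + 0) (3 + r) (p + 0)   ≡⟨ cong (λ t → F (s + 0) t (p + 0)) (+-comm 2 (suc r)) ⟩
      F (s + 0) (suc r + 2) (p + 0) ∎))
      where open ≤-Reasoning

-- Gallai's structure theorem.

module GallaiPartition where

  import Data.Fin as Fin
  open import Data.Fin.Properties using (toℕ-injective)
  open import Relation.Binary.Definitions using (tri<; tri≈; tri>)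
  import Data.List.Relation.Unary.AllPairs as Pairs
  open Subsets

  module Decomposition {n k} (c : Fin n → Fin n → Fin k) (c-sym : ∀ x y → c x y ≡ c y x)
    (gallai : ∀ x y z → x ≢ y → y ≢ z → x ≢ z → c x y ≢ c y z → c y z ≢ c x z → c x y ≢ c x z → ⊥) where

    Colours : Set₁
    Colours = Fin k → Set

    Closed : Colours → VSet n → VSet n → Set
    Closed U P S = ∀ {x y} → x ∈ S → y ∈ P → U (c x y) → y ∈ S

    -- A nontrivial union of components of the graph formed by the colours in U: a witness that this
    -- graph is disconnected on P.
    record Cut (U : Colours) (P : VSet n) : Set where
      field
        side   : VSet n
        side⊆  : side ⊆ P
        closed : Closed U P side
        inner  : ∃ (_∈ side)
        outer  : ∃ λ y → y ∈ P × ¬ y ∈ side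
    open Cut

    Connected : Colours → VSet n → Set
    Connected U P = ¬ Cut U P

    cross : ∀ {U P S} → Closed U P S → S ⊆ P → ∀ {x y} → x ∈ S → y ∈ P → ¬ y ∈ S → ¬ U (c x y)
    cross cl g p q ¬q u = ¬q (cl p q u)

    closed-complement : ∀ U {P S} (d : ∀ x → Dec (x ∈ P × ¬ x ∈ S)) → Closed U P S → Closed U P ⟨ d ⟩
    closed-complement U {P} {S} d cl {x} {y} p q u = ∈⟨⟩ d (q , λ s → proj₂ (⟨⟩∈ d p) (cl s (proj₁ (⟨⟩∈ d p)) (subst U (c-sym x y) u)))

    -- the U-component of y, as the least closed set containing y
    Reach : Colours → VSet n → Fin n → Fin n → Set
    Reach U P y w = w ∈ P × (∀ S → S ⊆ P → Closed U P S → y ∈ S → w ∈ S)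

    reach-closed : ∀ U {P y w w′} → Reach U P y w → w′ ∈ P → U (c w w′) → Reach U P y w′
    reach-closed U (p , h) q u = q , λ S g cl m → cl (h S g cl m) q u

    reach-refl : ∀ U {P y} → y ∈ P → Reach U P y y
    reach-refl U p = p , λ S g cl m → m

    reach-trans : ∀ U {P x y z} → Reach U P x y → Reach U P y z → Reach U P x z
    reach-trans U (_ , h) (q , h′) = q , λ S g cl m → h′ S g cl (h S g cl m)

    reach-sym : ∀ U {P x y} → x ∈ P → Reach U P x y → Reach U P y x
    reach-sym U {P} {x} {y} p (q , h) = p , λ S g cl m → decidable-stable (x ∈? S) λ ¬x →
      let d : ∀ z → Dec (z ∈ P × ¬ z ∈ S)
          d = λ z → (z ∈? P) ×-dec ¬? (z ∈? S) in proj₂ (⟨⟩∈ d (h ⟨ d ⟩ (proj₁ ∘ ⟨⟩∈ d) (closed-complement U d cl) (∈⟨⟩ d (p , ¬x)))) m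

    triangle : ∀ {x y z} → c x y ≢ c y z → c y z ≢ c x z → x ≢ y → y ≢ z → x ≢ z → c x y ≡ c x z
    triangle {x} {y} {z} a b xy yz xz = decidable-stable (c x y ≟ c x z) λ ne → gallai x y z xy yz xz a b ne

    -- a vertex outside a component sees it in a single colour
    reach-const : ∀ U {P y w z} → z ∈ P → y ∈ P → ¬ Reach U P y z → Reach U P y w → c y z ≡ c w z
    reach-const U {P} {y} {w} {z} zp yp nz r = decidable-stable (c y z ≟ c w z) λ ne → em-all (Reach U P y) λ R →
      let d : ∀ v → Dec (Reach U P y v × c y z ≡ c v z)
          d = λ v → R v ×-dec (c y z ≟ c v z)
          cl : Closed U P ⟨ d ⟩
          cl {v} {v′} p q u = let rv , e = ⟨⟩∈ d p ; rv′ = reach-closed U rv q u in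
            ∈⟨⟩ d (rv′ , trans e (decidable-stable (c v z ≟ c v′ z) λ ne′ →
              gallai v v′ z (λ { refl → ne′ refl }) (λ { refl → nz rv′ }) (λ { refl → nz rv })
                (λ h → nz (reach-closed U rv′ zp (subst U h u))) (λ h → ne′ (sym h)) (λ h → nz (reach-closed U rv zp (subst U h u)))))
      in ne (proj₂ (⟨⟩∈ d (proj₂ r ⟨ d ⟩ (proj₁ ∘ proj₁ ∘ ⟨⟩∈ d) cl (∈⟨⟩ d (reach-refl U yp , refl)))))

    without? : ∀ (P : VSet n) x y → Dec (y ∈ P × x ≢ y)
    without? P x y = (y ∈? P) ×-dec ¬? (x ≟ y)

    _without_ : VSet n → Fin n → VSet n
    P without x = ⟨ without? P x ⟩

    -- Deleting x from a set connected in the three colours r, b, g cannot disconnect r: the r-component of a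
    -- b-neighbour of x would be left in the colours r and b only.
    delete : ∀ {r b g P x} → r ≢ b → b ≢ g → r ≢ g → x ∈ P → Connected (_≡ r) P → Connected (_≡ b) P → Connected (_≡ g) P →
      Cut (_≡ r) (P without x) → ⊥
    delete {r} {b} {g} {P} {x} r≢b b≢g r≢g xp conr conb cong′ cut =
      let z , zp , _ = outer cut ; zp′ , x≢z = ⟨⟩∈ d zp in
      conb record { side = ⟨ x ≟_ ⟩ ; side⊆ = λ h → subst (_∈ P) (⟨⟩∈ (x ≟_) h) xp
                  ; closed = λ {u} {y} h yp e → decidable-stable (y ∈? ⟨ x ≟_ ⟩) λ ny →
                      found y yp (λ xy → ny (∈⟨⟩ (x ≟_) xy)) (trans (cong (λ t → c t y) (⟨⟩∈ (x ≟_) h)) e)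
                  ; inner = x , ∈⟨⟩ (x ≟_) refl ; outer = z , zp′ , λ h → x≢z (⟨⟩∈ (x ≟_) h) }
      where
      P′ : VSet n
      P′ = P without x
      d : ∀ y → Dec (y ∈ P × x ≢ y)
      d = without? P x
      found : ∀ y → y ∈ P → x ≢ y → c x y ≡ b → ⊥
      found y yp x≢y xy = em-all (Reach (_≡ r) P′ y) λ R → go R
        where
        yp′ : y ∈ P′
        yp′ = ∈⟨⟩ d (yp , x≢y)
        go : (∀ w → Dec (Reach (_≡ r) P′ y w)) → ⊥
        go R = cong′ record { side = ⟨ R ⟩ ; side⊆ = proj₁ ∘ ⟨⟩∈ d ∘ in-P′ ; closed = λ {w} {e} → green w e
                            ; inner = y , ∈⟨⟩ R (reach-refl (_≡ r) yp′) ; outer = x , xp , λ h → proj₂ (⟨⟩∈ d (in-P′ h)) refl }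
          where
          in-P′ : ∀ {w} → w ∈ ⟨ R ⟩ → w ∈ P′
          in-P′ = proj₁ ∘ ⟨⟩∈ R
          out? : ∀ w → Dec (w ∈ P′ × ¬ Reach (_≡ r) P′ y w)
          out? w = (w ∈? P′) ×-dec ¬? (R w)
          nonred : ∀ {w z} → Reach (_≡ r) P′ y w → z ∈ P′ → ¬ Reach (_≡ r) P′ y z → c w z ≢ r
          nonred rw zp nz e = nz (reach-closed (_≡ r) rw zp e)
          -- Consider the vertices outside the component that see y in a colour other than b. An
          -- r-edge from this set to x, or to a vertex that sees y in b, would form a rainbow
          -- triangle with y; so the set would be closed under r, against the connectivity of P.
          blue : ∀ {z} → z ∈ P′ → ¬ Reach (_≡ r) P′ y z → c y z ≡ b
          blue {z} zp nz = decidable-stable (c y z ≟ b) λ ne →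
            let D? : ∀ w → Dec ((w ∈ P′ × ¬ Reach (_≡ r) P′ y w) × c y w ≢ b)
                D? = λ w → out? w ×-dec ¬? (c y w ≟ b) in
            conr record { side = ⟨ D? ⟩ ; side⊆ = proj₁ ∘ ⟨⟩∈ d ∘ proj₁ ∘ proj₁ ∘ ⟨⟩∈ D?
                        ; closed = λ {v} {e} p ep h → decidable-stable (e ∈? ⟨ D? ⟩) λ ne′ →
                            let (vp , nv) , nb = ⟨⟩∈ D? p ; v≢y = λ { refl → nv (reach-refl (_≡ r) yp′) } in
                            case x ≟ e of λ
                            { (yes refl) → gallai v x y (λ w → proj₂ (⟨⟩∈ d vp) (sym w)) x≢y v≢y (λ t → r≢b (trans (sym h) (trans t xy)))
                                  (λ t → nb (trans (c-sym y v) (trans (sym t) xy))) (λ t → nonred (reach-refl (_≡ r) yp′) vp nv (trans (c-sym y v) (trans (sym t) h)))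
                            ; (no x≢e) → let ep′ = ∈⟨⟩ d (ep , x≢e) in case R e of λ
                              { (yes re) → nonred re vp nv (trans (c-sym e v) h)
                              ; (no nre) → case c y e ≟ b of λ
                                { (no neb) → ne′ (∈⟨⟩ D? ((ep′ , nre) , neb))
                                ; (yes eb) → gallai v e y (λ { refl → nb eb }) (λ { refl → nre (reach-refl (_≡ r) yp′) }) v≢y
                                    (λ t → r≢b (trans (sym h) (trans t (trans (c-sym e y) eb))))
                                    (λ t → nb (trans (c-sym y v) (trans (sym t) (trans (c-sym e y) eb))))
                                    (λ t → nonred (reach-refl (_≡ r) yp′) vp nv (trans (c-sym y v) (trans (sym t) h))) } } }
                        ; inner = z , ∈⟨⟩ D? ((zp , nz) , ne) ; outer = y , yp , λ h → proj₂ (proj₁ (⟨⟩∈ D? h)) (reach-refl (_≡ r) yp′) }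
          blue′ : ∀ {w z} → Reach (_≡ r) P′ y w → z ∈ P′ → ¬ Reach (_≡ r) P′ y z → c w z ≡ b
          blue′ rw zp nz = trans (sym (reach-const (_≡ r) zp yp′ nz rw)) (blue zp nz)
          side′ : ∀ w → Dec (w ∈ P′ × ¬ w ∈ side cut)
          side′ w = (w ∈? P′) ×-dec ¬? (w ∈? side cut)
          outside : ∃ λ z → z ∈ P′ × ¬ Reach (_≡ r) P′ y z
          outside with y ∈? side cut
          ... | yes ys = let z , zp , nz = outer cut in z , zp , λ rz → nz (proj₂ rz (side cut) (side⊆ cut) (closed cut) ys)
          ... | no ny = let z , zs = inner cut in
                  z , side⊆ cut zs , λ rz → proj₂ (⟨⟩∈ side′ (proj₂ rz ⟨ side′ ⟩ (proj₁ ∘ ⟨⟩∈ side′) (closed-complement (_≡ r) side′ (closed cut)) (∈⟨⟩ side′ (yp′ , ny)))) zs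
          red-to-x : (∀ z → z ∈ P′ → ¬ Reach (_≡ r) P′ y z → c z x ≡ r → ⊥) → ⊥
          red-to-x k = conr record { side = ⟨ out? ⟩ ; side⊆ = proj₁ ∘ ⟨⟩∈ d ∘ proj₁ ∘ ⟨⟩∈ out?
                                   ; closed = λ {v} {e} p ep h → decidable-stable (e ∈? ⟨ out? ⟩) λ ne →
                                       let vp , nv = ⟨⟩∈ out? p in case x ≟ e of λ
                                       { (yes refl) → k v vp nv h
                                       ; (no x≢e) → case R e of λ
                                         { (yes re) → nonred re vp nv (trans (c-sym e v) h)
                                         ; (no nre) → ne (∈⟨⟩ out? (∈⟨⟩ d (ep , x≢e) , nre)) } }
                                   ; inner = proj₁ outside , ∈⟨⟩ out? (proj₂ outside) ; outer = y , yp , λ h → proj₂ (⟨⟩∈ out? h) (reach-refl (_≡ r) yp′) }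
          -- Edges from the component to the rest of P′ have colour b. For a g-edge w x, some z
          -- outside the component has an r-edge to x, and w, x, z is rainbow.
          green : ∀ w e → w ∈ ⟨ R ⟩ → e ∈ P → c w e ≡ g → e ∈ ⟨ R ⟩
          green w e wR ep h = decidable-stable (e ∈? ⟨ R ⟩) λ ne → case x ≟ e of λ
            { (no x≢e) → b≢g (trans (sym (blue′ (⟨⟩∈ R wR) (∈⟨⟩ d (ep , x≢e)) (λ re → ne (∈⟨⟩ R re)))) h)
            ; (yes refl) → red-to-x λ z zp nz zx → let wz = blue′ (⟨⟩∈ R wR) zp nz in
                gallai w x z (λ { refl → proj₂ (⟨⟩∈ d (in-P′ wR)) refl }) (proj₂ (⟨⟩∈ d zp)) (λ { refl → nz (⟨⟩∈ R wR) })
                  (λ t → r≢g (sym (trans (sym h) (trans t (trans (c-sym x z) zx))))) (λ t → r≢b (trans (sym zx) (trans (c-sym z x) (trans t wz))))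
                  (λ t → b≢g (sym (trans (sym h) (trans t wz)))) }

    -- By `delete` a vertex can be removed without losing connectivity in any of the three colours.
    -- At two vertices the only edge would have to carry all of them.
    three-connected : ∀ m {r b g P} → count P ≤ m → 2 ≤ count P → r ≢ b → b ≢ g → r ≢ g → Connected (_≡ r) P → Connected (_≡ b) P → Connected (_≡ g) P → ⊥
    three-connected zero le two _ _ _ _ _ _ = case ≤-trans two le of λ ()
    three-connected (suc m) {r} {b} {g} {P} le two rb bg rg cr cb cg =
      let x , xp = pick₁ {Q = P} (≤-trans (s≤s z≤n) two)
          P′ = P without x
          d : ∀ y → Dec (y ∈ P × x ≢ y)
          d = without? P x
          small : count P′ < count P
          small = count-⊂ {A = P′} {P} (proj₁ ∘ ⟨⟩∈ d) xp (λ h → proj₂ (⟨⟩∈ d h) refl)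
      in case 2 ≤? count P′ of λ
        { (yes two′) → em {A = Cut (_≡ r) P′} λ
            { (yes k) → delete rb bg rg xp cr cb cg k
            ; (no nr) → em {A = Cut (_≡ b) P′} λ
              { (yes k) → delete (rb ∘ sym) rg bg xp cb cr cg k
              ; (no nb) → em {A = Cut (_≡ g) P′} λ
                { (yes k) → delete (rg ∘ sym) rb (bg ∘ sym) xp cg cr cb k
                ; (no ng) → three-connected m (≤-pred (≤-trans small le)) two′ rb bg rg nr nb ng } } }
        ; (no one) → pair x xp (≤-pred (≰⇒> one)) }
      where
      pair : ∀ x → x ∈ P → count (P without x) ≤ 1 → ⊥
      pair x xp one = both cr λ e → both cb λ e′ → rb (trans (sym e) e′)
        where
        d : ∀ y → Dec (y ∈ P × x ≢ y)
        d = without? P x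
        z∈ = pick₁ {Q = P without x} (≤-pred (≤-trans two (count≤1+ x λ p ne → ∈⟨⟩ d (p , ne ∘ sym))))
        z = proj₁ z∈
        only : ∀ {y} → y ∈ P → x ≢ y → y ≡ z
        only {y} p ne = decidable-stable (y ≟ z) λ ne′ → 1+n≰n (≤-trans (unpick {ys = y ∷ z ∷ []} 2 (refl , (ne′ All.∷ All.[]) Pairs.∷ All.[] Pairs.∷ Pairs.[] , ∈⟨⟩ d (p , ne) All.∷ proj₂ z∈ All.∷ All.[])) one)
        both : ∀ {q} → Connected (_≡ q) P → (c x z ≡ q → ⊥) → ⊥
        both {q} con k = con record { side = ⟨ x ≟_ ⟩ ; side⊆ = λ h → subst (_∈ P) (⟨⟩∈ (x ≟_) h) xp
          ; closed = λ {u} {y} h yp e → decidable-stable (y ∈? ⟨ x ≟_ ⟩) λ ny →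
              k (subst₂ (λ s t → c s t ≡ q) (sym (⟨⟩∈ (x ≟_) h)) (only yp (λ xy → ny (∈⟨⟩ (x ≟_) xy))) e)
          ; inner = x , ∈⟨⟩ (x ≟_) refl ; outer = z , proj₁ (⟨⟩∈ d (proj₂ z∈)) , λ h → proj₂ (⟨⟩∈ d (proj₂ z∈)) (⟨⟩∈ (x ≟_) h) }

    record Join (a : Fin k) (P : VSet n) : Set where
      field
        side   : VSet n
        side⊆  : side ⊆ P
        inner  : ∃ (_∈ side)
        outer  : ∃ λ y → y ∈ P × ¬ y ∈ side
        joined : ∀ {x y} → x ∈ side → y ∈ P → ¬ y ∈ side → c x y ≡ a

    record Partition (P : VSet n) : Set where
      field
        a b         : Fin k
        a≢b         : a ≢ b
        part        : Fin n → VSet n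
        part⊆       : ∀ {x} → part x ⊆ P
        apart       : ∃ λ u → ∃ λ v → u ∈ P × v ∈ P × ¬ v ∈ part u
        part-refl   : ∀ {x} → x ∈ P → x ∈ part x
        part-sym    : ∀ {x y} → x ∈ P → y ∈ part x → x ∈ part y
        part-trans  : ∀ {x y z} → y ∈ part x → z ∈ part y → z ∈ part x
        across      : ∀ {x y} → x ∈ P → y ∈ P → ¬ y ∈ part x → c x y ≡ a ⊎ c x y ≡ b
        uniform     : ∀ {x w z} → x ∈ P → w ∈ part x → z ∈ P → ¬ z ∈ part x → c x z ≡ c w z
        reps        : VSet n
        reps⊆       : reps ⊆ P
        rep         : ∀ {x} → x ∈ P → ∃ λ r → r ∈ reps × x ∈ part r
        rep-unique  : ∀ {r r′} → r ∈ reps → r′ ∈ reps → r′ ∈ part r → r ≡ r′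

    add : Fin k → Colours → Colours
    add g U i = U i ⊎ i ≡ g

    -- Colours are added one at a time as long as the graph stays disconnected. In the resulting
    -- maximal set every colour left out reconnects P.
    saturate : ∀ {P} gs U → Cut U P → (∀ U′ → (∀ {i} → U i → U′ i) → Cut U′ P → (∀ {g} → g ∈ˡ gs → U′ g ⊎ Connected (add g U′) P) → ⊥) → ⊥
    saturate [] U cut k = k U id cut λ ()
    saturate {P} (g ∷ gs) U cut k = em {A = Cut (add g U) P} λ
      { (yes cut′) → saturate gs (add g U) cut′ λ U′ sub cut″ h → k U′ (sub ∘ inj₁) cut″ λ { (here refl) → inj₁ (sub (inj₂ refl)) ; (there i) → h i }
      ; (no con) → saturate gs U cut λ U′ sub cut″ h → k U′ sub cut″ λ
          { (here refl) → inj₂ λ ct → con record { side = side ct ; side⊆ = side⊆ ct ; inner = inner ct ; outer = outer ct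
                                                 ; closed = λ { p q (inj₁ u) → closed ct p q (inj₁ (sub u)) ; p q (inj₂ e) → closed ct p q (inj₂ e) } }
          ; (there i) → h i } }

    module Components {P : VSet n} (U : Colours) (D : ∀ x y → Dec (Reach U P x y)) where

      IsRep : Fin n → Set
      IsRep x = x ∈ P × ¬ (∃ λ y → y Fin.< x × Reach U P x y)

      isRep? : ∀ x → Dec (IsRep x)
      isRep? x = (x ∈? P) ×-dec ¬? (any? λ y → (y Fin.<? x) ×-dec D x y)

      reps : VSet n
      reps = ⟨ isRep? ⟩

      rep : ∀ {x} → x ∈ P → ∃ λ r → r ∈ reps × Reach U P r x
      rep {x} p = go (suc (toℕ x)) x p ≤-refl
        where
        go : ∀ m x → x ∈ P → toℕ x < m → ∃ λ r → r ∈ reps × Reach U P r x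
        go (suc m) x p le with any? (λ y → (y Fin.<? x) ×-dec D x y)
        ... | no none = x , ∈⟨⟩ isRep? (p , none) , reach-refl U p
        ... | yes (y , lt , r) = let z , i , r′ = go m y (proj₁ r) (≤-trans lt (≤-pred le)) in z , i , reach-trans U r′ (reach-sym U p r)

      rep-unique : ∀ {r r′} → r ∈ reps → r′ ∈ reps → Reach U P r r′ → r ≡ r′
      rep-unique {r} {r′} p q h with <-cmp (toℕ r) (toℕ r′)
      ... | tri≈ _ e _ = toℕ-injective e
      ... | tri< lt _ _ = ⊥-elim (proj₂ (⟨⟩∈ isRep? q) (r , lt , reach-sym U (proj₁ (⟨⟩∈ isRep? p)) h))
      ... | tri> _ _ gt = ⊥-elim (proj₂ (⟨⟩∈ isRep? p) (r′ , gt , h))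

      two-reps : Cut U P → 2 ≤ count reps
      two-reps cut = let x , xs = inner cut ; y , yp , ny = outer cut ; r , i , rx = rep (side⊆ cut xs) ; r′ , i′ , ry = rep yp in
        unpick {ys = r ∷ r′ ∷ []} 2 (refl ,
          ((λ e → ny (proj₂ (reach-trans U (reach-sym U (proj₁ (⟨⟩∈ isRep? i)) rx) (subst (λ t → Reach U P t y) (sym e) ry)) (side cut) (side⊆ cut) (closed cut) xs)) All.∷ All.[]) Pairs.∷ All.[] Pairs.∷ Pairs.[] ,
          i All.∷ i′ All.∷ All.[])

      -- Between two U-components all edges have one colour, so a g-cut of the representatives
      -- extends to a cut for U together with g by taking whole components.
      lift : ∀ {g} → ¬ U g → Connected (add g U) P → Connected (_≡ g) reps
      lift {g} ¬g con cut = con record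
        { side = ⟨ S? ⟩ ; side⊆ = λ h → proj₁ (proj₂ (proj₂ (⟨⟩∈ S? h)))
        ; closed = λ {x} {y} h yp u → let q , qs , rx = ⟨⟩∈ S? h in case u of λ
            { (inj₁ u) → ∈⟨⟩ S? (q , qs , reach-closed U rx yp u)
            ; (inj₂ e) → decidable-stable (y ∈? ⟨ S? ⟩) λ ny →
                let r , i , ry = rep yp
                    qp = side⊆ cut qs
                    qP = proj₁ (⟨⟩∈ isRep? qp)
                    rP = proj₁ (⟨⟩∈ isRep? i)
                    q≁r = λ qr → ny (∈⟨⟩ S? (q , qs , reach-trans U qr ry))
                    q≁y = λ qy → ny (∈⟨⟩ S? (q , qs , qy))
                    e₁ : c q y ≡ c x y
                    e₁ = reach-const U yp qP q≁y rx
                    e₂ : c r q ≡ c y q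
                    e₂ = reach-const U qP rP (λ rq → q≁r (reach-sym U rP rq)) ry
                    e₃ : c q r ≡ g
                    e₃ = trans (c-sym q r) (trans e₂ (trans (c-sym y q) (trans e₁ e)))
                in ny (∈⟨⟩ S? (r , closed cut qs i e₃ , ry)) }
        ; inner = let q , qs = inner cut in q , ∈⟨⟩ S? (q , qs , reach-refl U (proj₁ (⟨⟩∈ isRep? (side⊆ cut qs))))
        ; outer = let z , zr , nz = outer cut in z , proj₁ (⟨⟩∈ isRep? zr) , λ h → let q , qs , rz = ⟨⟩∈ S? h in
            nz (subst (_∈ side cut) (rep-unique (side⊆ cut qs) zr rz) qs) }
        where
        S? : ∀ y → Dec (∃ λ q → q ∈ side cut × Reach U P q y)
        S? y = any? λ q → (q ∈? side cut) ×-dec D q y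

    -- For a maximal U, let a be the colour of an edge across a cut. If no other colour lies outside
    -- U, the cut is a join in a. Otherwise the U-components are the parts, and `three-connected` on
    -- the representatives excludes a third colour between them.
    decompose : ∀ P → 2 ≤ count P → (∀ {a} → Join a P → ⊥) → (Partition P → ⊥) → ⊥
    decompose P two noJoin noPartition with pick 2 two
    ... | u ∷ v ∷ [] , _ , (u≢v All.∷ _) Pairs.∷ _ , up All.∷ vp All.∷ _ =
      saturate (allFin k) (λ _ → ⊥) record { side = ⟨ u ≟_ ⟩ ; side⊆ = λ h → subst (_∈ P) (⟨⟩∈ (u ≟_) h) up ; closed = λ _ _ ()
                                          ; inner = u , ∈⟨⟩ (u ≟_) refl ; outer = v , vp , λ h → u≢v (⟨⟩∈ (u ≟_) h) }
        λ U _ cut sat → em-all U λ U? → ¬¬-all (λ x → em-all (Reach U P x)) λ D → go U cut (λ g → sat (∈-allFin g)) U? D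
      where
      go : ∀ U → Cut U P → (∀ g → U g ⊎ Connected (add g U) P) → (∀ i → Dec (U i)) → (∀ x y → Dec (Reach U P x y)) → ⊥
      go U cut sat U? D with any? (λ g → ¬? (U? g) ×-dec ¬? (g ≟ a))
        where
        a : Fin k
        a = c (proj₁ (inner cut)) (proj₁ (outer cut))
      ... | no none = noJoin {c (proj₁ (inner cut)) (proj₁ (outer cut))} record { side = side cut ; side⊆ = side⊆ cut ; inner = inner cut ; outer = outer cut
            ; joined = λ {x} {y} p q nq → decidable-stable (c x y ≟ _) λ ne → none (c x y , cross {U = U} (closed cut) (side⊆ cut) p q nq , ne) }
      ... | yes (b , ¬b , b≢a) = noPartition record
            { a = a ; b = b ; a≢b = b≢a ∘ sym ; part = λ x → ⟨ D x ⟩ ; part⊆ = λ {x} h → proj₁ (⟨⟩∈ (D x) h)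
            ; apart = let u , us = inner cut ; v , vp , nv = outer cut in u , v , side⊆ cut us , vp , λ h → nv (proj₂ (⟨⟩∈ (D u) h) (side cut) (side⊆ cut) (closed cut) us)
            ; part-refl = λ {x} p → ∈⟨⟩ (D x) (reach-refl U p)
            ; part-sym = λ {x} {y} p h → ∈⟨⟩ (D y) (reach-sym U p (⟨⟩∈ (D x) h)) ; part-trans = λ {x} {y} h h′ → ∈⟨⟩ (D x) (reach-trans U (⟨⟩∈ (D x) h) (⟨⟩∈ (D y) h′))
            ; across = λ {x} {y} p q nq → two-colours (c x y) λ u → nq (∈⟨⟩ (D x) (reach-closed U (reach-refl U p) q u))
            ; uniform = λ {x} p h zp nz → reach-const U zp p (λ r → nz (∈⟨⟩ (D x) r)) (⟨⟩∈ (D x) h)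
            ; reps = reps ; reps⊆ = proj₁ ∘ ⟨⟩∈ isRep? ; rep = λ p → let r , i , h = rep p in r , i , ∈⟨⟩ (D r) h
            ; rep-unique = λ {r} i j h → rep-unique i j (⟨⟩∈ (D r) h) }
        where
        open Components {P} U D
        a : Fin k
        a = c (proj₁ (inner cut)) (proj₁ (outer cut))
        ¬a : ¬ U a
        ¬a = cross {U = U} (closed cut) (side⊆ cut) (proj₂ (inner cut)) (proj₁ (proj₂ (outer cut))) (proj₂ (proj₂ (outer cut)))
        con : ∀ {g} → ¬ U g → Connected (_≡ g) reps
        con {g} ng with sat g
        ... | inj₁ u = ⊥-elim (ng u)
        ... | inj₂ h = lift ng h
        two-colours : ∀ g → ¬ U g → g ≡ a ⊎ g ≡ b
        two-colours g ng with g ≟ a | g ≟ b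
        ... | yes e | _ = inj₁ e
        ... | no _ | yes e = inj₂ e
        ... | no g≢a | no g≢b = ⊥-elim (three-connected (count reps) ≤-refl (two-reps cut) (b≢a ∘ sym) (g≢b ∘ sym) (g≢a ∘ sym) (con ¬a) (con ¬b) (con ng))

-- The induction step for a monochromatic join.

module Joins where

  open Subsets
  open SmallRamsey
  open ExtremalNumber
  open GallaiPartition

  upd : ∀ {k} → (Fin k → Target) → Fin k → Target → Fin k → Target
  upd X a α i = if does (i ≟ a) then α else X i

  upd-miss : ∀ {k} (X : Fin k → Target) {a i} α → i ≢ a → upd X a α i ≡ X i
  upd-miss X {a} {i} α ne with i ≟ a
  ... | yes e = ⊥-elim (ne e)
  ... | no _ = refl

  total : ∀ {k} → (Target → ℕ) → (Fin k → Target) → ℕ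
  total g X = sum (g ∘ X)

  total-upd : ∀ {k} g (X : Fin k → Target) a α → total g (upd X a α) + g (X a) ≡ total g X + g α
  total-upd {suc k} g X zero α = trans (cong (_+ g (X zero)) (cong (g α +_) (sum-cong-≗ {k} λ i → refl)))
    (trans (+-comm (g α + total g (X ∘ suc)) (g (X zero))) (trans (cong (g (X zero) +_) (+-comm (g α) _)) (sym (+-assoc (g (X zero)) _ (g α)))))
  total-upd {suc k} g X (suc a) α = trans (+-assoc (g (X zero)) _ _) (trans (cong (g (X zero) +_) (trans (cong (_+ g (X (suc a))) (sum-cong-≗ {k} λ i → cong g (lem i))) (total-upd g (X ∘ suc) a α))) (sym (+-assoc (g (X zero)) _ _)))
    where
    lem : ∀ i → upd X (suc a) α (suc i) ≡ upd (X ∘ suc) a α i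
    lem i with i ≟ a
    ... | yes _ = refl
    ... | no _ = refl

  -- The vanishing summand `g k₂` is kept to match the two-target shape of `val α k₂`.
  total-upd₁ : ∀ {k} g (X : Fin k → Target) a α → g k₂ ≡ 0 → total g (upd X a α) ≡ total g (upd X a k₂) + (g α + g k₂)
  total-upd₁ g X a α z = +-cancelʳ-≡ (g (X a)) _ _ (begin
    total g (upd X a α) + g (X a)                        ≡⟨ total-upd g X a α ⟩
    total g X + g α                                      ≡⟨ cong (_+ g α) (trans (sym (+-identityʳ _)) (trans (cong (total g X +_) (sym z)) (sym (total-upd g X a k₂)))) ⟩
    (total g (upd X a k₂) + g (X a)) + g α               ≡⟨ +-assoc (total g (upd X a k₂)) _ _ ⟩
    total g (upd X a k₂) + (g (X a) + g α)               ≡⟨ cong (total g (upd X a k₂) +_) (trans (+-comm (g (X a)) (g α)) (cong (_+ g (X a)) (trans (sym (+-identityʳ (g α))) (cong (g α +_) (sym z))))) ⟩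
    total g (upd X a k₂) + ((g α + g k₂) + g (X a))      ≡⟨ +-assoc (total g (upd X a k₂)) _ _ ⟨
    (total g (upd X a k₂) + (g α + g k₂)) + g (X a)      ∎)
    where open ≡-Reasoning

  total-upd₂ : ∀ {k} g (X : Fin k → Target) {a b} α β → a ≢ b → g k₂ ≡ 0 →
    total g (upd (upd X a α) b β) ≡ total g (upd (upd X a k₂) b k₂) + (g α + g β)
  total-upd₂ g X {a} {b} α β a≢b z = +-cancelʳ-≡ (g (X b)) _ _ (begin
    total g (upd (upd X a α) b β) + g (X b)  ≡⟨ step α β ⟩
    total g (upd X a α) + g β                ≡⟨ cong (_+ g β) (trans (total-upd₁ g X a α z) (cong (total g (upd X a k₂) +_) (trans (cong (g α +_) z) (+-identityʳ (g α))))) ⟩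
    (total g (upd X a k₂) + g α) + g β       ≡⟨ +-assoc (total g (upd X a k₂)) _ _ ⟩
    total g (upd X a k₂) + (g α + g β)       ≡⟨ cong (_+ (g α + g β)) (trans (sym (+-identityʳ _)) (trans (cong (total g (upd X a k₂) +_) (sym z)) (sym (step k₂ k₂)))) ⟩
    (T + g (X b)) + (g α + g β)              ≡⟨ trans (+-assoc T _ _) (trans (cong (T +_) (+-comm (g (X b)) _)) (sym (+-assoc T _ _))) ⟩
    (T + (g α + g β)) + g (X b)              ∎)
    where
    open ≡-Reasoning
    T = total g (upd (upd X a k₂) b k₂)
    step : ∀ α β → total g (upd (upd X a α) b β) + g (X b) ≡ total g (upd X a α) + g β
    step α β = trans (cong (λ t → total g (upd (upd X a α) b β) + g t) (sym (upd-miss X α (a≢b ∘ sym)))) (total-upd g (upd X a α) b β)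

  total-cong : ∀ {k} g {X Y : Fin k → Target} → (∀ i → X i ≡ Y i) → total g X ≡ total g Y
  total-cong g h = sum-cong-≗ λ i → cong g (h i)

  #d≤#h : ∀ {k} (X : Fin k → Target) → total #d X ≤ total #h X
  #d≤#h X = sum-mono λ i → lem (X i)
    where
    lem : ∀ α → #d α ≤ #h α
    lem k₂ = z≤n
    lem p₃ = z≤n
    lem k₃ = z≤n
    lem d₄ = ≤-refl
    lem h₃ = z≤n

  size : ∀ {k} → (Fin k → Target) → ℕ
  size X = F (total #k X) (total #h X) (total #p X)

  F-cong : ∀ {s s′ r r′ p p′} → s ≡ s′ → r ≡ r′ → p ≡ p′ → F s r p ≡ F s′ r′ p′
  F-cong refl refl refl = refl

  -- how a join in one colour distributes the forbidden graph of that colour over its two sides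
  data Split : Target → Target → Target → Set where
    k₃-split : Split k₃ k₂ k₂
    d₄-split : Split d₄ k₂ k₂
    left     : Split h₃ k₃ k₂
    right    : Split h₃ k₂ k₃
    middle   : Split h₃ p₃ p₃

  slackV : ∀ {δ α β} → Split δ α β → Target → List (Target × Target)
  slackV d₄-split γ = (k₂ , k₂) ∷ []
  slackV _ γ = []

  split-check : ∀ {δ α β} (s : Split δ α β) γ → check ((α , γ) ∷ (β , γ) ∷ slackV s γ) ((δ , γ) ∷ []) ≡ true
  split-check k₃-split k₂ = refl
  split-check k₃-split p₃ = refl
  split-check k₃-split k₃ = refl
  split-check k₃-split d₄ = refl
  split-check k₃-split h₃ = refl
  split-check d₄-split k₂ = refl
  split-check d₄-split p₃ = refl
  split-check d₄-split k₃ = refl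
  split-check d₄-split d₄ = refl
  split-check d₄-split h₃ = refl
  split-check left k₂ = refl
  split-check left p₃ = refl
  split-check left k₃ = refl
  split-check left d₄ = refl
  split-check left h₃ = refl
  split-check right k₂ = refl
  split-check right p₃ = refl
  split-check right k₃ = refl
  split-check right d₄ = refl
  split-check right h₃ = refl
  split-check middle k₂ = refl
  split-check middle p₃ = refl
  split-check middle k₃ = refl
  split-check middle d₄ = refl
  split-check middle h₃ = refl

  module States {n k} (c : Fin n → Fin n → Fin k) where

    e : Fin k → BGraph n
    e i x y = does (c x y ≟ i)

    e⁺ : ∀ {i x y} → c x y ≡ i → e i x y ≡ true
    e⁺ {i} {x} {y} h with c x y ≟ i
    ... | yes _ = refl
    ... | no ne = ⊥-elim (ne h)

    e⁻ : ∀ {i x y} → e i x y ≡ true → c x y ≡ i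
    e⁻ {i} {x} {y} h with c x y ≟ i
    ... | yes p = p

    Lacks : Fin k → Target → VSet n → Set
    Lacks i α P = ¬ Has (e i) (order-of α) (defect-of α) P

    Avoids : (Fin k → Target) → VSet n → Set
    Avoids X P = ∀ i → Lacks i (X i) P

    Lacks-⊆ : ∀ {i α A B} → A ⊆ B → Lacks i α B → Lacks i α A
    Lacks-⊆ g h = h ∘ Has-⊆ g

    Avoids-upd : ∀ {X A a α} → Avoids X A → Lacks a α A → Avoids (upd X a α) A
    Avoids-upd {X} {A} {a} {α} av h i with i ≟ a
    ... | yes refl = h
    ... | no _ = av i

    Bound-on : VSet n → Set
    Bound-on P = ∀ X → Avoids X P → count P + total #d X ≤ size X

    Joined : Fin k → VSet n → VSet n → Set
    Joined i A B = ∀ {x y} → x ∈ A → y ∈ B → x ≢ y × e i x y ≡ true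

    -- With two vertices on either side, an arbitrary pair on one side acts as K₂ with its edge
    -- missing and determines what the other side avoids. For H₃ the outcome depends on which sides
    -- contain an edge of colour i.
    splits : ∀ {i δ A B P} → A ⊆ P → B ⊆ P → Joined i A B → 2 ≤ count A → 2 ≤ count B → Lacks i δ P →
      (∀ {α β} → Split δ α β → Lacks i α A → Lacks i β B → ⊥) → ⊥
    splits {i} {k₂} {A} {B} g h j a b nt _ = nt (Has-join g h j (Has-1 (proj₂ (pick₁ {Q = A} (≤-trans (s≤s z≤n) a)))) (Has-1 (proj₂ (pick₁ {Q = B} (≤-trans (s≤s z≤n) b)))))
    splits {i} {p₃} {A} {B} g h j a b nt _ = nt (Has-join g h j (Has-1 (proj₂ (pick₁ {Q = A} (≤-trans (s≤s z≤n) a)))) (Has-21 b))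
    splits {i} {k₃} {A} {B} g h j a b nt ok = ok k₃-split
      (λ t → nt (Has-join g h j t (Has-1 (proj₂ (pick₁ {Q = B} (≤-trans (s≤s z≤n) b))))))
      (λ t → nt (Has-join g h j (Has-1 (proj₂ (pick₁ {Q = A} (≤-trans (s≤s z≤n) a)))) t))
    splits {i} {d₄} g h j a b nt ok = ok d₄-split (λ t → nt (Has-join g h j t (Has-21 b))) (λ t → nt (Has-join g h j (Has-21 a) t))
    splits {i} {h₃} {A} {B} g h j a b nt ok = em {A = Has (e i) 2 0 A} λ
      { (no ¬a) → ok right ¬a (λ t → nt (Has-join g h j (Has-21 a) t))
      ; (yes ha) → em {A = Has (e i) 2 0 B} λ
        { (no ¬b) → ok left (λ t → nt (Has-join g h j t (Has-21 b))) ¬b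
        ; (yes hb) → ok middle (λ t → nt (Has-join g h j t hb)) (λ t → nt (Has-join g h j ha t)) } }

    module _ {P : VSet n} {X : Fin k → Target} (av : Avoids X P) (ih : ∀ Q → count Q < count P → Bound-on Q) (a : Fin k) where

      private
        s = total #k (upd X a k₂)
        r = total #h (upd X a k₂)
        p = total #p (upd X a k₂)
        l = total #d (upd X a k₂)

      open Bounds s r p

      ih₁ : ∀ {A y} α → A ⊆ P → y ∈ P → ¬ y ∈ A → Lacks a α A → count A + (l + (#d α + 0)) ≤ val α k₂
      ih₁ {A} {y} α g yp ny h = subst₂ (λ t u → count A + t ≤ u) (total-upd₁ #d X a α refl)
        (F-cong (total-upd₁ #k X a α refl) (total-upd₁ #h X a α refl) (total-upd₁ #p X a α refl))
        (ih A (count-⊂ {A = A} {P} {y} g yp ny) (upd X a α) (Avoids-upd (λ i → Lacks-⊆ g (av i)) h))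

      goal : ∀ {δ} → X a ≡ δ → count P + (l + (#d δ + 0)) ≤ val δ k₂ → count P + total #d X ≤ size X
      goal {δ} e h = subst₂ (λ t u → count P + t ≤ u) (trans (sym (total-upd₁ #d X a δ refl)) (same #d))
        (trans (sym (F-cong (total-upd₁ #k X a δ refl) (total-upd₁ #h X a δ refl) (total-upd₁ #p X a δ refl))) (F-cong (same #k) (same #h) (same #p))) h
        where
        same : ∀ g → total g (upd X a δ) ≡ total g X
        same g = total-cong g λ i → lem i
          where
          lem : ∀ i → upd X a δ i ≡ X i
          lem i with i ≟ a
          ... | yes refl = sym e
          ... | no _ = refl

      lacks : ∀ {δ} → X a ≡ δ → Lacks a δ P
      lacks refl = av a

      arith : ∀ (A B : VSet n) d {va vb m t} → count P ≤ count A + count B → count A + l ≤ va → count B + l ≤ vb → d ≤ m → va + (vb + m) ≤ t →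
        count P + (l + (d + 0)) ≤ t
      arith A B d {va} {vb} {m} {t} h ha hb hd ht = begin
        count P + (l + (d + 0))          ≡⟨ cong (λ z → count P + (l + z)) (+-identityʳ d) ⟩
        count P + (l + d)                ≤⟨ +-mono-≤ h (+-monoʳ-≤ l hd) ⟩
        (count A + count B) + (l + m)    ≡⟨ trans (+-assoc (count A) (count B) _) (cong (count A +_) (sym (+-assoc (count B) l m))) ⟩
        count A + ((count B + l) + m)    ≤⟨ +-mono-≤ (≤-trans (m≤m+n (count A) l) ha) (+-monoˡ-≤ m hb) ⟩
        va + (vb + m)                    ≤⟨ ht ⟩
        t                                ∎
        where open ≤-Reasoning

      weaken : ∀ (A : VSet n) d {v} → count A + (l + d) ≤ v → count A + l ≤ v
      weaken A d = ≤-trans (+-monoʳ-≤ (count A) (m≤m+n l d))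

      one≤ : 1 ≤ val k₂ k₂
      one≤ = ≤-trans (s≤s z≤n) (room k₂ k₂ 1 refl s r p)

      from-split : ∀ {δ α β A B y z} → X a ≡ δ → Split δ α β → (∀ {x} → x ∈ P → x ∈ A ⊎ x ∈ B) → A ⊆ P → B ⊆ P →
        y ∈ P → ¬ y ∈ A → z ∈ P → ¬ z ∈ B → Lacks a α A → Lacks a β B → count P + total #d X ≤ size X
      from-split {δ} {α} {β} {A} {B} ex sp cov g h yp ny zp nz la lb = goal ex (arith A B (#d δ) (count-∪ cov) (weaken A (#d α + 0) (ih₁ α g yp ny la)) (weaken B (#d β + 0) (ih₁ β h zp nz lb)) (slack sp)
        (subst (val α k₂ + (val β k₂ + V (slackV sp k₂)) ≤_) (V₁ δ k₂) (V-≤ ((α , k₂) ∷ (β , k₂) ∷ slackV sp k₂) ((δ , k₂) ∷ []) (split-check sp k₂) s r p)))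
        where
        slack : ∀ {δ α β} (s : Split δ α β) → #d δ ≤ V (slackV s k₂)
        slack k₃-split = z≤n
        slack d₄-split = ≤-trans one≤ (m≤m+n _ 0)
        slack left = z≤n
        slack right = z≤n
        slack middle = z≤n

      from-vertex : ∀ {A B y} → (∀ {x} → x ∈ P → x ∈ A ⊎ x ∈ B) → A ⊆ P → B ⊆ P → count A ≤ 1 → y ∈ A → ¬ y ∈ B →
        Joined a A B → 1 ≤ count B → count P + total #d X ≤ size X
      from-vertex {A} {B} {y} cov g h ca ya ny j cb = go (X a) refl
        where
        A1 : Has (e a) 1 0 A
        A1 = Has-1 ya
        B1 = Has-1 {e = e a} {Q = B} (proj₂ (pick₁ {Q = B} cb))
        go : ∀ δ → X a ≡ δ → count P + total #d X ≤ size X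
        go k₂ ex = ⊥-elim (lacks ex (Has-join g h j A1 B1))
        go k₃ ex = let z , zb = pick₁ {Q = B} cb in from-split ex k₃-split cov g h (h zb) (λ za → proj₁ (j za zb) refl) (g ya) ny
          (λ t → lacks ex (Has-join g h j t B1)) (λ t → lacks ex (Has-join g h j A1 t))
        go p₃ ex with 2 ≤? count B
        ... | yes b2 = ⊥-elim (lacks ex (Has-join g h j A1 (Has-21 b2)))
        ... | no b1 = goal ex (≤-trans (+-mono-≤ (≤-trans (count-∪ cov) (+-mono-≤ ca (≤-pred (≰⇒> b1)))) (≤-trans (≤-reflexive (+-identityʳ l)) (#d≤#h (upd X a k₂)))) (room p₃ k₂ 2 refl s r p))
        -- B contains no P₃ of colour a, and twice the bound for P₃ fits under the bound for K₄ - e: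
        -- one copy holds B and the slack of the other colours, the other holds the vertex and the
        -- unit of slack.
        go d₄ ex = goal ex (begin
          count P + (l + 1)                ≤⟨ +-monoˡ-≤ (l + 1) (≤-trans (count-∪ cov) (+-monoˡ-≤ (count B) ca)) ⟩
          (1 + count B) + (l + 1)          ≡⟨ trans (+-comm (1 + count B) (l + 1)) (trans (cong (_+ (1 + count B)) (+-comm l 1)) (cong suc (trans (+-suc l (count B)) (cong suc (+-comm l (count B)))))) ⟩
          2 + (count B + l)                ≤⟨ +-mono-≤ (≤-trans (m≤m+n 2 r) (room p₃ k₂ 2 refl s r p)) (weaken B 0 (ih₁ p₃ h (g ya) ny (λ t → lacks ex (Has-join g h j A1 t)))) ⟩
          val p₃ k₂ + val p₃ k₂            ≡⟨ cong (val p₃ k₂ +_) (+-identityʳ _) ⟨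
          V ((p₃ , k₂) ∷ (p₃ , k₂) ∷ [])   ≤⟨ V-≤ ((p₃ , k₂) ∷ (p₃ , k₂) ∷ []) ((d₄ , k₂) ∷ []) refl s r p ⟩
          V ((d₄ , k₂) ∷ [])               ≡⟨ V₁ d₄ k₂ ⟩
          val d₄ k₂                        ∎)
          where open ≤-Reasoning
        go h₃ ex = goal ex (begin
          count P + (l + 0)                ≤⟨ +-monoˡ-≤ (l + 0) (≤-trans (count-∪ cov) (+-monoˡ-≤ (count B) ca)) ⟩
          (1 + count B) + (l + 0)          ≡⟨ trans (cong suc (cong (count B +_) (+-identityʳ l))) (trans (sym (+-suc (count B) l)) (cong (count B +_) (+-comm 1 l))) ⟩
          count B + (l + 1)                ≤⟨ ih₁ d₄ h (g ya) ny (λ t → lacks ex (Has-join g h j A1 t)) ⟩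
          val h₃ k₂                        ∎)
          where open ≤-Reasoning

    module _ {P : VSet n} {X : Fin k → Target} (c-sym : ∀ x y → c x y ≡ c y x)
      (gallai : ∀ x y z → x ≢ y → y ≢ z → x ≢ z → c x y ≢ c y z → c y z ≢ c x z → c x y ≢ c x z → ⊥)
      (av : Avoids X P) (ih : ∀ Q → count Q < count P → Bound-on Q) where

      open Decomposition c c-sym gallai using (Join)

      join-case : ∀ {a} → Join a P → count P + total #d X ≤ size X
      join-case {a} J with 2 ≤? count A | 2 ≤? count B
        where
        open Join J
        A = side
        B? : ∀ x → Dec (x ∈ P × ¬ x ∈ side)
        B? x = (x ∈? P) ×-dec ¬? (x ∈? side)
        B = ⟨ B? ⟩
      ... | a2 | b2 = decidable-stable (count P + total #d X ≤? size X) λ nle → go nle a2 b2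
        where
        open Join J
        A = side
        B? : ∀ x → Dec (x ∈ P × ¬ x ∈ side)
        B? x = (x ∈? P) ×-dec ¬? (x ∈? side)
        B = ⟨ B? ⟩
        B⊆ : B ⊆ P
        B⊆ = proj₁ ∘ ⟨⟩∈ B?
        cover : ∀ {x} → x ∈ P → x ∈ A ⊎ x ∈ B
        cover {x} p with x ∈? side
        ... | yes q = inj₁ q
        ... | no nq = inj₂ (∈⟨⟩ B? (p , nq))
        u = proj₁ inner
        uA = proj₂ inner
        v = proj₁ outer
        vB : v ∈ B
        vB = ∈⟨⟩ B? (proj₂ outer)
        j : Joined a A B
        j xa yb = (λ { refl → proj₂ (⟨⟩∈ B? yb) xa }) , e⁺ (joined xa (B⊆ yb) (proj₂ (⟨⟩∈ B? yb)))
        j′ : Joined a B A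
        j′ {x} {y} xb ya = (λ { refl → proj₂ (⟨⟩∈ B? xb) ya }) , e⁺ (trans (c-sym x y) (joined ya (B⊆ xb) (proj₂ (⟨⟩∈ B? xb))))
        ¬uB : ¬ u ∈ B
        ¬uB h = proj₂ (⟨⟩∈ B? h) uA
        go : ¬ (count P + total #d X ≤ size X) → Dec (2 ≤ count A) → Dec (2 ≤ count B) → ⊥
        go nle (yes a2) (yes b2) = splits side⊆ B⊆ j a2 b2 (av a) λ sp la lb →
          nle (from-split av ih a refl sp cover side⊆ B⊆ (B⊆ vB) (proj₂ (⟨⟩∈ B? vB)) (side⊆ uA) ¬uB la lb)
        go nle (no a1) _ = nle (from-vertex av ih a cover side⊆ B⊆ (≤-pred (≰⇒> a1)) uA ¬uB j (count-∈ vB))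
        go nle (yes _) (no b1) = nle (from-vertex av ih a (λ p → case cover p of λ { (inj₁ h) → inj₂ h ; (inj₂ h) → inj₁ h }) B⊆ side⊆ (≤-pred (≰⇒> b1)) vB (proj₂ (⟨⟩∈ B? vB)) j′ (count-∈ uA))

-- Neighbourhoods of parts in a Gallai partition.

module Parts where

  open Subsets
  open SmallRamsey
  open ExtremalNumber
  open GallaiPartition
  open Joins

  val-comm : ∀ s r p α β → Bounds.val s r p α β ≡ Bounds.val s r p β α
  val-comm s r p α β = F-cong (cong (s +_) (+-comm (#k α) (#k β))) (cong (r +_) (+-comm (#h α) (#h β))) (cong (p +_) (+-comm (#p α) (#p β)))

  -- A vertex without edges in A would miss k - 1 > d pairs of the copy, so no copy contains it.
  isolated : ∀ {n} {e : BGraph n} {u k d A B} → Symm e → (∀ {y} → y ∈ A → y ≢ u → e u y ≡ false) → (∀ {y} → y ∈ A → y ≢ u → y ∈ B) →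
    2 + d ≤ k → Has e k d A → Has e k d B
  isolated {e = e} {u} {k} {d} {A} {B} s iso g h (ys , (l , un , q) , m) = ys , (l , un , All.map (λ { (a , ne) → g a ne }) (All.zip (q , absent))) , m
    where
    full : ∀ {zs} → All (_∈ A) zs → All (u ≢_) zs → row e u zs ≡ length zs
    full [] [] = refl
    full (a ∷ as) (ne ∷ nes) = cong₂ _+_ (cong (χ ∘ not) (iso a (ne ∘ sym))) (full as nes)
    one : ∀ {z ws} → z ∈ A → z ≢ u → u ∈ˡ ws → 1 ≤ row e z ws
    one {z} a ne (here refl) = ≤-trans (≤-reflexive (sym (cong (χ ∘ not) (trans (s z u) (iso a ne))))) (m≤m+n _ _)
    one a ne (there i) = ≤-trans (one a ne i) (m≤n+m _ _)
    many : ∀ {zs} → Unique zs → All (_∈ A) zs → u ∈ˡ zs → length zs ≤ suc (miss e zs)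
    many (n ∷ _) (a ∷ as) (here refl) = s≤s (≤-trans (≤-reflexive (sym (full as n))) (m≤m+n _ _))
    many {z ∷ zs} (n ∷ ns) (a ∷ as) (there i) = s≤s (≤-trans (many ns as i) (+-monoˡ-≤ (miss e zs) (one a (All.lookup n i) i)))
    absent : All (_≢ u) ys
    absent = All.tabulate λ { i refl → <-irrefl refl (≤-trans h (≤-trans (≤-reflexive (sym l)) (≤-trans (many un q i) (s≤s m)))) }

  Has-tail : ∀ {n} {e : BGraph n} {k d A} → Has e (suc k) d A → Has e k d A
  Has-tail {e = e} (y ∷ ys , (l , _ ∷ u , _ ∷ q) , m) = ys , (suc-injective l , u , q) , ≤-trans (m≤n+m (miss e ys) _) m

  Has-small : ∀ {n} {e : BGraph n} {k d A} → count A < k → ¬ Has e k d A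
  Has-small {k = k} lt (ys , p , _) = <-irrefl refl (≤-trans lt (unpick {ys = ys} k p))

  module Two {n k} {c : Fin n → Fin n → Fin k} (c-sym : ∀ x y → c x y ≡ c y x)
    {gallai : ∀ x y z → x ≢ y → y ≢ z → x ≢ z → c x y ≢ c y z → c y z ≢ c x z → c x y ≢ c x z → ⊥} where

    open States c
    open Decomposition c c-sym gallai using (Join; Partition)

    e-sym : ∀ i → Symm (e i)
    e-sym i x y = cong (λ t → does (t ≟ i)) (c-sym x y)

    e-distinct : ∀ {i j x y} → i ≢ j → c x y ≡ i → e j x y ≡ false
    e-distinct {i} {j} {x} {y} ne h with c x y ≟ j
    ... | yes h′ = ⊥-elim (ne (trans (sym h) h′))
    ... | no _ = refl

    swapped : ∀ {P} → Partition P → Partition P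
    swapped π = record { a = b ; b = a ; a≢b = a≢b ∘ sym ; part = part ; part⊆ = part⊆ ; apart = apart ; part-refl = part-refl ; part-sym = part-sym
      ; part-trans = part-trans ; across = λ p q nq → case across p q nq of λ { (inj₁ h) → inj₂ h ; (inj₂ h) → inj₁ h } ; uniform = uniform
      ; reps = reps ; reps⊆ = reps⊆ ; rep = rep ; rep-unique = rep-unique }
      where open Partition π

    -- The induction hypothesis for proper subsets of P, y being a witness of properness. The
    -- targets in a and b are free; s, r, p and l describe the other colours, l counting those with
    -- target K₄ - e.
    Bounded : ∀ {P} → Partition P → ℕ → ℕ → ℕ → ℕ → Set
    Bounded {P} π s r p l = ∀ {A y} γ δ → A ⊆ P → y ∈ P → ¬ y ∈ A → Lacks (Partition.a π) γ A → Lacks (Partition.b π) δ A →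
      count A + (l + (#d γ + #d δ)) ≤ Bounds.val s r p γ δ

    Bounded-swap : ∀ {P} {π : Partition P} {s r p l} → Bounded π s r p l → Bounded (swapped π) s r p l
    Bounded-swap {s = s} {r} {p} {l} bd {A} γ δ g yp ny la lb = subst₂ (λ t u → count A + (l + t) ≤ u) (+-comm (#d δ) (#d γ)) (val-comm s r p δ γ) (bd δ γ g yp ny lb la)

    module Tools {P} (π : Partition P) {s r p l} (l≤r : l ≤ r) (bounded : Bounded π s r p l) (noJoin : ∀ {i} → Join i P → ⊥) where

      open Partition π
      open Bounds s r p

      bound : ∀ {A y} γ δ → A ⊆ P → y ∈ P → ¬ y ∈ A → Lacks a γ A → Lacks b δ A → count A ≤ val γ δ
      bound γ δ g yp ny la lb = ≤-trans (m≤m+n _ _) (bounded γ δ g yp ny la lb)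

      bound-l : ∀ {A y} γ δ → A ⊆ P → y ∈ P → ¬ y ∈ A → Lacks a γ A → Lacks b δ A → count A + l ≤ val γ δ
      bound-l {A} γ δ g yp ny la lb = ≤-trans (+-monoʳ-≤ (count A) (m≤m+n l _)) (bounded γ δ g yp ny la lb)

      N? : ∀ i x y → Dec (y ∈ P × ¬ y ∈ part x × c x y ≡ i)
      N? i x y = (y ∈? P) ×-dec ¬? (y ∈? part x) ×-dec (c x y ≟ i)

      N : Fin k → Fin n → VSet n
      N i x = ⟨ N? i x ⟩

      N⊆ : ∀ {i x} → N i x ⊆ P
      N⊆ {i} {x} = proj₁ ∘ ⟨⟩∈ (N? i x)

      cover : ∀ {x y} → x ∈ P → y ∈ P → ¬ y ∈ part x → y ∈ N a x ⊎ y ∈ N b x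
      cover {x} p q nq = case across p q nq of λ { (inj₁ h) → inj₁ (∈⟨⟩ (N? a x) (q , nq , h)) ; (inj₂ h) → inj₂ (∈⟨⟩ (N? b x) (q , nq , h)) }

      count-P : ∀ {x} → x ∈ P → count P ≤ count (part x) + (count (N a x) + count (N b x))
      count-P {x} xp = ≤-trans (count-∪ {A = part x} {⟨ out? ⟩} λ {y} yp → case y ∈? part x of λ { (yes h) → inj₁ h ; (no nh) → inj₂ (∈⟨⟩ out? (yp , nh)) })
        (+-monoʳ-≤ (count (part x)) (count-∪ λ h → let yp , ny = ⟨⟩∈ out? h in cover xp yp ny))
        where
        out? : ∀ y → Dec (y ∈ P × ¬ y ∈ part x)
        out? y = (y ∈? P) ×-dec ¬? (y ∈? part x)

      joined : ∀ {i x} → x ∈ P → Joined i (part x) (N i x)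
      joined {i} {x} xp {w} {z} wx zn = let zp , nz , h = ⟨⟩∈ (N? i x) zn in (λ { refl → nz wx }) , e⁺ (trans (sym (uniform xp wx zp nz)) h)

      Closed : VSet n → Set
      Closed Y = ∀ {y z} → y ∈ Y → z ∈ part y → z ∈ Y

      N-closed : ∀ {i x} → x ∈ P → Closed (N i x)
      N-closed {i} {x} xp {y} {z} yn zy = let yp , ny , h = ⟨⟩∈ (N? i x) yn in
        ∈⟨⟩ (N? i x) (part⊆ zy , (λ zx → ny (part-trans zx (part-sym yp zy))) ,
          trans (c-sym x z) (trans (sym (uniform yp zy xp (λ xy → ny (part-sym yp xy)))) (trans (c-sym y x) h)))

      x∉N : ∀ {i x} → x ∈ P → ¬ x ∈ N i x
      x∉N {i} {x} xp h = proj₁ (proj₂ (⟨⟩∈ (N? i x) h)) (part-refl xp)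

      outside : ∀ {x} → x ∈ P → ∃ λ y → y ∈ P × ¬ y ∈ part x
      outside {x} xp with apart
      ... | u , v , up , vp , nv with u ∈? part x
      ...   | no nu = u , up , nu
      ...   | yes ux = v , vp , λ vx → nv (part-trans (part-sym xp ux) vx)

      -- Otherwise the part of x would be joined to everything else in colour b.
      N-nonempty : ∀ {x} → x ∈ P → 1 ≤ count (N a x)
      N-nonempty {x} xp = decidable-stable (1 ≤? count (N a x)) λ none → noJoin {b} record
        { side = part x ; side⊆ = part⊆ ; inner = x , part-refl xp ; outer = outside xp
        ; joined = λ {w} {y} wx yp ny → trans (sym (uniform xp wx yp ny)) (case across xp yp ny of λ
            { (inj₁ h) → ⊥-elim (none (count-∈ (∈⟨⟩ (N? a x) (yp , ny , h)))) ; (inj₂ h) → h }) }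

      Big : Fin n → Set
      Big x = 2 ≤ count (part x)

      single : ∀ {x y} → x ∈ P → ¬ Big x → y ∈ part x → x ≡ y
      single {x} {y} xp nb yx = decidable-stable (x ≟ y) λ ne → nb (unpick {ys = x ∷ y ∷ []} 2 (refl , (ne ∷ []) ∷ [] ∷ [] , part-refl xp ∷ yx ∷ []))

      edge-big : ∀ {i d x} → Has (e i) 2 d (part x) → Big x
      edge-big (ys , q , _) = unpick {ys = ys} 2 q

      -- A part with a single a-neighbour u splits P into part ∪ {u} and its b-neighbours.
      two-neighbours : ∀ {α β} → Lacks a α P → Lacks b β P → ¬ (count P + (l + (#d α + #d β)) ≤ val α β) → (∀ {x} → x ∈ P → 1 ≤ count (N b x)) →
        ∀ {x} → x ∈ P → Big x → 2 ≤ count (N a x)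
      two-neighbours {α} {β} la lb nle nonempty-b {x} xp big = decidable-stable (2 ≤? count (N a x)) λ few → go few (2 ≤? count (N b x))
        where
        u = proj₁ (pick₁ {Q = N a x} (N-nonempty xp))
        un : u ∈ N a x
        un = proj₂ (pick₁ {Q = N a x} (N-nonempty xp))
        up = N⊆ {a} {x} un
        v = proj₁ (pick₁ {Q = N b x} (nonempty-b xp))
        vn : v ∈ N b x
        vn = proj₂ (pick₁ {Q = N b x} (nonempty-b xp))
        vp = N⊆ {b} {x} vn
        unique : ∀ {i y w} → ¬ (2 ≤ count (N i x)) → y ∈ N i x → w ∈ N i x → y ≡ w
        unique {i} {y} {w} few yn wn = decidable-stable (y ≟ w) λ ne → few (unpick {ys = y ∷ w ∷ []} 2 (refl , (ne ∷ []) ∷ [] ∷ [] , yn ∷ wn ∷ []))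
        A? : ∀ y → Dec (y ∈ part x ⊎ y ∈ N a x)
        A? y = (y ∈? part x) ⊎-dec (y ∈? N a x)
          where open import Relation.Nullary.Decidable using (_⊎-dec_)
        A = ⟨ A? ⟩
        A⊆ : A ⊆ P
        A⊆ h = case ⟨⟩∈ A? h of λ { (inj₁ q) → part⊆ q ; (inj₂ q) → N⊆ q }
        v∉A : ¬ v ∈ A
        v∉A h = let _ , nv , vb = ⟨⟩∈ (N? b x) vn in case ⟨⟩∈ A? h of λ
          { (inj₁ q) → nv q ; (inj₂ q) → a≢b (trans (sym (proj₂ (proj₂ (⟨⟩∈ (N? a x) q)))) vb) }
        up-x : c u x ≡ a
        up-x = trans (c-sym u x) (proj₂ (proj₂ (⟨⟩∈ (N? a x) un)))
        u-part : ∀ {y} → y ∈ part x → c u y ≡ a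
        u-part {y} yx = trans (c-sym u y) (e⁻ (proj₂ (joined {a} xp yx un)))
        cov : ∀ {y} → y ∈ P → y ∈ A ⊎ y ∈ N b x
        cov {y} yp with y ∈? part x
        ... | yes yx = inj₁ (∈⟨⟩ A? (inj₁ yx))
        ... | no ny = case cover xp yp ny of λ { (inj₁ h) → inj₁ (∈⟨⟩ A? (inj₂ h)) ; (inj₂ h) → inj₂ h }
        go : ¬ (2 ≤ count (N a x)) → Dec (2 ≤ count (N b x)) → ⊥
        -- Within part ∪ {u} the vertex u has edges of colour a only. By `isolated` it adds no
        -- forbidden graph in b, so the bounds for a join in b carry over to this set and N b x.
        go few (yes b2) = splits part⊆ N⊆ (joined {b} xp) big b2 lb λ {γ} {δ} sp lγ lδ →
          let lγ′ : Lacks b γ A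
              lγ′ h = lγ (isolated {u = u} (e-sym b) (u-free few) (in-part few) (wide sp) h)
          in nle (begin
            count P + (l + (#d α + #d β))               ≤⟨ +-monoˡ-≤ _ (count-∪ cov) ⟩
            (count A + count (N b x)) + (l + (#d α + #d β)) ≤⟨ rearrange (count A) (count (N b x)) (#d α) (#d β) ⟩
            (count A + (l + (#d α + #d γ))) + ((count (N b x) + (l + (#d α + #d δ))) + #d β)
              ≤⟨ +-mono-≤ (bounded α γ A⊆ vp v∉A (Lacks-⊆ A⊆ la) lγ′) (+-mono-≤ (bounded α δ N⊆ xp (x∉N xp) (Lacks-⊆ N⊆ la) lδ) (slack sp)) ⟩
            val α γ + (val α δ + V (slackV sp α))       ≡⟨ cong₂ _+_ (val-comm s r p α γ) (cong (_+ V (slackV sp α)) (val-comm s r p α δ)) ⟩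
            V ((γ , α) ∷ (δ , α) ∷ slackV sp α)         ≤⟨ V-≤ ((γ , α) ∷ (δ , α) ∷ slackV sp α) ((β , α) ∷ []) (split-check sp α) s r p ⟩
            V ((β , α) ∷ [])                            ≡⟨ trans (V₁ β α) (val-comm s r p β α) ⟩
            val α β                                     ∎)
          where
          open ≤-Reasoning
          wide : ∀ {δ γ γ′} → Split δ γ γ′ → 2 + defect-of γ ≤ order-of γ
          wide k₃-split = ≤-refl
          wide d₄-split = ≤-refl
          wide left = s≤s (s≤s z≤n)
          wide right = ≤-refl
          wide middle = ≤-refl
          slack : ∀ {δ γ γ′} (sp : Split δ γ γ′) → #d δ ≤ V (slackV sp α)
          slack k₃-split = z≤n
          slack d₄-split = ≤-trans (≤-trans (s≤s z≤n) (room k₂ k₂ 1 refl s r p)) (m≤m+n _ 0)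
          slack left = z≤n
          slack right = z≤n
          slack middle = z≤n
          rearrange : ∀ x y d d′ {g h} → (x + y) + (l + (d + d′)) ≤ (x + (l + (d + g))) + ((y + (l + (d + h))) + d′)
          rearrange x y d d′ {g} {h} = begin
            (x + y) + (l + (d + d′))       ≡⟨ trans (+-assoc x y _) (cong (x +_) (trans (cong (y +_) (sym (+-assoc l d d′))) (sym (+-assoc y (l + d) d′)))) ⟩
            x + ((y + (l + d)) + d′)       ≤⟨ +-mono-≤ (m≤m+n x _) (+-monoˡ-≤ d′ (+-monoʳ-≤ y (+-monoʳ-≤ l (m≤m+n d h)))) ⟩
            (x + (l + (d + g))) + ((y + (l + (d + h))) + d′) ∎
          in-part : ¬ (2 ≤ count (N a x)) → ∀ {y} → y ∈ A → y ≢ u → y ∈ part x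
          in-part few yA ne = case ⟨⟩∈ A? yA of λ { (inj₁ q) → q ; (inj₂ q) → ⊥-elim (ne (unique few q un)) }
          u-free : ¬ (2 ≤ count (N a x)) → ∀ {y} → y ∈ A → y ≢ u → e b u y ≡ false
          u-free few yA ne = e-distinct a≢b (u-part (in-part few yA ne))
        -- Now P is the part with u and v. Depending on the colour of u v, either u is joined to the
        -- rest in a or v is joined to the rest in b.
        go few (no b1) = case c u v ≟ a of λ
          { (yes h) → noJoin {a} record { side = ⟨ u ≟_ ⟩ ; side⊆ = λ h → subst (_∈ P) (⟨⟩∈ (u ≟_) h) up ; inner = u , ∈⟨⟩ (u ≟_) refl
              ; outer = v , vp , λ h′ → a≢b (trans (sym (proj₂ (proj₂ (⟨⟩∈ (N? a x) un)))) (trans (cong (c x) (⟨⟩∈ (u ≟_) h′)) (proj₂ (proj₂ (⟨⟩∈ (N? b x) vn)))))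
              ; joined = λ {w} {y} wu yp ny → subst (λ t → c t y ≡ a) (⟨⟩∈ (u ≟_) wu) (case cov yp of λ
                  { (inj₂ yb) → trans (cong (c u) (unique b1 yb vn)) h
                  ; (inj₁ yA) → u-part (case ⟨⟩∈ A? yA of λ { (inj₁ q) → q ; (inj₂ q) → ⊥-elim (ny (∈⟨⟩ (u ≟_) (unique few un q))) }) }) }
          ; (no nh) → noJoin {b} record { side = ⟨ v ≟_ ⟩ ; side⊆ = λ h → subst (_∈ P) (⟨⟩∈ (v ≟_) h) vp ; inner = v , ∈⟨⟩ (v ≟_) refl
              ; outer = u , up , λ h′ → a≢b (trans (sym (proj₂ (proj₂ (⟨⟩∈ (N? a x) un)))) (trans (cong (c x) (sym (⟨⟩∈ (v ≟_) h′))) (proj₂ (proj₂ (⟨⟩∈ (N? b x) vn)))))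
              ; joined = λ {w} {y} wv yp ny → subst (λ t → c t y ≡ b) (⟨⟩∈ (v ≟_) wv) (case y ∈? part x of λ
                  { (yes yx) → trans (c-sym v y) (e⁻ (proj₂ (joined {b} xp yx vn)))
                  ; (no nyx) → case cover xp yp nyx of λ
                    { (inj₂ yb) → ⊥-elim (ny (∈⟨⟩ (v ≟_) (unique b1 vn yb)))
                    ; (inj₁ ya) → subst (λ t → c v t ≡ b) (unique few un ya) (uv-b nh) } }) } }
          where
          uv-b : c u v ≢ a → c v u ≡ b
          uv-b nh = trans (c-sym v u) (case across up vp (λ vu → a≢b (trans (sym up-x) (trans (uniform up vu xp (λ xu → proj₁ (proj₂ (⟨⟩∈ (N? a x) un)) (part-sym up xu))) (trans (c-sym v x) (proj₂ (proj₂ (⟨⟩∈ (N? b x) vn))))))) of λ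
            { (inj₁ h) → ⊥-elim (nh h) ; (inj₂ h) → h })

-- Sizes of unions of parts when one colour is nearly absent.

module PartSizes where

  open Subsets
  open SmallRamsey
  open ExtremalNumber
  open GallaiPartition
  open Joins
  open Parts

  Pairs : Set
  Pairs = List (Target × Target)

  -- sizes of a set of parts that has no edge of colour b and no H₃ in colour a
  one-colour : List Pairs
  one-colour = ((k₂ , k₂) ∷ (k₃ , k₂) ∷ []) ∷ ((p₃ , k₂) ∷ (p₃ , k₂) ∷ []) ∷ []

  -- ... when moreover no part contains a P₃ of colour a
  one-colour-thin : List Pairs
  one-colour-thin = ((p₃ , k₂) ∷ (p₃ , k₂) ∷ []) ∷ ((k₂ , k₂) ∷ (k₂ , k₂) ∷ (k₂ , k₂) ∷ []) ∷ ((k₂ , k₂) ∷ (p₃ , k₂) ∷ []) ∷ []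

  -- sizes of a set of parts that has no K₃ of colour b and no H₃ in colour a
  two-colour : List Pairs
  two-colour = map (λ W → (k₂ , k₂) ∷ (k₃ , k₃) ∷ W) one-colour ++ map (λ W → (p₃ , k₂) ∷ (p₃ , k₃) ∷ W) one-colour
    ++ map (λ W → (k₃ , k₂) ∷ (k₂ , k₃) ∷ W) one-colour ++ ((k₂ , k₃) ∷ (k₃ , k₃) ∷ []) ∷ []

  module Cases {n k} {c : Fin n → Fin n → Fin k} (c-sym : ∀ x y → c x y ≡ c y x)
    {gallai : ∀ x y z → x ≢ y → y ≢ z → x ≢ z → c x y ≢ c y z → c y z ≢ c x z → c x y ≢ c x z → ⊥} where

    open States c
    open Decomposition c c-sym gallai using (Join; Partition)
    open Two c-sym {gallai}

    module Sizes {P} (π : Partition P) {s r p l} (l≤r : l ≤ r) (bounded : Bounded π s r p l) (noJoin : ∀ {i} → Join i P → ⊥) where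

      open Partition π public
      open Bounds s r p public
      open Tools π {s} {r} {p} {l} l≤r bounded noJoin public

      minus? : ∀ Y y z → Dec (z ∈ Y × ¬ z ∈ part y)
      minus? Y y z = (z ∈? Y) ×-dec ¬? (z ∈? part y)

      minus : VSet n → Fin n → VSet n
      minus Y y = ⟨ minus? Y y ⟩

      minus⊆ : ∀ {Y y} → minus Y y ⊆ Y
      minus⊆ {Y} {y} = proj₁ ∘ ⟨⟩∈ (minus? Y y)

      count-minus : ∀ {Y} y → count Y ≤ count (part y) + count (minus Y y)
      count-minus {Y} y = count-∪ λ {z} zY → case z ∈? part y of λ { (yes h) → inj₁ h ; (no nh) → inj₂ (∈⟨⟩ (minus? Y y) (zY , nh)) }

      minus-closed : ∀ {Y y} → y ∈ P → Y ⊆ P → Closed Y → Closed (minus Y y)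
      minus-closed {Y} {y} yp g cl {u} {v} um vu = let uY , nu = ⟨⟩∈ (minus? Y y) um in
        ∈⟨⟩ (minus? Y y) (cl uY vu , λ vy → nu (part-trans vy (part-sym (g uY) vu)))

      edge-or : ∀ {Y i u v} → Y ⊆ P → i ≢ b → Lacks b k₂ Y → u ∈ Y → v ∈ Y → u ≢ v → ¬ v ∈ part u → e a u v ≡ true
      edge-or g _ nb uY vY ne nv = case across (g uY) (g vY) nv of λ { (inj₁ h) → e⁺ h ; (inj₂ h) → ⊥-elim (nb (Has-2 uY vY ne (e⁺ h))) }

      joined-minus : ∀ {Y y} → y ∈ Y → Y ⊆ P → Closed Y → Lacks b k₂ Y → Joined a (part y) (minus Y y)
      joined-minus {Y} {y} yY g cl nb {u} {v} uy vm = let vY , nv = ⟨⟩∈ (minus? Y y) vm ; ne = λ { refl → nv uy } in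
        ne , edge-or {i = a} g a≢b nb (cl yY uy) vY ne (λ vu → nv (part-trans uy vu))

      size-lemma : ∀ {y x z u v : ℕ} → y ≤ x + z → x ≤ u → z ≤ v → y ≤ u + v
      size-lemma h x y = ≤-trans h (+-mono-≤ x y)

      V₂ : ∀ {x α β γ δ} → x ≤ val α β + val γ δ → x ≤ V ((α , β) ∷ (γ , δ) ∷ [])
      V₂ {x} {α} {β} {γ} {δ} h = ≤-trans h (≤-reflexive (cong (val α β +_) (sym (+-identityʳ (val γ δ)))))

      has-big : ∀ Y → Dec (∃ λ y → y ∈ Y × Big y)
      has-big Y = any? λ y → (y ∈? Y) ×-dec (2 ≤? count (part y))

      spread : ∀ {Y} → Y ⊆ P → ¬ (∃ λ y → y ∈ Y × Big y) → Covers (e a) (e b) Y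
      spread g none {x} {y} xY yY ne = case across (g xY) (g yY) (λ yx → ne (single (g xY) (λ big → none (x , xY , big)) yx)) of λ
        { (inj₁ h) → inj₁ (e⁺ h) ; (inj₂ h) → inj₂ (e⁺ h) }

      clique-4 : ∀ {Y i} → Lacks i h₃ P → Y ⊆ P → (∀ {x y} → x ∈ Y → y ∈ Y → x ≢ y → e i x y ≡ true) → count Y ≤ 4
      clique-4 {Y} no-h g full = decidable-stable (count Y ≤? 4) λ gt → no-h (Has-⊆ g (Has-≤ z≤n (Has-full 5 full (≰⇒> gt))))

      four : 4 ≤ V ((p₃ , k₂) ∷ (p₃ , k₂) ∷ [])
      four = ≤-trans (+-mono-≤ two two) (≤-reflexive (cong (val p₃ k₂ +_) (sym (+-identityʳ (val p₃ k₂)))))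
        where
        two : 2 ≤ val p₃ k₂
        two = ≤-trans (m≤m+n 2 r) (room p₃ k₂ 2 refl s r p)

      module OneColour (no-h : Lacks a h₃ P) (two-a : ∀ {x} → x ∈ P → Big x → 2 ≤ count (N a x))
        {Y x₀} (Y⊆ : Y ⊆ P) (cl : Closed Y) (x₀P : x₀ ∈ P) (x₀Y : ¬ x₀ ∈ Y) (no-b : Lacks b k₂ Y) where

        data Shape : Set where
          tiny : count Y ≤ 4 → Shape
          empty-part : ∀ {y} → y ∈ Y → Big y → Lacks a k₂ (part y) → Lacks a k₃ (minus Y y) → Shape
          empty-rest : ∀ {y} → y ∈ Y → Big y → Has (e a) 2 0 (part y) → Lacks a k₃ (part y) → Lacks a k₂ (minus Y y) → Shape
          matchings : ∀ {y} → y ∈ Y → Lacks a p₃ (part y) → Lacks a p₃ (minus Y y) → Shape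

        -- Without colour b between the parts, a big part is joined in a to the rest of Y and H₃
        -- splits between them. The rest may have fewer than two vertices; when it has no a-edge, K₃
        -- is kept out of the part by two a-neighbours taken from all of P.
        shape : (Shape → ⊥) → ⊥
        shape out with has-big Y
        ... | no none = out (tiny (clique-4 no-h Y⊆ λ xY yY ne → case spread Y⊆ none xY yY ne of λ
                { (inj₁ h) → h ; (inj₂ h) → ⊥-elim (no-b (Has-2 xY yY ne h)) }))
        ... | yes (y , yY , big) = em {A = Has (e a) 2 0 (part y)} λ
            { (no ¬e) → out (empty-part yY big ¬e λ t → no-h (Has-join part⊆ m⊆ j (Has-21 big) t))
            ; (yes h) → em {A = Has (e a) 2 0 (minus Y y)} λ
              { (no ¬e) → out (empty-rest yY big h (λ t → no-h (Has-join part⊆ N⊆ (joined {a} yP) t (Has-21 (two-a yP big)))) ¬e)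
              ; (yes h′) → out (matchings yY (λ t → no-h (Has-join part⊆ m⊆ j t h′)) (λ t → no-h (Has-join part⊆ m⊆ j h t))) } }
          where
          yP = Y⊆ yY
          j = joined-minus yY Y⊆ cl no-b
          m⊆ : minus Y y ⊆ P
          m⊆ = Y⊆ ∘ minus⊆

        part-bound : ∀ {y} γ → y ∈ Y → Lacks a γ (part y) → count (part y) ≤ val γ k₂
        part-bound γ yY h = bound γ k₂ part⊆ x₀P (λ q → x₀Y (cl yY q)) h (Lacks-⊆ {α = k₂} (cl yY) no-b)

        sub-bound : ∀ {Z} γ → Z ⊆ Y → Lacks a γ Z → count Z ≤ val γ k₂
        sub-bound γ g h = bound γ k₂ (Y⊆ ∘ g) x₀P (x₀Y ∘ g) h (Lacks-⊆ {α = k₂} g no-b)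

        sizes : (∀ {L} → L ∈ˡ one-colour → count Y ≤ V L → ⊥) → ⊥
        sizes out = shape λ
          { (tiny h) → out (there (here refl)) (≤-trans h four)
          ; (empty-part {y} yY _ h h′) → out (here refl) (V₂ {α = k₂} {k₂} {k₃} {k₂} (size-lemma (count-minus y) (part-bound k₂ yY h) (sub-bound k₃ minus⊆ h′)))
          ; (empty-rest {y} yY _ _ h h′) → out (here refl) (V₂ {α = k₂} {k₂} {k₃} {k₂} (≤-trans (size-lemma (count-minus y) (part-bound k₃ yY h) (sub-bound k₂ minus⊆ h′)) (≤-reflexive (+-comm (val k₃ k₂) (val k₂ k₂)))))
          ; (matchings {y} yY h h′) → out (there (here refl)) (V₂ {α = p₃} {k₂} {p₃} {k₂} (size-lemma (count-minus y) (part-bound p₃ yY h) (sub-bound p₃ minus⊆ h′))) }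

        -- The new case is a big part without a-edges, whose complement in Y avoids K₃. If that
        -- complement consists of at least two parts, it divides into two edge-free pieces, giving
        -- three copies of `val k₂ k₂`; otherwise it is empty or a single part.
        thin-sizes : (∀ {y} → y ∈ P → Has (e a) 2 0 (part y) → Lacks a p₃ (part y)) → (∀ {L} → L ∈ˡ one-colour-thin → count Y ≤ V L → ⊥) → ⊥
        thin-sizes thin out = shape λ
          { (tiny h) → out (here refl) (≤-trans h four)
          ; (matchings {y} yY h h′) → out (here refl) (V₂ {α = p₃} {k₂} {p₃} {k₂} (size-lemma (count-minus y) (part-bound p₃ yY h) (sub-bound p₃ minus⊆ h′)))
          ; (empty-rest {y} yY _ h _ h′) → out (there (there (here refl))) (V₂ {α = k₂} {k₂} {p₃} {k₂} (≤-trans (size-lemma (count-minus y) (part-bound p₃ yY (thin (Y⊆ yY) h)) (sub-bound k₂ minus⊆ h′)) (≤-reflexive (+-comm (val p₃ k₂) (val k₂ k₂)))))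
          ; (empty-part {y} yY big h h′) → rest yY h h′ (1 ≤? count (minus Y y)) }
          where
          three-parts : ∀ {x y z w m} → x ≤ y + z → y ≤ m → z ≤ w + m → w ≤ m → x ≤ m + (m + (m + 0))
          three-parts {m = m} h hy hz hw = ≤-trans h (+-mono-≤ hy (≤-trans hz (+-mono-≤ hw (≤-reflexive (sym (+-identityʳ m))))))
          rest : ∀ {y} → y ∈ Y → Lacks a k₂ (part y) → Lacks a k₃ (minus Y y) → Dec (1 ≤ count (minus Y y)) → ⊥
          rest {y} yY h h′ (no none) = out (there (there (here refl))) (≤-trans (≤-trans (count-minus y) (+-mono-≤ (part-bound k₂ yY h) (≤-pred (≰⇒> none)))) (+-monoʳ-≤ (val k₂ k₂) z≤n))
          rest {y} yY h h′ (yes some) = let z , zm = pick₁ {Q = minus Y y} some in last z zm (1 ≤? count (minus (minus Y y) z))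
            where
            m⊆P : minus Y y ⊆ P
            m⊆P = Y⊆ ∘ minus⊆
            mcl : Closed (minus Y y)
            mcl = minus-closed (Y⊆ yY) Y⊆ cl
            last : ∀ z → z ∈ minus Y y → Dec (1 ≤ count (minus (minus Y y) z)) → ⊥
            last z zm (no none) = em {A = Has (e a) 2 0 (part z)} λ
              { (yes t) → out (there (there (here refl))) (V₂ {α = k₂} {k₂} {p₃} {k₂} (size-lemma (count-minus y) (part-bound k₂ yY h)
                  (≤-trans (≤-trans (count-minus z) (+-mono-≤ (part-bound p₃ (minus⊆ zm) (thin (m⊆P zm) t)) (≤-pred (≰⇒> none)))) (≤-reflexive (+-identityʳ _)))))
              ; (no t) → out (there (here refl)) (≤-trans (count-minus y) (+-mono-≤ (part-bound k₂ yY h)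
                  (≤-trans (≤-trans (count-minus z) (+-mono-≤ (part-bound k₂ (minus⊆ zm) t) (≤-pred (≰⇒> none)))) (+-monoʳ-≤ (val k₂ k₂) z≤n)))) }
            last z zm (yes more) = out (there (here refl)) (≤-trans (count-minus y) (+-mono-≤ (part-bound k₂ yY h) (≤-trans (count-minus z) (+-mono-≤
              (part-bound k₂ (minus⊆ zm) (λ t → h′ (Has-join (mcl zm) minus⊆ j t (Has-1 (proj₂ (pick₁ {Q = minus (minus Y y) z} more))))))
              (≤-trans (sub-bound k₂ (minus⊆ ∘ minus⊆) (λ t → h′ (Has-join (mcl zm) minus⊆ j (Has-1 (part-refl (m⊆P zm))) t))) (≤-reflexive (sym (+-identityʳ _))))))))
              where
              j = joined-minus zm m⊆P mcl (Lacks-⊆ {α = k₂} minus⊆ no-b)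

      -- The a-edges in Y form a matching. Hence a part with its a-neighbours in Y, the set `X y`,
      -- is joined in b to the rest `Z y`, as another a-edge would make a P₃. H₃ then splits in
      -- colour b, and every outcome fits under the same bound.
      matching-sizes : Lacks b h₃ P → (∀ {x} → x ∈ P → Big x → 2 ≤ count (N b x)) → ∀ {Y x₀} → Y ⊆ P → Closed Y → x₀ ∈ P → ¬ x₀ ∈ Y → Lacks a p₃ Y →
        count Y ≤ V ((p₃ , k₂) ∷ (p₃ , k₃) ∷ [])
      matching-sizes no-h two-b {Y} {x₀} Y⊆ cl x₀P x₀Y no-p = decidable-stable (count Y ≤? V ((p₃ , k₂) ∷ (p₃ , k₃) ∷ [])) λ out → go out (any? big?)
        where
        X? : ∀ y z → Dec (z ∈ Y × (z ∈ part y ⊎ z ∈ N a y))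
        X? y z = (z ∈? Y) ×-dec ((z ∈? part y) ⊎-dec (z ∈? N a y))
          where open import Relation.Nullary.Decidable using (_⊎-dec_)
        X : Fin n → VSet n
        X y = ⟨ X? y ⟩
        X⊆ : ∀ {y} → X y ⊆ Y
        X⊆ {y} = proj₁ ∘ ⟨⟩∈ (X? y)
        Z? : ∀ y z → Dec (z ∈ Y × z ∈ N b y)
        Z? y z = (z ∈? Y) ×-dec (z ∈? N b y)
        Z : Fin n → VSet n
        Z y = ⟨ Z? y ⟩
        Z⊆ : ∀ {y} → Z y ⊆ Y
        Z⊆ {y} = proj₁ ∘ ⟨⟩∈ (Z? y)
        big? : ∀ y → Dec (y ∈ Y × 2 ≤ count (X y))
        big? y = (y ∈? Y) ×-dec (2 ≤? count (X y))
        at-most-one : ∀ {y u v} → y ∈ Y → u ∈ Y → v ∈ Y → u ∈ N a y → v ∈ N a y → u ≡ v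
        at-most-one {y} {u} {v} yY uY vY un vn = decidable-stable (u ≟ v) λ ne →
          let d : ∀ w → Dec (w ∈ Y × w ∈ N a y)
              d w = (w ∈? Y) ×-dec (w ∈? N a y)
          in no-p (Has-join {A = ⟨ y ≟_ ⟩} {⟨ d ⟩} (λ h → subst (_∈ Y) (⟨⟩∈ (y ≟_) h) yY) (proj₁ ∘ ⟨⟩∈ d)
            (λ h w → joined {a} (Y⊆ yY) (subst (_∈ part y) (⟨⟩∈ (y ≟_) h) (part-refl (Y⊆ yY))) (proj₂ (⟨⟩∈ d w))) (Has-1 (∈⟨⟩ (y ≟_) refl))
            (Has-21 (unpick {ys = u ∷ v ∷ []} 2 (refl , (ne ∷ []) ∷ [] ∷ [] , ∈⟨⟩ d (uY , un) ∷ ∈⟨⟩ d (vY , vn) ∷ []))))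
        flip-N : ∀ {y u} → y ∈ P → u ∈ N a y → y ∈ N a u
        flip-N {y} {u} yp un = let up , nu , h = ⟨⟩∈ (N? a y) un in ∈⟨⟩ (N? a u) (yp , (λ q → nu (part-sym up q)) , trans (c-sym u y) h)
        go : ¬ (count Y ≤ V ((p₃ , k₂) ∷ (p₃ , k₃) ∷ [])) → Dec (∃ λ y → y ∈ Y × 2 ≤ count (X y)) → ⊥
        go out (no none) = out (≤-trans (clique-4 no-h Y⊆ λ {x} {y} xY yY ne →
            let apart′ : ¬ y ∈ X x
                apart′ h = none (x , xY , unpick {ys = x ∷ y ∷ []} 2 (refl , (ne ∷ []) ∷ [] ∷ [] , ∈⟨⟩ (X? x) (xY , inj₁ (part-refl (Y⊆ xY))) ∷ h ∷ []))
                ny = λ yx → apart′ (∈⟨⟩ (X? x) (yY , inj₁ yx))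
            in case across (Y⊆ xY) (Y⊆ yY) ny of λ { (inj₁ h) → ⊥-elim (apart′ (∈⟨⟩ (X? x) (yY , inj₂ (∈⟨⟩ (N? a x) (Y⊆ yY , ny , h))))) ; (inj₂ h) → e⁺ h })
          (≤-trans four (V-≤ ((p₃ , k₂) ∷ (p₃ , k₂) ∷ []) ((p₃ , k₂) ∷ (p₃ , k₃) ∷ []) refl s r p)))
        go out (yes (y , yY , big)) = em {A = Has (e b) 2 0 (Z y)} λ
            { (no ¬e) → fin (p₃ , k₃) (p₃ , k₂) refl (bX k₃ X-lacks) (bZ k₂ ¬e)
            ; (yes h) → em {A = Has (e b) 2 0 (X y)} λ
              { (no ¬e) → fin (p₃ , k₂) (p₃ , k₃) refl (bX k₂ ¬e) (bZ k₃ (λ t → no-h (Has-join (Y⊆ ∘ X⊆) (Y⊆ ∘ Z⊆) j (Has-21 big) t)))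
              ; (yes h′) → fin (p₃ , p₃) (p₃ , p₃) refl (bX p₃ (λ t → no-h (Has-join (Y⊆ ∘ X⊆) (Y⊆ ∘ Z⊆) j t h))) (bZ p₃ (λ t → no-h (Has-join (Y⊆ ∘ X⊆) (Y⊆ ∘ Z⊆) j h′ t))) } }
          where
          yP = Y⊆ yY
          bX : ∀ γ → Lacks b γ (X y) → count (X y) ≤ val p₃ γ
          bX γ h = bound p₃ γ (Y⊆ ∘ X⊆) x₀P (x₀Y ∘ X⊆) (Lacks-⊆ {α = p₃} X⊆ no-p) h
          bZ : ∀ γ → Lacks b γ (Z y) → count (Z y) ≤ val p₃ γ
          bZ γ h = bound p₃ γ (Y⊆ ∘ Z⊆) x₀P (x₀Y ∘ Z⊆) (Lacks-⊆ {α = p₃} Z⊆ no-p) h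
          fin : ∀ σ τ → check (σ ∷ τ ∷ []) ((p₃ , k₂) ∷ (p₃ , k₃) ∷ []) ≡ true → count (X y) ≤ val (proj₁ σ) (proj₂ σ) → count (Z y) ≤ val (proj₁ τ) (proj₂ τ) → ⊥
          fin σ τ chk hX hZ = out (≤-trans (V₂ {α = proj₁ σ} {proj₂ σ} {proj₁ τ} {proj₂ τ} (≤-trans (count-∪ {A = X y} {Z y} split) (+-mono-≤ hX hZ))) (V-≤ (σ ∷ τ ∷ []) ((p₃ , k₂) ∷ (p₃ , k₃) ∷ []) chk s r p))
            where
            split : ∀ {z} → z ∈ Y → z ∈ X y ⊎ z ∈ Z y
            split {z} zY with z ∈? part y
            ... | yes h = inj₁ (∈⟨⟩ (X? y) (zY , inj₁ h))
            ... | no nh = case cover yP (Y⊆ zY) nh of λ { (inj₁ h) → inj₁ (∈⟨⟩ (X? y) (zY , inj₂ h)) ; (inj₂ h) → inj₂ (∈⟨⟩ (Z? y) (zY , h)) }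
          -- if y has an a-neighbour u in Y then X y = {y , u}
          no-b-edge : ∀ {u} → u ∈ Y → u ∈ N a y → ¬ Has (e b) 3 0 (X y)
          no-b-edge {u} uY un = Has-small (s≤s (≤-trans (count≤1+ {A = ⟨ y ≟_ ⟩} u λ {w} wX ne → ∈⟨⟩ (y ≟_) (lem wX ne)) (s≤s (count≤1 λ p q → trans (sym (⟨⟩∈ (y ≟_) p)) (⟨⟩∈ (y ≟_) q)))))
            where
            lem : ∀ {w} → w ∈ X y → w ≢ u → y ≡ w
            lem {w} wX ne with ⟨⟩∈ (X? y) wX
            ... | wY , inj₂ wn = ⊥-elim (ne (at-most-one yY wY uY wn un))
            ... | wY , inj₁ wy = at-most-one uY yY wY (flip-N yP un) (flip-N (Y⊆ wY) (let up , nu , h = ⟨⟩∈ (N? a y) un in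
                    ∈⟨⟩ (N? a w) (up , (λ uw → nu (part-trans wy uw)) , trans (sym (uniform yP wy up nu)) h)))
          X-lacks : Lacks b k₃ (X y)
          X-lacks h = case any? (λ u → (u ∈? Y) ×-dec (u ∈? N a y)) of λ
            { (yes (u , uY , un)) → no-b-edge uY un h
            ; (no none) → let X⊆part = λ {w} → in-part none {w} in
                no-h (Has-join part⊆ N⊆ (joined {b} yP) (Has-⊆ X⊆part h) (Has-21 (two-b yP (≤-trans big (count-mono X⊆part))))) }
            where
            in-part : ¬ (∃ λ u → u ∈ Y × u ∈ N a y) → X y ⊆ part y
            in-part none {w} wX with ⟨⟩∈ (X? y) wX
            ... | wY , inj₁ wy = wy
            ... | wY , inj₂ wn = ⊥-elim (none (w , wY , wn))
          j : Joined b (X y) (Z y)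
          j {u} {z} uX zZ with ⟨⟩∈ (X? y) uX | ⟨⟩∈ (Z? y) zZ
          ... | uY , inj₁ uy | zY , zn = joined {b} yP uy zn
          ... | uY , inj₂ un | zY , zn = ne , e⁺ (case across (Y⊆ uY) (Y⊆ zY) nzu of λ
                { (inj₂ h) → h
                ; (inj₁ h) → ⊥-elim (y≢z (at-most-one uY yY zY (flip-N yP un) (∈⟨⟩ (N? a u) (Y⊆ zY , nzu , h)))) })
            where
            zP = proj₁ (⟨⟩∈ (N? b y) zn)
            c-yz = proj₂ (proj₂ (⟨⟩∈ (N? b y) zn))
            uP = proj₁ (⟨⟩∈ (N? a y) un)
            c-yu = proj₂ (proj₂ (⟨⟩∈ (N? a y) un))
            ne : u ≢ z
            ne refl = a≢b (trans (sym c-yu) c-yz)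
            y≢z : y ≢ z
            y≢z refl = proj₁ (proj₂ (⟨⟩∈ (N? b y) zn)) (part-refl yP)
            nzu : ¬ z ∈ part u
            nzu zu = a≢b (trans (sym c-yu) (trans (c-sym y u) (trans (uniform uP zu yP (λ yu → proj₁ (proj₂ (⟨⟩∈ (N? a y) un)) (part-sym uP yu))) (trans (c-sym z y) c-yz))))

-- Counting the parts when some part has two vertices.

module BigParts where

  open Subsets
  open SmallRamsey
  open ExtremalNumber
  open GallaiPartition
  open Joins
  open Parts
  open PartSizes

  clique-edges : ∀ {n} {e : BGraph n} {ys} → Symm e → miss e ys ≤ 0 → ∀ {x y} → x ∈ˡ ys → y ∈ˡ ys → x ≢ y → e x y ≡ true
  clique-edges {e = e} {z ∷ zs} s m = go
    where
    row0 : row e z zs ≡ 0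
    row0 = m+n≡0⇒m≡0 (row e z zs) (n≤0⇒n≡0 m)
    along : ∀ {zs} → row e z zs ≡ 0 → ∀ {y} → y ∈ˡ zs → e z y ≡ true
    along {w ∷ ws} h (here refl) with e z w
    ... | true = refl
    ... | false = case h of λ ()
    along {w ∷ ws} h (there i) = along {ws} (m+n≡0⇒n≡0 (χ (not (e z w))) h) i
    go : ∀ {x y} → x ∈ˡ (z ∷ zs) → y ∈ˡ (z ∷ zs) → x ≢ y → e x y ≡ true
    go (here refl) (here refl) ne = ⊥-elim (ne refl)
    go (here refl) (there j) ne = along row0 j
    go {x} {y} (there i) (here refl) ne = trans (s x y) (along row0 i)
    go (there i) (there j) ne = clique-edges {ys = zs} s (≤-trans (m≤n+m _ _) m) i j ne

  row≤1 : ∀ {n} {e : BGraph n} {x y ys} → Unique ys → (∀ {z} → z ∈ˡ ys → z ≢ y → e x z ≡ true) → row e x ys ≤ 1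
  row≤1 [] h = z≤n
  row≤1 {e = e} {x} {y} {z ∷ zs} (u ∷ us) h with z ≟ y
  ... | no ne = ≤-trans (≤-reflexive (cong (λ b → χ (not b) + row e x zs) (h (here refl) ne))) (row≤1 us (h ∘ there))
  ... | yes refl = ≤-trans (+-mono-≤ (χ≤1 (not (e x z))) (≤-reflexive (row-0 (All.tabulate λ i → h (there i) λ { refl → All.lookup u i refl })))) (≤-reflexive (+-identityʳ 1))

  _∈ᴸ?_ : ∀ {n} (x : Fin n) (ys : List (Fin n)) → Dec (x ∈ˡ ys)
  x ∈ᴸ? ys = Any.any? (x ≟_) ys

  count-list : ∀ {n} (ys : List (Fin n)) → count ⟨ _∈ᴸ? ys ⟩ ≤ length ys
  count-list {n} [] = ≤-reflexive (sum-zero {n} λ _ → refl)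
  count-list (y ∷ ys) = ≤-trans (count≤1+ {A = ⟨ _∈ᴸ? ys ⟩} y λ p ne → case ⟨⟩∈ (_∈ᴸ? (y ∷ ys)) p of λ
    { (here e) → ⊥-elim (ne e) ; (there i) → ∈⟨⟩ (_∈ᴸ? ys) i }) (s≤s (count-list ys))

  -- Of K places of capacity w, t = K - b ≥ 3 are not taken by big parts. The σ ≤ t + 3j single
  -- vertices fit into them, since t + 3j ≤ t (1 + j) ≤ t w.
  few-singles : ∀ j {K q b σ w} → 1 + j ≤ w → b + 3 ≤ K → b + σ ≤ q → q ≤ K + 3 * j → b * w + σ ≤ K * w
  few-singles j {K} {q} {b} {σ} {w} hw hb hσ hq = begin
    b * w + σ            ≤⟨ +-monoʳ-≤ (b * w) (≤-trans σ≤ (+-monoʳ-≤ t (*-monoˡ-≤ j t≥3))) ⟩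
    b * w + (t + t * j)  ≡⟨ cong (b * w +_) (*-suc t j) ⟨
    b * w + t * (1 + j)  ≤⟨ +-monoʳ-≤ (b * w) (*-monoʳ-≤ t hw) ⟩
    b * w + t * w        ≡⟨ *-distribʳ-+ w b t ⟨
    (b + t) * w          ≡⟨ cong (_* w) b+t ⟩
    K * w                ∎
    where
    open ≤-Reasoning
    t = K ∸ b
    b+t : b + t ≡ K
    b+t = m+[n∸m]≡n (≤-trans (m≤m+n b 3) hb)
    t≥3 : 3 ≤ t
    t≥3 = +-cancelˡ-≤ b 3 t (≤-trans hb (≤-reflexive (sym b+t)))
    σ≤ : σ ≤ t + 3 * j
    σ≤ = +-cancelˡ-≤ b σ (t + 3 * j) (≤-trans hσ (≤-trans hq (≤-reflexive (trans (cong (_+ 3 * j) (sym b+t)) (+-assoc b t (3 * j))))))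

  module Case {n k} {c : Fin n → Fin n → Fin k} (c-sym : ∀ x y → c x y ≡ c y x)
    {gallai : ∀ x y z → x ≢ y → y ≢ z → x ≢ z → c x y ≢ c y z → c y z ≢ c x z → c x y ≢ c x z → ⊥} where

    open States c
    open Decomposition c c-sym gallai using (Join; Partition)
    open Two c-sym {gallai}
    open Cases c-sym {gallai}

    module Targets {P} (π : Partition P) {s r p l} (l≤r : l ≤ r) (bounded : Bounded π s r p l) (noJoin : ∀ {i} → Join i P → ⊥)
      {α β} (la : Lacks (Partition.a π) α P) (lb : Lacks (Partition.b π) β P) (nle : ¬ (count P + (l + (#d α + #d β)) ≤ Bounds.val s r p α β)) where

      open Sizes π {s} {r} {p} {l} l≤r bounded noJoin public
      module S′ = Sizes (swapped π) {s} {r} {p} {l} l≤r (Bounded-swap {π = π} {s} {r} {p} {l} bounded) noJoin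

      nle′ : ¬ (count P + (l + (#d β + #d α)) ≤ val β α)
      nle′ h = nle (subst₂ (λ t u → count P + (l + t) ≤ u) (+-comm (#d β) (#d α)) (val-comm s r p β α) h)

      two-a : ∀ {x} → x ∈ P → Big x → 2 ≤ count (N a x)
      two-a = two-neighbours {α} {β} la lb nle S′.N-nonempty

      two-b : ∀ {x} → x ∈ P → Big x → 2 ≤ count (N b x)
      two-b = S′.two-neighbours {β} {α} lb la nle′ N-nonempty

      -- P consists of one part and its two neighbourhoods. The slack l of the other colours is
      -- charged to the part, the slack of a and b to the b-neighbourhood.
      finish′ : ∀ {x} → x ∈ P → ∀ L₁ L₂ L₃ → count (part x) + l ≤ V L₁ → count (N a x) ≤ V L₂ → count (N b x) + (#d α + #d β) ≤ V L₃ →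
        V (L₁ ++ L₂ ++ L₃) ≤ V ((α , β) ∷ []) → ⊥
      finish′ {x} xP L₁ L₂ L₃ q₁ q₂ q₃ fits = nle (begin
        count P + (l + (#d α + #d β))                                  ≤⟨ +-monoˡ-≤ _ (count-P xP) ⟩
        (count (part x) + (count (N a x) + count (N b x))) + (l + (#d α + #d β)) ≡⟨ shuffle (count (part x)) (count (N a x)) (count (N b x)) (#d α + #d β) ⟩
        (count (part x) + l) + (count (N a x) + (count (N b x) + (#d α + #d β))) ≤⟨ +-mono-≤ q₁ (+-mono-≤ q₂ q₃) ⟩
        V L₁ + (V L₂ + V L₃)                                           ≡⟨ cong (V L₁ +_) (V-++ L₂ L₃) ⟨
        V L₁ + V (L₂ ++ L₃)                                            ≡⟨ V-++ L₁ (L₂ ++ L₃) ⟨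
        V (L₁ ++ L₂ ++ L₃)                                             ≤⟨ fits ⟩
        V ((α , β) ∷ [])                                               ≡⟨ V₁ α β ⟩
        val α β                                                        ∎)
        where
        open ≤-Reasoning
        shuffle : ∀ x y z d → (x + (y + z)) + (l + d) ≡ (x + l) + (y + (z + d))
        shuffle x y z d = trans (+-assoc x (y + z) (l + d)) (trans (cong (x +_) (trans (cong ((y + z) +_) (+-comm l d)) (trans (sym (+-assoc (y + z) d l)) (trans (cong (_+ l) (+-assoc y z d)) (+-comm _ l))))) (sym (+-assoc x l _)))

      finish : ∀ {x} → x ∈ P → ∀ L₁ L₂ L₃ L₄ → count (part x) + l ≤ V L₁ → count (N a x) ≤ V L₂ → count (N b x) ≤ V L₃ → #d α + #d β ≤ V L₄ →
        check (L₁ ++ L₂ ++ L₃ ++ L₄) ((α , β) ∷ []) ≡ true → ⊥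
      finish xP L₁ L₂ L₃ L₄ q₁ q₂ q₃ q₄ chk = finish′ xP L₁ L₂ (L₃ ++ L₄) q₁ q₂ (≤-trans (+-mono-≤ q₃ q₄) (≤-reflexive (sym (V-++ L₃ L₄))))
        (V-≤ (L₁ ++ L₂ ++ L₃ ++ L₄) ((α , β) ∷ []) chk s r p)

      part-bound : ∀ {x} γ δ → x ∈ P → Lacks a γ (part x) → Lacks b δ (part x) → count (part x) ≤ val γ δ
      part-bound γ δ xP h h′ = let y , yP , ny = outside xP in bound γ δ part⊆ yP ny h h′

      part-bound-l : ∀ {x} γ δ → x ∈ P → Lacks a γ (part x) → Lacks b δ (part x) → count (part x) + l ≤ V ((γ , δ) ∷ [])
      part-bound-l γ δ xP h h′ = let y , yP , ny = outside xP in ≤-trans (bound-l γ δ part⊆ yP ny h h′) (≤-reflexive (sym (V₁ γ δ)))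

      Na-bound : ∀ {x} γ δ → x ∈ P → Lacks a γ (N a x) → Lacks b δ (N a x) → count (N a x) ≤ V ((γ , δ) ∷ [])
      Na-bound γ δ xP h h′ = ≤-trans (bound γ δ N⊆ xP (x∉N xP) h h′) (≤-reflexive (sym (V₁ γ δ)))

      Nb-bound : ∀ {x} γ δ → x ∈ P → Lacks a γ (N b x) → Lacks b δ (N b x) → count (N b x) ≤ V ((γ , δ) ∷ [])
      Nb-bound γ δ xP h h′ = ≤-trans (bound γ δ N⊆ xP (x∉N xP) h h′) (≤-reflexive (sym (V₁ γ δ)))

      reps-cover : Covers (e a) (e b) reps
      reps-cover {x} {y} xr yr ne = case across (reps⊆ xr) (reps⊆ yr) (λ yx → ne (rep-unique xr yr yx)) of λ { (inj₁ h) → inj₁ (e⁺ h) ; (inj₂ h) → inj₂ (e⁺ h) }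

      big-rep? : ∀ x → Dec (x ∈ reps × Big x)
      big-rep? x = (x ∈? reps) ×-dec (2 ≤? count (part x))

      single-rep? : ∀ x → Dec (x ∈ reps × ¬ Big x)
      single-rep? x = (x ∈? reps) ×-dec ¬? (2 ≤? count (part x))

      count-reps : ∀ w → (∀ {x} → x ∈ P → count (part x) ≤ w) → count P ≤ count ⟨ big-rep? ⟩ * w + count ⟨ single-rep? ⟩
      count-reps w h = begin
        count P                                                     ≤⟨ sum-mono (λ y → covered y (P y) refl) ⟩
        sum (λ y → sum (λ x → χ (reps x) * χ (part x y)))           ≡⟨ ∑-comm (λ y x → χ (reps x) * χ (part x y)) ⟩
        sum (λ x → sum (λ y → χ (reps x) * χ (part x y)))           ≡⟨ sum-cong-≗ (λ x → *-distribˡ-sum (χ (reps x)) (χ ∘ part x)) ⟨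
        sum (λ x → χ (reps x) * count (part x))                     ≤⟨ sum-mono (λ x → weigh x (reps x) refl) ⟩
        sum (λ x → χ (⟨ big-rep? ⟩ x) * w + χ (⟨ single-rep? ⟩ x))  ≡⟨ ∑-distrib-+ (λ x → χ (⟨ big-rep? ⟩ x) * w) (χ ∘ ⟨ single-rep? ⟩) ⟩
        sum (λ x → χ (⟨ big-rep? ⟩ x) * w) + count ⟨ single-rep? ⟩  ≡⟨ cong (_+ count ⟨ single-rep? ⟩) (*-distribʳ-sum w (χ ∘ ⟨ big-rep? ⟩)) ⟨
        count ⟨ big-rep? ⟩ * w + count ⟨ single-rep? ⟩              ∎
        where
        open ≤-Reasoning
        covered : ∀ y t → P y ≡ t → χ t ≤ sum (λ x → χ (reps x) * χ (part x y))
        covered y false _ = z≤n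
        covered y true q = let x , xr , yx = rep (mem q) in
          ≤-trans (≤-reflexive (sym (cong₂ (λ t u → χ t * χ u) (_∈_.holds xr) (_∈_.holds yx)))) (term≤sum (λ x → χ (reps x) * χ (part x y)) x)
        weigh : ∀ x t → reps x ≡ t → χ t * count (part x) ≤ χ (⟨ big-rep? ⟩ x) * w + χ (⟨ single-rep? ⟩ x)
        weigh x false _ = z≤n
        weigh x true q with 2 ≤? count (part x)
        ... | yes big = ≤-trans (≤-reflexive (*-identityˡ _)) (≤-trans (h (reps⊆ (mem q))) (≤-trans (≤-reflexive (sym (trans (cong (λ t → χ t * w) (_∈_.holds (∈⟨⟩ big-rep? (mem q , big)))) (*-identityˡ w)))) (m≤m+n _ _)))
        ... | no nb = ≤-trans (≤-reflexive (*-identityˡ _)) (≤-trans (≤-pred (≰⇒> nb)) (≤-trans (≤-reflexive (sym (cong χ (_∈_.holds (∈⟨⟩ single-rep? (mem q , nb)))))) (m≤n+m _ _)))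

      big+single : count ⟨ big-rep? ⟩ + count ⟨ single-rep? ⟩ ≤ count reps
      big+single = count-⊎ (proj₁ ∘ ⟨⟩∈ big-rep?) (proj₁ ∘ ⟨⟩∈ single-rep?) (λ p q → proj₂ (⟨⟩∈ single-rep? q) (proj₂ (⟨⟩∈ big-rep? p)))

      -- four representatives of mutually i-joined parts, one of them big, would give H₃
      no-K₄ : ∀ {i T} → Lacks i h₃ P → T ⊆ reps → (∀ Z → Z ⊆ T → Z ⊆ ⟨ single-rep? ⟩ → count Z ≤ 3) → ¬ Has (e i) 4 0 T
      no-K₄ {i} {T} no-h g few (ys , (len , u , q) , m) with Any.any? (λ y → 2 ≤? count (part y)) ys
      ... | no none = <-irrefl refl (≤-trans (unpick {Q = Z} {ys} 4 (len , u , All.tabulate λ {z} iz → ∈⟨⟩ Z? (All.lookup q iz , λ big → none (Any.map (λ { refl → big }) iz)))) (few Z (proj₁ ∘ ⟨⟩∈ Z?) (λ h → ∈⟨⟩ single-rep? (g (proj₁ (⟨⟩∈ Z? h)) , proj₂ (⟨⟩∈ Z? h)))))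
        where
        Z? : ∀ z → Dec (z ∈ T × ¬ Big z)
        Z? z = (z ∈? T) ×-dec ¬? (2 ≤? count (part z))
        Z = ⟨ Z? ⟩
      ... | yes some = let y , iy , big = find some in twin y iy big (pick 2 big)
        where
        open import Data.List.Membership.Propositional using (find)
        -- A second vertex z of the big part is joined like y to the other three representatives.
        -- Only the pair y, z can fail, so these five vertices miss at most one edge.
        twin : ∀ y → y ∈ˡ ys → Big y → ∃ (Picks 2 (part y)) → ⊥
        twin y iy big (z₁ ∷ z₂ ∷ [] , _ , (z₁≢z₂ ∷ _) ∷ _ , z₁y ∷ z₂y ∷ _) = case z₁ ≟ y of λ
          { (no ne) → use z₁ z₁y ne ; (yes refl) → use z₂ z₂y (z₁≢z₂ ∘ sym) }
          where
          yr : ∀ {z} → z ∈ˡ ys → z ∈ reps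
          yr iz = g (All.lookup q iz)
          use : ∀ z → z ∈ part y → z ≢ y → ⊥
          use z zy ne = no-h (z ∷ ys , (cong suc len ,
              All.tabulate (λ { iw refl → ne (sym (rep-unique (yr iy) (yr iw) zy)) }) ∷ u , part⊆ zy ∷ All.map (reps⊆ ∘ g) q) ,
            +-mono-≤ (row≤1 {y = y} u λ {w} iw w≢y → e⁺ (trans (sym (uniform (reps⊆ (yr iy)) zy (reps⊆ (yr iw)) (λ wy → w≢y (sym (rep-unique (yr iy) (yr iw) wy)))))
              (e⁻ (clique-edges (e-sym i) m iy iw (w≢y ∘ sym))))) m)

      -- K bounds the number of parts when few of them are single, q in general
      few-parts : ∀ K q w → (∀ T → T ⊆ reps → (∀ Z → Z ⊆ T → Z ⊆ ⟨ single-rep? ⟩ → count Z ≤ 3) → count T ≤ K) → count reps ≤ q → 1 ≤ w →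
        (∀ {x} → x ∈ P → count (part x) ≤ w) → count P ≤ K * w ⊎ (∃ λ b → ∃ λ σ → b + 3 ≤ K × b + σ ≤ q × count P ≤ b * w + σ)
      few-parts K q w small hq hw h with 3 ≤? count ⟨ single-rep? ⟩
      ... | no few = inj₁ (≤-trans (count-reps w h) (≤-trans (+-monoʳ-≤ (count ⟨ big-rep? ⟩ * w) (≤-trans (≤-reflexive (sym (*-identityʳ _))) (*-monoʳ-≤ (count ⟨ single-rep? ⟩) hw)))
            (≤-trans (≤-reflexive (sym (*-distribʳ-+ w (count ⟨ big-rep? ⟩) (count ⟨ single-rep? ⟩)))) (*-monoˡ-≤ w (≤-trans big+single
              (small reps (λ x → x) (λ Z _ g → ≤-trans (count-mono g) (≤-trans (≤-pred (≰⇒> few)) (s≤s (s≤s z≤n))))))))))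
      -- All big representatives together with just three single ones still obey the bound K, which
      -- gives b + 3 ≤ K.
      ... | yes three = inj₂ (count ⟨ big-rep? ⟩ , count ⟨ single-rep? ⟩ , few-big (pick 3 three) , ≤-trans big+single hq , count-reps w h)
        where
        few-big : ∃ (Picks 3 ⟨ single-rep? ⟩) → count ⟨ big-rep? ⟩ + 3 ≤ K
        few-big (zs , (len , u , q)) = ≤-trans (+-monoʳ-≤ (count ⟨ big-rep? ⟩) (unpick {Q = ⟨ _∈ᴸ? zs ⟩} {zs} 3 (len , u , All.tabulate (∈⟨⟩ (_∈ᴸ? zs)))))
          (≤-trans (count-⊎ {Q = T} {⟨ big-rep? ⟩} {⟨ _∈ᴸ? zs ⟩} (λ h → ∈⟨⟩ T? (inj₁ h)) (λ h → ∈⟨⟩ T? (inj₂ (⟨⟩∈ (_∈ᴸ? zs) h)))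
              (λ h h′ → proj₂ (⟨⟩∈ single-rep? (All.lookup q (⟨⟩∈ (_∈ᴸ? zs) h′))) (proj₂ (⟨⟩∈ big-rep? h))))
            (small T (λ h → case ⟨⟩∈ T? h of λ { (inj₁ b) → proj₁ (⟨⟩∈ big-rep? b) ; (inj₂ i) → proj₁ (⟨⟩∈ single-rep? (All.lookup q i)) })
              (λ Z g g′ → ≤-trans (count-mono {B = ⟨ _∈ᴸ? zs ⟩} λ zZ → case ⟨⟩∈ T? (g zZ) of λ
                { (inj₁ b) → ⊥-elim (proj₂ (⟨⟩∈ single-rep? (g′ zZ)) (proj₂ (⟨⟩∈ big-rep? b))) ; (inj₂ i) → ∈⟨⟩ (_∈ᴸ? zs) i }) (≤-trans (count-list zs) (≤-reflexive len)))))
          where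
          T? : ∀ x → Dec (x ∈ ⟨ big-rep? ⟩ ⊎ x ∈ˡ zs)
          T? x = (x ∈? ⟨ big-rep? ⟩) ⊎-dec (x ∈ᴸ? zs)
            where open import Relation.Nullary.Decidable using (_⊎-dec_)
          T = ⟨ T? ⟩

      m = val k₂ k₂
      -- A bound for a part with edges of neither a nor b inside, the slack of the other colours
      -- being deducted.
      w = m ∸ l

      all-small : (∀ {x} → x ∈ P → Lacks a k₂ (part x) × Lacks b k₂ (part x)) → ∀ {x} → x ∈ P → count (part x) ≤ w
      all-small h {x} xP = m+n≤o⇒m≤o∸n (count (part x)) (≤-trans (part-bound-l k₂ k₂ xP (proj₁ (h xP)) (proj₂ (h xP))) (≤-reflexive (V₁ k₂ k₂)))

      l<m : l < m
      l<m = ≤-trans (s≤s l≤r) (room k₂ k₂ 1 refl s r p)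

      w+l : w + l ≡ m
      w+l = m∸n+n≡m (<⇒≤ l<m)

      w≥1 : 1 ≤ w
      w≥1 = m<n⇒0<n∸m l<m

      copies : ℕ → Pairs
      copies zero = []
      copies (suc j) = (k₂ , k₂) ∷ copies j

      V-copies : ∀ j → V (copies j) ≡ j * m
      V-copies zero = refl
      V-copies (suc j) = cong (m +_) (V-copies j)

      -- at most K + 1 copies of w, that is K * m with room for l
      finish-copies : ∀ K → #d α + #d β ≡ 0 → check (copies (suc K)) ((α , β) ∷ []) ≡ true → count P ≤ suc K * w → ⊥
      finish-copies K d0 chk h = nle (begin
        count P + (l + (#d α + #d β))   ≡⟨ cong (λ t → count P + (l + t)) d0 ⟩
        count P + (l + 0)               ≤⟨ +-mono-≤ h (≤-trans (≤-reflexive (+-identityʳ l)) (m≤m+n l (K * l))) ⟩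
        suc K * w + suc K * l           ≡⟨ *-distribˡ-+ (suc K) w l ⟨
        suc K * (w + l)                 ≡⟨ cong (suc K *_) w+l ⟩
        suc K * m                       ≡⟨ V-copies (suc K) ⟨
        V (copies (suc K))              ≤⟨ V-≤ (copies (suc K)) ((α , β) ∷ []) chk s r p ⟩
        V ((α , β) ∷ [])                ≡⟨ V₁ α β ⟩
        val α β                         ∎)
        where open ≤-Reasoning

-- Partitions in which one of the two colours forbids K₃.

module Combinations where

  open Subsets
  open SmallRamsey
  open Enumeration using (all-sound)
  open ExtremalNumber
  open GallaiPartition
  open Joins
  open Parts
  open TwoColours using (J₅-K₃)
  open PartSizes
  open TwoColours using (J₄-K₃-6)
  open BigParts

  -- every combination of the sizes in Ls and Ms fits, together with L₁ and L₄, into (α , β)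
  checkAll : Pairs → List Pairs → List Pairs → Pairs → Target × Target → Bool
  checkAll L₁ Ls Ms L₄ αβ = all (λ L → all (λ M → check (L₁ ++ L ++ M ++ L₄) (αβ ∷ [])) Ms) Ls

  checkAll-sound : ∀ L₁ Ls Ms L₄ αβ → checkAll L₁ Ls Ms L₄ αβ ≡ true → ∀ {L M} → L ∈ˡ Ls → M ∈ˡ Ms → check (L₁ ++ L ++ M ++ L₄) (αβ ∷ []) ≡ true
  checkAll-sound L₁ Ls Ms L₄ αβ h {L} i j = all-sound (λ M → check (L₁ ++ L ++ M ++ L₄) (αβ ∷ [])) (all-sound (λ L → all (λ M → check (L₁ ++ L ++ M ++ L₄) (αβ ∷ [])) Ms) h i) j

  module Prime {n k} {c : Fin n → Fin n → Fin k} (c-sym : ∀ x y → c x y ≡ c y x)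
    {gallai : ∀ x y z → x ≢ y → y ≢ z → x ≢ z → c x y ≢ c y z → c y z ≢ c x z → c x y ≢ c x z → ⊥} where

    open States c
    open Decomposition c c-sym gallai using (Join; Partition)
    open Two c-sym {gallai}
    open Cases c-sym {gallai}
    open Case c-sym {gallai}

    module TwoColour {P} (π : Partition P) {s r p l} (l≤r : l ≤ r) (bounded : Bounded π s r p l) (noJoin : ∀ {i} → Join i P → ⊥) where

      open Sizes π {s} {r} {p} {l} l≤r bounded noJoin

      -- If all parts in Y are single, the H₃/K₃ bound 10 = 1 + 5 + 4 fits. Otherwise a big part
      -- stands against its a-neighbours N₁ and b-neighbours N₂ in Y. A b-edge in N₂ would be a K₃
      -- with y, so `OneColour` bounds N₂, while H₃ splits in colour a between the part and N₁. A
      -- b-edge in the part makes N₂ empty.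
      two-colour-sizes : Lacks a h₃ P → (∀ {x} → x ∈ P → Big x → 2 ≤ count (N a x)) →
        (∀ {x} → x ∈ P → Has (e a) 2 0 (part x) → Lacks b k₂ (part x)) →
        ∀ {Y x₀} → Y ⊆ P → Closed Y → x₀ ∈ P → ¬ x₀ ∈ Y → Lacks b k₃ Y → (∀ {L} → L ∈ˡ two-colour → count Y ≤ V L → ⊥) → ⊥
      two-colour-sizes no-h two-a not-both {Y} {x₀} Y⊆ cl x₀P x₀Y no-k out with has-big Y
      ... | no none = out (there (here refl)) (≤-trans (J₅-K₃ (e a) (e b) (e-sym a) (spread Y⊆ none) (no-h ∘ Has-⊆ Y⊆) no-k) ten)
        where
        ten : 10 ≤ V ((k₂ , k₂) ∷ (k₃ , k₃) ∷ (p₃ , k₂) ∷ (p₃ , k₂) ∷ [])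
        ten = +-mono-≤ {1} {val k₂ k₂} (≤-trans (s≤s z≤n) (room k₂ k₂ 1 refl s r p)) (+-mono-≤ {5} {val k₃ k₃} (≤-trans (m≤m+n 5 r) (room k₃ k₃ 5 refl s r p)) four)
      ... | yes (y , yY , big) = em {A = Has (e b) 2 0 (part y)} λ
          { (yes h) → out (there (there (there (there (there (there (here refl))))))) (V₂ {α = k₂} {k₃} {k₃} {k₃}
              (≤-trans whole (≤-trans (+-mono-≤ (in-part k₂ k₃ (λ t → not-both yP t h) (no-k ∘ Has-⊆ (cl yY))) (+-mono-≤ (in-N₁ k₃ k₃ N₁-a (no-k ∘ Has-⊆ N₁⊆)) (empty h)))
                (≤-reflexive (cong (val k₂ k₃ +_) (+-identityʳ _))))))
          ; (no ¬h) → em {A = Has (e a) 2 0 (part y)} λ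
            { (no ¬g) → W.sizes λ {L} i hL → out (∈-++⁺ˡ (∈-map⁺ (λ W → (k₂ , k₂) ∷ (k₃ , k₃) ∷ W) i))
                (≤-trans whole (+-mono-≤ (in-part k₂ k₂ ¬g ¬h) (+-mono-≤ (in-N₁ k₃ k₃ N₁-a (no-k ∘ Has-⊆ N₁⊆)) hL)))
            ; (yes g) → em {A = Has (e a) 2 0 N₁} λ
              { (yes g′) → W.sizes λ {L} i hL → out (∈-++⁺ʳ (map (λ W → (k₂ , k₂) ∷ (k₃ , k₃) ∷ W) one-colour) (∈-++⁺ˡ (∈-map⁺ (λ W → (p₃ , k₂) ∷ (p₃ , k₃) ∷ W) i)))
                  (≤-trans whole (+-mono-≤ (in-part p₃ k₂ (λ t → no-h (Has-join part⊆ (Y⊆ ∘ N₁⊆) (j {a} N₁⊆N) t g′)) ¬h)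
                    (+-mono-≤ (in-N₁ p₃ k₃ (λ t → no-h (Has-join part⊆ (Y⊆ ∘ N₁⊆) (j {a} N₁⊆N) g t)) (no-k ∘ Has-⊆ N₁⊆)) hL)))
              ; (no ¬g′) → W.sizes λ {L} i hL → out (∈-++⁺ʳ (map (λ W → (k₂ , k₂) ∷ (k₃ , k₃) ∷ W) one-colour)
                    (∈-++⁺ʳ (map (λ W → (p₃ , k₂) ∷ (p₃ , k₃) ∷ W) one-colour) (∈-++⁺ˡ (∈-map⁺ (λ W → (k₃ , k₂) ∷ (k₂ , k₃) ∷ W) i))))
                  (≤-trans whole (+-mono-≤ (in-part k₃ k₂ (λ t → no-h (Has-join part⊆ N⊆ (joined {a} yP) t (Has-21 (two-a yP big)))) ¬h)
                    (+-mono-≤ (in-N₁ k₂ k₃ ¬g′ (no-k ∘ Has-⊆ N₁⊆)) hL))) } } }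
        where
        yP = Y⊆ yY
        N₁? : ∀ z → Dec (z ∈ Y × z ∈ N a y)
        N₁? z = (z ∈? Y) ×-dec (z ∈? N a y)
        N₁ : VSet n
        N₁ = ⟨ N₁? ⟩
        N₂? : ∀ z → Dec (z ∈ Y × z ∈ N b y)
        N₂? z = (z ∈? Y) ×-dec (z ∈? N b y)
        N₂ : VSet n
        N₂ = ⟨ N₂? ⟩
        N₁⊆ : N₁ ⊆ Y
        N₁⊆ = proj₁ ∘ ⟨⟩∈ N₁?
        N₂⊆ : N₂ ⊆ Y
        N₂⊆ = proj₁ ∘ ⟨⟩∈ N₂?
        N₁⊆N : N₁ ⊆ N a y
        N₁⊆N = proj₂ ∘ ⟨⟩∈ N₁?
        j : ∀ {i Z} → Z ⊆ N i y → Joined i (part y) Z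
        j g p q = joined yP p (g q)
        N₁-a : Lacks a k₃ N₁
        N₁-a t = no-h (Has-join part⊆ (Y⊆ ∘ N₁⊆) (j {a} N₁⊆N) (Has-21 big) t)
        whole : count Y ≤ count (part y) + (count N₁ + count N₂)
        whole = ≤-trans (count-minus y) (+-monoʳ-≤ (count (part y)) (count-∪ λ zm → let zY , nz = ⟨⟩∈ (minus? Y y) zm in
          case cover yP (Y⊆ zY) nz of λ { (inj₁ h) → inj₁ (∈⟨⟩ N₁? (zY , h)) ; (inj₂ h) → inj₂ (∈⟨⟩ N₂? (zY , h)) }))
        in-part : ∀ γ δ → Lacks a γ (part y) → Lacks b δ (part y) → count (part y) ≤ val γ δ
        in-part γ δ h h′ = bound γ δ part⊆ x₀P (x₀Y ∘ cl yY) h h′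
        in-N₁ : ∀ γ δ → Lacks a γ N₁ → Lacks b δ N₁ → count N₁ ≤ val γ δ
        in-N₁ γ δ h h′ = bound γ δ (Y⊆ ∘ N₁⊆) x₀P (x₀Y ∘ N₁⊆) h h′
        empty : Has (e b) 2 0 (part y) → count N₂ ≤ 0
        empty h with 1 ≤? count N₂
        ... | no z = ≤-pred (≰⇒> z)
        ... | yes some = ⊥-elim (no-k (Has-join (cl yY) N₂⊆ (j {b} (proj₂ ∘ ⟨⟩∈ N₂?)) h (Has-1 (proj₂ (pick₁ {Q = N₂} some)))))
        N₂-closed : Closed N₂
        N₂-closed q zq = let qY , qN = ⟨⟩∈ N₂? q in ∈⟨⟩ N₂? (cl qY zq , N-closed yP qN zq)
        module W = OneColour no-h two-a {N₂} {x₀} (Y⊆ ∘ N₂⊆) N₂-closed x₀P (x₀Y ∘ N₂⊆)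
          (λ t → no-k (Has-join {A = ⟨ y ≟_ ⟩} (λ q → subst (_∈ Y) (⟨⟩∈ (y ≟_) q) yY) N₂⊆
            (λ q z → joined {b} yP (subst (_∈ part y) (⟨⟩∈ (y ≟_) q) (part-refl yP)) (proj₂ (⟨⟩∈ N₂? z))) (Has-1 (∈⟨⟩ (y ≟_) refl)) t))

    module _ {P} (π : Partition P) {s r p l} (l≤r : l ≤ r) (bounded : Bounded π s r p l) (noJoin : ∀ {i} → Join i P → ⊥) (some : 2 ≤ count P) where

      private
        x₀ : ∃ (_∈ P)
        x₀ = pick₁ {Q = P} (≤-trans (s≤s z≤n) some)

      module K₃K₃ (la : Lacks (Partition.a π) k₃ P) (lb : Lacks (Partition.b π) k₃ P) (nle : ¬ (count P + (l + 0) ≤ Bounds.val s r p k₃ k₃)) where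
        open Targets π {s} {r} {p} {l} l≤r bounded noJoin {k₃} {k₃} la lb nle

        contradiction′ : ⊥
        contradiction′ = finish-copies 4 refl refl (≤-trans (count-reps w parts) (≤-trans (+-monoʳ-≤ _ (≤-trans (≤-reflexive (sym (*-identityʳ _))) (*-monoʳ-≤ (count ⟨ single-rep? ⟩) w≥1)))
          (≤-trans (≤-reflexive (sym (*-distribʳ-+ w (count ⟨ big-rep? ⟩) (count ⟨ single-rep? ⟩)))) (*-monoˡ-≤ w (≤-trans big+single
            (K₃-K₃ (e a) (e b) reps-cover (Lacks-⊆ {α = k₃} reps⊆ la) (Lacks-⊆ {α = k₃} reps⊆ lb)))))))
          where
          parts : ∀ {x} → x ∈ P → count (part x) ≤ w
          parts = all-small λ xP → (λ h → la (Has-join part⊆ N⊆ (joined {a} xP) h (Has-1 (proj₂ (pick₁ {Q = N a _} (N-nonempty xP)))))) ,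
            (λ h → lb (Has-join part⊆ N⊆ (joined {b} xP) h (Has-1 (proj₂ (pick₁ {Q = N b _} (S′.N-nonempty xP))))))

      module D₄K₃ (la : Lacks (Partition.a π) d₄ P) (lb : Lacks (Partition.b π) k₃ P) (nle : ¬ (count P + (l + 1) ≤ Bounds.val s r p d₄ k₃)) where
        open Targets π {s} {r} {p} {l} l≤r bounded noJoin {d₄} {k₃} la lb nle

        contradiction′ : ⊥
        contradiction′ with has-big P
        ... | no none = nle (≤-trans (+-mono-≤ (J₄-K₃-6 (e a) (e b) (spread (λ q → q) none) la lb) (+-monoˡ-≤ 1 l≤r)) (≤-trans (≤-trans (≤-reflexive (cong (6 +_) (+-comm r 1))) (+-monoˡ-≤ r (m≤m+n 7 3))) (room h₃ k₃ 10 refl s r p)))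
        ... | yes (x , xP , big) = finish′ xP ((k₂ , k₂) ∷ []) ((k₂ , k₃) ∷ []) ((d₄ , k₂) ∷ [])
            (part-bound-l k₂ k₂ xP (λ h → la (Has-join part⊆ N⊆ (joined {a} xP) h (Has-21 (two-a xP big)))) (λ h → lb (Has-join part⊆ N⊆ (joined {b} xP) h (Has-1 (proj₂ (pick₁ {Q = N b x} (S′.N-nonempty xP)))))))
            (Na-bound k₂ k₃ xP (λ h → la (Has-join part⊆ N⊆ (joined {a} xP) (Has-21 big) h)) (Lacks-⊆ {α = k₃} N⊆ lb))
            (≤-trans (≤-trans (+-monoʳ-≤ (count (N b x)) (m≤n+m 1 l)) (bounded d₄ k₂ N⊆ xP (x∉N xP) (Lacks-⊆ {α = d₄} N⊆ la) (λ h → lb (Has-join part⊆ N⊆ (joined {b} xP) (Has-1 (part-refl xP)) h)))) (≤-reflexive (sym (V₁ d₄ k₂))))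
            (V-≤ ((k₂ , k₂) ∷ (k₂ , k₃) ∷ (d₄ , k₂) ∷ []) ((d₄ , k₃) ∷ []) refl s r p)

      module H₃K₃ (la : Lacks (Partition.a π) h₃ P) (lb : Lacks (Partition.b π) k₃ P) (nle : ¬ (count P + (l + 0) ≤ Bounds.val s r p h₃ k₃)) where
        open Targets π {s} {r} {p} {l} l≤r bounded noJoin {h₃} {k₃} la lb nle

        part-b : ∀ {x} → x ∈ P → Lacks b k₂ (part x)
        part-b {x} xP h = lb (Has-join part⊆ N⊆ (joined {b} xP) h (Has-1 (proj₂ (pick₁ {Q = N b x} (S′.N-nonempty xP)))))

        Nb-empty : ∀ {x} → x ∈ P → Lacks b k₂ (N b x)
        Nb-empty xP h = lb (Has-join part⊆ N⊆ (joined {b} xP) (Has-1 (part-refl xP)) h)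

        Edgy : Fin n → Set
        Edgy x = x ∈ P × Has (e a) 2 0 (part x)

        edge-in-N : ∀ {x} → Edgy x → Has (e a) 2 0 (N a x) → Lacks a p₃ (part x)
        edge-in-N (xP , _) h t = la (Has-join part⊆ N⊆ (joined {a} xP) t h)

        plain : (∀ {x} → ¬ Edgy x) → ⊥
        plain none with has-big P
        ... | no nobig = nle (≤-trans (+-mono-≤ (J₅-K₃ (e a) (e b) (e-sym a) (spread (λ q → q) nobig) la lb) (≤-trans (≤-reflexive (+-identityʳ l)) l≤r)) (room h₃ k₃ 10 refl s r p))
        -- There are at most 8 = R(4,3) - 1 parts when few of them are single, and 10 in general;
        -- the big part ensures w ≥ 2.
        ... | yes (x , xP , big) = finish-copies 7 refl refl (case few-parts 8 10 w small (J₅-K₃ (e a) (e b) (e-sym a) reps-cover (Lacks-⊆ {α = h₃} reps⊆ la) (Lacks-⊆ {α = k₃} reps⊆ lb)) w≥1 parts of λ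
            { (inj₁ h) → h
            ; (inj₂ (bb , σ , h , h′ , h″)) → ≤-trans h″ (few-singles 1 (≤-trans big (parts xP)) h h′ (m≤n+m 10 1)) })
          where
          parts : ∀ {x} → x ∈ P → count (part x) ≤ w
          parts = all-small λ xP → (λ h → none (xP , h)) , part-b xP
          small : ∀ T → T ⊆ reps → (∀ Z → Z ⊆ T → Z ⊆ ⟨ single-rep? ⟩ → count Z ≤ 3) → count T ≤ 8
          small T g few = K₄-K₃ (e a) (e b) (e-sym b) (λ p q → reps-cover (g p) (g q)) (no-K₄ la g few) (Lacks-⊆ {α = k₃} (reps⊆ ∘ g) lb)

        module WB {x} (xP : x ∈ P) = OneColour la two-a {N b x} {x} N⊆ (N-closed xP) xP (x∉N xP) (Nb-empty xP)

        -- Any y in N a x divides this set into the part of y with its a-neighbours, and the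
        -- b-neighbours of y. The second half has no b-edge because b avoids K₃; the first has none
        -- because parts contain no b-edge and y has at most one a-neighbour in N a x.
        two-parts : ∀ {x} γ → x ∈ P → Lacks a γ (N a x) → γ ≡ k₂ ⊎ γ ≡ p₃ → count (N a x) ≤ V ((γ , k₂) ∷ (γ , k₂) ∷ [])
        two-parts {x} γ xP lγ sh = V₂ {α = γ} {k₂} {γ} {k₂} (≤-trans (count-∪ {A = ⟨ X? ⟩} {⟨ Z? ⟩} split) (+-mono-≤
            (bound γ k₂ (N⊆ ∘ X⊆) xP (x∉N xP ∘ X⊆) (Lacks-⊆ {α = γ} X⊆ lγ) X-empty)
            (bound γ k₂ (N⊆ ∘ Z⊆) xP (x∉N xP ∘ Z⊆) (Lacks-⊆ {α = γ} Z⊆ lγ) (Nb-empty yP ∘ Has-⊆ (proj₂ ∘ ⟨⟩∈ Z?)))))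
          where
          y = proj₁ (pick₁ {Q = N a x} (N-nonempty xP))
          yN : y ∈ N a x
          yN = proj₂ (pick₁ {Q = N a x} (N-nonempty xP))
          yP = N⊆ {a} {x} yN
          X? : ∀ z → Dec (z ∈ N a x × (z ∈ part y ⊎ z ∈ N a y))
          X? z = (z ∈? N a x) ×-dec ((z ∈? part y) ⊎-dec (z ∈? N a y))
            where open import Relation.Nullary.Decidable using (_⊎-dec_)
          Z? : ∀ z → Dec (z ∈ N a x × z ∈ N b y)
          Z? z = (z ∈? N a x) ×-dec (z ∈? N b y)
          X⊆ : ⟨ X? ⟩ ⊆ N a x
          X⊆ = proj₁ ∘ ⟨⟩∈ X?
          Z⊆ : ⟨ Z? ⟩ ⊆ N a x
          Z⊆ = proj₁ ∘ ⟨⟩∈ Z?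
          split : ∀ {z} → z ∈ N a x → z ∈ ⟨ X? ⟩ ⊎ z ∈ ⟨ Z? ⟩
          split {z} zN with z ∈? part y
          ... | yes h = inj₁ (∈⟨⟩ X? (zN , inj₁ h))
          ... | no nh = case cover yP (N⊆ zN) nh of λ { (inj₁ h) → inj₁ (∈⟨⟩ X? (zN , inj₂ h)) ; (inj₂ h) → inj₂ (∈⟨⟩ Z? (zN , h)) }
          weak : Lacks a p₃ (N a x)
          weak = case sh of λ { (inj₂ refl) → lγ ; (inj₁ refl) → λ h → no-P₃ lγ h }
            where
            no-P₃ : Lacks a k₂ (N a x) → Lacks a p₃ (N a x)
            no-P₃ nk (u ∷ v ∷ z ∷ [] , (_ , (uv ∷ uz ∷ []) ∷ _ , qu ∷ qv ∷ qz ∷ []) , m) with e a u v in e₁ | e a u z in e₂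
            ... | true | _ = nk (Has-2 qu qv uv e₁)
            ... | false | true = nk (Has-2 qu qz uz e₂)
            ... | false | false = case m of λ { (s≤s ()) }
          at-most-one : ∀ {u v} → u ∈ N a x → v ∈ N a x → u ∈ N a y → v ∈ N a y → u ≡ v
          at-most-one {u} {v} uN vN un vn = decidable-stable (u ≟ v) λ ne →
            let d : ∀ z → Dec (z ∈ N a x × z ∈ N a y)
                d z = (z ∈? N a x) ×-dec (z ∈? N a y)
            in weak (Has-join {A = ⟨ y ≟_ ⟩} {⟨ d ⟩} (λ h → subst (_∈ N a x) (⟨⟩∈ (y ≟_) h) yN) (proj₁ ∘ ⟨⟩∈ d)
              (λ h z → joined {a} yP (subst (_∈ part y) (⟨⟩∈ (y ≟_) h) (part-refl yP)) (proj₂ (⟨⟩∈ d z))) (Has-1 (∈⟨⟩ (y ≟_) refl))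
              (Has-21 (unpick {ys = u ∷ v ∷ []} 2 (refl , (ne ∷ []) ∷ [] ∷ [] , ∈⟨⟩ d (uN , un) ∷ ∈⟨⟩ d (vN , vn) ∷ []))))
          X-empty : Lacks b k₂ ⟨ X? ⟩
          X-empty h with edge h
          ... | u , v , uX , vX , ne , uv with ⟨⟩∈ X? uX | ⟨⟩∈ X? vX
          ...   | uN , inj₁ uy | vN , inj₁ vy = part-b yP (Has-2 uy vy ne uv)
          ...   | uN , inj₁ uy | vN , inj₂ vn = a≢b (trans (sym (e⁻ (proj₂ (joined {a} yP uy vn)))) (e⁻ uv))
          ...   | uN , inj₂ un | vN , inj₁ vy = a≢b (trans (sym (e⁻ (proj₂ (joined {a} yP vy un)))) (trans (c-sym v u) (e⁻ uv)))
          ...   | uN , inj₂ un | vN , inj₂ vn = ne (at-most-one uN vN un vn)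

        contradiction′ : ⊥
        contradiction′ = ¬¬-all (λ x → em {A = Edgy x}) λ edgy? → ¬¬-all (λ x → em {A = Has (e a) 2 0 (N a x)}) λ N-edge? → go edgy? N-edge?
          where
          go : (∀ x → Dec (Edgy x)) → (∀ x → Dec (Has (e a) 2 0 (N a x))) → ⊥
          go edgy? N-edge? with any? (λ x → edgy? x ×-dec ¬? (N-edge? x))
          -- A part with an a-edge whose a-neighbourhood has none. If no such part exists, every
          -- part with an a-edge avoids P₃ in a, which is what `thin-sizes` requires.
          ... | yes (x , (xP , h) , nh) = WB.sizes xP λ {L} i hL → finish xP ((k₃ , k₂) ∷ []) ((k₂ , k₂) ∷ (k₂ , k₂) ∷ []) L []
                  (part-bound-l k₃ k₂ xP (λ t → la (Has-join part⊆ N⊆ (joined {a} xP) t (Has-21 (two-a xP (edge-big h))))) (part-b xP))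
                  (two-parts k₂ xP nh (inj₁ refl)) hL z≤n
                  (checkAll-sound ((k₃ , k₂) ∷ []) (((k₂ , k₂) ∷ (k₂ , k₂) ∷ []) ∷ []) one-colour [] (h₃ , k₃) refl (here refl) i)
          ... | no none with any? edgy?
          ...   | no plain′ = plain (λ {x} h → plain′ (x , h))
          ...   | yes (x , ed@(xP , h)) = WB.thin-sizes xP (λ {y} yP t → thin (yP , t)) λ {L} i hL → finish xP ((p₃ , k₂) ∷ []) ((p₃ , k₂) ∷ (p₃ , k₂) ∷ []) L []
                  (part-bound-l p₃ k₂ xP (thin ed) (part-b xP))
                  (two-parts p₃ xP (λ t → la (Has-join part⊆ N⊆ (joined {a} xP) h t)) (inj₂ refl)) hL z≤n
                  (checkAll-sound ((p₃ , k₂) ∷ []) (((p₃ , k₂) ∷ (p₃ , k₂) ∷ []) ∷ []) one-colour-thin [] (h₃ , k₃) refl (here refl) i)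
            where
            thin : ∀ {y} → Edgy y → Lacks a p₃ (part y)
            thin {y} ed with N-edge? y
            ... | yes h = edge-in-N ed h
            ... | no nh = ⊥-elim (none (y , ed , nh))

-- Partitions with two H₃-like colours, and the induction.

module UpperBound where

  open Subsets
  open SmallRamsey
  open ExtremalNumber
  open GallaiPartition
  open Joins
  open Parts
  open TwoColours using (H₃-H₃)
  open PartSizes
  open BigParts
  open Parts using (Has-tail)
  open Combinations

  module Main {n k} {c : Fin n → Fin n → Fin k} (c-sym : ∀ x y → c x y ≡ c y x)
    {gallai : ∀ x y z → x ≢ y → y ≢ z → x ≢ z → c x y ≢ c y z → c y z ≢ c x z → c x y ≢ c x z → ⊥} where

    open States c
    open Decomposition c c-sym gallai using (Join; Partition; decompose)
    open Two c-sym {gallai}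
    open Cases c-sym {gallai}
    open Case c-sym {gallai}
    open Prime c-sym {gallai}

    module _ {P} (π : Partition P) {s r p l} (l≤r : l ≤ r) (bounded : Bounded π s r p l) (noJoin : ∀ {i} → Join i P → ⊥) where

      module D₄H₃ {β} (β∈ : β ≡ d₄ ⊎ β ≡ h₃) (la : Lacks (Partition.a π) d₄ P) (lb : Lacks (Partition.b π) β P)
        (nle : ¬ (count P + (l + (1 + #d β)) ≤ Bounds.val s r p d₄ β)) where

        open Targets π {s} {r} {p} {l} l≤r bounded noJoin {d₄} {β} la lb nle

        lh : Lacks b h₃ P
        lh h = case β∈ of λ { (inj₁ refl) → lb (Has-tail h) ; (inj₂ refl) → lb h }

        #dβ : #d β ≤ 1
        #dβ = case β∈ of λ { (inj₁ refl) → ≤-refl ; (inj₂ refl) → z≤n }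

        val-β : val d₄ β ≡ val h₃ h₃
        val-β = case β∈ of λ { (inj₁ refl) → refl ; (inj₂ refl) → refl }

        fits : ∀ L₁ M L → L ∈ˡ one-colour → checkAll L₁ one-colour (M ∷ []) [] (h₃ , h₃) ≡ true → V (L₁ ++ L ++ M) ≤ V ((d₄ , β) ∷ [])
        fits L₁ M L i chk = subst₂ _≤_ (cong (λ t → V (L₁ ++ L ++ t)) (++-identityʳ M)) (cong (_+ 0) (sym val-β))
          (V-≤ (L₁ ++ L ++ M ++ []) ((h₃ , h₃) ∷ []) (checkAll-sound L₁ one-colour (M ∷ []) [] (h₃ , h₃) chk i (here refl)) s r p)

        contradiction′ : ⊥
        contradiction′ with has-big P
        ... | no none = nle (begin
            count P + (l + (1 + #d β))  ≤⟨ +-mono-≤ (J₄-J₅ (e a) (e b) (spread (λ q → q) none) la lh) (+-mono-≤ l≤r (s≤s #dβ)) ⟩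
            19 + (r + 2)                ≡⟨ cong (19 +_) (+-comm r 2) ⟩
            21 + r                      ≤⟨ room h₃ h₃ 21 refl s r p ⟩
            val h₃ h₃                   ≡⟨ val-β ⟨
            val d₄ β                    ∎)
          where open ≤-Reasoning
        -- An a-edge in the part, joined to two a-neighbours, would be K₄ - e, and so would an
        -- a-edge in N a x joined to two vertices of the part. Thus N a x has colour b only, and
        -- `OneColour` applies with the colours exchanged.
        ... | yes (x , xP , big) = em {A = Has (e b) 2 0 (part x)} λ
            { (no ¬h) → W.sizes λ {L} i hL → finish′ xP ((k₂ , k₂) ∷ []) L ((d₄ , k₃) ∷ (k₂ , k₂) ∷ []) (part-bound-l k₂ k₂ xP part-a ¬h) hL
                (Nb k₃ λ t → lh (Has-join part⊆ N⊆ (joined {b} xP) (Has-21 big) t)) (fits ((k₂ , k₂) ∷ []) ((d₄ , k₃) ∷ (k₂ , k₂) ∷ []) L i refl)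
            ; (yes h) → W.sizes λ {L} i hL → finish′ xP ((k₂ , k₃) ∷ []) L ((d₄ , p₃) ∷ (k₂ , k₂) ∷ [])
                (part-bound-l k₂ k₃ xP part-a (λ t → lh (Has-join part⊆ N⊆ (joined {b} xP) t (Has-21 (two-b xP big))))) hL
                (Nb p₃ λ t → lh (Has-join part⊆ N⊆ (joined {b} xP) h t)) (fits ((k₂ , k₃) ∷ []) ((d₄ , p₃) ∷ (k₂ , k₂) ∷ []) L i refl) }
          where
          part-a : Lacks a k₂ (part x)
          part-a h = la (Has-join part⊆ N⊆ (joined {a} xP) h (Has-21 (two-a xP big)))
          module W = S′.OneColour lh two-b {N a x} {x} N⊆ (N-closed xP) xP (x∉N xP) (λ h → la (Has-join part⊆ N⊆ (joined {a} xP) (Has-21 big) h))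
          -- One unit of slack comes from the target K₄ - e kept in a; the one for β = d₄ comes out
          -- of `val k₂ k₂` ≥ 1.
          Nb : ∀ γ → Lacks b γ (N b x) → count (N b x) + (1 + #d β) ≤ V ((d₄ , γ) ∷ (k₂ , k₂) ∷ [])
          Nb γ h = begin
            count (N b x) + (1 + #d β)  ≡⟨ +-assoc (count (N b x)) 1 (#d β) ⟨
            (count (N b x) + 1) + #d β  ≤⟨ +-mono-≤ (≤-trans (+-monoʳ-≤ (count (N b x)) (≤-trans (m≤m+n 1 (#d γ)) (m≤n+m _ l))) (bounded d₄ γ N⊆ xP (x∉N xP) (Lacks-⊆ {α = d₄} N⊆ la) h))
                                             (≤-trans #dβ (≤-trans (s≤s z≤n) (room k₂ k₂ 1 refl s r p))) ⟩
            val d₄ γ + val k₂ k₂        ≡⟨ cong (val d₄ γ +_) (+-identityʳ (val k₂ k₂)) ⟨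
            V ((d₄ , γ) ∷ (k₂ , k₂) ∷ []) ∎
            where open ≤-Reasoning

      module H₃H₃ (la : Lacks (Partition.a π) h₃ P) (lb : Lacks (Partition.b π) h₃ P) (nle : ¬ (count P + (l + 0) ≤ Bounds.val s r p h₃ h₃)) where

        open Targets π {s} {r} {p} {l} l≤r bounded noJoin {h₃} {h₃} la lb nle
        open TwoColour π {s} {r} {p} {l} l≤r bounded noJoin

        -- An a-edge in the part keeps P₃ out of N a x in colour a, and likewise for b, so both
        -- neighbourhoods are covered by `matching-sizes`. Two neighbours in each colour keep K₃ out
        -- of the part.
        both-edges : ∀ {x} → x ∈ P → Has (e a) 2 0 (part x) → Has (e b) 2 0 (part x) → ⊥
        both-edges {x} xP h h′ = finish xP ((k₃ , k₃) ∷ []) ((p₃ , k₂) ∷ (p₃ , k₃) ∷ []) ((p₃ , k₂) ∷ (p₃ , k₃) ∷ []) []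
          (part-bound-l k₃ k₃ xP (λ t → la (Has-join part⊆ N⊆ (joined {a} xP) t (Has-21 (two-a xP big)))) (λ t → lb (Has-join part⊆ N⊆ (joined {b} xP) t (Has-21 (two-b xP big)))))
          (matching-sizes lb two-b N⊆ (N-closed xP) xP (x∉N xP) (λ t → la (Has-join part⊆ N⊆ (joined {a} xP) h t)))
          (S′.matching-sizes la two-a N⊆ (N-closed xP) xP (x∉N xP) (λ t → lb (Has-join part⊆ N⊆ (joined {b} xP) h′ t))) z≤n refl
          where big = edge-big h

        one-edge : (∀ {x} → x ∈ P → Has (e a) 2 0 (part x) → Lacks b k₂ (part x)) → ∀ {x} → x ∈ P → Has (e a) 2 0 (part x) → ⊥
        one-edge not-both {x} xP h = em {A = Has (e a) 2 0 (N a x)} λ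
            { (no ¬h) → let module W = S′.OneColour lb two-b {N a x} {x} N⊆ (N-closed xP) xP (x∉N xP) ¬h in
                W.sizes λ {L} i hL → Nb λ {M} j hM → finish xP ((k₃ , k₂) ∷ []) L M []
                  (part-bound-l k₃ k₂ xP (λ t → la (Has-join part⊆ N⊆ (joined {a} xP) t (Has-21 (two-a xP big)))) (not-both xP h)) hL hM z≤n
                  (checkAll-sound ((k₃ , k₂) ∷ []) one-colour two-colour [] (h₃ , h₃) refl i j)
            ; (yes h′) → Nb λ {M} j hM → finish xP ((p₃ , k₂) ∷ []) ((p₃ , k₂) ∷ (p₃ , k₃) ∷ []) M []
                  (part-bound-l p₃ k₂ xP (λ t → la (Has-join part⊆ N⊆ (joined {a} xP) t h′)) (not-both xP h))
                  (matching-sizes lb two-b N⊆ (N-closed xP) xP (x∉N xP) (λ t → la (Has-join part⊆ N⊆ (joined {a} xP) h t))) hM z≤n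
                  (checkAll-sound ((p₃ , k₂) ∷ []) (((p₃ , k₂) ∷ (p₃ , k₃) ∷ []) ∷ []) two-colour [] (h₃ , h₃) refl (here refl) j) }
          where
          big = edge-big h
          Nb : (∀ {M} → M ∈ˡ two-colour → count (N b x) ≤ V M → ⊥) → ⊥
          Nb = two-colour-sizes la two-a not-both N⊆ (N-closed xP) xP (x∉N xP) (λ t → lb (Has-join part⊆ N⊆ (joined {b} xP) (Has-21 big) t))

        -- Every part has at most w vertices. There are at most 17 parts when few are single and 21
        -- in any case; for w ≥ 3 the surplus of single vertices fits into 17 places, and for w ≤ 2
        -- `trichotomy` decides.
        no-edges : (∀ {x} → x ∈ P → Lacks a k₂ (part x) × Lacks b k₂ (part x)) → ⊥
        no-edges none with has-big P
        ... | no nobig = nle (≤-trans (+-mono-≤ (H₃-H₃ (e a) (e b) (e-sym a) (spread (λ q → q) nobig) la lb) (≤-trans (≤-reflexive (+-identityʳ l)) l≤r)) (room h₃ h₃ 21 refl s r p))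
        ... | yes (x , xP , big) = case few-parts 17 21 w small (H₃-H₃ (e a) (e b) (e-sym a) reps-cover (Lacks-⊆ {α = h₃} reps⊆ la) (Lacks-⊆ {α = h₃} reps⊆ lb)) w≥1 parts of λ
            { (inj₁ h) → finish-copies 16 refl refl h
            ; (inj₂ (bb , σ , h , h′ , h″)) → case 3 ≤? w of λ
              { (yes w3) → finish-copies 16 refl refl (≤-trans h″ (few-singles 2 w3 h h′ (m≤n+m 21 2)))
              ; (no w2) → tight bb σ h h′ (≤-trans h″ (+-monoˡ-≤ σ (*-monoʳ-≤ bb (≤-pred (≰⇒> w2))))) } }
          where
          parts : ∀ {x} → x ∈ P → count (part x) ≤ w
          parts = all-small none
          small : ∀ T → T ⊆ reps → (∀ Z → Z ⊆ T → Z ⊆ ⟨ single-rep? ⟩ → count Z ≤ 3) → count T ≤ 17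
          small T g few = K₄-K₄ (e a) (e b) (e-sym a) (e-sym b) (λ p q → reps-cover (g p) (g q)) (no-K₄ la g few) (no-K₄ lb g few)
          -- 2b + σ = b + (b + σ) ≤ 14 + 21 = 35.
          tight : ∀ bb σ → bb + 3 ≤ 17 → bb + σ ≤ 21 → count P ≤ bb * 2 + σ → ⊥
          tight bb σ h h′ h″ = case trichotomy s r p of λ
            { (inj₁ m≡1) → 1+n≰n (≤-trans (≤-trans big (parts xP)) (≤-trans (m∸n≤m m l) (≤-reflexive m≡1)))
            ; (inj₂ (inj₁ t)) → nle (≤-trans (+-mono-≤ (≤-trans h″ (≤-trans (≤-reflexive (trans (cong (_+ σ) (*-comm bb 2)) (trans (cong (λ t → bb + t + σ) (+-identityʳ bb)) (+-assoc bb bb σ)))) (+-mono-≤ (+-cancelʳ-≤ 3 bb 14 h) h′))) (≤-trans (≤-reflexive (+-identityʳ l)) l≤r)) t)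
            ; (inj₂ (inj₂ t)) → finish′ xP ((k₂ , k₂) ∷ []) ((k₃ , h₃) ∷ []) ((h₃ , k₃) ∷ []) (part-bound-l k₂ k₂ xP (proj₁ (none xP)) (proj₂ (none xP)))
                (Na-bound k₃ h₃ xP (λ q → la (Has-join part⊆ N⊆ (joined {a} xP) (Has-21 big) q)) (Lacks-⊆ {α = h₃} N⊆ lb))
                (≤-trans (≤-reflexive (+-identityʳ _)) (Nb-bound h₃ k₃ xP (Lacks-⊆ {α = h₃} N⊆ la) (λ q → lb (Has-join part⊆ N⊆ (joined {b} xP) (Has-21 big) q))))
                (≤-trans (≤-reflexive (cong (val k₂ k₂ +_) (trans (cong (val k₃ h₃ +_) (+-identityʳ _)) (trans (+-comm (val k₃ h₃) (val h₃ k₃)) (cong (val h₃ k₃ +_) (sym (+-identityʳ _)))))))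
                  (≤-trans t (≤-reflexive (sym (V₁ h₃ h₃))))) }

    module _ {P} (π : Partition P) {s r p l} (l≤r : l ≤ r) (bounded : Bounded π s r p l) (noJoin : ∀ {i} → Join i P → ⊥) (some : 2 ≤ count P) where

      open Partition π

      both-h₃ : Lacks a h₃ P → Lacks b h₃ P → ¬ (count P + (l + 0) ≤ Bounds.val s r p h₃ h₃) → ⊥
      both-h₃ la lb nle = ¬¬-all (λ x → em {A = Has (e a) 2 0 (part x)}) λ A? → ¬¬-all (λ x → em {A = Has (e b) 2 0 (part x)}) λ B? → go A? B?
        where
        module H = H₃H₃ π {s} {r} {p} {l} l≤r bounded noJoin la lb nle
        module H′ = H₃H₃ (swapped π) {s} {r} {p} {l} l≤r (Bounded-swap {π = π} {s} {r} {p} {l} bounded) noJoin lb la nle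
        go : (∀ x → Dec (Has (e a) 2 0 (part x))) → (∀ x → Dec (Has (e b) 2 0 (part x))) → ⊥
        go A? B? with any? (λ x → (x ∈? P) ×-dec A? x ×-dec B? x)
        ... | yes (x , xP , h , h′) = H.both-edges xP h h′
        ... | no not-both with any? (λ x → (x ∈? P) ×-dec A? x) | any? (λ x → (x ∈? P) ×-dec B? x)
        ...   | yes (x , xP , h) | _ = H.one-edge (λ {y} yP t t′ → not-both (y , yP , t , t′)) xP h
        ...   | no _ | yes (x , xP , h) = H′.one-edge (λ {y} yP t t′ → not-both (y , yP , t′ , t)) xP h
        ...   | no na | no nb = H.no-edges λ {x} xP → (λ t → na (x , xP , t)) , (λ t → nb (x , xP , t))

    -- a colour joining parts of a partition contains P₃
    no-P₃ : ∀ {P} (π : Partition P) {s r p l} (l≤r : l ≤ r) (bounded : Bounded π s r p l) → (∀ {i} → Join i P → ⊥) → 2 ≤ count P → Lacks (Partition.a π) p₃ P → ⊥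
    no-P₃ {P} π {s} {r} {p} {l} l≤r bounded noJoin some la = noJoin {b} record
      { side = ⟨ S? ⟩ ; side⊆ = λ h → case ⟨⟩∈ S? h of λ { (inj₁ e) → subst (_∈ P) (sym e) xP ; (inj₂ e) → subst (_∈ P) (sym e) uP } ; inner = x , ∈⟨⟩ S? (inj₁ refl)
      ; outer = v , N⊆ vN , λ h → case ⟨⟩∈ S? h of λ { (inj₁ e) → x∉N xP (subst (_∈ N b x) e vN) ; (inj₂ e) → a≢b (trans (sym (N-col uN)) (trans (cong (c x) (sym e)) (N-col vN))) }
      ; joined = λ {w} {y} ws yP ny → case ⟨⟩∈ S? ws of λ
          { (inj₁ e) → subst (λ t → c t y ≡ b) (sym e) (other x xP yP (λ t → ny (∈⟨⟩ S? (inj₁ t))) (λ yx → ny (∈⟨⟩ S? (inj₁ (sym (alone yx))))) (λ yn → ny (∈⟨⟩ S? (inj₂ (sym (unique uN yn))))))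
          ; (inj₂ e) → subst (λ t → c t y ≡ b) (sym e) (case y ∈? part u of λ
            { (yes yu) → ⊥-elim (ny (∈⟨⟩ S? (inj₂ (sym (unique uN (N-closed xP uN yu))))))
            ; (no nyu) → case across uP yP nyu of λ
              { (inj₂ h) → h
              ; (inj₁ h) → ⊥-elim (P₃ uP (∈⟨⟩ (N? a u) (xP , (λ xu → proj₁ (proj₂ (⟨⟩∈ (N? a x) uN)) (part-sym uP xu)) , trans (c-sym u x) (N-col uN)))
                  (∈⟨⟩ (N? a u) (yP , nyu , h)) (λ e → ny (∈⟨⟩ S? (inj₁ (sym e)))))} }) } }
      where
      open Sizes π {s} {r} {p} {l} l≤r bounded noJoin
      module S′ = Sizes (swapped π) {s} {r} {p} {l} l≤r (Bounded-swap {π = π} {s} {r} {p} {l} bounded) noJoin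
      x = proj₁ (pick₁ {Q = P} (≤-trans (s≤s z≤n) some))
      xP : x ∈ P
      xP = proj₂ (pick₁ {Q = P} (≤-trans (s≤s z≤n) some))
      u = proj₁ (pick₁ {Q = N a x} (N-nonempty xP))
      uN : u ∈ N a x
      uN = proj₂ (pick₁ {Q = N a x} (N-nonempty xP))
      uP : u ∈ P
      uP = N⊆ {a} {x} uN
      v = proj₁ (pick₁ {Q = N b x} (S′.N-nonempty xP))
      vN : v ∈ N b x
      vN = proj₂ (pick₁ {Q = N b x} (S′.N-nonempty xP))
      N-col : ∀ {i z y} → y ∈ N i z → c z y ≡ i
      N-col {i} {z} h = proj₂ (proj₂ (⟨⟩∈ (N? i z) h))
      S? : ∀ y → Dec (y ≡ x ⊎ y ≡ u)
      S? y = (y ≟ x) ⊎-dec (y ≟ u)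
        where open import Relation.Nullary.Decidable using (_⊎-dec_)
      P₃ : ∀ {z y y′} → z ∈ P → y ∈ N a z → y′ ∈ N a z → y ≢ y′ → ⊥
      P₃ {z} {y} {y′} zP yN yN′ ne = la (Has-join part⊆ N⊆ (joined {a} zP) (Has-1 (part-refl zP)) (Has-21 (unpick {ys = y ∷ y′ ∷ []} 2 (refl , (ne ∷ []) ∷ [] ∷ [] , yN ∷ yN′ ∷ []))))
      unique : ∀ {y y′} → y ∈ N a x → y′ ∈ N a x → y ≡ y′
      unique {y} {y′} h h′ = decidable-stable (y ≟ y′) (P₃ xP h h′)
      alone : ∀ {y} → y ∈ part x → x ≡ y
      alone {y} yx = decidable-stable (x ≟ y) λ ne → P₃ uP
        (∈⟨⟩ (N? a u) (xP , (λ xu → proj₁ (proj₂ (⟨⟩∈ (N? a x) uN)) (part-sym uP xu)) , trans (c-sym u x) (N-col uN)))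
        (∈⟨⟩ (N? a u) (part⊆ yx , (λ yu → proj₁ (proj₂ (⟨⟩∈ (N? a x) uN)) (part-trans yx (part-sym uP yu))) ,
          trans (c-sym u y) (trans (sym (uniform xP yx uP (proj₁ (proj₂ (⟨⟩∈ (N? a x) uN))))) (N-col uN)))) ne
      other : ∀ z → z ∈ P → ∀ {y} → y ∈ P → (y ≢ z) → (y ∈ part z → ⊥) → (y ∈ N a z → ⊥) → c z y ≡ b
      other z zP yP _ np nn = case across zP yP np of λ { (inj₂ h) → h ; (inj₁ h) → ⊥-elim (nn (∈⟨⟩ (N? a z) (yP , np , h))) }

    no-k₂ : ∀ {P} (π : Partition P) {s r p l} (l≤r : l ≤ r) (bounded : Bounded π s r p l) → (∀ {i} → Join i P → ⊥) → 2 ≤ count P → Lacks (Partition.a π) k₂ P → ⊥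
    no-k₂ {P} π {s} {r} {p} {l} l≤r bounded noJoin some la =
      let x , xP = pick₁ {Q = P} (≤-trans (s≤s z≤n) some) in
      la (Has-join part⊆ N⊆ (joined {a} xP) (Has-1 (part-refl xP)) (Has-1 (proj₂ (pick₁ {Q = N a x} (N-nonempty xP)))))
      where open Sizes π {s} {r} {p} {l} l≤r bounded noJoin

    prime-case : ∀ {P} (π : Partition P) {s r p l} (l≤r : l ≤ r) (bounded : Bounded π s r p l) → (∀ {i} → Join i P → ⊥) → 2 ≤ count P →
      ∀ α β → Lacks (Partition.a π) α P → Lacks (Partition.b π) β P → ¬ (count P + (l + (#d α + #d β)) ≤ Bounds.val s r p α β) → ⊥
    prime-case {P} π {s} {r} {p} {l} l≤r bd nj some = go
      where
      open Partition π using (a; b)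
      π′ = swapped π
      bd′ : Bounded π′ s r p l
      bd′ = Bounded-swap {π = π} {s} {r} {p} {l} bd
      go : ∀ α β → Lacks a α P → Lacks b β P → ¬ (count P + (l + (#d α + #d β)) ≤ Bounds.val s r p α β) → ⊥
      go k₂ β la lb nle = no-k₂ π {s} {r} {p} {l} l≤r bd nj some la
      go p₃ β la lb nle = no-P₃ π {s} {r} {p} {l} l≤r bd nj some la
      go α k₂ la lb nle = no-k₂ π′ {s} {r} {p} {l} l≤r bd′ nj some lb
      go α p₃ la lb nle = no-P₃ π′ {s} {r} {p} {l} l≤r bd′ nj some lb
      go k₃ k₃ la lb nle = K₃K₃.contradiction′ π {s} {r} {p} {l} l≤r bd nj some la lb nle
      go d₄ k₃ la lb nle = D₄K₃.contradiction′ π {s} {r} {p} {l} l≤r bd nj some la lb nle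
      go k₃ d₄ la lb nle = D₄K₃.contradiction′ π′ {s} {r} {p} {l} l≤r bd′ nj some lb la (nle ∘ subst (count P + (l + 1) ≤_) (val-comm s r p d₄ k₃))
      go h₃ k₃ la lb nle = H₃K₃.contradiction′ π {s} {r} {p} {l} l≤r bd nj some la lb nle
      go k₃ h₃ la lb nle = H₃K₃.contradiction′ π′ {s} {r} {p} {l} l≤r bd′ nj some lb la (nle ∘ subst (count P + (l + 0) ≤_) (val-comm s r p h₃ k₃))
      go d₄ d₄ la lb nle = D₄H₃.contradiction′ π {s} {r} {p} {l} l≤r bd nj (inj₁ refl) la lb nle
      go d₄ h₃ la lb nle = D₄H₃.contradiction′ π {s} {r} {p} {l} l≤r bd nj (inj₂ refl) la lb nle
      go h₃ d₄ la lb nle = D₄H₃.contradiction′ π′ {s} {r} {p} {l} l≤r bd′ nj (inj₂ refl) lb la nle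
      go h₃ h₃ la lb nle = both-h₃ π {s} {r} {p} {l} l≤r bd nj some la lb nle

    small-case : ∀ {P : VSet n} (X : Fin k → Target) → count P ≤ 1 → count P + total #d X ≤ size X
    small-case X h = ≤-trans (+-mono-≤ h (#d≤#h X)) (≤-trans (room k₂ k₂ 1 refl (total #k X) (total #h X) (total #p X))
      (≤-reflexive (F-cong (+-identityʳ (total #k X)) (+-identityʳ (total #h X)) (+-identityʳ (total #p X)))))

    upper-bound : ∀ t {P : VSet n} → count P ≤ t → Bound-on P
    upper-bound zero {P} h X av = small-case {P} X (≤-trans h z≤n)
    upper-bound (suc t) {P} h X av with 2 ≤? count P
    ... | no one = small-case {P} X (≤-pred (≰⇒> one))
    ... | yes two = decidable-stable (count P + total #d X ≤? size X) λ nle →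
        let ih : ∀ Q → count Q < count P → Bound-on Q
            ih Q lt = upper-bound t {Q} (≤-pred (≤-trans lt h))
            nj : ∀ {i} → Join i P → ⊥
            nj J = nle (join-case c-sym gallai av ih J)
        in decompose P two nj λ π → partition-case nle ih nj π
      where
      partition-case : ¬ (count P + total #d X ≤ size X) → (∀ Q → count Q < count P → Bound-on Q) → (∀ {i} → Join i P → ⊥) → Partition P → ⊥
      partition-case nle ih nj π = prime-case π {s} {r} {p} {l} (#d≤#h Z) bd nj two (X a) (X b) (av a) (av b)
          (nle ∘ subst₂ (λ t u → count P + t ≤ u) (same #d refl) (F-cong (same #k refl) (same #h refl) (same #p refl)))
        where
        open Partition π
        Z = upd (upd X a k₂) b k₂
        s = total #k Z
        r = total #h Z
        p = total #p Z
        l = total #d Z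
        same : ∀ g → g k₂ ≡ 0 → total g Z + (g (X a) + g (X b)) ≡ total g X
        same g z = trans (sym (total-upd₂ g X (X a) (X b) a≢b z)) (total-cong g λ i → lem i)
          where
          lem : ∀ i → upd (upd X a (X a)) b (X b) i ≡ X i
          lem i with i ≟ b
          ... | yes refl = refl
          ... | no _ with i ≟ a
          ...   | yes refl = refl
          ...   | no _ = refl
        bd : Bounded π s r p l
        bd {A} {y} γ δ g yP ny la lb = subst₂ (λ t u → count A + t ≤ u) (total-upd₂ #d X γ δ a≢b refl)
          (F-cong (total-upd₂ #k X γ δ a≢b refl) (total-upd₂ #h X γ δ a≢b refl) (total-upd₂ #p X γ δ a≢b refl))
          (ih A (count-⊂ {A = A} {P} {y} g yP ny) (upd (upd X a γ) b δ) (Avoids-upd (Avoids-upd (λ i → Lacks-⊆ g (av i)) la) lb))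

-- Extremal colourings by substitution.

module LowerBound where

  open import Data.Nat.Properties using (≤-refl; ≤-trans; <-irrefl; m≤n+m; n≤1+n; m^n≢0)
  import Data.Nat.Properties as ℕ
  open import Data.Bool using (T)
  import Data.Bool.Properties as Bool
  open import Data.Fin using (remQuot; combine)
  open import Data.Fin.Properties using (_≟_; combine-remQuot)
  open import Data.Vec using (Vec; []; _∷_; lookup)
  open import Relation.Nullary using (¬?)
  open import Relation.Nullary.Decidable using (True; toWitness; _→-dec_)
  open ExtremalNumber

  -- Colours are named by kind and number: `hat` for target H₃, `tri` for K₃. A single tag stands
  -- for the P₃-colours, since `F` only depends on whether there is one.
  data Tag : Set where
    hat tri : ℕ → Tag
    path    : Tag

  -- H₃ is a triangle with two further vertices joined to all of it, so a triangle may have at most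
  -- one common neighbour. Vertices and edge hypotheses alternate so that the search in `free?` is
  -- pruned early.
  Free : {V : Set} → Tag → (V → V → Set) → Set
  Free (hat _) E = ∀ x y → E x y → ∀ z → E x z → E y z →
    ∀ a → E x a → E y a → E z a → ∀ b → E x b → E y b → E z b → a ≡ b
  Free (tri _) E = ∀ x y → E x y → ∀ z → E x z → E y z → ⊥
  Free path    E = ∀ x y → E x y → ∀ z → E y z → x ≡ z

  -- The requirement on a pattern: after substitution the two nonadjacent vertices of H₃, or the two
  -- ends of P₃, may come from one vertex of the pattern. Hence already K₄, respectively a single
  -- edge, is excluded.
  Strict : {V : Set} → Tag → (V → V → Set) → Set
  Strict (hat _) E = ∀ x y → E x y → ∀ z → E x z → E y z → ∀ a → E x a → E y a → E z a → ⊥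
  Strict (tri _) E = ∀ x y → E x y → ∀ z → E x z → E y z → ⊥
  Strict path    E = ∀ x y → E x y → ⊥

  _≟ᵗ_ : (t u : Tag) → Dec (t ≡ u)
  hat a ≟ᵗ hat b with a ℕ.≟ b
  ... | yes refl = yes refl
  ... | no a≢b   = no λ { refl → a≢b refl }
  hat _ ≟ᵗ tri _ = no λ ()
  hat _ ≟ᵗ path  = no λ ()
  tri _ ≟ᵗ hat _ = no λ ()
  tri a ≟ᵗ tri b with a ℕ.≟ b
  ... | yes refl = yes refl
  ... | no a≢b   = no λ { refl → a≢b refl }
  tri _ ≟ᵗ path  = no λ ()
  path  ≟ᵗ hat _ = no λ ()
  path  ≟ᵗ tri _ = no λ ()
  path  ≟ᵗ path  = yes refl

  Strict-⊥ : {V : Set} (t : Tag) {E : V → V → Set} → (∀ x y → ¬ E x y) → Strict t E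
  Strict-⊥ (hat _) f x y e = ⊥-elim (f x y e)
  Strict-⊥ (tri _) f x y e = ⊥-elim (f x y e)
  Strict-⊥ path    f x y e = f x y e

  Strict-⊆ : {V : Set} (t : Tag) {E E′ : V → V → Set} → (∀ x y → E x y → E′ x y) → Strict t E′ → Strict t E
  Strict-⊆ (hat _) f S x y e z e₁ e₂ a e₃ e₄ e₅ = S x y (f _ _ e) z (f _ _ e₁) (f _ _ e₂) a (f _ _ e₃) (f _ _ e₄) (f _ _ e₅)
  Strict-⊆ (tri _) f S x y e z e₁ e₂ = S x y (f _ _ e) z (f _ _ e₁) (f _ _ e₂)
  Strict-⊆ path    f S x y e = S x y (f _ _ e)

  Free-map : {V W : Set} (t : Tag) {E : V → V → Set} {E′ : W → W → Set} (g : V → W) →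
    (∀ {x y} → g x ≡ g y → x ≡ y) → (∀ x y → E x y → E′ (g x) (g y)) → Free t E′ → Free t E
  Free-map (hat _) g inj f S x y e z e₁ e₂ a e₃ e₄ e₅ b e₆ e₇ e₈ =
    inj (S _ _ (f _ _ e) _ (f _ _ e₁) (f _ _ e₂) _ (f _ _ e₃) (f _ _ e₄) (f _ _ e₅) _ (f _ _ e₆) (f _ _ e₇) (f _ _ e₈))
  Free-map (tri _) g inj f S x y e z e₁ e₂ = S _ _ (f _ _ e) _ (f _ _ e₁) (f _ _ e₂)
  Free-map path    g inj f S x y e z e₁ = inj (S _ _ (f _ _ e) _ (f _ _ e₁))

  Strict⇒Free : {V W : Set} (t : Tag) {E : V → V → Set} {E′ : W → W → Set} (g : V → W) →
    (∀ x y → E x y → E′ (g x) (g y)) → Strict t E′ → Free t E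
  Strict⇒Free (hat _) g f S x y e z e₁ e₂ a e₃ e₄ e₅ b _ _ _ =
    ⊥-elim (S _ _ (f _ _ e) _ (f _ _ e₁) (f _ _ e₂) _ (f _ _ e₃) (f _ _ e₄) (f _ _ e₅))
  Strict⇒Free (tri _) g f S x y e z e₁ e₂ = S _ _ (f _ _ e) _ (f _ _ e₁) (f _ _ e₂)
  Strict⇒Free path    g f S x y e z e₁ = ⊥-elim (S _ _ (f _ _ e))

  -- An edge of a fibre of g stays in that fibre, so any forbidden copy lies in a single fibre.
  Free-fibre : {V U W : Set} (t : Tag) {E : V → V → Set} {E′ : W → W → Set} (g : V → W) (q : V → U) →
    (∀ {x y} → q x ≡ q y → g x ≡ g y → x ≡ y) → (∀ x y → E x y → q x ≡ q y × E′ (g x) (g y)) → Free t E′ → Free t E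
  Free-fibre (hat _) g q inj f S x y e z e₁ e₂ a e₃ e₄ e₅ b e₆ e₇ e₈ =
    inj (trans (sym (proj₁ (f _ _ e₃))) (proj₁ (f _ _ e₆)))
      (S _ _ (h e) _ (h e₁) (h e₂) _ (h e₃) (h e₄) (h e₅) _ (h e₆) (h e₇) (h e₈))
    where
    h : ∀ {x y} → _ → _
    h {x} {y} e = proj₂ (f x y e)
  Free-fibre (tri _) g q inj f S x y e z e₁ e₂ = S _ _ (proj₂ (f _ _ e)) _ (proj₂ (f _ _ e₁)) (proj₂ (f _ _ e₂))
  Free-fibre path    g q inj f S x y e z e₁ =
    inj (trans (proj₁ (f _ _ e)) (proj₁ (f _ _ e₁))) (S _ _ (proj₂ (f _ _ e)) _ (proj₂ (f _ _ e₁)))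

  -- The values of a colouring on the diagonal are arbitrary and must not count as edges.
  Edge : {V : Set} → (V → V → Tag) → Tag → V → V → Set
  Edge c t x y = x ≢ y × c x y ≡ t

  Symmetric : {V : Set} → (V → V → Tag) → Set
  Symmetric c = ∀ x y → c x y ≡ c y x

  No-rainbow : {V : Set} → (V → V → Tag) → Set
  No-rainbow c = ∀ x y z → x ≢ y → y ≢ z → x ≢ z → c x y ≢ c y z → c y z ≢ c x z → c x y ≢ c x z → ⊥

  Valid : ℕ → ℕ → Bool → Tag → Set
  Valid s r p (hat q) = q < r
  Valid s r p (tri q) = q < s
  Valid s r p path    = T p

  valid? : ∀ s r p t → Dec (Valid s r p t)
  valid? s r p (hat q) = q <? r
  valid? s r p (tri q) = q <? s
  valid? s r p path    = Bool.T? p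

  Valid-mono : ∀ {s s′ r r′ p} t → s ≤ s′ → r ≤ r′ → Valid s r p t → Valid s′ r′ p t
  Valid-mono (hat _) _ r≤ v = ≤-trans v r≤
  Valid-mono (tri _) s≤ _ v = ≤-trans v s≤
  Valid-mono path    _ _ v = v

  record Colouring (V : Set) (s r : ℕ) (p : Bool) : Set where
    field
      colour     : V → V → Tag
      symmetric  : Symmetric colour
      no-rainbow : No-rainbow colour
      valid      : ∀ x y → x ≢ y → Valid s r p (colour x y)
      free       : ∀ t → Free t (Edge colour t)

  open Colouring

  pullback : ∀ {V W s r p} (g : V → W) → (∀ {x y} → g x ≡ g y → x ≡ y) → Colouring W s r p → Colouring V s r p
  pullback g inj C = record
    { colour = λ x y → colour C (g x) (g y)
    ; symmetric = λ x y → symmetric C (g x) (g y)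
    ; no-rainbow = λ x y z x≢y y≢z x≢z → no-rainbow C (g x) (g y) (g z) (x≢y ∘ inj) (y≢z ∘ inj) (x≢z ∘ inj)
    ; valid = λ x y x≢y → valid C (g x) (g y) (x≢y ∘ inj)
    ; free = λ t → Free-map t g inj (λ x y e → proj₁ e ∘ inj , proj₂ e) (free C t)
    }

  record Pattern (m : ℕ) (s r s′ r′ : ℕ) (p : Bool) : Set where
    field
      tag            : Fin m → Fin m → Tag
      tag-symmetric  : Symmetric tag
      tag-no-rainbow : No-rainbow tag
      tag-valid      : ∀ i j → Valid s′ r′ p (tag i j)
      tag-fresh      : ∀ i j → ¬ Valid s r p (tag i j)
      tag-strict     : ∀ t → Strict t (Edge tag t)
      s≤s′           : s ≤ s′
      r≤r′           : r ≤ r′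

  module _ {m s r s′ r′ p} {V : Set} (P : Pattern m s r s′ r′ p) (C : Colouring V s r p) where
    open Pattern P

    blow : Fin m × V → Fin m × V → Tag
    blow (i , x) (j , y) with i ≟ j
    ... | yes _ = colour C x y
    ... | no _  = tag i j

    private
      blow-symmetric : Symmetric blow
      blow-symmetric (i , x) (j , y) with i ≟ j | j ≟ i
      ... | yes _   | yes _   = symmetric C x y
      ... | yes i≡j | no j≢i  = contradiction (sym i≡j) j≢i
      ... | no i≢j  | yes j≡i = contradiction (sym j≡i) i≢j
      ... | no _    | no _    = tag-symmetric i j

      -- Two vertices of one fibre see a vertex of another fibre in the same colour.
      blow-no-rainbow : No-rainbow blow
      blow-no-rainbow (i , x) (j , y) (l , z) a b d with i ≟ j | j ≟ l | i ≟ l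
      ... | yes refl | yes refl | yes _    = no-rainbow C x y z (a ∘ cong (i ,_)) (b ∘ cong (i ,_)) (d ∘ cong (i ,_))
      ... | yes refl | yes j≡l  | no i≢l   = contradiction j≡l i≢l
      ... | yes refl | no j≢l   | yes i≡l  = contradiction i≡l j≢l
      ... | yes refl | no _     | no _     = λ _ h _ → h refl
      ... | no i≢j   | yes refl | yes i≡l  = contradiction i≡l i≢j
      ... | no i≢j   | yes refl | no _     = λ _ _ h → h refl
      ... | no i≢j   | no _     | yes refl = λ h _ _ → h (tag-symmetric i j)
      ... | no i≢j   | no j≢l   | no i≢l   = tag-no-rainbow i j l i≢j j≢l i≢l

      blow-valid : ∀ x y → x ≢ y → Valid s′ r′ p (blow x y)
      blow-valid (i , x) (j , y) x≢y with i ≟ j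
      ... | yes refl = Valid-mono (colour C x y) s≤s′ r≤r′ (valid C x y (x≢y ∘ cong (i ,_)))
      ... | no _     = tag-valid i j

      inside : ∀ t → Valid s r p t → ∀ x y → Edge blow t x y → proj₁ x ≡ proj₁ y × Edge (colour C) t (proj₂ x) (proj₂ y)
      inside t v (i , x) (j , y) (x≢y , e) with i ≟ j
      ... | yes refl = refl , x≢y ∘ cong (i ,_) , e
      ... | no _     = contradiction (subst (Valid s r p) (sym e) v) (tag-fresh i j)

      outside : ∀ t → ¬ Valid s r p t → ∀ x y → Edge blow t x y → Edge tag t (proj₁ x) (proj₁ y)
      outside t ¬v (i , x) (j , y) (x≢y , e) with i ≟ j
      ... | yes refl = contradiction (subst (Valid s r p) e (valid C x y (x≢y ∘ cong (i ,_)))) ¬v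
      ... | no i≢j   = i≢j , e

      blow-free : ∀ t → Free t (Edge blow t)
      blow-free t with valid? s r p t
      ... | yes v = Free-fibre t proj₂ proj₁ (cong₂ _,_) (inside t v) (free C t)
      ... | no ¬v = Strict⇒Free t proj₁ (outside t ¬v) (tag-strict t)

    blow-up : Colouring (Fin m × V) s′ r′ p
    blow-up = record
      { colour = blow ; symmetric = blow-symmetric ; no-rainbow = blow-no-rainbow ; valid = blow-valid ; free = blow-free }

  substitute : ∀ {m n s r s′ r′ p} → Pattern m s r s′ r′ p → Colouring (Fin n) s r p → Colouring (Fin (m * n)) s′ r′ p
  substitute {m} {n} P C = pullback (remQuot n) inj (blow-up P C)
    where
    inj : ∀ {x y} → remQuot {m} n x ≡ remQuot n y → x ≡ y
    inj {x} {y} eq = trans (sym (combine-remQuot {m} n x)) (trans (cong (λ u → combine (proj₁ u) (proj₂ u)) eq) (combine-remQuot {m} n y))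

  module _ {n : ℕ} (O : Fin n → Fin n → Bool) where

    Adjacent : Bool → Fin n → Fin n → Set
    Adjacent b x y = x ≢ y × O x y ≡ b

    adjacent? : ∀ b x y → Dec (Adjacent b x y)
    adjacent? b x y = ¬? (x ≟ y) ×-dec (O x y Bool.≟ b)

    symmetric? : Dec (∀ x y → O x y ≡ O y x)
    symmetric? = all? λ x → all? λ y → O x y Bool.≟ O y x

    free? : ∀ t b → Dec (Free t (Adjacent b))
    free? (hat _) b = all? λ x → all? λ y → E x y →-dec all? λ z → E x z →-dec (E y z →-dec
      all? λ u → E x u →-dec (E y u →-dec (E z u →-dec all? λ v → E x v →-dec (E y v →-dec (E z v →-dec (u ≟ v))))))
      where E = adjacent? b
    free? (tri _) b = all? λ x → all? λ y → E x y →-dec all? λ z → E x z →-dec (E y z →-dec no λ ())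
      where E = adjacent? b
    free? path b = all? λ x → all? λ y → E x y →-dec all? λ z → E y z →-dec (x ≟ z)
      where E = adjacent? b

    strict? : ∀ t b → Dec (Strict t (Adjacent b))
    strict? (hat _) b = all? λ x → all? λ y → E x y →-dec all? λ z → E x z →-dec (E y z →-dec
      all? λ u → E x u →-dec (E y u →-dec (E z u →-dec no λ ())))
      where E = adjacent? b
    strict? (tri _) b = all? λ x → all? λ y → E x y →-dec all? λ z → E x z →-dec (E y z →-dec no λ ())
      where E = adjacent? b
    strict? path b = all? λ x → all? λ y → E x y →-dec no λ ()
      where E = adjacent? b

    module _ (A B : Tag) where

      two : Fin n → Fin n → Tag
      two x y = if O x y then A else B

      two-no-rainbow : No-rainbow two
      two-no-rainbow x y z _ _ _ with O x y | O y z | O x z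
      ... | true  | true  | _     = λ h _ _ → h refl
      ... | true  | false | true  = λ _ _ h → h refl
      ... | true  | false | false = λ _ h _ → h refl
      ... | false | false | _     = λ h _ _ → h refl
      ... | false | true  | true  = λ _ h _ → h refl
      ... | false | true  | false = λ _ _ h → h refl

      module _ where
        true-edges : A ≢ B → ∀ x y → Edge two A x y → Adjacent true x y
        true-edges A≢B x y (x≢y , e) with O x y
        ... | true  = x≢y , refl
        ... | false = contradiction (sym e) A≢B

        false-edges : A ≢ B → ∀ x y → Edge two B x y → Adjacent false x y
        false-edges A≢B x y (x≢y , e) with O x y
        ... | true  = contradiction e A≢B
        ... | false = x≢y , refl

        no-edges : ∀ {t} → A ≢ t → B ≢ t → ∀ x y → Edge two t x y → ⊥
        no-edges A≢t B≢t x y (_ , e) with O x y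
        ... | true  = A≢t e
        ... | false = B≢t e

        module _ (A≢B : A ≢ B) (sO : True symmetric?) where

          two-symmetric : Symmetric two
          two-symmetric x y = cong (if_then A else B) (toWitness sO x y)

          two-free : True (free? A true) → True (free? B false) → ∀ t → Free t (Edge two t)
          two-free fA fB t with A ≟ᵗ t | B ≟ᵗ t
          ... | yes refl | _ = Free-map t id id (true-edges A≢B) (toWitness fA)
          ... | no _ | yes refl = Free-map t id id (false-edges A≢B) (toWitness fB)
          ... | no A≢t | no B≢t = Strict⇒Free t id (λ x y e → no-edges A≢t B≢t x y e) (Strict-⊥ t {λ (x y : Fin n) → ⊥} λ _ _ ())

          two-strict : True (strict? A true) → True (strict? B false) → ∀ t → Strict t (Edge two t)
          two-strict fA fB t with A ≟ᵗ t | B ≟ᵗ t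
          ... | yes refl | _ = Strict-⊆ t (true-edges A≢B) (toWitness fA)
          ... | no _ | yes refl = Strict-⊆ t (false-edges A≢B) (toWitness fB)
          ... | no A≢t | no B≢t = Strict-⊥ t (no-edges A≢t B≢t)

      two-colours : {P : Tag → Set} → P A → P B → ∀ x y → P (two x y)
      two-colours a b x y with O x y
      ... | true  = a
      ... | false = b

      colouring : ∀ {s r p} {sO : True symmetric?} {fA : True (free? A true)} {fB : True (free? B false)} →
        A ≢ B → (∀ x y → x ≢ y → Valid s r p (two x y)) → Colouring (Fin n) s r p
      colouring {sO = sO} {fA} {fB} A≢B v = record
        { colour = two ; symmetric = two-symmetric A≢B sO ; no-rainbow = two-no-rainbow ; valid = v ; free = two-free A≢B sO fA fB }

      pattern-of : ∀ {s r s′ r′ p} {sO : True symmetric?} {fA : True (strict? A true)} {fB : True (strict? B false)} →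
        A ≢ B → s ≤ s′ → r ≤ r′ → (∀ x y → Valid s′ r′ p (two x y)) → (∀ x y → ¬ Valid s r p (two x y)) →
        Pattern n s r s′ r′ p
      pattern-of {sO = sO} {fA} {fB} A≢B s≤ r≤ v f = record
        { tag = two ; tag-symmetric = two-symmetric A≢B sO ; tag-no-rainbow = two-no-rainbow ; tag-valid = v ; tag-fresh = f
        ; tag-strict = two-strict A≢B sO fA fB ; s≤s′ = s≤ ; r≤r′ = r≤ }

  complete : ∀ {n} → Fin n → Fin n → Bool
  complete _ _ = true

  -- The difference of labels is not reduced modulo n, so each list of differences is closed under d
  -- ↦ n - d.
  circulant : ∀ {n} → List ℕ → Fin n → Fin n → Bool
  circulant D x y = does (∣ toℕ x - toℕ y ∣ ∈? D)
    where open import Data.List.Membership.DecPropositional ℕ._≟_ using (_∈?_)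

  -- Found by computer search; the cyclic permutation of the first 20 vertices exchanges the two colours.
  codes : Vec ℕ 21
  codes = 1841580 ∷ 511140 ∷ 1074867 ∷ 995985 ∷ 1153740 ∷ 838215 ∷ 1469232 ∷ 207135 ∷ 1682625 ∷ 828540 ∷
    1487622 ∷ 168435 ∷ 1756185 ∷ 673740 ∷ 1781862 ∷ 597810 ∷ 1884570 ∷ 294090 ∷ 1246827 ∷ 127785 ∷ 349525 ∷ []

  G₂₁ : Fin 21 → Fin 21 → Bool
  G₂₁ x y = does ((((lookup codes x / 2 ^ toℕ y) {{m^n≢0 2 (toℕ y)}}) % 2) ℕ.≟ 1)

  private
    variable
      s r n : ℕ
      p : Bool

  K₂∘ : Colouring (Fin n) s r p → Colouring (Fin (2 * n)) (1 + s) r p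
  -- The tag `path` only fills the place of the second colour; `complete` never selects it.
  K₂∘ {s = s} = substitute (pattern-of (complete {2}) (tri s) path (λ ()) (ℕ.n≤1+n s) ≤-refl (λ _ _ → ≤-refl) (λ _ _ → <-irrefl refl))

  C₅∘ : Colouring (Fin n) s r p → Colouring (Fin (5 * n)) (2 + s) r p
  C₅∘ {s = s} {r = r} {p = p} = substitute (pattern-of C₅ (tri s) (tri (1 + s)) (λ ()) (ℕ.m≤n+m s 2) ≤-refl
    (two-colours C₅ (tri s) (tri (1 + s)) {Valid (2 + s) r p} (ℕ.n≤1+n (1 + s)) ≤-refl)
    (two-colours C₅ (tri s) (tri (1 + s)) {¬_ ∘ Valid s r p} (<-irrefl refl) (ℕ.<-asym ≤-refl)))
    where
    C₅ : Fin 5 → Fin 5 → Bool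
    C₅ = circulant (1 ∷ 4 ∷ [])

  Paley₁₇∘ : Colouring (Fin n) s r p → Colouring (Fin (17 * n)) s (2 + r) p
  Paley₁₇∘ {s = s} {r = r} {p = p} = substitute (pattern-of G (hat r) (hat (1 + r)) (λ ()) ≤-refl (ℕ.m≤n+m r 2)
    (two-colours G (hat r) (hat (1 + r)) {Valid s (2 + r) p} (ℕ.n≤1+n (1 + r)) ≤-refl)
    (two-colours G (hat r) (hat (1 + r)) {¬_ ∘ Valid s r p} (<-irrefl refl) (ℕ.<-asym ≤-refl)))
    where
    -- The nonzero squares modulo 17.
    G : Fin 17 → Fin 17 → Bool
    G = circulant (1 ∷ 2 ∷ 4 ∷ 8 ∷ 9 ∷ 13 ∷ 15 ∷ 16 ∷ [])

  Wagner∘ : Colouring (Fin n) s r p → Colouring (Fin (8 * n)) (1 + s) (1 + r) p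
  Wagner∘ {s = s} {r = r} {p = p} = substitute (pattern-of G (tri s) (hat r) (λ ()) (ℕ.n≤1+n s) (ℕ.n≤1+n r)
    (two-colours G (tri s) (hat r) {Valid (1 + s) (1 + r) p} ≤-refl ≤-refl)
    (two-colours G (tri s) (hat r) {¬_ ∘ Valid s r p} (<-irrefl refl) (<-irrefl refl)))
    where
    G : Fin 8 → Fin 8 → Bool
    G = circulant (1 ∷ 4 ∷ 7 ∷ [])

  extremal : ∀ s r p → Colouring (Fin (F′ s r p)) s r p
  extremal (suc (suc (suc s))) r p = C₅∘ (extremal (suc s) r p)
  extremal 0 (suc (suc (suc r))) p = Paley₁₇∘ (extremal 0 (suc r) p)
  extremal 1 (suc (suc (suc r))) p = Paley₁₇∘ (extremal 1 (suc r) p)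
  extremal 2 (suc (suc (suc r))) p = Paley₁₇∘ (extremal 2 (suc r) p)
  extremal 0 0 false = colouring complete path (hat 0) (λ ()) λ { zero zero x≢x → contradiction refl x≢x }
  extremal 1 0 false = K₂∘ (extremal 0 0 false)
  extremal 2 0 false = C₅∘ (extremal 0 0 false)
  extremal 0 1 false = colouring complete (hat 0) path (λ ()) λ _ _ _ → s≤s z≤n
  extremal 1 1 false = colouring G (hat 0) (tri 0) (λ ()) λ x y _ →
      two-colours G (hat 0) (tri 0) {Valid 1 1 false} (s≤s z≤n) (s≤s z≤n) x y
    where
    -- The listed differences span no H₃, the remaining ones 2, 3, 7, 8 no triangle.
    G : Fin 10 → Fin 10 → Bool
    G = circulant (1 ∷ 4 ∷ 5 ∷ 6 ∷ 9 ∷ [])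
  extremal 2 1 false = C₅∘ (extremal 0 1 false)
  extremal 0 2 false = colouring G₂₁ (hat 0) (hat 1) (λ ()) λ x y _ →
      two-colours G₂₁ (hat 0) (hat 1) {Valid 0 2 false} (s≤s z≤n) (s≤s (s≤s z≤n)) x y
  extremal 1 2 false = K₂∘ (extremal 0 2 false)
  extremal 2 2 false = C₅∘ (extremal 0 2 false)
  extremal 0 0 true = colouring complete path (hat 0) (λ ()) λ _ _ _ → tt
  extremal 1 0 true = K₂∘ (extremal 0 0 true)
  extremal 2 0 true = C₅∘ (extremal 0 0 true)
  extremal 0 1 true = colouring G path (hat 0) (λ ()) λ x y _ →
      two-colours G path (hat 0) {Valid 0 1 true} tt (s≤s z≤n) x y
    where
    -- A perfect matching in the P₃-colour; its complement, the octahedron, contains no K₄ and so no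
    -- H₃.
    G : Fin 6 → Fin 6 → Bool
    G = circulant (3 ∷ [])
  extremal 1 1 true = Wagner∘ (extremal 0 0 true)
  -- Doubling the 16 vertices at s = 1 gives 32, whereas a pentagon over the 6 vertices at s = 0
  -- would give only 30.
  extremal 2 1 true = K₂∘ (extremal 1 1 true)
  extremal 0 2 true = Paley₁₇∘ (extremal 0 0 true)
  extremal 1 2 true = K₂∘ (extremal 0 2 true)
  extremal 2 2 true = C₅∘ (extremal 0 2 true)

-- Translation to colourings with numbered colours and monochromatic copies.

module Arrowing where

  import Data.Nat as ℕ
  open import Data.Fin using (inject≤; #_)
  open import Data.Fin.Properties using (toℕ-fromℕ<; inject≤-injective)
  open import Data.Bool using (T)
  open import Data.List using (lookup)
  import Data.List.Relation.Unary.Unique.DecPropositional as DecUnique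
  open import Data.List.Relation.Binary.Permutation.Propositional.Properties using (All-resp-↭; ↭-length)
  import Data.List.Relation.Binary.Permutation.Setoid.Properties as Permutation
  open import Function.Definitions using (Injective)
  open import Relation.Nullary.Decidable using (_⊎-dec_; False; toWitnessFalse; dec-true; dec-false)
  open Subsets
  open SmallRamsey
  open Goodman using (⊤ˢ)
  open ExtremalNumber
  open Joins
  open UpperBound using (module Main)
  open LowerBound

  module _ {A : Set} {R : A → A → Set} (R-sym : ∀ {x y} → R x y → R y x) where

    AllPairs-↭ : ∀ {xs ys} → xs ↭ ys → AllPairs R xs → AllPairs R ys
    AllPairs-↭ p = Permutation.AllPairs-resp-↭ (setoid A) R-sym (resp₂ R) (↭⇒↭ₛ p)

    AllPairs-lookup : ∀ {xs} → AllPairs R xs → ∀ i j → i ≢ j → R (lookup xs i) (lookup xs j)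
    AllPairs-lookup (_ ∷ _) zero zero i≢j = contradiction refl i≢j
    AllPairs-lookup (r ∷ _) zero (suc j) _ = All.lookup r (∈-lookup j)
    AllPairs-lookup (r ∷ _) (suc i) zero _ = R-sym (All.lookup r (∈-lookup i))
    AllPairs-lookup (_ ∷ ps) (suc i) (suc j) i≢j = AllPairs-lookup ps i j (i≢j ∘ cong suc)

  Unique-lookup : ∀ {A : Set} {xs : List A} → Unique xs → Injective _≡_ _≡_ (lookup xs)
  Unique-lookup u {i} {j} eq with i ≟ j
  ... | yes i≡j = i≡j
  ... | no i≢j  = contradiction eq (AllPairs-lookup ≢-sym u i j i≢j)

  module _ {n : ℕ} {e : BGraph n} (e-sym : Symm e) where

    private
      R : Fin n → Fin n → Set
      R x y = e x y ≡ true

      R-sym : ∀ {x y} → R x y → R y x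
      R-sym {x} {y} h = trans (e-sym y x) h

    row-complete : ∀ y ys → row e y ys ≤ 0 → All (R y) ys
    row-complete y [] h = []
    row-complete y (z ∷ ys) h with e y z in eq
    ... | true = eq ∷ row-complete y ys h

    miss-complete : ∀ ys → miss e ys ≤ 0 → AllPairs R ys
    miss-complete [] h = []
    miss-complete (y ∷ ys) h = row-complete y ys (≤-trans (m≤m+n _ _) h) ∷ miss-complete ys (≤-trans (m≤n+m _ (row e y ys)) h)

    row-extract : ∀ y z ys → row e y (z ∷ ys) ≤ 1 → ∃₂ λ w ws → z ∷ ys ↭ w ∷ ws × All (R y) ws
    row-extract y z ys h with e y z in eq
    row-extract y z ys h | false = z , ys , ↭-refl , row-complete y ys (≤-pred h)
    row-extract y z [] h | true = z , [] , ↭-refl , []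
    row-extract y z (x ∷ ys) h | true with row-extract y x ys h
    ... | w , ws , p , a = w , z ∷ ws , ↭-trans (prep z p) (swap z w ↭-refl) , eq ∷ a

    -- The pair that may be missing is moved to the front; both of its vertices are then complete to
    -- the clique formed by the others, which is how P₃ and H₃ are laid out.
    miss-extract : ∀ x y ys → miss e (x ∷ y ∷ ys) ≤ 1 →
      ∃₂ λ a b → ∃ λ zs → x ∷ y ∷ ys ↭ a ∷ b ∷ zs × AllPairs R (a ∷ zs) × AllPairs R (b ∷ zs)
    miss-extract x y ys h with row e x (y ∷ ys) in eq
    miss-extract x y ys h | suc q with row-extract x y ys (≤-trans (≤-reflexive eq) (≤-trans (m≤m+n _ _) h))
                                    | miss-complete (y ∷ ys) (≤-trans (m≤n+m _ q) (≤-pred h))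
    ... | w , ws , p , a | c with AllPairs-↭ R-sym p c
    ...   | d ∷ ds = x , w , ws , prep x p , a ∷ ds , d ∷ ds
    miss-extract x y [] h | zero = x , y , [] , ↭-refl , [] ∷ [] , [] ∷ []
    miss-extract x y (z ∷ ys) h | zero with miss-extract y z ys h | row-complete x (y ∷ z ∷ ys) (≤-reflexive eq)
    ... | a , b , zs , p , qa ∷ qs , qb ∷ _ | all with All-resp-↭ p all
    ...   | xa ∷ xb ∷ xs = a , b , x ∷ zs , ↭-trans (prep x p) (↭-trans (swap x a ↭-refl) (prep a (swap x b ↭-refl)))
                         , (R-sym xa ∷ qa) ∷ xs ∷ qs , (R-sym xb ∷ qb) ∷ xs ∷ qs

  any-list? : ∀ {n} l {P : List (Fin n) → Set} → (∀ ys → Dec (P ys)) → Dec (∃ λ ys → length ys ≡ l × P ys)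
  any-list? zero P? = map′ (λ p → [] , refl , p) (λ { ([] , _ , p) → p }) (P? [])
  any-list? (suc l) P? = map′ (λ { (y , ys , q , p) → y ∷ ys , cong suc q , p }) (λ { (y ∷ ys , q , p) → y , ys , suc-injective q , p })
    (any? λ y → any-list? l (P? ∘ (y ∷_)))

  has? : ∀ {n} (e : BGraph n) l d → Dec (Has e l d ⊤ˢ)
  has? e l d = map′ (λ { (ys , q , u , m) → ys , (q , u , All.universal (λ _ → mem refl) ys) , m }) (λ { (ys , (q , u , _) , m) → ys , q , u , m })
    (any-list? l λ ys → DecUnique.unique? _≟_ ys ×-dec (miss e ys ≤? d))

  kind : ℕ → ℕ → ℕ → Target
  kind s r i = if i <ᵇ r then h₃ else if i <ᵇ r + s then k₃ else p₃

  kind-h₃ : ∀ {s r i} → i < r → kind s r i ≡ h₃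
  kind-h₃ {s} {r} {i} i<r rewrite dec-true (i <? r) i<r = refl

  kind-k₃ : ∀ {s r i} → ¬ i < r → i < r + s → kind s r i ≡ k₃
  kind-k₃ {s} {r} {i} i≮r i<r+s rewrite dec-false (i <? r) i≮r | dec-true (i <? r + s) i<r+s = refl

  kind-p₃ : ∀ {s r i} → ¬ i < r → ¬ i < r + s → kind s r i ≡ p₃
  kind-p₃ {s} {r} {i} i≮r i≮r+s rewrite dec-false (i <? r) i≮r | dec-false (i <? r + s) i≮r+s = refl

  total-kind : ∀ g s r p → total {r + (s + p)} g (kind s r ∘ toℕ) ≡ r * g h₃ + (s * g k₃ + p * g p₃)
  total-kind g s (suc r) p = trans (cong (g h₃ +_) (total-kind g s r p)) (sym (+-assoc (g h₃) _ _))
  total-kind g (suc s) zero p = trans (cong (g k₃ +_) (total-kind g s zero p)) (sym (+-assoc (g k₃) _ _))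
  total-kind g zero zero p = sum-const p (g p₃)

  module _ {n k : ℕ} (C : Coloring n k) where

    open States (col C)

    e-sym : ∀ i → Symm (e i)
    e-sym i x y = cong (λ j → does (j ≟ i)) (symm C x y)

    copy-K₃ : ∀ i → Has (e i) 3 0 ⊤ˢ → MonoCopy C K3 i
    copy-K₃ i (ys@(_ ∷ _ ∷ _ ∷ []) , (refl , u , _) , m) = lookup ys , Unique-lookup u , λ x y x≢y →
      e⁻ (AllPairs-lookup (λ {a} {b} h → trans (e-sym i b a) h) (miss-complete (e-sym i) ys m) x y x≢y)

    copy-P₃ : ∀ i → Has (e i) 3 1 ⊤ˢ → MonoCopy C P3 i
    copy-P₃ i ((x ∷ y ∷ z ∷ []) , (refl , u , _) , m) with miss-extract (e-sym i) x y (z ∷ []) m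
    ... | a , b , zs , p , qa , qb = go zs (↭-length p) qa qb (AllPairs-↭ ≢-sym p u)
      where
      go : ∀ zs → 3 ≡ length (a ∷ b ∷ zs) → AllPairs _ (a ∷ zs) → AllPairs _ (b ∷ zs) → Unique (a ∷ b ∷ zs) → MonoCopy C P3 i
      go (w ∷ []) refl ((aw ∷ []) ∷ _) ((bw ∷ []) ∷ _) ((a≢b ∷ a≢w ∷ []) ∷ (b≢w ∷ []) ∷ _) =
        -- The ends a and b may be nonadjacent; the middle vertex takes position 1 as in `P3-adj`.
        lookup (a ∷ w ∷ b ∷ []) , Unique-lookup ((a≢w ∷ a≢b ∷ []) ∷ (≢-sym b≢w ∷ []) ∷ [] ∷ []) , edges
        where
        edges : ∀ x y → P3-adj x y → col C (lookup (a ∷ w ∷ b ∷ []) x) (lookup (a ∷ w ∷ b ∷ []) y) ≡ i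
        edges zero (suc zero) _ = e⁻ aw
        edges (suc zero) zero _ = trans (symm C w a) (e⁻ aw)
        edges (suc zero) (suc (suc zero)) _ = trans (symm C w b) (e⁻ bw)
        edges (suc (suc zero)) (suc zero) _ = e⁻ bw
        edges zero zero (inj₁ (() , _))
        edges zero zero (inj₂ (_ , ()))
        edges zero (suc (suc zero)) (inj₁ (() , _))
        edges zero (suc (suc zero)) (inj₂ (_ , ()))
        edges (suc zero) (suc zero) (inj₁ (_ , q)) = contradiction refl q
        edges (suc zero) (suc zero) (inj₂ (q , _)) = contradiction refl q
        edges (suc (suc zero)) zero (inj₁ (() , _))
        edges (suc (suc zero)) zero (inj₂ (_ , ()))
        edges (suc (suc zero)) (suc (suc zero)) (inj₁ (() , _))
        edges (suc (suc zero)) (suc (suc zero)) (inj₂ (_ , ()))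

    copy-H₃ : ∀ i → Has (e i) 5 1 ⊤ˢ → MonoCopy C H3 i
    copy-H₃ i ((x ∷ y ∷ ys@(_ ∷ _ ∷ _ ∷ [])) , (refl , u , _) , m) with miss-extract (e-sym i) x y ys m
    ... | a , b , zs , p , qa , qb = go zs (↭-length p) qa qb (AllPairs-↭ ≢-sym p u)
      where
      edge-lookup : ∀ {xs} → AllPairs (λ x y → e i x y ≡ true) xs → ∀ x y → x ≢ y → col C (lookup xs x) (lookup xs y) ≡ i
      edge-lookup q x y x≢y = e⁻ (AllPairs-lookup (λ {a} {b} h → trans (e-sym i b a) h) q x y x≢y)

      go : ∀ zs → 5 ≡ length (a ∷ b ∷ zs) → AllPairs _ (a ∷ zs) → AllPairs _ (b ∷ zs) → Unique (a ∷ b ∷ zs) → MonoCopy C H3 i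
      go zs@(_ ∷ _ ∷ _ ∷ []) refl qa qb u = lookup (a ∷ b ∷ zs) , Unique-lookup u , edges
        where
        edges : ∀ x y → H3-adj x y → col C (lookup (a ∷ b ∷ zs) x) (lookup (a ∷ b ∷ zs) y) ≡ i
        edges zero zero (x≢x , _) = contradiction refl x≢x
        edges zero (suc zero) (_ , q) = contradiction (inj₁ (refl , refl)) q
        edges (suc zero) zero (_ , q) = contradiction (inj₂ (refl , refl)) q
        edges (suc zero) (suc zero) (x≢x , _) = contradiction refl x≢x
        edges zero (suc (suc y)) _ = edge-lookup qa zero (suc y) λ ()
        edges (suc zero) (suc (suc y)) _ = edge-lookup qb zero (suc y) λ ()
        edges (suc (suc x)) zero _ = edge-lookup qa (suc x) zero λ ()
        edges (suc (suc x)) (suc zero) _ = edge-lookup qb (suc x) zero λ ()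
        edges (suc (suc x)) (suc (suc y)) (x≢y , _) = edge-lookup qa (suc x) (suc y) (x≢y ∘ cong suc)

    copy : ∀ s r v i → Has (e i) (order-of (kind s r v)) (defect-of (kind s r v)) ⊤ˢ → MonoCopy C (target s r v) i
    copy s r v i h with v <? r
    ... | yes v<r = copy-H₃ i (subst (λ α → Has (e i) (order-of α) (defect-of α) ⊤ˢ) (kind-h₃ v<r) h)
    ... | no v≮r with v <? r + s
    ...   | yes v<r+s = copy-K₃ i (subst (λ α → Has (e i) (order-of α) (defect-of α) ⊤ˢ) (kind-k₃ v≮r v<r+s) h)
    ...   | no v≮r+s = copy-P₃ i (subst (λ α → Has (e i) (order-of α) (defect-of α) ⊤ˢ) (kind-p₃ v≮r v≮r+s) h)

  count-⊤ : ∀ n → count (⊤ˢ {n}) ≡ n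
  count-⊤ n = trans (sum-const n 1) (*-identityʳ n)

  -- The upper bound speaks only of the absence of subgraphs. The copy itself comes from deciding
  -- all colours exhaustively, and if every search failed the bound would be violated on the whole
  -- vertex set.
  arrows : ∀ s r p → Arrows (r + (s + p)) s r (F s r p + 1)
  arrows s r p C gallai with any? (λ i → has? (States.e (col C) i) (order-of (kind s r (toℕ i))) (defect-of (kind s r (toℕ i))))
  ... | yes (i , h) = i , copy C s r (toℕ i) i h
  ... | no none = contradiction (≤-trans (m≤m+n _ _) (upper-bound _ {⊤ˢ} ≤-refl X λ i h → none (i , h)))
      (<⇒≱ (≤-trans (≤-reflexive size-X) (≤-trans (≤-reflexive (+-comm 1 (F s r p))) (≤-reflexive (sym (count-⊤ (F s r p + 1)))))))
    where
    open Main (symm C) {λ x y z x≢y y≢z x≢z p q t → gallai x y z (x≢y , y≢z , x≢z , p , q , t)} using (upper-bound)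
    X : Fin (r + (s + p)) → Target
    X = kind s r ∘ toℕ
    total≡ : ∀ g → total g X ≡ r * g h₃ + (s * g k₃ + p * g p₃)
    total≡ g = total-kind g s r p
    size-X : suc (size X) ≡ suc (F s r p)
    size-X = cong suc (F-cong
      (trans (total≡ #k) (cong₂ _+_ (*-zeroʳ r) (trans (cong₂ _+_ (*-identityʳ s) (*-zeroʳ p)) (+-identityʳ s))))
      (trans (total≡ #h) (trans (cong₂ _+_ (*-identityʳ r) (cong₂ _+_ (*-zeroʳ s) (*-zeroʳ p))) (+-identityʳ r)))
      (trans (total≡ #p) (cong₂ _+_ (*-zeroʳ r) (cong₂ _+_ (*-zeroʳ s) (*-identityʳ p)))))

  T-positive : ∀ {p} → T (positive p) → 0 < p
  T-positive {suc p} _ = s≤s z≤n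

  module _ (s r p : ℕ) where

    index : Tag → ℕ
    index (hat q) = q
    index (tri q) = r + q
    index path    = r + s

    index-< : ∀ t → Valid s r (positive p) t → index t < r + (s + p)
    index-< (hat q) v = ≤-trans v (m≤m+n r (s + p))
    index-< (tri q) v = +-monoʳ-< r (≤-trans v (m≤m+n s p))
    index-< path v = +-monoʳ-< r (≤-trans (≤-reflexive (+-comm 1 s)) (+-monoʳ-≤ s (T-positive {p} v)))

    index-hat : ∀ {v} t → index t ≡ v → v < r → t ≡ hat v
    index-hat (hat q) refl _ = refl
    index-hat (tri q) refl lt = contradiction lt (≤⇒≯ (m≤m+n r q))
    index-hat path    refl lt = contradiction lt (≤⇒≯ (m≤m+n r s))

    index-tri : ∀ {v} t → Valid s r (positive p) t → index t ≡ v → ¬ v < r → v < r + s → t ≡ tri (v ∸ r)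
    index-tri (hat q) v refl nlt _ = contradiction v nlt
    index-tri (tri q) _ refl _ _ = cong tri (sym (m+n∸m≡n r q))
    index-tri path    _ refl _ lt = contradiction lt (<-irrefl refl)

    index-path : ∀ {v} t → Valid s r (positive p) t → index t ≡ v → ¬ v < r → ¬ v < r + s → t ≡ path
    index-path (hat q) v refl nlt _ = contradiction v nlt
    index-path (tri q) v refl _ nlt = contradiction (+-monoʳ-< r v) nlt
    index-path path    _ refl _ _ = refl

    module _ {m : ℕ} .{{_ : NonZero (r + (s + p))}} (C : Colouring (Fin m) s r (positive p)) where

      open Colouring C

      -- Reduction modulo the number of colours makes this total, also at the arbitrary tags of the
      -- diagonal; on valid tags it changes nothing.
      encode : Tag → Fin (r + (s + p))
      encode t = index t mod (r + (s + p))

      encoded : Coloring m (r + (s + p))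
      encoded = record { col = λ x y → encode (colour x y) ; symm = λ x y → cong encode (symmetric x y) }

      encoded-gallai : IsGallai encoded
      encoded-gallai x y z (x≢y , y≢z , x≢z , a , b , d) =
        no-rainbow x y z x≢y y≢z x≢z (a ∘ cong encode) (b ∘ cong encode) (d ∘ cong encode)

      decoded : ∀ {x y i} → x ≢ y → encode (colour x y) ≡ i → index (colour x y) ≡ toℕ i
      decoded {x} {y} {i} x≢y h = trans (sym (m<n⇒m%n≡m (index-< (colour x y) (valid x y x≢y))))
        (trans (sym (toℕ-fromℕ< _)) (cong toℕ h))

      copy-free : ∀ i → ¬ MonoCopy encoded (target s r (toℕ i)) i
      copy-free i copy with toℕ i <? r
      copy-free i (f , inj , h) | yes i<r =
        contradiction (inj (free (hat (toℕ i)) _ _ (E (# 2) (# 3)) _ (E (# 2) (# 4)) (E (# 3) (# 4))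
          _ (E (# 2) (# 0)) (E (# 3) (# 0)) (E (# 4) (# 0)) _ (E (# 2) (# 1)) (E (# 3) (# 1)) (E (# 4) (# 1)))) λ ()
        where
        E : ∀ x y {x≢y : False (x ≟ y)} {≢01 : False ((toℕ x ℕ.≟ 0 ×-dec toℕ y ℕ.≟ 1) ⊎-dec (toℕ x ℕ.≟ 1 ×-dec toℕ y ℕ.≟ 0))} →
          Edge colour (hat (toℕ i)) (f x) (f y)
        E x y {x≢y} {≢01} = toWitnessFalse x≢y ∘ inj
          , index-hat _ (decoded (toWitnessFalse x≢y ∘ inj) (h x y (toWitnessFalse x≢y , toWitnessFalse ≢01))) i<r
      ... | no i≮r with toℕ i <? r + s
      copy-free i (f , inj , h) | no i≮r | yes i<r+s = free (tri (toℕ i ∸ r)) _ _ (E (# 0) (# 1)) _ (E (# 0) (# 2)) (E (# 1) (# 2))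
        where
        E : ∀ x y {x≢y : False (x ≟ y)} → Edge colour (tri (toℕ i ∸ r)) (f x) (f y)
        E x y {x≢y} = toWitnessFalse x≢y ∘ inj
          , index-tri _ (valid _ _ (toWitnessFalse x≢y ∘ inj)) (decoded (toWitnessFalse x≢y ∘ inj) (h x y (toWitnessFalse x≢y))) i≮r i<r+s
      copy-free i (f , inj , h) | no i≮r | no i≮r+s = contradiction
        (inj (free path _ _ (E (# 0) (# 1) (inj₂ ((λ ()) , refl))) _ (E (# 1) (# 2) (inj₁ (refl , λ ()))))) λ ()
        where
        E : ∀ x y {x≢y : False (x ≟ y)} → P3-adj x y → Edge colour path (f x) (f y)
        E x y {x≢y} a = toWitnessFalse x≢y ∘ inj
          , index-path _ (valid _ _ (toWitnessFalse x≢y ∘ inj)) (decoded (toWitnessFalse x≢y ∘ inj) (h x y a)) i≮r i≮r+s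

  arrows-fails : ∀ s r p → 1 ≤ r + (s + p) → ∀ m → m < F s r p + 1 → ¬ Arrows (r + (s + p)) s r m
  arrows-fails s r p 1≤k m m<N ar = copy-free s r p C (proj₁ found) (proj₂ found)
    where
    instance _ = >-nonZero 1≤k
    m≤F : m ≤ F s r p
    m≤F = ≤-pred (≤-trans m<N (≤-reflexive (+-comm (F s r p) 1)))
    C : Colouring (Fin m) s r (positive p)
    C = pullback (λ x → inject≤ x m≤F) (inject≤-injective m≤F m≤F _ _) (extremal s r (positive p))
    found : Σ (Fin (r + (s + p))) λ i → MonoCopy (encoded s r p C) (target s r (toℕ i)) i
    found = ar (encoded s r p C) (encoded-gallai s r p C)

  is-GR : ∀ s r p → 1 ≤ r + (s + p) → IsGR (r + (s + p)) s r (F s r p + 1)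
  is-GR s r p 1≤k = arrows s r p , arrows-fails s r p 1≤k

-- Closed forms of the extremal number.

module Formula where

  import Data.Nat as ℕ
  open ExtremalNumber
  open Arrowing

  F′-17 : ∀ s r b → F′ s (3 + r) b ≡ 17 * F′ s (1 + r) b
  F′-17 s r false = F-17 s r 0
  F′-17 s r true = F-17 s r 1

  F′-odd-s : ∀ a r b → F′ (1 + a * 2) r b ≡ 5 ^ a * F′ 1 r b
  F′-odd-s zero r b = sym (+-identityʳ _)
  F′-odd-s (suc a) r b = trans (cong (5 *_) (F′-odd-s a r b)) (sym (*-assoc 5 (5 ^ a) _))

  F′-even-s : ∀ a r b → F′ 2 r b ≡ 5 * F′ 0 r b → F′ (a * 2) r b ≡ 5 ^ a * F′ 0 r b
  F′-even-s zero r b h = sym (+-identityʳ _)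
  F′-even-s (suc zero) r b h = h
  F′-even-s (suc (suc a)) r b h = trans (cong (5 *_) (F′-even-s (suc a) r b h)) (sym (*-assoc 5 (5 ^ (suc a)) _))

  F′-odd-r : ∀ s c b → F′ s (1 + c * 2) b ≡ 17 ^ c * F′ s 1 b
  F′-odd-r s zero b = sym (+-identityʳ _)
  F′-odd-r s (suc c) b = trans (F′-17 s (c * 2) b) (trans (cong (17 *_) (F′-odd-r s c b)) (sym (*-assoc 17 (17 ^ c) _)))

  scale : ∀ d m y {x} → x ≡ m * y → d * x ≡ m * (d * y)
  scale d m y refl = trans (sym (*-assoc d m y)) (trans (cong (_* y) (*-comm d m)) (*-assoc m d y))

  F′-2-0-false : ∀ r → F′ 2 r false ≡ 5 * F′ 0 r false
  F′-2-0-false 0 = refl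
  F′-2-0-false 1 = refl
  F′-2-0-false 2 = refl
  F′-2-0-false (suc (suc (suc r))) = scale 17 5 (F′ 0 (suc r) false) (F′-2-0-false (suc r))

  F′-2-0-true : ∀ c → F′ 2 (c * 2) true ≡ 5 * F′ 0 (c * 2) true
  F′-2-0-true 0 = refl
  F′-2-0-true 1 = refl
  F′-2-0-true (suc (suc c)) = scale 17 5 (F′ 0 (2 + c * 2) true) (F′-2-0-true (suc c))

  -- ⌊m·d^(c - 1)⌋ is stated as (m * d ^ c) / d.
  /-suc-^ : ∀ d m c .{{_ : ℕ.NonZero d}} → (m * d ^ suc c) / d ≡ m * d ^ c
  /-suc-^ d m c = trans (cong (_/ d) (trans (cong (m *_) (*-comm d (d ^ c))) (sym (*-assoc m (d ^ c) d)))) (m*n/n≡m (m * d ^ c) d)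

  F′-0-even : ∀ c → F′ 0 (c * 2) false ≡ (21 * 17 ^ c) / 17
  F′-0-even zero = refl
  F′-0-even (suc c) = trans (go c) (sym (/-suc-^ 17 21 c))
    where
    go : ∀ c → F′ 0 (2 + c * 2) false ≡ 21 * 17 ^ c
    go zero = refl
    go (suc c) = scale 17 21 (17 ^ c) (go c)

  F′-1-even : ∀ c → F′ 1 (c * 2) false ≡ (42 * 17 ^ c) / 17
  F′-1-even zero = refl
  F′-1-even (suc c) = trans (go c) (sym (/-suc-^ 17 42 c))
    where
    go : ∀ c → F′ 1 (2 + c * 2) false ≡ 42 * 17 ^ c
    go zero = refl
    go (suc c) = scale 17 42 (17 ^ c) (go c)

  F′-0-even-true : ∀ c → F′ 0 (c * 2) true ≡ 2 * 17 ^ c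
  F′-0-even-true 0 = refl
  F′-0-even-true 1 = refl
  F′-0-even-true (suc (suc c)) = scale 17 2 (17 ^ suc c) (F′-0-even-true (suc c))

  F′-1-even-true : ∀ c → F′ 1 (c * 2) true ≡ 4 * 17 ^ c
  F′-1-even-true 0 = refl
  F′-1-even-true 1 = refl
  F′-1-even-true (suc (suc c)) = scale 17 4 (17 ^ suc c) (F′-1-even-true (suc c))

  F′-even-1 : ∀ a → F′ (a * 2) 1 true ≡ (32 * 5 ^ a) / 5
  F′-even-1 zero = refl
  F′-even-1 (suc a) = trans (go a) (sym (/-suc-^ 5 32 a))
    where
    go : ∀ a → F′ (2 + a * 2) 1 true ≡ 32 * 5 ^ a
    go zero = refl
    go (suc a) = scale 5 32 (5 ^ a) (go a)

  pull : ∀ x y z → x * (y * z) ≡ y * x * z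
  pull x y z = trans (sym (*-assoc x y z)) (cong (_* z) (*-comm x y))

  even-form : ∀ {n} → Even n → n ≡ n / 2 * 2
  even-form (divides q refl) = cong (_* 2) (sym (m*n/n≡m q 2))

  odd-form : ∀ {n} → Odd n → n ≡ 1 + (n ∸ 1) / 2 * 2
  odd-form {n} odd with n % 2 in eq | m≡m%n+[m/n]*n n 2 | m%n<n n 2
  ... | 0 | _ | _ = contradiction (m%n≡0⇒n∣m n 2 eq) odd
  ... | 1 | h | _ = trans h (cong suc (trans (sym (cong (_∸ 1) h)) (even-form (divides (n / 2) (cong (_∸ 1) h)))))
  ... | suc (suc q) | _ | s≤s (s≤s ())

-- The eight cases of the formula.

open ExtremalNumber
open Arrowing
open Formula

theorem1p5 : ∀ (k s r : ℕ) → 1 ≤ k → s + r ≤ k →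
    (Even s → Even r → s + r ≡ k →
      IsGR k s r (5 ^ (s / 2) * ((21 * 17 ^ (r / 2)) / 17) + 1)) ×
    (Even s → Even r → s + r < k →
      IsGR k s r (2 * 5 ^ (s / 2) * 17 ^ (r / 2) + 1)) ×
    (Odd s → Even r → s + r ≡ k →
      IsGR k s r (5 ^ ((s ∸ 1) / 2) * ((42 * 17 ^ (r / 2)) / 17) + 1)) ×
    (Odd s → Even r → s + r < k →
      IsGR k s r (4 * 5 ^ ((s ∸ 1) / 2) * 17 ^ (r / 2) + 1)) ×
    (Odd s → Odd r → s + r ≡ k →
      IsGR k s r (10 * 5 ^ ((s ∸ 1) / 2) * 17 ^ ((r ∸ 1) / 2) + 1)) ×
    (Odd s → Odd r → s + r < k →
      IsGR k s r (16 * 5 ^ ((s ∸ 1) / 2) * 17 ^ ((r ∸ 1) / 2) + 1)) ×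
    (Even s → Odd r → s + r ≡ k →
      IsGR k s r (4 * 5 ^ (s / 2) * 17 ^ ((r ∸ 1) / 2) + 1)) ×
    (Even s → Odd r → s + r < k →
      IsGR k s r (((32 * 5 ^ (s / 2)) / 5) * 17 ^ ((r ∸ 1) / 2) + 1))
theorem1p5 k s r 1≤k s+r≤k =
    (λ se re eq → exact eq (at (even-form se) (even-form re) (
      trans (F′-even-s a (c * 2) false (F′-2-0-false (c * 2))) (cong (5 ^ a *_) (F′-0-even c)))))
  , (λ se re lt → spare lt (at (even-form se) (even-form re) (
      trans (F′-even-s a (c * 2) true (F′-2-0-true c)) (trans (cong (5 ^ a *_) (F′-0-even-true c)) (pull (5 ^ a) 2 (17 ^ c))))))
  , (λ so re eq → exact eq (at (odd-form so) (even-form re) (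
      trans (F′-odd-s a′ (c * 2) false) (cong (5 ^ a′ *_) (F′-1-even c)))))
  , (λ so re lt → spare lt (at (odd-form so) (even-form re) (
      trans (F′-odd-s a′ (c * 2) true) (trans (cong (5 ^ a′ *_) (F′-1-even-true c)) (pull (5 ^ a′) 4 (17 ^ c))))))
  , (λ so ro eq → exact eq (at (odd-form so) (odd-form ro) (odd-odd a′ c′ false)))
  , (λ so ro lt → spare lt (at (odd-form so) (odd-form ro) (odd-odd a′ c′ true)))
  , (λ se ro eq → exact eq (at (even-form se) (odd-form ro) (
      trans (F′-even-s a (1 + c′ * 2) false (F′-2-0-false (1 + c′ * 2))) (trans (cong (5 ^ a *_) (F′-odd-r 0 c′ false)) (
        trans (cong (5 ^ a *_) (*-comm (17 ^ c′) 4)) (pull (5 ^ a) 4 (17 ^ c′)))))))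
  , (λ se ro lt → spare lt (at (even-form se) (odd-form ro) (
      trans (F′-odd-r (a * 2) c′ true) (trans (*-comm (17 ^ c′) _) (cong (_* 17 ^ c′) (F′-even-1 a))))))
  where
  p a a′ c c′ : ℕ
  p = k ∸ (s + r)
  a = s / 2
  a′ = (s ∸ 1) / 2
  c = r / 2
  c′ = (r ∸ 1) / 2

  k≡ : r + (s + p) ≡ k
  k≡ = trans (sym (+-assoc r s p)) (trans (cong (_+ p) (+-comm r s)) (m+[n∸m]≡n s+r≤k))

  general : ∀ {N} → F s r p ≡ N → IsGR k s r (N + 1)
  general refl = subst (λ j → IsGR j s r (F s r p + 1)) k≡ (is-GR s r p (subst (1 ≤_) (sym k≡) 1≤k))

  exact : s + r ≡ k → ∀ {N} → F′ s r false ≡ N → IsGR k s r (N + 1)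
  exact eq h = general (trans (cong (F s r) (trans (cong (k ∸_) eq) (n∸n≡0 k))) h)

  spare : s + r < k → ∀ {N} → F′ s r true ≡ N → IsGR k s r (N + 1)
  spare lt h = general (trans (cong (F′ s r) (positive-true (m<n⇒0<n∸m lt))) h)
    where
    positive-true : ∀ {q} → 0 < q → positive q ≡ true
    positive-true (s≤s _) = refl

  at : ∀ {s′ r′ b N} → s ≡ s′ → r ≡ r′ → F′ s′ r′ b ≡ N → F′ s r b ≡ N
  at {b = b} e₁ e₂ h = trans (cong₂ (λ s r → F′ s r b) e₁ e₂) h

  odd-odd : ∀ a c b → F′ (1 + a * 2) (1 + c * 2) b ≡ F′ 1 1 b * 5 ^ a * 17 ^ c
  odd-odd a c b = trans (F′-odd-s a (1 + c * 2) b) (trans (cong (5 ^ a *_) (trans (F′-odd-r 1 c b) (*-comm (17 ^ c) _))) (pull (5 ^ a) (F′ 1 1 b) (17 ^ c)))
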